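{- ${\rm inv}_3(n)\le \frac{257}{2592}(1+o(1))n^2$, where $o(1)\to 0$ as $n\to\infty$.
   Context: For an oriented graph $D$ and $X\subseteq V(D)$, inverting $X$ means reversing the direction of every edge of $D$ with both endpoints in $X$. A set $\{X_1,\dots,X_t\}$ of vertex subsets is $k$-decycling for $D$ if every $X_i$ has size at most $k$ and inverting $X_1,\dots,X_t$ yields an acyclic digraph. ${\rm inv}_k(D)$ is the minimum size of a $k$-decycling set of $D$, and ${\rm inv}_k(n)$ is the maximum of ${\rm inv}_k(D)$ over all oriented graphs (equivalently, all tournaments) $D$ on $n$ vertices. -}

module Defs where

open import Data.Nat using (ℕ)
open import Data.Bool using (Bool; true; false; _∧_; if_then_else_)
open import Data.Fin using (Fin)
open import Data.Fin.Subset using (Subset)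
open import Data.Vec using (lookup)
open import Data.List using (List; foldr)
open import Relation.Binary.PropositionalEquality using (_≡_)
open import Relation.Binary.Construct.Closure.Transitive using (TransClosure)
open import Relation.Nullary using (¬_)

Digraph : ℕ → Set
Digraph n = Fin n → Fin n → Bool

record Oriented {n : ℕ} (A : Digraph n) : Set where
  field
    irrefl : ∀ i → A i i ≡ false
    antisym : ∀ i j → A i j ≡ true → A j i ≡ false

invert : {n : ℕ} → Subset n → Digraph n → Digraph n
invert X A i j = if (lookup X i ∧ lookup X j) then A j i else A i j

invertAll : {n : ℕ} → List (Subset n) → Digraph n → Digraph n
invertAll Xs A = foldr invert A Xs

Acyclic : {n : ℕ} → Digraph n → Set
Acyclic A = ∀ i → ¬ TransClosure (λ i j → A i j ≡ true) i i

-- An order of the vertices turns a tournament into the graph of its backward arcs. If this graph is, modulo 2, a sum of cliques on sets of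
-- size at most 3, then inverting these sets makes the tournament acyclic. A 4-cycle is the sum of two triangles and a graph with no 4-cycle
-- is sparse, so a graph with e edges, k edge-disjoint triangles among them, costs at most (e - k)/2 + o(n²).
--
-- The order is chosen at random. With probability 114/125 the vertices get independent uniform keys. The backward transitive triangles then
-- form a linear 3-uniform hypergraph on the arcs; after the excess over n/3 of each degree is thrown away, a semirandom greedy procedure
-- finds an edge-disjoint family containing almost a proportion 3/n of what remains. The expected excess at an arc a → b is a convex
-- function of the numbers of vertices w with a → w → b, with w → a, b and with a, b → w; interpolation on a grid of mesh 1/24 bounds it
-- by a quadratic form in these numbers.
-- With probability 11/125 the order is determined by the arcs to two random roots, which favours another kind of tournament.
--
-- The resulting bound for the expected cost is a sum over all quadruples of vertices of a function of the arcs between them. Its average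
-- over the orderings of a quadruple is bounded by inspection of the 64 labelled tournaments on four vertices.

module Submission where

open import Defs
open import Data.Nat.Base as ℕ using (ℕ; zero; suc; _<ᵇ_)
import Data.Nat.Properties as ℕP
import Data.Nat.DivMod as DM
open import Data.Nat.Divisibility using (divides)
open import Data.Bool.Base using (Bool; true; false; if_then_else_; _∧_; _∨_; not; _xor_)
import Data.Bool.Properties as 𝔹
open import Data.Bool.Solver using (module xor-∧-Solver)
open import Data.Fin.Base using (Fin; zero; suc; toℕ; combine; opposite; _↑ˡ_; _↑ʳ_)
import Data.Fin.Properties as FP
import Data.Fin.Subset as Subset
import Data.Fin.Subset.Properties as SP
import Data.Rational.Properties as ℚ
open import Data.List.Base using (List; []; _∷_; length; _++_)
open import Data.Product.Base using (∃-syntax; Σ-syntax; _×_; _,_; proj₁; proj₂)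
open import Data.Sum.Base using (_⊎_; inj₁; inj₂)
open import Data.Vec.Base using (Vec; []; _∷_; lookup; _[_]≔_)
open import Data.Vec.Properties using (lookup∘update; lookup∘update′; lookup-zipWith; lookup-replicate)
open import Data.Unit.Base using (tt)
open import Data.Empty using (⊥-elim)
open import Function.Base using (_∘_; id)
open import Relation.Nullary using (¬_; Dec; yes; no)
open import Relation.Binary.Definitions using (tri<; tri≈; tri>)
open import Data.List.Membership.Propositional using (_∈_)
open import Data.List.Relation.Unary.Any using (here; there)
open import Data.List.Relation.Unary.All.Properties using (++⁺)
open import Data.Maybe.Base using (just; nothing)
open import Level using (0ℓ)
open import Relation.Nullary.Decidable using (_×-dec_)
open import Tactic.RingSolver using (solve-∀)
open import Data.List.Relation.Unary.All as All using (All; []; _∷_)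
open import Relation.Binary.Construct.Closure.Transitive as Closure using (TransClosure)
open import Relation.Binary.PropositionalEquality hiding ([_])
open import Tactic.RingSolver.Core.AlmostCommutativeRing using (AlmostCommutativeRing; fromCommutativeRing)

-- The cap n/3 is the largest possible mean degree: for a backward arc with uniform keys y < z, each
-- of the three kinds of third vertex completes a backward triangle with mean probability 1/3. The
-- semirandom procedure is run on explicit finite distributions and without concentration
-- inequalities. For all sets S of arcs at once, the probability that S survives is compared with a
-- product of predicted survival probabilities; the error weight is exponential in the size of S, so
-- the quadratically many pairs that a linear hypergraph produces cost little. The grid knows
-- integer proportions only. True proportions are rounded to it with a common random shift.
-- Convexity moves the hinge to the grid; on the way back the shifted rounding has variance at most
-- 1/4, which is harmless for a majorant whose quadratic part is a nonnegative combination of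
-- squares of sums of consecutive parts. The four-vertex bound 3238384464 lies 813552 below the
-- value that 257/2592 allows. This slack absorbs all error terms at accuracy 1/1000000.

module GridMajorant where

  -- A quadratic majorant of the interpolated excess on the grid.

  open import Data.Nat.Base
  open import Data.Bool.Base using (T)

  -- In 24ths, `a`, `b`, `c` are the proportions of vertices between, above and below an arc, and
  -- `i` ≤ `j` are the keys of its head and tail. The unit is n/576, so 192 is the cap n/3;
  -- truncated subtraction takes the positive part.
  hinge : ℕ → ℕ → ℕ → ℕ → ℕ → ℕ
  hinge a b c i j = (a * (j ∸ i) + (b * (24 ∸ j) + c * i)) ∸ 192

  -- Twelve times the integral of the interpolated hinge: a quarter of the four corner values on a
  -- unit square, a sixth of the three corner values on the half square above the diagonal.
  cell diag : ℕ → ℕ → ℕ → ℕ → ℕ → ℕ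
  cell a b c i j = 3 * ((hinge a b c i j + hinge a b c i (suc j)) + (hinge a b c (suc i) j + hinge a b c (suc i) (suc j)))
  diag a b c i j = 2 * (hinge a b c i j + (hinge a b c i (suc j) + hinge a b c (suc i) (suc j)))

  patch : ℕ → ℕ → ℕ → ℕ → ℕ → ℕ
  patch a b c i j = if i <ᵇ j then cell a b c i j else (if j <ᵇ i then 0 else diag a b c i j)

  sumTo : ℕ → (ℕ → ℕ) → ℕ
  sumTo zero f = 0
  sumTo (suc n) f = f 0 + sumTo n (λ i → f (suc i))

  allTo : ℕ → (ℕ → Bool) → Bool
  allTo zero f = f 0
  allTo (suc n) f = f (suc n) ∧ allTo n f

  allTo-sound : ∀ n f → allTo n f ≡ true → ∀ {k} → k ≤ n → f k ≡ true
  allTo-sound zero f p z≤n = p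
  allTo-sound (suc n) f p {k} k≤ with f (suc n) in eq
  ... | true with ℕP.m≤n⇒m<n∨m≡n k≤
  ...   | inj₁ k< = allTo-sound n f p (ℕP.≤-pred k<)
  ...   | inj₂ refl = eq

  all-grid : (ℕ → ℕ → ℕ → Bool) → Bool
  all-grid p = allTo 24 (λ s → allTo s (λ b → allTo (s ∸ b) (λ a → p a b (s ∸ b ∸ a))))

  all-grid-sound : ∀ p → all-grid p ≡ true → ∀ a b c → b + a + c ≤ 24 → p a b c ≡ true
  all-grid-sound p ok a b c small = trans (cong (p a b) (sym c≡)) (allTo-sound (s ∸ b) (λ a → p a b (s ∸ b ∸ a))
       (allTo-sound s (λ b → allTo (s ∸ b) (λ a → p a b (s ∸ b ∸ a)))
         (allTo-sound 24 (λ s → allTo s (λ b → allTo (s ∸ b) (λ a → p a b (s ∸ b ∸ a)))) ok small)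
         (ℕP.≤-trans (ℕP.m≤m+n b a) (ℕP.m≤m+n (b + a) c)))
       (ℕP.≤-trans (ℕP.m≤m+n a c) (ℕP.≤-reflexive (sym s∸b))))
    where
    s : ℕ
    s = b + a + c
    s∸b : s ∸ b ≡ a + c
    s∸b = trans (cong (_∸ b) (ℕP.+-assoc b a c)) (ℕP.m+n∸m≡n b (a + c))
    c≡ : s ∸ b ∸ a ≡ c
    c≡ = trans (cong (_∸ a) s∸b) (ℕP.m+n∸m≡n a c)

  ≤ᵇ-sound : ∀ (f g : ℕ → ℕ → ℕ → ℕ) a b c → (f a b c ≤ᵇ g a b c) ≡ true → f a b c ≤ g a b c
  ≤ᵇ-sound f g a b c p = ℕP.≤ᵇ⇒≤ (f a b c) (g a b c) (subst T (sym p) tt)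

  grid-check : (f g : ℕ → ℕ → ℕ → ℕ) → all-grid (λ a b c → f a b c ≤ᵇ g a b c) ≡ true → ∀ a b c → b + a + c ≤ 24 → f a b c ≤ g a b c
  grid-check f g ok a b c small = ≤ᵇ-sound f g a b c (all-grid-sound (λ a b c → f a b c ≤ᵇ g a b c) ok a b c small)

  abstract
    weight : ℕ → ℕ → ℕ → ℕ
    weight a b c = sumTo 24 (λ i → sumTo 24 (λ j → patch a b c i j))

    -- The coefficients come from a linear program: the least quadratic majorant of the weight for the moments of the worst tournament.
    lower upper : ℕ → ℕ → ℕ → ℕ
    lower a b c = weight a b c + (a * 31915 + (b + c) * 21349)
    upper a b c = ((a * a) * 592 + ((b * b + c * c) * 324 + (((b + a) * (b + a) + (a + c) * (a + c)) * 214 + ((b + a + c) * (b + a + c)) * 436))) + 204940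

    -- Evaluation at the 2925 points of the grid simplex. The squares in `upper` are those of all
    -- sums of consecutive parts in the order `b`, `a`, `c`, because such sums are rounded well; the
    -- linear part stands in `lower` so that nothing is subtracted.
    majorant : ∀ a b c → b + a + c ≤ 24 → lower a b c ≤ upper a b c
    majorant = grid-check lower upper refl

    weight-eq : ∀ a b c → weight a b c ≡ sumTo 24 (λ i → sumTo 24 (λ j → patch a b c i j))
    weight-eq a b c = refl

    lower-eq : ∀ a b c → lower a b c ≡ weight a b c + (a * 31915 + (b + c) * 21349)
    lower-eq a b c = refl

    upper-eq : ∀ a b c → upper a b c ≡ ((a * a) * 592 + ((b * b + c * c) * 324 + (((b + a) * (b + a) + (a + c) * (a + c)) * 214 + ((b + a + c) * (b + a + c)) * 436))) + 204940
    upper-eq a b c = refl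

-- Finite sums of rationals and indicators.

module FiniteSums where
  open import Data.Rational.Base hiding (truncate)

  ring : AlmostCommutativeRing 0ℓ 0ℓ
  ring = fromCommutativeRing ℚ.+-*-commutativeRing isZero
    where
    isZero : ∀ x → _
    isZero x with 0ℚ ℚ.≟ x
    ... | yes p = just p
    ... | no _ = nothing

  0≤1 : 0ℚ ≤ 1ℚ
  0≤1 = ℚ.nonNegative⁻¹ 1ℚ

  -- The standard way to an inequality below: exhibit the difference `d` as visibly nonnegative and
  -- leave the identity to the ring solver.
  ≤-by : ∀ {a b} d → 0ℚ ≤ d → b ≡ a + d → a ≤ b
  ≤-by {a} {b} d 0≤d eq = subst₂ _≤_ (ℚ.+-identityʳ a) (sym eq) (ℚ.+-monoʳ-≤ a 0≤d)

  diff≥0 : ∀ {a b} → a ≤ b → 0ℚ ≤ b - a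
  diff≥0 {a} {b} a≤b = subst (_≤ b - a) (ℚ.+-inverseʳ a) (ℚ.+-monoˡ-≤ (- a) a≤b)

  *-nn : ∀ {a b} → 0ℚ ≤ a → 0ℚ ≤ b → 0ℚ ≤ a * b
  *-nn {a} {b} p q = subst (_≤ a * b) (ℚ.*-zeroʳ a) (ℚ.*-monoˡ-≤-nonNeg a {{nonNegative p}} q)

  +-nn : ∀ {a b} → 0ℚ ≤ a → 0ℚ ≤ b → 0ℚ ≤ a + b
  +-nn {a} {b} p q = subst (_≤ a + b) (ℚ.+-identityʳ 0ℚ) (ℚ.+-mono-≤ p q)

  *-monoˡ : ∀ {a b} c → 0ℚ ≤ c → a ≤ b → c * a ≤ c * b
  *-monoˡ c p q = ℚ.*-monoˡ-≤-nonNeg c {{nonNegative p}} q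

  *-monoʳ : ∀ {a b} c → 0ℚ ≤ c → a ≤ b → a * c ≤ b * c
  *-monoʳ c p q = ℚ.*-monoʳ-≤-nonNeg c {{nonNegative p}} q

  *-mono : ∀ {a b c d} → 0ℚ ≤ a → 0ℚ ≤ d → a ≤ b → c ≤ d → a * c ≤ b * d
  *-mono 0≤a 0≤d p q = ℚ.≤-trans (*-monoˡ _ 0≤a q) (*-monoʳ _ 0≤d p)

  sq-nn : ∀ a → 0ℚ ≤ a * a
  sq-nn a with ℚ.≤-total 0ℚ a
  ... | inj₁ p = *-nn p p
  ... | inj₂ p = subst (0ℚ ≤_) (lem a) (*-nn (opp p) (opp p))
    where
    lem : ∀ a → (- a) * (- a) ≡ a * a
    lem = solve-∀ ring
    opp : a ≤ 0ℚ → 0ℚ ≤ - a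
    opp p = subst (_≤ - a) refl (ℚ.neg-antimono-≤ p)

  *-cancelˡ : ∀ {a b} c → 0ℚ < c → c * a ≤ c * b → a ≤ b
  *-cancelˡ c 0<c p = ℚ.*-cancelˡ-≤-pos c {{positive 0<c}} p

  inv : ∀ c → 0ℚ < c → ∃[ d ] (0ℚ < d × c * d ≡ 1ℚ)
  inv c 0<c = 1/ c , ℚ.positive⁻¹ _ {{ℚ.1/pos⇒pos c}} , ℚ.*-inverseʳ c
    where
    instance
      p : Positive c
      p = positive 0<c
      q : NonZero c
      q = ℚ.pos⇒nonZero c

  abstract
    -- Opaque, since the unary recursion must not be unfolded on numerals beyond 10^11; identities
    -- between numerals go through `ι-+` and `ι-*`.
    ι : ℕ → ℚ
    ι zero = 0ℚ
    ι (suc n) = 1ℚ + ι n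

    ι-zero : ι 0 ≡ 0ℚ
    ι-zero = refl

    ι-suc : ∀ n → ι (suc n) ≡ 1ℚ + ι n
    ι-suc n = refl

  ι-one : ι 1 ≡ 1ℚ
  ι-one = trans (ι-suc 0) (trans (cong (1ℚ +_) ι-zero) (ℚ.+-identityʳ 1ℚ))

  ι-nn : ∀ n → 0ℚ ≤ ι n
  ι-nn zero = ℚ.≤-reflexive (sym ι-zero)
  ι-nn (suc n) = subst (0ℚ ≤_) (sym (ι-suc n)) (+-nn 0≤1 (ι-nn n))

  ι-+ : ∀ m n → ι (m ℕ.+ n) ≡ ι m + ι n
  ι-+ zero n = sym (trans (cong (_+ ι n) ι-zero) (ℚ.+-identityˡ _))
  ι-+ (suc m) n = begin
    ι (suc (m ℕ.+ n)) ≡⟨ ι-suc _ ⟩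
    1ℚ + ι (m ℕ.+ n) ≡⟨ cong (1ℚ +_) (ι-+ m n) ⟩
    1ℚ + (ι m + ι n) ≡⟨ sym (ℚ.+-assoc 1ℚ (ι m) (ι n)) ⟩
    1ℚ + ι m + ι n ≡⟨ cong (_+ ι n) (sym (ι-suc m)) ⟩
    ι (suc m) + ι n ∎
    where open ≡-Reasoning

  ι-* : ∀ m n → ι (m ℕ.* n) ≡ ι m * ι n
  ι-* zero n = trans ι-zero (sym (trans (cong (_* ι n) ι-zero) (ℚ.*-zeroˡ (ι n))))
  ι-* (suc m) n = begin
    ι (n ℕ.+ m ℕ.* n) ≡⟨ ι-+ n _ ⟩
    ι n + ι (m ℕ.* n) ≡⟨ cong (ι n +_) (ι-* m n) ⟩
    ι n + ι m * ι n ≡⟨ lem (ι m) (ι n) ⟩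
    (1ℚ + ι m) * ι n ≡⟨ cong (_* ι n) (sym (ι-suc m)) ⟩
    ι (suc m) * ι n ∎
    where
    open ≡-Reasoning
    lem : ∀ x y → y + x * y ≡ (1ℚ + x) * y
    lem = solve-∀ ring

  ι-mono : ∀ {m n} → m ℕ.≤ n → ι m ≤ ι n
  ι-mono {m} {n} m≤n = ≤-by (ι (n ℕ.∸ m)) (ι-nn _)
    (trans (cong ι (sym (ℕP.m+[n∸m]≡n m≤n))) (ι-+ m _))

  1≤ι : ∀ n → 1ℚ ≤ ι (suc n)
  1≤ι n = subst (_≤ ι (suc n)) ι-one (ι-mono {1} (ℕ.s≤s ℕ.z≤n))

  0<ι : ∀ n → 0ℚ < ι (suc n)
  0<ι n = ℚ.<-≤-trans (ℚ.positive⁻¹ 1ℚ) (1≤ι n)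

  ι-cancel-≤ : ∀ {m n} → ι m ≤ ι n → m ℕ.≤ n
  ι-cancel-≤ {m} {n} p with m ℕP.≤? n
  ... | yes q = q
  ... | no q = ⊥-elim (ℚ.<-irrefl refl (ℚ.<-≤-trans step (ℚ.≤-trans (ι-mono (ℕP.≰⇒> q)) p)))
    where
    step : ι n < ι (suc n)
    step = subst₂ _<_ (ℚ.+-identityˡ (ι n)) (sym (ι-suc n)) (ℚ.+-monoˡ-< (ι n) (ℚ.positive⁻¹ 1ℚ))

  [_] : Bool → ℚ
  [ true ] = 1ℚ
  [ false ] = 0ℚ

  []-nn : ∀ b → 0ℚ ≤ [ b ]
  []-nn true = 0≤1
  []-nn false = ℚ.≤-refl

  []≤1 : ∀ b → [ b ] ≤ 1ℚ
  []≤1 true = ℚ.≤-refl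
  []≤1 false = 0≤1

  [∧] : ∀ a b → [ a ∧ b ] ≡ [ a ] * [ b ]
  [∧] true b = sym (ℚ.*-identityˡ [ b ])
  [∧] false b = sym (ℚ.*-zeroˡ [ b ])

  [not] : ∀ a → [ not a ] ≡ 1ℚ - [ a ]
  [not] true = refl
  [not] false = refl

  Σ : ∀ {n} → (Fin n → ℚ) → ℚ
  Σ {zero} f = 0ℚ
  Σ {suc n} f = f zero + Σ (f ∘ suc)

  Σ-cong : ∀ {n} {f g : Fin n → ℚ} → (∀ i → f i ≡ g i) → Σ f ≡ Σ g
  Σ-cong {zero} p = refl
  Σ-cong {suc n} p = cong₂ _+_ (p zero) (Σ-cong (p ∘ suc))

  Σ-mono : ∀ {n} {f g : Fin n → ℚ} → (∀ i → f i ≤ g i) → Σ f ≤ Σ g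
  Σ-mono {zero} p = ℚ.≤-refl
  Σ-mono {suc n} p = ℚ.+-mono-≤ (p zero) (Σ-mono (p ∘ suc))

  Σ-zero : ∀ n → Σ {n} (λ _ → 0ℚ) ≡ 0ℚ
  Σ-zero zero = refl
  Σ-zero (suc n) = trans (cong (0ℚ +_) (Σ-zero n)) (ℚ.+-identityˡ 0ℚ)

  Σ-nn : ∀ {n} {f : Fin n → ℚ} → (∀ i → 0ℚ ≤ f i) → 0ℚ ≤ Σ f
  Σ-nn {n} {f} p = subst (_≤ Σ f) (Σ-zero n) (Σ-mono p)

  Σ-+ : ∀ {n} (f g : Fin n → ℚ) → Σ (λ i → f i + g i) ≡ Σ f + Σ g
  Σ-+ {zero} f g = sym (ℚ.+-identityˡ 0ℚ)
  Σ-+ {suc n} f g = trans (cong (f zero + g zero +_) (Σ-+ (f ∘ suc) (g ∘ suc)))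
    (lem (f zero) (g zero) (Σ (f ∘ suc)) (Σ (g ∘ suc)))
    where
    lem : ∀ a b c d → a + b + (c + d) ≡ a + c + (b + d)
    lem = solve-∀ ring

  Σ-*ˡ : ∀ {n} c (f : Fin n → ℚ) → Σ (λ i → c * f i) ≡ c * Σ f
  Σ-*ˡ {zero} c f = sym (ℚ.*-zeroʳ c)
  Σ-*ˡ {suc n} c f = trans (cong (c * f zero +_) (Σ-*ˡ c (f ∘ suc))) (sym (ℚ.*-distribˡ-+ c _ _))

  Σ-*ʳ : ∀ {n} c (f : Fin n → ℚ) → Σ (λ i → f i * c) ≡ Σ f * c
  Σ-*ʳ c f = trans (Σ-cong (λ i → ℚ.*-comm (f i) c)) (trans (Σ-*ˡ c f) (ℚ.*-comm c _))

  Σ-- : ∀ {n} (f g : Fin n → ℚ) → Σ (λ i → f i - g i) ≡ Σ f - Σ g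
  Σ-- {zero} f g = refl
  Σ-- {suc n} f g = trans (cong (f zero - g zero +_) (Σ-- (f ∘ suc) (g ∘ suc)))
    (lem (f zero) (g zero) (Σ (f ∘ suc)) (Σ (g ∘ suc)))
    where
    lem : ∀ a b c d → a - b + (c - d) ≡ a + c - (b + d)
    lem = solve-∀ ring

  Σ-const : ∀ n c → Σ {n} (λ _ → c) ≡ ι n * c
  Σ-const zero c = sym (trans (cong (_* c) ι-zero) (ℚ.*-zeroˡ c))
  Σ-const (suc n) c = trans (cong (c +_) (Σ-const n c)) (trans (lem c (ι n)) (cong (_* c) (sym (ι-suc n))))
    where
    lem : ∀ c x → c + x * c ≡ (1ℚ + x) * c
    lem = solve-∀ ring

  Σ-swap : ∀ {m n} (f : Fin m → Fin n → ℚ) → Σ (λ i → Σ (f i)) ≡ Σ (λ j → Σ (λ i → f i j))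
  Σ-swap {zero} {n} f = sym (Σ-zero n)
  Σ-swap {suc m} f = trans (cong (Σ (f zero) +_) (Σ-swap (f ∘ suc))) (sym (Σ-+ (f zero) _))

  Σ-upper : ∀ {n} {f : Fin n → ℚ} c → (∀ i → f i ≤ c) → Σ f ≤ ι n * c
  Σ-upper {n} c p = ℚ.≤-trans (Σ-mono p) (ℚ.≤-reflexive (Σ-const n c))

  infix 4 _==_
  _==_ : ∀ {n} → Fin n → Fin n → Bool
  zero == zero = true
  zero == suc j = false
  suc i == zero = false
  suc i == suc j = i == j

  ==-refl : ∀ {n} (i : Fin n) → (i == i) ≡ true
  ==-refl zero = refl
  ==-refl (suc i) = ==-refl i

  ==⇒≡ : ∀ {n} (i j : Fin n) → (i == j) ≡ true → i ≡ j
  ==⇒≡ zero zero p = refl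
  ==⇒≡ (suc i) (suc j) p = cong suc (==⇒≡ i j p)

  ≢⇒== : ∀ {n} {i j : Fin n} → i ≢ j → (i == j) ≡ false
  ≢⇒== {i = i} {j} p with i == j in eq
  ... | true = ⊥-elim (p (==⇒≡ i j eq))
  ... | false = refl

  ==-sym : ∀ {n} (i j : Fin n) → (i == j) ≡ (j == i)
  ==-sym zero zero = refl
  ==-sym zero (suc j) = refl
  ==-sym (suc i) zero = refl
  ==-sym (suc i) (suc j) = ==-sym i j

  Σ-δ : ∀ {n} (a : Fin n) (f : Fin n → ℚ) → Σ (λ i → [ i == a ] * f i) ≡ f a
  Σ-δ {suc n} zero f = trans (cong₂ _+_ (ℚ.*-identityˡ (f zero)) (trans (Σ-cong (λ i → ℚ.*-zeroˡ (f (suc i)))) (Σ-zero n))) (ℚ.+-identityʳ _)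
  Σ-δ {suc n} (suc a) f = trans (cong₂ _+_ (ℚ.*-zeroˡ (f zero)) (Σ-δ a (f ∘ suc))) (ℚ.+-identityˡ _)

  Σ-term : ∀ {n} {f : Fin n → ℚ} → (∀ i → 0ℚ ≤ f i) → ∀ a → f a ≤ Σ f
  Σ-term {suc n} {f} p zero = ≤-by _ (Σ-nn (p ∘ suc)) refl
  Σ-term {suc n} {f} p (suc a) = ℚ.≤-trans (Σ-term (p ∘ suc) a) (≤-by (f zero) (p zero) (ℚ.+-comm (f zero) _))

  ∣∣-bounds : ∀ {a b} → - b ≤ a → a ≤ b → ∣ a ∣ ≤ b
  ∣∣-bounds {a} {b} p q with ℚ.∣p∣≡p∨∣p∣≡-p a
  ... | inj₁ e = subst (_≤ b) (sym e) q
  ... | inj₂ e = subst (_≤ b) (sym e) (≤-by (b + a) (subst (0ℚ ≤_) (lem₁ a b) (diff≥0 p)) (lem₂ a b))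
    where
    lem₁ : ∀ a b → a - (- b) ≡ b + a
    lem₁ = solve-∀ ring
    lem₂ : ∀ a b → b ≡ - a + (b + a)
    lem₂ = solve-∀ ring

  ≤∣∣ : ∀ a → a ≤ ∣ a ∣
  ≤∣∣ a with ℚ.∣p∣≡p∨∣p∣≡-p a
  ... | inj₁ e = ℚ.≤-reflexive (sym e)
  ... | inj₂ e = ℚ.≤-trans (≤-by (- (a + a)) h (lem a)) (ℚ.≤-reflexive (sym e))
    where
    lem : ∀ a → - a ≡ a + - (a + a)
    lem = solve-∀ ring
    nn : 0ℚ ≤ - a
    nn = subst (0ℚ ≤_) e (ℚ.0≤∣p∣ a)
    h : 0ℚ ≤ - (a + a)
    h = subst (0ℚ ≤_) (sym (ℚ.neg-distrib-+ a a)) (+-nn nn nn)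

-- Random greedy packing and joint survival probabilities.

module RandomStates where
  open import Data.Rational.Base hiding (truncate)
  open FiniteSums

  w : Bool → ℚ → ℚ
  w true x = x
  w false x = 1ℚ

  Π : ∀ {n} → (Fin n → ℚ) → ℚ
  Π {zero} f = 1ℚ
  Π {suc n} f = f zero * Π (f ∘ suc)

  Π-cong : ∀ {n} {f g : Fin n → ℚ} → (∀ i → f i ≡ g i) → Π f ≡ Π g
  Π-cong {zero} p = refl
  Π-cong {suc n} p = cong₂ _*_ (p zero) (Π-cong (p ∘ suc))

  Π-* : ∀ {n} (f g : Fin n → ℚ) → Π (λ i → f i * g i) ≡ Π f * Π g
  Π-* {zero} f g = refl
  Π-* {suc n} f g = trans (cong (f zero * g zero *_) (Π-* (f ∘ suc) (g ∘ suc)))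
    (lem (f zero) (g zero) (Π (f ∘ suc)) (Π (g ∘ suc)))
    where
    lem : ∀ a b c d → a * b * (c * d) ≡ a * c * (b * d)
    lem = solve-∀ ring

  Π-one : ∀ n → Π {n} (λ _ → 1ℚ) ≡ 1ℚ
  Π-one zero = refl
  Π-one (suc n) = trans (ℚ.*-identityˡ _) (Π-one n)

  Π-single : ∀ {n} (a : Fin n) x → Π (λ i → w (i == a) x) ≡ x
  Π-single {suc n} zero x = trans (cong (x *_) (Π-one n)) (ℚ.*-identityʳ x)
  Π-single {suc n} (suc a) x = trans (ℚ.*-identityˡ _) (Π-single a x)

  Π-nn : ∀ {n} {f : Fin n → ℚ} → (∀ i → 0ℚ ≤ f i) → 0ℚ ≤ Π f
  Π-nn {zero} p = 0≤1
  Π-nn {suc n} p = *-nn (p zero) (Π-nn (p ∘ suc))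

  Π-mono : ∀ {n} {f g : Fin n → ℚ} → (∀ i → 0ℚ ≤ f i) → (∀ i → f i ≤ g i) → Π f ≤ Π g
  Π-mono {zero} p q = ℚ.≤-refl
  Π-mono {suc n} p q = *-mono (p zero) (ℚ.≤-trans (Π-nn (p ∘ suc)) (Π-mono (p ∘ suc) (q ∘ suc))) (q zero) (Π-mono (p ∘ suc) (q ∘ suc))

  module _ {M : ℕ} where

    -- The vertices of the hypergraph are called edges, because they are going to be the arcs of a
    -- tournament.
    Edge : Set
    Edge = Fin M

    record Triple : Set where
      constructor triple
      field
        a b c : Edge
        a≢b : (a == b) ≡ false
        a≢c : (a == c) ≡ false
        b≢c : (b == c) ≡ false
    open Triple

    infix 5 _∋_
    _∋_ : Triple → Edge → Bool
    t ∋ e = (e == a t) ∨ ((e == b t) ∨ (e == c t))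

    -- The probability that all of `S` survives if the edges survived independently with
    -- probabilities `f`.
    pr : (Edge → Bool) → (Edge → ℚ) → ℚ
    pr S f = Π (λ e → w (S e) (f e))

    off : (Edge → Bool) → Triple → Edge → Bool
    off S t e = S e ∧ not (t ∋ e)

    _∪_ : (Edge → Bool) → Triple → Edge → Bool
    (S ∪ t) e = S e ∨ (t ∋ e)

    -- Isolates the factors at `t`, the only ones that a step at `t` changes; since its three edges
    -- are distinct, no factor is taken out twice.
    split : ∀ S t f → pr S f ≡ pr (off S t) f * (w (S (a t)) (f (a t)) * (w (S (b t)) (f (b t)) * w (S (c t)) (f (c t))))
    split S t f = begin
      Π (λ e → w (S e) (f e)) ≡⟨ Π-cong point ⟩
      Π (λ e → w (off S t e) (f e) * (A e * (B e * C e))) ≡⟨ Π-* (λ e → w (off S t e) (f e)) (λ e → A e * (B e * C e)) ⟩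
      pr (off S t) f * Π (λ e → A e * (B e * C e)) ≡⟨ cong (pr (off S t) f *_) (trans (Π-* A (λ e → B e * C e)) (cong₂ _*_ (Π-single (a t) _) (trans (Π-* B C) (cong₂ _*_ (Π-single (b t) _) (Π-single (c t) _))))) ⟩
      _ ∎
      where
      open ≡-Reasoning
      A B C : Edge → ℚ
      A e = w (e == a t) (w (S (a t)) (f (a t)))
      B e = w (e == b t) (w (S (b t)) (f (b t)))
      C e = w (e == c t) (w (S (c t)) (f (c t)))
      l₁ : ∀ x → x ≡ 1ℚ * (x * (1ℚ * 1ℚ))
      l₁ = solve-∀ ring
      l₂ : ∀ x → x ≡ 1ℚ * (1ℚ * (x * 1ℚ))
      l₂ = solve-∀ ring
      l₃ : ∀ x → x ≡ 1ℚ * (1ℚ * (1ℚ * x))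
      l₃ = solve-∀ ring
      l₀ : ∀ x → x ≡ x * (1ℚ * (1ℚ * 1ℚ))
      l₀ = solve-∀ ring
      and-false : ∀ x → x ∧ false ≡ false
      and-false true = refl
      and-false false = refl
      and-true : ∀ x → x ∧ true ≡ x
      and-true true = refl
      and-true false = refl
      point : ∀ e → w (S e) (f e) ≡ w (off S t e) (f e) * (A e * (B e * C e))
      point e with e == a t in ea | e == b t in eb | e == c t in ec
      ... | true | true | _ = ⊥-elim (contra (trans (sym (trans (cong (_== b t) (sym (==⇒≡ e (a t) ea))) eb)) (a≢b t)))
        where contra : true ≢ false
              contra ()
      ... | true | false | true = ⊥-elim (contra (trans (sym (trans (cong (_== c t) (sym (==⇒≡ e (a t) ea))) ec)) (a≢c t)))
        where contra : true ≢ false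
              contra ()
      ... | false | true | true = ⊥-elim (contra (trans (sym (trans (cong (_== c t) (sym (==⇒≡ e (b t) eb))) ec)) (b≢c t)))
        where contra : true ≢ false
              contra ()
      ... | true | false | false rewrite and-false (S e) | ==⇒≡ e (a t) ea = l₁ _
      ... | false | true | false rewrite and-false (S e) | ==⇒≡ e (b t) eb = l₂ _
      ... | false | false | true rewrite and-false (S e) | ==⇒≡ e (c t) ec = l₃ _
      ... | false | false | false rewrite and-true (S e) = l₀ _

    ∋a : ∀ t → (t ∋ a t) ≡ true
    ∋a t rewrite ==-refl (a t) = refl

    ∋b : ∀ t → (t ∋ b t) ≡ true
    ∋b t rewrite ==-refl (b t) with b t == a t
    ... | true = refl
    ... | false = refl

    ∋c : ∀ t → (t ∋ c t) ≡ true
    ∋c t rewrite ==-refl (c t) with c t == a t | c t == b t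
    ... | true | _ = refl
    ... | false | true = refl
    ... | false | false = refl

    or-true : ∀ x → x ∨ true ≡ true
    or-true true = refl
    or-true false = refl

    split-∪ : ∀ S t f → pr (S ∪ t) f ≡ pr (off S t) f * (f (a t) * (f (b t) * f (c t)))
    split-∪ S t f = trans (split (S ∪ t) t f) (cong₂ _*_ (Π-cong point)
        (cong₂ _*_ (on (a t) (∋a t)) (cong₂ _*_ (on (b t) (∋b t)) (on (c t) (∋c t)))))
      where
      on : ∀ e → (t ∋ e) ≡ true → w ((S ∪ t) e) (f e) ≡ f e
      on e p rewrite p | or-true (S e) = refl
      point : ∀ e → w (off (S ∪ t) t e) (f e) ≡ w (off S t e) (f e)
      point e with S e | t ∋ e
      ... | true | true = refl
      ... | true | false = refl
      ... | false | true = refl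
      ... | false | false = refl

    off-cong : ∀ S t {f g : Edge → ℚ} → (∀ e → (t ∋ e) ≡ false → f e ≡ g e) → pr (off S t) f ≡ pr (off S t) g
    off-cong S t {f} {g} p = Π-cong point
      where
      point : ∀ e → w (off S t e) (f e) ≡ w (off S t e) (g e)
      point e with t ∋ e in eq
      ... | false = cong (w (S e ∧ true)) (p e eq)
      ... | true with S e
      ...   | true = refl
      ...   | false = refl

    w-nn : ∀ s {x} → 0ℚ ≤ x → 0ℚ ≤ w s x
    w-nn true p = p
    w-nn false p = 0≤1

    pr-nn : ∀ S {f} → (∀ e → 0ℚ ≤ f e) → 0ℚ ≤ pr S f
    pr-nn S p = Π-nn (λ e → w-nn (S e) (p e))

    pr-mono : ∀ S {f g} → (∀ e → 0ℚ ≤ f e) → (∀ e → f e ≤ g e) → pr S f ≤ pr S g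
    pr-mono S {f} {g} p q = Π-mono (λ e → w-nn (S e) (p e)) mono
      where
      mono : ∀ e → w (S e) (f e) ≤ w (S e) (g e)
      mono e with S e
      ... | true = q e
      ... | false = ℚ.≤-refl

    pr-one : ∀ S → pr S (λ _ → 1ℚ) ≡ 1ℚ
    pr-one S = trans (Π-cong point) (Π-one M)
      where
      point : ∀ e → w (S e) 1ℚ ≡ 1ℚ
      point e with S e
      ... | true = refl
      ... | false = refl

    pr≤1 : ∀ S {f} → (∀ e → 0ℚ ≤ f e) → (∀ e → f e ≤ 1ℚ) → pr S f ≤ 1ℚ
    pr≤1 S p q = ℚ.≤-trans (pr-mono S p q) (ℚ.≤-reflexive (pr-one S))

    kill : Triple → (Edge → Bool) → Edge → Bool
    kill t s e = s e ∧ not (t ∋ e)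

    full : Triple → (Edge → Bool) → Bool
    full t s = s (a t) ∧ (s (b t) ∧ s (c t))

    -- Ties the counter to an actual run: every pick found its three edges alive and killed them, so
    -- the picked triples are pairwise disjoint and can be replayed later.
    data Reach (H : List Triple) : (Edge → Bool) → ℕ → Set where
      start : Reach H (λ _ → true) 0
      pick : ∀ {s k} t → t ∈ H → full t s ≡ true → Reach H s k → Reach H (kill t s) (suc k)

    record State (H : List Triple) : Set where
      constructor state
      field
        alive : Edge → Bool
        count : ℕ
        reach : Reach H alive count
    open State

    -- A finite distribution as a list of weighted states. Repeated states are harmless because only
    -- expectations are used.
    Dist : List Triple → Set
    Dist H = List (ℚ × State H)

    𝔼 : ∀ {H} → Dist H → (State H → ℚ) → ℚ
    𝔼 [] F = 0ℚ
    𝔼 ((p , s) ∷ d) F = p * F s + 𝔼 d F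

    module _ {H : List Triple} where

      branch : (t : Triple) → t ∈ H → ℚ → ℚ → (s : State H) → (v : Bool) → full t (alive s) ≡ v → Dist H → Dist H
      branch t t∈H x p s false _ d = (p , s) ∷ d
      branch t t∈H x p s true eq d =
        (p * x , state (kill t (alive s)) (suc (count s)) (pick t t∈H eq (reach s))) ∷ (p * (1ℚ - x) , s) ∷ d

      step : (t : Triple) → t ∈ H → ℚ → Dist H → Dist H
      step t t∈H x [] = []
      step t t∈H x ((p , s) ∷ d) = branch t t∈H x p s (full t (alive s)) refl (step t t∈H x d)

      data NonNeg : Dist H → Set where
        [] : NonNeg []
        _∷_ : ∀ {p s d} → 0ℚ ≤ p → NonNeg d → NonNeg ((p , s) ∷ d)

      step-nn : ∀ t t∈H x → 0ℚ ≤ x → x ≤ 1ℚ → ∀ {d} → NonNeg d → NonNeg (step t t∈H x d)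
      step-nn t t∈H x 0≤x x≤1 [] = []
      step-nn t t∈H x 0≤x x≤1 {(p , s) ∷ d} (0≤p ∷ nn) = go (full t (alive s)) refl
        where
        go : ∀ v eq → NonNeg (branch t t∈H x p s v eq (step t t∈H x d))
        go false eq = 0≤p ∷ step-nn t t∈H x 0≤x x≤1 nn
        go true eq = *-nn 0≤p 0≤x ∷ *-nn 0≤p (diff≥0 x≤1) ∷ step-nn t t∈H x 0≤x x≤1 nn

      𝔼-mono : ∀ {d} → NonNeg d → ∀ {F G : State H → ℚ} → (∀ s → F s ≤ G s) → 𝔼 d F ≤ 𝔼 d G
      𝔼-mono [] q = ℚ.≤-refl
      𝔼-mono (0≤p ∷ nn) q = ℚ.+-mono-≤ (*-monoˡ _ 0≤p (q _)) (𝔼-mono nn q)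

      𝔼-cong : ∀ d {F G : State H → ℚ} → (∀ s → F s ≡ G s) → 𝔼 d F ≡ 𝔼 d G
      𝔼-cong [] q = refl
      𝔼-cong ((p , s) ∷ d) q = cong₂ _+_ (cong (p *_) (q s)) (𝔼-cong d q)

      𝔼-linear : ∀ d (F G : State H → ℚ) c → 𝔼 d (λ s → F s + c * G s) ≡ 𝔼 d F + c * 𝔼 d G
      𝔼-linear [] F G c = lem c
        where
        lem : ∀ c → 0ℚ ≡ 0ℚ + c * 0ℚ
        lem = solve-∀ ring
      𝔼-linear ((p , s) ∷ d) F G c = trans (cong (p * (F s + c * G s) +_) (𝔼-linear d F G c)) (lem p (F s) (G s) c (𝔼 d F) (𝔼 d G))
        where
        lem : ∀ p f g c u v → p * (f + c * g) + (u + c * v) ≡ p * f + u + c * (p * g + v)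
        lem = solve-∀ ring

      Obs : Set
      Obs = (Edge → Bool) → ℕ → ℚ

      ob : Obs → State H → ℚ
      ob F s = F (alive s) (count s)

      after : Triple → ℚ → Obs → Obs
      after t x F s k = if full t s then x * F (kill t s) (suc k) + (1ℚ - x) * F s k else F s k

      𝔼-step : ∀ t t∈H x d F → 𝔼 (step t t∈H x d) (ob F) ≡ 𝔼 d (ob (after t x F))
      𝔼-step t t∈H x [] F = refl
      𝔼-step t t∈H x ((p , s) ∷ d) F = go (full t (alive s)) refl
        where
        lem : ∀ p x u v r → p * x * u + (p * (1ℚ - x) * v + r) ≡ p * (x * u + (1ℚ - x) * v) + r
        lem = solve-∀ ring
        go : ∀ v (eq : full t (alive s) ≡ v) → 𝔼 (branch t t∈H x p s v eq (step t t∈H x d)) (ob F) ≡ p * ob (after t x F) s + 𝔼 d (ob (after t x F))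
        go false eq rewrite eq = cong (p * ob F s +_) (𝔼-step t t∈H x d F)
        go true eq rewrite eq = trans (lem p x _ _ _) (cong (p * _ +_) (𝔼-step t t∈H x d F))

      I : (Edge → Bool) → Edge → ℚ
      I s e = [ s e ]

      -- The probability that all of `S` is alive: for the 0-1 values `I s` the product `pr` is the
      -- indicator of this event.
      P : Dist H → (Edge → Bool) → ℚ
      P d S = 𝔼 d (ob (λ s _ → pr S (I s)))

      touches : (Edge → Bool) → Triple → Bool
      touches S t = S (a t) ∨ (S (b t) ∨ S (c t))

      -- A surviving `S` is lost exactly if `t` meets it and is picked. Picking requires `t` alive,
      -- so the event lost has probability `x` times that of `S ∪ t` being alive.
      P-step : ∀ t t∈H x d S → P (step t t∈H x d) S ≡ P d S + (- ([ touches S t ] * x)) * P d (S ∪ t)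
      P-step t t∈H x d S = trans (𝔼-step t t∈H x d _) (trans (𝔼-cong d (λ s → point (alive s))) (𝔼-linear d (ob (λ s _ → pr S (I s))) (ob (λ s _ → pr (S ∪ t) (I s))) (- ([ touches S t ] * x))))
        where
        killed : ∀ s e → (t ∋ e) ≡ true → [ kill t s e ] ≡ 0ℚ
        killed s e p rewrite p with s e
        ... | true = refl
        ... | false = refl
        kept : ∀ s e → (t ∋ e) ≡ false → I (kill t s) e ≡ I s e
        kept s e p rewrite p with s e
        ... | true = refl
        ... | false = refl
        zeros : ∀ u v r → w u 0ℚ * (w v 0ℚ * w r 0ℚ) ≡ 1ℚ - [ u ∨ (v ∨ r) ]
        zeros true true true = refl
        zeros true true false = refl
        zeros true false true = refl
        zeros true false false = refl
        zeros false true true = refl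
        zeros false true false = refl
        zeros false false true = refl
        zeros false false false = refl
        ones : ∀ u v r → w u 1ℚ * (w v 1ℚ * w r 1ℚ) ≡ 1ℚ
        ones true true true = refl
        ones true true false = refl
        ones true false true = refl
        ones true false false = refl
        ones false true true = refl
        ones false true false = refl
        ones false false true = refl
        ones false false false = refl
        fullring : ∀ x R m → x * (R * (1ℚ - m)) + (1ℚ - x) * (R * 1ℚ) ≡ R * 1ℚ + (- (m * x)) * (R * (1ℚ * (1ℚ * 1ℚ)))
        fullring = solve-∀ ring
        zero-ring : ∀ p m x R → p ≡ p + (- (m * x)) * (R * 0ℚ)
        zero-ring = solve-∀ ring
        point : ∀ s → after t x (λ s _ → pr S (I s)) s 0 ≡ pr S (I s) + (- ([ touches S t ] * x)) * pr (S ∪ t) (I s)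
        point s with s (a t) in ea | s (b t) in eb | s (c t) in ec
        ... | false | _ | _ = trans (zero-ring _ [ touches S t ] x (pr (off S t) (I s))) (cong (λ z → pr S (I s) + (- ([ touches S t ] * x)) * z)
                (sym (trans (split-∪ S t (I s)) (cong (pr (off S t) (I s) *_) (trans (cong (λ z → [ z ] * ([ s (b t) ] * [ s (c t) ])) ea) (ℚ.*-zeroˡ ([ s (b t) ] * [ s (c t) ])))))))
        ... | true | false | _ = trans (zero-ring _ [ touches S t ] x (pr (off S t) (I s))) (cong (λ z → pr S (I s) + (- ([ touches S t ] * x)) * z)
                (sym (trans (split-∪ S t (I s)) (cong (pr (off S t) (I s) *_) (trans (cong (λ z → [ s (a t) ] * ([ z ] * [ s (c t) ])) eb)
                  (trans (cong ([ s (a t) ] *_) (ℚ.*-zeroˡ [ s (c t) ])) (ℚ.*-zeroʳ [ s (a t) ])))))))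
        ... | true | true | false = trans (zero-ring _ [ touches S t ] x (pr (off S t) (I s))) (cong (λ z → pr S (I s) + (- ([ touches S t ] * x)) * z)
                (sym (trans (split-∪ S t (I s)) (cong (pr (off S t) (I s) *_) (trans (cong (λ z → [ s (a t) ] * ([ s (b t) ] * [ z ])) ec)
                  (trans (cong ([ s (a t) ] *_) (ℚ.*-zeroʳ [ s (b t) ])) (ℚ.*-zeroʳ [ s (a t) ])))))))
        ... | true | true | true = trans (cong₂ (λ u v → x * u + (1ℚ - x) * v) dead same) (trans (fullring x R [ touches S t ])
                (cong₂ (λ u v → u + (- ([ touches S t ] * x)) * v) (sym same) (sym uni)))
          where
          R = pr (off S t) (I s)
          same : pr S (I s) ≡ R * 1ℚ
          same = trans (split S t (I s)) (cong (R *_) (trans (cong₂ _*_ (cong (λ z → w (S (a t)) [ z ]) ea) (cong₂ _*_ (cong (λ z → w (S (b t)) [ z ]) eb) (cong (λ z → w (S (c t)) [ z ]) ec))) (ones (S (a t)) (S (b t)) (S (c t)))))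
          uni : pr (S ∪ t) (I s) ≡ R * (1ℚ * (1ℚ * 1ℚ))
          uni = trans (split-∪ S t (I s)) (cong (R *_) (cong₂ _*_ (cong [_] ea) (cong₂ _*_ (cong [_] eb) (cong [_] ec))))
          dead : pr S (I (kill t s)) ≡ R * (1ℚ - [ touches S t ])
          dead = trans (split S t (I (kill t s))) (cong₂ _*_ (off-cong S t (kept s))
            (trans (cong₂ _*_ (cong (w (S (a t))) (killed s (a t) (∋a t))) (cong₂ _*_ (cong (w (S (b t))) (killed s (b t) (∋b t))) (cong (w (S (c t))) (killed s (c t) (∋c t)))))
              (zeros (S (a t)) (S (b t)) (S (c t)))))

-- The error invariant under one random choice.

module NibbleStep where
  open import Data.Rational.Base hiding (truncate)
  open FiniteSums
  open RandomStates

  2ℚ 4ℚ 64ℚ : ℚ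
  2ℚ = 1ℚ + 1ℚ
  4ℚ = 2ℚ * 2ℚ
  64ℚ = 4ℚ * (4ℚ * 4ℚ)

  0≤2 : 0ℚ ≤ 2ℚ
  0≤2 = +-nn 0≤1 0≤1

  0≤4 : 0ℚ ≤ 4ℚ
  0≤4 = *-nn 0≤2 0≤2

  0≤64 : 0ℚ ≤ 64ℚ
  0≤64 = *-nn 0≤4 (*-nn 0≤4 0≤4)

  scaled-bound : ∀ {R y k c} → 0ℚ ≤ R → R ≤ 1ℚ → 0ℚ ≤ y → - c ≤ k → k ≤ c → 0ℚ ≤ c → ∣ R * y * k ∣ ≤ y * c
  scaled-bound {R} {y} {k} {c} 0≤R R≤1 0≤y lo hi 0≤c = ∣∣-bounds below above
    where
    Ry≤y : R * y ≤ y
    Ry≤y = ℚ.≤-trans (*-monoʳ y 0≤y R≤1) (ℚ.≤-reflexive (ℚ.*-identityˡ y))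
    above : R * y * k ≤ y * c
    above = ℚ.≤-trans (*-monoˡ (R * y) (*-nn 0≤R 0≤y) hi) (*-monoʳ c 0≤c Ry≤y)
    e : ∀ R y c → R * y * (- c) ≡ - (R * y * c)
    e = solve-∀ ring
    below : - (y * c) ≤ R * y * k
    below = ℚ.≤-trans (ℚ.neg-antimono-≤ (*-monoʳ c 0≤c Ry≤y)) (ℚ.≤-trans (ℚ.≤-reflexive (sym (e R y c))) (*-monoˡ (R * y) (*-nn 0≤R 0≤y) lo))

  -- `R` is the predicted product off `t`, and `p`, `q`, `r` are the predictions at `t`. Lowering
  -- these by `y` reproduces the true loss to first order: exactly if at most one edge of `t` lies
  -- in `S`, and otherwise up to `y` for each pair of edges in `S`.
  module Drop {R y p q r : ℚ} (0≤R : 0ℚ ≤ R) (R≤1 : R ≤ 1ℚ) (0≤y : 0ℚ ≤ y)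
    (yp : y ≤ p) (p1 : p ≤ 1ℚ) (yq : y ≤ q) (q1 : q ≤ 1ℚ) (yr : y ≤ r) (r1 : r ≤ 1ℚ) where

    two : ∀ {a b} → y ≤ a → a ≤ 1ℚ → y ≤ b → b ≤ 1ℚ → - 1ℚ ≤ a + b - 1ℚ - y × a + b - 1ℚ - y ≤ 1ℚ
    two {a} {b} ya a1 yb b1 =
        ≤-by (b + (a - y)) (+-nn (ℚ.≤-trans 0≤y yb) (diff≥0 ya)) (l₁ a b y)
      , ≤-by ((1ℚ - a) + ((1ℚ - b) + y)) (+-nn (diff≥0 a1) (+-nn (diff≥0 b1) 0≤y)) (l₂ a b y)
      where
      l₁ : ∀ a b y → a + b - 1ℚ - y ≡ - 1ℚ + (b + (a - y))
      l₁ = solve-∀ ring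
      l₂ : ∀ a b y → 1ℚ ≡ a + b - 1ℚ - y + ((1ℚ - a) + ((1ℚ - b) + y))
      l₂ = solve-∀ ring

    k₃ : ℚ
    k₃ = p * q + p * r + q * r - 1ℚ - y * (p + q + r) + y * y

    k₃-lo : - (1ℚ + 1ℚ + 1ℚ) ≤ k₃
    k₃-lo = ≤-by ((1ℚ + 1ℚ) + (q * (p - y) + (p * (r - y) + (r * (q - y) + y * y))))
      (+-nn 0≤2 (+-nn (*-nn 0q (diff≥0 yp)) (+-nn (*-nn 0p (diff≥0 yr)) (+-nn (*-nn 0r (diff≥0 yq)) (sq-nn y)))))
      (l p q r y)
      where
      0p : 0ℚ ≤ p
      0p = ℚ.≤-trans 0≤y yp
      0q : 0ℚ ≤ q
      0q = ℚ.≤-trans 0≤y yq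
      0r : 0ℚ ≤ r
      0r = ℚ.≤-trans 0≤y yr
      l : ∀ p q r y → p * q + p * r + q * r - 1ℚ - y * (p + q + r) + y * y
            ≡ - (1ℚ + 1ℚ + 1ℚ) + ((1ℚ + 1ℚ) + (q * (p - y) + (p * (r - y) + (r * (q - y) + y * y))))
      l = solve-∀ ring

    k₃-hi : k₃ ≤ 1ℚ + 1ℚ + 1ℚ
    k₃-hi = ≤-by (1ℚ + (((1ℚ - p * q) + ((1ℚ - p * r) + (1ℚ - q * r))) + (y * (p - y) + y * (q + r))))
      (+-nn 0≤1 (+-nn (+-nn (prod p1 q1 0p) (+-nn (prod p1 r1 0p) (prod q1 r1 0q))) (+-nn (*-nn 0≤y (diff≥0 yp)) (*-nn 0≤y (+-nn 0q 0r)))))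
      (l p q r y)
      where
      0p : 0ℚ ≤ p
      0p = ℚ.≤-trans 0≤y yp
      0q : 0ℚ ≤ q
      0q = ℚ.≤-trans 0≤y yq
      0r : 0ℚ ≤ r
      0r = ℚ.≤-trans 0≤y yr
      prod : ∀ {u v} → u ≤ 1ℚ → v ≤ 1ℚ → 0ℚ ≤ u → 0ℚ ≤ 1ℚ - u * v
      prod {u} {v} u1 v1 0u = diff≥0 (ℚ.≤-trans (*-mono 0u 0≤1 u1 v1) (ℚ.≤-reflexive (ℚ.*-identityˡ 1ℚ)))
      l : ∀ p q r y → 1ℚ + 1ℚ + 1ℚ ≡ p * q + p * r + q * r - 1ℚ - y * (p + q + r) + y * y
           + (1ℚ + (((1ℚ - p * q) + ((1ℚ - p * r) + (1ℚ - q * r))) + (y * (p - y) + y * (q + r))))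
      l = solve-∀ ring

    pairCount : Bool → Bool → Bool → ℚ
    pairCount u v z = [ u ] * [ v ] + [ u ] * [ z ] + [ v ] * [ z ]

    drop : ∀ u v z → ∣ R * (w u p * (w v q * w z r)) - [ u ∨ (v ∨ z) ] * (R * y) - R * (w u (p - y) * (w v (q - y) * w z (r - y))) ∣
             ≤ y * pairCount u v z
    drop true true true = subst (λ e → ∣ e ∣ ≤ y * pairCount true true true) (sym (l R p q r y)) (scaled-bound 0≤R R≤1 0≤y k₃-lo k₃-hi (+-nn 0≤2 0≤1))
      where
      l : ∀ R p q r y → R * (p * (q * r)) - 1ℚ * (R * y) - R * ((p - y) * ((q - y) * (r - y))) ≡ R * y * (p * q + p * r + q * r - 1ℚ - y * (p + q + r) + y * y)
      l = solve-∀ ring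
    drop true true false = subst (λ e → ∣ e ∣ ≤ y * pairCount true true false) (sym (l R p q y)) (scaled-bound 0≤R R≤1 0≤y (proj₁ (two yp p1 yq q1)) (proj₂ (two yp p1 yq q1)) 0≤1)
      where
      l : ∀ R p q y → R * (p * (q * 1ℚ)) - 1ℚ * (R * y) - R * ((p - y) * ((q - y) * 1ℚ)) ≡ R * y * (p + q - 1ℚ - y)
      l = solve-∀ ring
    drop true false true = subst (λ e → ∣ e ∣ ≤ y * pairCount true false true) (sym (l R p r y)) (scaled-bound 0≤R R≤1 0≤y (proj₁ (two yp p1 yr r1)) (proj₂ (two yp p1 yr r1)) 0≤1)
      where
      l : ∀ R p q y → R * (p * (1ℚ * q)) - 1ℚ * (R * y) - R * ((p - y) * (1ℚ * (q - y))) ≡ R * y * (p + q - 1ℚ - y)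
      l = solve-∀ ring
    drop false true true = subst (λ e → ∣ e ∣ ≤ y * pairCount false true true) (sym (l R q r y)) (scaled-bound 0≤R R≤1 0≤y (proj₁ (two yq q1 yr r1)) (proj₂ (two yq q1 yr r1)) 0≤1)
      where
      l : ∀ R p q y → R * (1ℚ * (p * q)) - 1ℚ * (R * y) - R * (1ℚ * ((p - y) * (q - y))) ≡ R * y * (p + q - 1ℚ - y)
      l = solve-∀ ring
    drop true false false = subst (λ e → ∣ e ∣ ≤ y * pairCount true false false) (sym (l R p y)) (scaled-bound 0≤R R≤1 0≤y ℚ.≤-refl ℚ.≤-refl ℚ.≤-refl)
      where
      l : ∀ R p y → R * (p * (1ℚ * 1ℚ)) - 1ℚ * (R * y) - R * ((p - y) * (1ℚ * 1ℚ)) ≡ R * y * 0ℚ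
      l = solve-∀ ring
    drop false true false = subst (λ e → ∣ e ∣ ≤ y * pairCount false true false) (sym (l R q y)) (scaled-bound 0≤R R≤1 0≤y ℚ.≤-refl ℚ.≤-refl ℚ.≤-refl)
      where
      l : ∀ R p y → R * (1ℚ * (p * 1ℚ)) - 1ℚ * (R * y) - R * (1ℚ * ((p - y) * 1ℚ)) ≡ R * y * 0ℚ
      l = solve-∀ ring
    drop false false true = subst (λ e → ∣ e ∣ ≤ y * pairCount false false true) (sym (l R r y)) (scaled-bound 0≤R R≤1 0≤y ℚ.≤-refl ℚ.≤-refl ℚ.≤-refl)
      where
      l : ∀ R p y → R * (1ℚ * (1ℚ * p)) - 1ℚ * (R * y) - R * (1ℚ * (1ℚ * (p - y))) ≡ R * y * 0ℚ
      l = solve-∀ ring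
    drop false false false = subst (λ e → ∣ e ∣ ≤ y * pairCount false false false) (sym (l R y)) (scaled-bound 0≤R R≤1 0≤y ℚ.≤-refl ℚ.≤-refl ℚ.≤-refl)
      where
      l : ∀ R y → R * (1ℚ * (1ℚ * 1ℚ)) - 0ℚ * (R * y) - R * (1ℚ * (1ℚ * 1ℚ)) ≡ R * y * 0ℚ
      l = solve-∀ ring

  -- The old error at `S ∪ t` enters with factor `x` and has to be absorbed by raising the error
  -- weights at `t` by `h`. As weights are at most 4, it is at most 64 `x` ≤ `h` times the weight
  -- off `t`.
  module Grow {R h x p q r : ℚ} (0≤R : 0ℚ ≤ R) (0≤x : 0ℚ ≤ x) (64x≤h : 64ℚ * x ≤ h)
    (1p : 1ℚ ≤ p) (p4 : p ≤ 4ℚ) (1q : 1ℚ ≤ q) (q4 : q ≤ 4ℚ) (1r : 1ℚ ≤ r) (r4 : r ≤ 4ℚ) where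

    0≤h : 0ℚ ≤ h
    0≤h = ℚ.≤-trans (*-nn 0≤64 0≤x) 64x≤h

    pos≥ : ∀ {a} → 1ℚ ≤ a → 0ℚ ≤ a
    pos≥ = ℚ.≤-trans 0≤1

    up : ∀ {a} → a ≤ a + h
    up = ≤-by h 0≤h refl

    wmono : ∀ u {a} → w u a ≤ w u (a + h)
    wmono true = up
    wmono false = ℚ.≤-refl

    w≥1 : ∀ u {a} → 1ℚ ≤ a → 1ℚ ≤ w u a
    w≥1 true p = p
    w≥1 false p = ℚ.≤-refl

    bump : ∀ {a V V′} → 1ℚ ≤ a → V ≤ V′ → 1ℚ ≤ V′ → a * V + h ≤ (a + h) * V′
    bump {a} {V} {V′} 1a VV 1V = ≤-by (a * (V′ - V) + h * (V′ - 1ℚ)) (+-nn (*-nn (pos≥ 1a) (diff≥0 VV)) (*-nn 0≤h (diff≥0 1V))) (l a V V′ h)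
      where
      l : ∀ a V V′ h → (a + h) * V′ ≡ a * V + h + (a * (V′ - V) + h * (V′ - 1ℚ))
      l = solve-∀ ring

    1≤* : ∀ {a b} → 1ℚ ≤ a → 1ℚ ≤ b → 1ℚ ≤ a * b
    1≤* {a} {b} pa pb = ℚ.≤-trans pb (ℚ.≤-trans (ℚ.≤-reflexive (sym (ℚ.*-identityˡ b))) (*-monoʳ b (pos≥ pb) pa))

    h1 : ∀ {a} → 1ℚ ≤ a → 1ℚ ≤ a + h
    h1 p = ℚ.≤-trans p up

    -- Raising a single factor already gains `h`, since the remaining factors are at least 1.
    bundle : ∀ u v z → w u p * (w v q * w z r) + [ u ∨ (v ∨ z) ] * h ≤ w u (p + h) * (w v (q + h) * w z (r + h))
    bundle true v z = ℚ.≤-trans (ℚ.≤-reflexive (cong (p * (w v q * w z r) +_) (ℚ.*-identityˡ h)))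
        (bump {p} {w v q * w z r} 1p (*-mono (pos≥ (w≥1 v 1q)) (pos≥ (w≥1 z (h1 1r))) (wmono v) (wmono z)) (1≤* (w≥1 v (h1 1q)) (w≥1 z (h1 1r))))
    bundle false true z = ℚ.≤-trans (ℚ.≤-reflexive (l q (w z r) h)) (ℚ.≤-trans (bump {q} {w z r} 1q (wmono z) (w≥1 z (h1 1r))) (ℚ.≤-reflexive (sym (ℚ.*-identityˡ ((q + h) * w z (r + h))))))
      where
      l : ∀ q z h → 1ℚ * (q * z) + 1ℚ * h ≡ q * z + h
      l = solve-∀ ring
    bundle false false true = ℚ.≤-reflexive (l r h)
      where
      l : ∀ r h → 1ℚ * (1ℚ * r) + 1ℚ * h ≡ 1ℚ * (1ℚ * (r + h))
      l = solve-∀ ring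
    bundle false false false = ℚ.≤-reflexive (l h)
      where
      l : ∀ h → 1ℚ * (1ℚ * 1ℚ) + 0ℚ * h ≡ 1ℚ * (1ℚ * 1ℚ)
      l = solve-∀ ring

    pqr≤64 : p * (q * r) ≤ 64ℚ
    pqr≤64 = *-mono (pos≥ 1p) (*-nn 0≤4 0≤4) p4 (*-mono (pos≥ 1q) 0≤4 q4 r4)

    x-pqr : x * (p * (q * r)) ≤ h
    x-pqr = ℚ.≤-trans (*-monoˡ x 0≤x pqr≤64) (ℚ.≤-trans (ℚ.≤-reflexive (ℚ.*-comm x 64ℚ)) 64x≤h)

    grow : ∀ u v z → R * (w u p * (w v q * w z r)) + [ u ∨ (v ∨ z) ] * x * (R * (p * (q * r)))
        ≤ R * (w u (p + h) * (w v (q + h) * w z (r + h)))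
    grow u v z = begin
      R * W + m * x * (R * (p * (q * r))) ≡⟨ l R W m x (p * (q * r)) ⟩
      R * (W + m * (x * (p * (q * r)))) ≤⟨ *-monoˡ R 0≤R (ℚ.+-monoʳ-≤ W (*-monoˡ m ([]-nn (u ∨ (v ∨ z))) x-pqr)) ⟩
      R * (W + m * h) ≤⟨ *-monoˡ R 0≤R (bundle u v z) ⟩
      _ ∎
      where
      open ℚ.≤-Reasoning
      W m : ℚ
      W = w u p * (w v q * w z r)
      m = [ u ∨ (v ∨ z) ]
      l : ∀ R W m x t → R * W + m * x * (R * t) ≡ R * (W + m * (x * t))
      l = solve-∀ ring

  module _ {M : ℕ} where
    open Triple

    private
      T : Set
      T = Triple {M}
      E : Set
      E = Edge {M}

    deg : List T → E → ℚ
    deg [] e = 0ℚ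
    deg (t ∷ ts) e = [ t ∋ e ] + deg ts e

    pairs : T → (E → Bool) → ℚ
    pairs t S = [ S (a t) ] * [ S (b t) ] + [ S (a t) ] * [ S (c t) ] + [ S (b t) ] * [ S (c t) ]

    -- The budget for second-order errors: pairs of edges of `S`, counted once for each triple still
    -- to be processed that contains both.
    later : List T → (E → Bool) → ℚ
    later [] S = 0ℚ
    later (t ∷ ts) S = pairs t S + later ts S

    deg-nn : ∀ ts e → 0ℚ ≤ deg ts e
    deg-nn [] e = ℚ.≤-refl
    deg-nn (t ∷ ts) e = +-nn ([]-nn (t ∋ e)) (deg-nn ts e)

    pairs-nn : ∀ t S → 0ℚ ≤ pairs t S
    pairs-nn t S = +-nn (+-nn (*-nn ([]-nn (S (a t))) ([]-nn (S (b t)))) (*-nn ([]-nn (S (a t))) ([]-nn (S (c t))))) (*-nn ([]-nn (S (b t))) ([]-nn (S (c t))))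

    later-nn : ∀ ts S → 0ℚ ≤ later ts S
    later-nn [] S = ℚ.≤-refl
    later-nn (t ∷ ts) S = +-nn (pairs-nn t S) (later-nn ts S)

    shift : T → ℚ → (E → ℚ) → E → ℚ
    shift t y f e = if t ∋ e then f e + y else f e

    shift-on : ∀ t y f e → (t ∋ e) ≡ true → shift t y f e ≡ f e + y
    shift-on t y f e p rewrite p = refl

    shift-off : ∀ t y f e → (t ∋ e) ≡ false → f e ≡ shift t y f e
    shift-off t y f e p rewrite p = refl

    shift-eq : ∀ t y f e → shift t y f e ≡ f e + y * [ t ∋ e ]
    shift-eq t y f e with t ∋ e
    ... | true = cong (f e +_) (sym (ℚ.*-identityʳ y))
    ... | false = sym (trans (cong (f e +_) (ℚ.*-zeroʳ y)) (ℚ.+-identityʳ (f e)))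

    -- `f` predicts survival, `g` weighs the error, and `later` is the unspent budget. The error at
    -- `S` after the step involves the errors at `S` and at `S ∪ t` before it, which is why the
    -- invariant `err` speaks of all sets.
    module Step {H : List T} (t : T) (t∈H : t ∈ H) (ts : List T) (d : Dist H) (f g : E → ℚ) {y ε h x : ℚ}
      (0≤y : 0ℚ ≤ y) (0≤ε : 0ℚ ≤ ε) (0≤x : 0ℚ ≤ x) (64x≤h : 64ℚ * x ≤ h)
      (xf : x * (f (a t) * (f (b t) * f (c t))) ≡ y)
      (f-nn : ∀ e → 0ℚ ≤ f e) (f≤1 : ∀ e → f e ≤ 1ℚ) (ya : y ≤ f (a t)) (yb : y ≤ f (b t)) (yc : y ≤ f (c t))
      (1≤g : ∀ e → 1ℚ ≤ g e) (g≤4 : ∀ e → g e ≤ 4ℚ)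
      (err : ∀ S → ∣ P d S - pr S f ∣ + y * later (t ∷ ts) S ≤ ε * pr S g) where

      f′ g′ : E → ℚ
      f′ = shift t (- y) f
      g′ = shift t h g

      pr-shift : ∀ S z k → pr S (shift t z k) ≡ pr (off S t) k * (w (S (a t)) (k (a t) + z) * (w (S (b t)) (k (b t) + z) * w (S (c t)) (k (c t) + z)))
      pr-shift S z k = trans (split S t (shift t z k)) (cong₂ _*_ (sym (off-cong S t (shift-off t z k)))
        (cong₂ _*_ (cong (w (S (a t))) (shift-on t z k (a t) (∋a t))) (cong₂ _*_ (cong (w (S (b t))) (shift-on t z k (b t) (∋b t))) (cong (w (S (c t))) (shift-on t z k (c t) (∋c t))))))

      err′ : ∀ S → ∣ P (step t t∈H x d) S - pr S f′ ∣ + y * later ts S ≤ ε * pr S g′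
      err′ S = begin
        ∣ P (step t t∈H x d) S - F′ ∣ + y * later ts S ≡⟨ cong (λ z → ∣ z ∣ + y * later ts S) decomposition ⟩
        ∣ (p - F) + (- (m * x) * (q - G) + Δ) ∣ + y * later ts S ≤⟨ ℚ.+-monoˡ-≤ (y * later ts S) tri ⟩
        (∣ p - F ∣ + (m * x * ∣ q - G ∣ + ∣ Δ ∣)) + y * later ts S ≤⟨ ℚ.+-monoˡ-≤ (y * later ts S) (ℚ.+-monoʳ-≤ ∣ p - F ∣ (ℚ.+-mono-≤ (*-monoˡ (m * x) 0≤mx q-err) Δ-bound)) ⟩
        (∣ p - F ∣ + (m * x * (ε * pr (S ∪ t) g) + y * pairs t S)) + y * later ts S ≡⟨ l₁ (∣ p - F ∣) m x ε (pr (S ∪ t) g) y (pairs t S) (later ts S) ⟩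
        (∣ p - F ∣ + y * later (t ∷ ts) S) + ε * (m * x * pr (S ∪ t) g) ≤⟨ ℚ.+-monoˡ-≤ _ (err S) ⟩
        ε * pr S g + ε * (m * x * pr (S ∪ t) g) ≡⟨ sym (ℚ.*-distribˡ-+ ε _ _) ⟩
        ε * (pr S g + m * x * pr (S ∪ t) g) ≤⟨ *-monoˡ ε 0≤ε growth ⟩
        ε * pr S g′ ∎
        where
        open ℚ.≤-Reasoning
        p q m F G F′ Δ R : ℚ
        p = P d S
        q = P d (S ∪ t)
        m = [ touches {H = H} S t ]
        F = pr S f
        G = pr (S ∪ t) f
        F′ = pr S f′
        R = pr (off S t) f
        Δ = F - m * (R * y) - F′
        0≤mx : 0ℚ ≤ m * x
        0≤mx = *-nn ([]-nn (touches {H = H} S t)) 0≤x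
        l₁ : ∀ u m x ε v y s r → (u + (m * x * (ε * v) + y * s)) + y * r ≡ (u + y * (s + r)) + ε * (m * x * v)
        l₁ = solve-∀ ring
        xG : x * G ≡ R * y
        xG = trans (cong (x *_) (split-∪ S t f)) (trans (l x R _) (cong (R *_) xf))
          where
          l : ∀ x R v → x * (R * v) ≡ R * (x * v)
          l = solve-∀ ring
        -- Three contributions: the old error at `S`, the old error at `S ∪ t`, and the error `Δ` of
        -- the prediction itself.
        decomposition : P (step t t∈H x d) S - F′ ≡ (p - F) + (- (m * x) * (q - G) + Δ)
        decomposition = trans (cong (_- F′) (P-step t t∈H x d S)) (trans (l p m x q F′ F G) (cong (λ z → (p - F) + (- (m * x) * (q - G) + (F - m * z - F′))) xG))
          where
          l : ∀ p m x q F′ F G → p + - (m * x) * q - F′ ≡ (p - F) + (- (m * x) * (q - G) + (F - m * (x * G) - F′))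
          l = solve-∀ ring
        tri : ∣ (p - F) + (- (m * x) * (q - G) + Δ) ∣ ≤ ∣ p - F ∣ + (m * x * ∣ q - G ∣ + ∣ Δ ∣)
        tri = ℚ.≤-trans (ℚ.∣p+q∣≤∣p∣+∣q∣ (p - F) _) (ℚ.+-monoʳ-≤ ∣ p - F ∣ (ℚ.≤-trans (ℚ.∣p+q∣≤∣p∣+∣q∣ (- (m * x) * (q - G)) Δ)
          (ℚ.+-monoˡ-≤ ∣ Δ ∣ (ℚ.≤-reflexive (trans (ℚ.∣p*q∣≡∣p∣*∣q∣ (- (m * x)) (q - G)) (cong (_* ∣ q - G ∣) (trans (ℚ.∣-p∣≡∣p∣ (m * x)) (ℚ.0≤p⇒∣p∣≡p 0≤mx))))))))
        q-err : ∣ q - G ∣ ≤ ε * pr (S ∪ t) g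
        q-err = ℚ.≤-trans (≤-by (y * later (t ∷ ts) (S ∪ t)) (*-nn 0≤y (later-nn (t ∷ ts) (S ∪ t))) refl) (err (S ∪ t))
        Δ-bound : ∣ Δ ∣ ≤ y * pairs t S
        Δ-bound = subst (λ z → ∣ z ∣ ≤ y * pairs t S) (sym (cong₂ (λ u v → u - m * (R * y) - v) (split S t f) (pr-shift S (- y) f)))
          (Drop.drop (pr-nn (off S t) f-nn) (pr≤1 (off S t) f-nn f≤1) 0≤y ya (f≤1 _) yb (f≤1 _) yc (f≤1 _) (S (a t)) (S (b t)) (S (c t)))
        growth : pr S g + m * x * pr (S ∪ t) g ≤ pr S g′
        growth = subst₂ _≤_ (sym (cong₂ (λ u v → u + m * x * v) (split S t g) (split-∪ S t g))) (sym (pr-shift S h g))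
          (Grow.grow (pr-nn (off S t) (λ e → ℚ.≤-trans 0≤1 (1≤g e))) 0≤x 64x≤h (1≤g _) (g≤4 _) (1≤g _) (g≤4 _) (1≤g _) (g≤4 _) (S (a t)) (S (b t)) (S (c t)))

-- One pass through all hyperedges.

module OnePass where
  open import Data.Rational.Base hiding (truncate)
  open FiniteSums
  open RandomStates
  open NibbleStep

  module _ {M : ℕ} where
    open Triple {M}
    private
      T : Set
      T = Triple {M}
      E : Set
      E = Edge {M}

    size : (E → Bool) → ℚ
    size S = Σ (λ e → [ S e ])

    none : E → Bool
    none _ = false

    module _ {H : List T} where

      N : Dist H → ℚ
      N d = 𝔼 d (λ s → ι (State.count s))

      mass : Dist H → ℚ
      mass d = 𝔼 d (λ _ → 1ℚ)

      mass-step : ∀ t t∈H x d → mass (step t t∈H x d) ≡ mass d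
      mass-step t t∈H x d = trans (𝔼-step t t∈H x d (λ _ _ → 1ℚ)) (𝔼-cong d (λ s → point (full t (State.alive s))))
        where
        l : ∀ x → x * 1ℚ + (1ℚ - x) * 1ℚ ≡ 1ℚ
        l = solve-∀ ring
        point : ∀ v → (if v then x * 1ℚ + (1ℚ - x) * 1ℚ else 1ℚ) ≡ 1ℚ
        point true = l x
        point false = refl

      pr-∪none : ∀ t (f : E → ℚ) → pr (none ∪ t) f ≡ f (a t) * (f (b t) * f (c t))
      pr-∪none t f = trans (split-∪ none t f) (trans (cong (_* (f (a t) * (f (b t) * f (c t)))) (Π-one M)) (ℚ.*-identityˡ _))

      N-step : ∀ t t∈H x d → N (step t t∈H x d) ≡ N d + x * P d (none ∪ t)
      N-step t t∈H x d = trans (𝔼-step t t∈H x d (λ _ k → ι k)) (trans (𝔼-cong d (λ s → point (State.alive s) (State.count s)))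
          (𝔼-linear d (λ s → ι (State.count s)) (ob (λ s _ → pr (none ∪ t) (I {H = H} s))) x))
        where
        l : ∀ x k → x * (1ℚ + k) + (1ℚ - x) * k ≡ k + x * (1ℚ * (1ℚ * 1ℚ))
        l = solve-∀ ring
        l₁ : ∀ x k u v → k ≡ k + x * (0ℚ * (u * v))
        l₁ = solve-∀ ring
        l₂ : ∀ x k v → k ≡ k + x * (1ℚ * (0ℚ * v))
        l₂ = solve-∀ ring
        l₃ : ∀ x k → k ≡ k + x * (1ℚ * (1ℚ * 0ℚ))
        l₃ = solve-∀ ring
        cases : ∀ u v z k → (if u ∧ (v ∧ z) then x * ι (suc k) + (1ℚ - x) * ι k else ι k) ≡ ι k + x * ([ u ] * ([ v ] * [ z ]))
        cases true true true k = trans (cong (λ y → x * y + (1ℚ - x) * ι k) (ι-suc k)) (l x (ι k))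
        cases true true false k = l₃ x (ι k)
        cases true false z k = l₂ x (ι k) [ z ]
        cases false v z k = l₁ x (ι k) [ v ] [ z ]
        point : ∀ s k → after {H = H} t x (λ _ k → ι k) s k ≡ ι k + x * pr (none ∪ t) (I {H = H} s)
        point s k = trans (cases (s (a t)) (s (b t)) (s (c t)) k) (cong (λ z → ι k + x * z) (sym (pr-∪none t (I {H = H} s))))

      -- ρ is the final survival probability and r its inverse, h the growth of the weights g per triple.
      module Pass {y ε h ρ r : ℚ} (0<y : 0ℚ < y) (0≤ε : 0ℚ ≤ ε) (0<ρ : 0ℚ < ρ) (y≤ρ : y ≤ ρ) (ρr : ρ * r ≡ 1ℚ) (1≤r : 1ℚ ≤ r)
        (h≡ : h ≡ 64ℚ * (y * (r * (r * r)))) (x≤1 : y * (r * (r * r)) ≤ 1ℚ) where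

        0≤y : 0ℚ ≤ y
        0≤y = ℚ.<⇒≤ 0<y
        0≤ρ : 0ℚ ≤ ρ
        0≤ρ = ℚ.<⇒≤ 0<ρ
        0≤r : 0ℚ ≤ r
        0≤r = ℚ.≤-trans 0≤1 1≤r
        r³ : ℚ
        r³ = r * (r * r)
        0≤r³ : 0ℚ ≤ r³
        0≤r³ = *-nn 0≤r (*-nn 0≤r 0≤r)
        0≤h : 0ℚ ≤ h
        0≤h = subst (0ℚ ≤_) (sym h≡) (*-nn 0≤64 (*-nn 0≤y 0≤r³))

        inverse : ∀ v → ρ ≤ v → ∃[ i ] (0ℚ ≤ i × i ≤ r × v * i ≡ 1ℚ)
        inverse v ρ≤v with inv v (ℚ.<-≤-trans 0<ρ ρ≤v)
        ... | i , 0<i , vi = i , ℚ.<⇒≤ 0<i , bound , vi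
          where
          l : ∀ i ρ r → i * (ρ * r) ≡ ρ * (i * r)
          l = solve-∀ ring
          l′ : ∀ v i r → v * (i * r) ≡ (v * i) * r
          l′ = solve-∀ ring
          bound : i ≤ r
          bound = ℚ.≤-trans (ℚ.≤-reflexive (trans (sym (ℚ.*-identityʳ i)) (trans (cong (i *_) (sym ρr)) (l i ρ r))))
            (ℚ.≤-trans (*-monoʳ (i * r) (*-nn (ℚ.<⇒≤ 0<i) 0≤r) ρ≤v) (ℚ.≤-reflexive (trans (l′ v i r) (trans (cong (_* r) vi) (ℚ.*-identityˡ r)))))

        -- The bounds on `f` and `g` hold in reserve, for every edge, the drops `y` and the growths
        -- `h` caused by the triples still to come. The invariant for all sets implies in particular
        -- that every triple is picked with probability about `y`.
        pass : ∀ ts → (∀ {t} → t ∈ ts → t ∈ H) → (d : Dist H) (f g : E → ℚ) → NonNeg d → mass d ≡ 1ℚ →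
          (∀ e → ρ + y * deg ts e ≤ f e) → (∀ e → f e ≤ 1ℚ) → (∀ e → 1ℚ ≤ g e) → (∀ e → g e + h * deg ts e ≤ 4ℚ) →
          (∀ S → ∣ P d S - pr S f ∣ + y * later ts S ≤ ε * pr S g) →
          Σ[ d′ ∈ Dist H ] (NonNeg d′ × mass d′ ≡ 1ℚ × (∀ S → ∣ P d′ S - pr S (λ e → f e - y * deg ts e) ∣ ≤ ε * pr S (λ _ → 4ℚ))
            × N d + ι (length ts) * (y - ε * h) ≤ N d′)
        pass [] ⊆H d f g nn m=1 low top 1≤g g≤4 err = d , nn , m=1 , final , ℚ.≤-reflexive (trans (cong (λ z → N d + z * (y - ε * h)) ι-zero) (l (N d) (y - ε * h)))
          where
          l : ∀ n u → n + 0ℚ * u ≡ n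
          l = solve-∀ ring
          l₀ : ∀ f y → f ≡ f - y * 0ℚ
          l₀ = solve-∀ ring
          l₁ : ∀ u v y → u ≡ v + y * 0ℚ → u ≡ v
          l₁ u v y p = trans p (trans (cong (v +_) (ℚ.*-zeroʳ y)) (ℚ.+-identityʳ v))
          final : ∀ S → ∣ P d S - pr S (λ e → f e - y * 0ℚ) ∣ ≤ ε * pr S (λ _ → 4ℚ)
          final S = begin
            ∣ P d S - pr S (λ e → f e - y * 0ℚ) ∣ ≡⟨ cong (λ z → ∣ P d S - z ∣) (Π-cong (λ e → cong (w (S e)) (sym (l₀ (f e) y)))) ⟩
            ∣ P d S - pr S f ∣ ≡⟨ sym (trans (cong (∣ P d S - pr S f ∣ +_) (ℚ.*-zeroʳ y)) (ℚ.+-identityʳ _)) ⟩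
            ∣ P d S - pr S f ∣ + y * 0ℚ ≤⟨ err S ⟩
            ε * pr S g ≤⟨ *-monoˡ ε 0≤ε (pr-mono S (λ e → ℚ.≤-trans 0≤1 (1≤g e)) (λ e → ℚ.≤-trans (≤-by (h * 0ℚ) (ℚ.≤-reflexive (sym (ℚ.*-zeroʳ h))) refl) (g≤4 e))) ⟩
            ε * pr S (λ _ → 4ℚ) ∎
            where open ℚ.≤-Reasoning
        pass (t ∷ ts) ⊆H d f g nn m=1 low top 1≤g g≤4 err = finish (pass ts (⊆H ∘ there) d₁ f₁ g₁
              (step-nn t t∈H x 0≤x x≤1′ nn) (trans (mass-step t t∈H x d) m=1) low₁ top₁ 1≤g₁ g≤4₁ (Step.err′ t t∈H ts d f g 0≤y 0≤ε 0≤x 64x≤h xf f-nn top (ρ→y (a t)) (ρ→y (b t)) (ρ→y (c t)) 1≤g g≤4′ err))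
          where
          t∈H : t ∈ H
          t∈H = ⊆H (here refl)
          deg≥ : ∀ e → 0ℚ ≤ y * deg (t ∷ ts) e
          deg≥ e = *-nn 0≤y (deg-nn (t ∷ ts) e)
          ρ≤f : ∀ e → ρ ≤ f e
          ρ≤f e = ℚ.≤-trans (≤-by _ (deg≥ e) refl) (low e)
          ρ→y : ∀ e → y ≤ f e
          ρ→y e = ℚ.≤-trans y≤ρ (ρ≤f e)
          f-nn : ∀ e → 0ℚ ≤ f e
          f-nn e = ℚ.≤-trans 0≤ρ (ρ≤f e)
          A = inverse (f (a t)) (ρ≤f (a t))
          B = inverse (f (b t)) (ρ≤f (b t))
          C = inverse (f (c t)) (ρ≤f (c t))
          i j k : ℚ
          i = proj₁ A
          j = proj₁ B
          k = proj₁ C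
          0≤i : 0ℚ ≤ i
          0≤i = proj₁ (proj₂ A)
          0≤j : 0ℚ ≤ j
          0≤j = proj₁ (proj₂ B)
          0≤k : 0ℚ ≤ k
          0≤k = proj₁ (proj₂ C)
          -- `i`, `j`, `k` are the inverses of the predictions at `t`: dividing by the predicted
          -- probability that `t` is alive makes the predicted probability of a pick equal to `y`
          -- for every triple.
          x : ℚ
          x = y * (i * (j * k))
          0≤x : 0ℚ ≤ x
          0≤x = *-nn 0≤y (*-nn 0≤i (*-nn 0≤j 0≤k))
          x≤ : x ≤ y * r³
          x≤ = *-monoˡ y 0≤y (*-mono 0≤i (*-nn 0≤r 0≤r) (proj₁ (proj₂ (proj₂ A))) (*-mono 0≤j 0≤r (proj₁ (proj₂ (proj₂ B))) (proj₁ (proj₂ (proj₂ C)))))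
          x≤1′ : x ≤ 1ℚ
          x≤1′ = ℚ.≤-trans x≤ x≤1
          64x≤h : 64ℚ * x ≤ h
          64x≤h = subst (64ℚ * x ≤_) (sym h≡) (*-monoˡ 64ℚ 0≤64 x≤)
          xf : x * (f (a t) * (f (b t) * f (c t))) ≡ y
          xf = trans (l y i j k (f (a t)) (f (b t)) (f (c t))) (trans (cong₂ (λ u v → y * (u * v)) (proj₂ (proj₂ (proj₂ A))) (cong₂ _*_ (proj₂ (proj₂ (proj₂ B))) (proj₂ (proj₂ (proj₂ C))))) (l1 y))
            where
            l : ∀ y i j k p q s → y * (i * (j * k)) * (p * (q * s)) ≡ y * ((p * i) * ((q * j) * (s * k)))
            l = solve-∀ ring
            l1 : ∀ y → y * (1ℚ * (1ℚ * 1ℚ)) ≡ y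
            l1 = solve-∀ ring
          g≤4′ : ∀ e → g e ≤ 4ℚ
          g≤4′ e = ℚ.≤-trans (≤-by _ (*-nn 0≤h (deg-nn (t ∷ ts) e)) refl) (g≤4 e)
          d₁ : Dist H
          d₁ = step t t∈H x d
          f₁ g₁ : E → ℚ
          f₁ = shift t (- y) f
          g₁ = shift t h g
          low₁ : ∀ e → ρ + y * deg ts e ≤ f₁ e
          low₁ e = subst (ρ + y * deg ts e ≤_) (sym (shift-eq t (- y) f e)) (≤-by (f e - (ρ + y * deg (t ∷ ts) e)) (diff≥0 (low e)) (l (f e) ρ y [ t ∋ e ] (deg ts e)))
            where
            l : ∀ f ρ y u v → f + (- y) * u ≡ ρ + y * v + (f - (ρ + y * (u + v)))
            l = solve-∀ ring
          top₁ : ∀ e → f₁ e ≤ 1ℚ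
          top₁ e = ℚ.≤-trans (ℚ.≤-trans (ℚ.≤-reflexive (shift-eq t (- y) f e)) (≤-by (y * [ t ∋ e ]) (*-nn 0≤y ([]-nn (t ∋ e))) (l (f e) y [ t ∋ e ]))) (top e)
            where
            l : ∀ f y u → f ≡ f + (- y) * u + y * u
            l = solve-∀ ring
          1≤g₁ : ∀ e → 1ℚ ≤ g₁ e
          1≤g₁ e = ℚ.≤-trans (1≤g e) (≤-by (h * [ t ∋ e ]) (*-nn 0≤h ([]-nn (t ∋ e))) (shift-eq t h g e))
          g≤4₁ : ∀ e → g₁ e + h * deg ts e ≤ 4ℚ
          g≤4₁ e = ℚ.≤-trans (ℚ.≤-reflexive (trans (cong (_+ h * deg ts e) (shift-eq t h g e)) (l (g e) h [ t ∋ e ] (deg ts e)))) (g≤4 e)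
            where
            l : ∀ g h u v → g + h * u + h * v ≡ g + h * (u + v)
            l = solve-∀ ring
          -- The invariant at the set `t` itself: its probability of being alive is off by at most
          -- 64 `ε`, and 64 `x` ≤ `h`.
          gain : N d + (y - ε * h) ≤ N d₁
          gain = ℚ.≤-trans (ℚ.+-monoʳ-≤ (N d) bound) (ℚ.≤-reflexive (sym (N-step t t∈H x d)))
            where
            p G : ℚ
            p = P d (none ∪ t)
            G = pr (none ∪ t) f
            1≤64 : pr (none ∪ t) g ≤ 64ℚ
            1≤64 = ℚ.≤-trans (ℚ.≤-reflexive (pr-∪none t g)) (*-mono (g-nn (a t)) (*-nn 0≤4 0≤4) (g≤4′ (a t)) (*-mono (g-nn (b t)) 0≤4 (g≤4′ (b t)) (g≤4′ (c t))))
              where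
              g-nn : ∀ e → 0ℚ ≤ g e
              g-nn e = ℚ.≤-trans 0≤1 (1≤g e)
            dev : G - p ≤ ε * 64ℚ
            dev = begin
              G - p ≤⟨ ≤∣∣ (G - p) ⟩
              ∣ G - p ∣ ≡⟨ trans (sym (ℚ.∣-p∣≡∣p∣ (G - p))) (cong ∣_∣ (neg-diff G p)) ⟩
              ∣ p - G ∣ ≤⟨ ≤-by (y * later (t ∷ ts) (none ∪ t)) (*-nn 0≤y (later-nn (t ∷ ts) (none ∪ t))) refl ⟩
              ∣ p - G ∣ + y * later (t ∷ ts) (none ∪ t) ≤⟨ err (none ∪ t) ⟩
              ε * pr (none ∪ t) g ≤⟨ *-monoˡ ε 0≤ε 1≤64 ⟩
              ε * 64ℚ ∎
              where
              open ℚ.≤-Reasoning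
              neg-diff : ∀ G p → - (G - p) ≡ p - G
              neg-diff = solve-∀ ring
            bound : y - ε * h ≤ x * p
            bound = begin
              y - ε * h ≤⟨ ℚ.+-monoʳ-≤ y (ℚ.neg-antimono-≤ (*-monoˡ ε 0≤ε 64x≤h)) ⟩
              y - ε * (64ℚ * x) ≡⟨ cong (λ z → z - ε * (64ℚ * x)) (sym (trans (cong (x *_) (pr-∪none t f)) xf)) ⟩
              x * G - ε * (64ℚ * x) ≡⟨ l x G ε 64ℚ p ⟩
              x * p + x * ((G - p) - ε * 64ℚ) ≤⟨ ℚ.+-monoʳ-≤ (x * p) (ℚ.≤-trans (*-monoˡ x 0≤x (ℚ.≤-trans (ℚ.+-monoˡ-≤ (- (ε * 64ℚ)) dev) (ℚ.≤-reflexive (ℚ.+-inverseʳ (ε * 64ℚ))))) (ℚ.≤-reflexive (ℚ.*-zeroʳ x))) ⟩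
              x * p + 0ℚ ≡⟨ ℚ.+-identityʳ (x * p) ⟩
              x * p ∎
              where
              open ℚ.≤-Reasoning
              l : ∀ x G ε k p → x * G - ε * (k * x) ≡ x * p + x * ((G - p) - ε * k)
              l = solve-∀ ring
          finish : Σ[ d′ ∈ Dist H ] (NonNeg d′ × mass d′ ≡ 1ℚ × (∀ S → ∣ P d′ S - pr S (λ e → f₁ e - y * deg ts e) ∣ ≤ ε * pr S (λ _ → 4ℚ)) × N d₁ + ι (length ts) * (y - ε * h) ≤ N d′) →
            Σ[ d′ ∈ Dist H ] (NonNeg d′ × mass d′ ≡ 1ℚ × (∀ S → ∣ P d′ S - pr S (λ e → f e - y * deg (t ∷ ts) e) ∣ ≤ ε * pr S (λ _ → 4ℚ)) × N d + ι (suc (length ts)) * (y - ε * h) ≤ N d′)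
          finish (d′ , nn′ , m′ , err′ , gain′) = d′ , nn′ , m′ , (λ S → subst (λ z → ∣ P d′ S - z ∣ ≤ ε * pr S (λ _ → 4ℚ)) (Π-cong (λ e → cong (w (S e)) (point e))) (err′ S)) , total
            where
            l : ∀ f y u v → f + (- y) * u - y * v ≡ f - y * (u + v)
            l = solve-∀ ring
            point : ∀ e → f₁ e - y * deg ts e ≡ f e - y * deg (t ∷ ts) e
            point e = trans (cong (_- y * deg ts e) (shift-eq t (- y) f e)) (l (f e) y [ t ∋ e ] (deg ts e))
            l₂ : ∀ n k u → n + (1ℚ + k) * u ≡ (n + u) + k * u
            l₂ = solve-∀ ring
            total : N d + ι (suc (length ts)) * (y - ε * h) ≤ N d′
            total = ℚ.≤-trans (ℚ.≤-reflexive (trans (cong (λ z → N d + z * (y - ε * h)) (ι-suc (length ts))) (l₂ (N d) (ι (length ts)) (y - ε * h))))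
              (ℚ.≤-trans (ℚ.+-monoˡ-≤ (ι (length ts) * (y - ε * h)) gain) gain′)

-- Almost perfect packings by repeated passes.

module Packing where
  open import Data.Rational.Base hiding (truncate)
  open FiniteSums
  open RandomStates
  open NibbleStep
  open OnePass

  -- Error tolerances of successive passes, indexed by the number of passes still to come.
  n-tol : ℕ → ℕ → ℕ
  n-tol n₀ zero = n₀
  n-tol n₀ (suc j) = 2 ℕ.* (n-tol n₀ j ℕ.* n-tol n₀ j)

  n-tol-pos : ∀ n₀ j → 1 ℕ.≤ n₀ → 1 ℕ.≤ n-tol n₀ j
  n-tol-pos n₀ zero p = p
  n-tol-pos n₀ (suc j) p = ℕP.≤-trans (ℕP.*-mono-≤ (n-tol-pos n₀ j p) (n-tol-pos n₀ j p)) (ℕP.m≤m+n _ _)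

  n-tol-step : ∀ n₀ j → 1 ℕ.≤ n₀ → n-tol n₀ j ℕ.≤ n-tol n₀ (suc j)
  n-tol-step n₀ j p = ℕP.≤-trans (ℕP.≤-trans (ℕP.≤-reflexive (sym (ℕP.*-identityʳ _))) (ℕP.*-monoʳ-≤ (n-tol n₀ j) (n-tol-pos n₀ j p))) (ℕP.m≤m+n _ _)

  n-tol-mono : ∀ n₀ {i j} → 1 ℕ.≤ n₀ → i ℕ.≤′ j → n-tol n₀ i ℕ.≤ n-tol n₀ j
  n-tol-mono n₀ p (ℕ.≤′-reflexive refl) = ℕP.≤-refl
  n-tol-mono n₀ p (ℕ.≤′-step {n} q) = ℕP.≤-trans (n-tol-mono n₀ p q) (n-tol-step n₀ n p)

  module _ {M : ℕ} where
    open Triple {M}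
    private
      T : Set
      T = Triple {M}
      E : Set
      E = Edge {M}

    -- Induction on the stronger s² + 2s + 3 ≤ 3 · 2^s, whose left side at most doubles when s grows
    -- by one.
    size²≤ : ∀ S → size {M} S * size S ≤ (1ℚ + 1ℚ + 1ℚ) * pr S (λ _ → 2ℚ)
    size²≤ S = ℚ.≤-trans (≤-by (2ℚ * size S + (1ℚ + 1ℚ + 1ℚ)) (+-nn (*-nn 0≤2 (Σ-nn (λ e → []-nn (S e)))) (+-nn 0≤2 0≤1)) (l (size S))) (go S)
      where
      l : ∀ s → s * s + (1ℚ + 1ℚ) * s + (1ℚ + 1ℚ + 1ℚ) ≡ s * s + ((1ℚ + 1ℚ) * s + (1ℚ + 1ℚ + 1ℚ))
      l = solve-∀ ring
      go : ∀ {n} (S : Fin n → Bool) → (let s = Σ (λ e → [ S e ]) in s * s + 2ℚ * s + (1ℚ + 1ℚ + 1ℚ)) ≤ (1ℚ + 1ℚ + 1ℚ) * Π (λ e → w (S e) 2ℚ)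
      go {zero} S = ℚ.≤-refl
      go {suc n} S with S zero
      ... | false = subst₂ (λ s v → s * s + 2ℚ * s + (1ℚ + 1ℚ + 1ℚ) ≤ (1ℚ + 1ℚ + 1ℚ) * v) (sym (ℚ.+-identityˡ (Σ (λ e → [ S (suc e) ])))) (sym (ℚ.*-identityˡ (Π (λ e → w (S (suc e)) 2ℚ)))) (go (S ∘ suc))
      ... | true = begin
          (1ℚ + s) * (1ℚ + s) + 2ℚ * (1ℚ + s) + (1ℚ + 1ℚ + 1ℚ) ≤⟨ ≤-by (s * s) (sq-nn s) (l₁ s) ⟩
          2ℚ * (s * s + 2ℚ * s + (1ℚ + 1ℚ + 1ℚ)) ≤⟨ *-monoˡ 2ℚ 0≤2 (go (S ∘ suc)) ⟩
          2ℚ * ((1ℚ + 1ℚ + 1ℚ) * v) ≡⟨ l₂ v ⟩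
          (1ℚ + 1ℚ + 1ℚ) * (2ℚ * v) ∎
          where
          open ℚ.≤-Reasoning
          s v : ℚ
          s = Σ (λ e → [ S (suc e) ])
          v = Π (λ e → w (S (suc e)) 2ℚ)
          l₁ : ∀ s → (1ℚ + 1ℚ) * (s * s + (1ℚ + 1ℚ) * s + (1ℚ + 1ℚ + 1ℚ)) ≡ (1ℚ + s) * (1ℚ + s) + (1ℚ + 1ℚ) * (1ℚ + s) + (1ℚ + 1ℚ + 1ℚ) + s * s
          l₁ = solve-∀ ring
          l₂ : ∀ v → (1ℚ + 1ℚ) * ((1ℚ + 1ℚ + 1ℚ) * v) ≡ (1ℚ + 1ℚ + 1ℚ) * ((1ℚ + 1ℚ) * v)
          l₂ = solve-∀ ring

    module _ {H : List T} where

      best : ∀ {p s} {d : Dist H} → NonNeg ((p , s) ∷ d) → Σ[ s′ ∈ State H ] N ((p , s) ∷ d) ≤ ι (State.count s′) * mass ((p , s) ∷ d)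
      best {p} {s} {[]} (0≤p ∷ []) = s , ℚ.≤-reflexive (l p (ι (State.count s)))
        where
        l : ∀ p n → p * n + 0ℚ ≡ n * (p * 1ℚ + 0ℚ)
        l = solve-∀ ring
      best {p} {s} {(q , t) ∷ d} (0≤p ∷ nn) with best nn
      ... | s′ , b with ℕP.≤-total (State.count s) (State.count s′)
      ...   | inj₁ le = s′ , (begin
            p * ι (State.count s) + N ((q , t) ∷ d) ≤⟨ ℚ.+-mono-≤ (*-monoˡ p 0≤p (ι-mono le)) b ⟩
            p * κ + κ * mass ((q , t) ∷ d) ≡⟨ l p κ (mass ((q , t) ∷ d)) ⟩
            κ * (p * 1ℚ + mass ((q , t) ∷ d)) ∎)
            where
            open ℚ.≤-Reasoning
            κ : ℚ
            κ = ι (State.count s′)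
            l : ∀ p c m → p * c + c * m ≡ c * (p * 1ℚ + m)
            l = solve-∀ ring
      ...   | inj₂ le = s , (begin
            p * κ + N ((q , t) ∷ d) ≤⟨ ℚ.+-monoʳ-≤ (p * κ) (ℚ.≤-trans b (*-monoʳ _ (mass-nn nn) (ι-mono le))) ⟩
            p * κ + κ * mass ((q , t) ∷ d) ≡⟨ l p κ (mass ((q , t) ∷ d)) ⟩
            κ * (p * 1ℚ + mass ((q , t) ∷ d)) ∎)
            where
            open ℚ.≤-Reasoning
            κ : ℚ
            κ = ι (State.count s)
            l : ∀ p c m → p * c + c * m ≡ c * (p * 1ℚ + m)
            l = solve-∀ ring
            mass-nn : ∀ {d : Dist H} → NonNeg d → 0ℚ ≤ mass d
            mass-nn [] = ℚ.≤-refl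
            mass-nn (q ∷ nn) = +-nn (*-nn q 0≤1) (mass-nn nn)

      exists : ∀ {d : Dist H} {c} → NonNeg d → mass d ≡ 1ℚ → c ≤ N d → Σ[ s ∈ State H ] c ≤ ι (State.count s)
      exists {[]} nn () c≤
      exists {x ∷ d} nn m=1 c≤ with best nn
      ... | s , b = s , ℚ.≤-trans c≤ (ℚ.≤-trans b (ℚ.≤-reflexive (trans (cong (ι (State.count s) *_) m=1) (ℚ.*-identityʳ _))))

      P-bounds : ∀ {d : Dist H} → NonNeg d → mass d ≡ 1ℚ → ∀ S → 0ℚ ≤ P d S × P d S ≤ 1ℚ
      P-bounds {d} nn m=1 S =
          ℚ.≤-trans (ℚ.≤-reflexive (sym (𝔼-zero d))) (𝔼-mono nn (λ s → pr-nn S (λ e → []-nn (State.alive s e))))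
        , ℚ.≤-trans (𝔼-mono nn (λ s → pr≤1 S (λ e → []-nn (State.alive s e)) (λ e → []≤1 (State.alive s e)))) (ℚ.≤-reflexive m=1)
        where
        𝔼-zero : ∀ (d : Dist H) → 𝔼 d (λ _ → 0ℚ) ≡ 0ℚ
        𝔼-zero [] = refl
        𝔼-zero ((p , s) ∷ d) = trans (cong₂ _+_ (ℚ.*-zeroʳ p) (𝔼-zero d)) (ℚ.+-identityʳ 0ℚ)

      -- A quadratic error bound is traded for a linear one, because no error exceeds 1.
      rebase : ∀ {e} {u : ℚ} S → 0ℚ ≤ e → ∣ u ∣ ≤ 1ℚ → ∣ u ∣ ≤ e * e * pr S (λ _ → 4ℚ) → ∣ u ∣ ≤ e * pr {M} S (λ _ → 2ℚ)
      rebase {e} {u} S 0≤e u≤1 u≤ with ℚ.≤-total 1ℚ (e * pr S (λ _ → 2ℚ))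
      ... | inj₁ p = ℚ.≤-trans u≤1 p
      ... | inj₂ p = begin
          ∣ u ∣ ≤⟨ u≤ ⟩
          e * e * pr S (λ _ → 4ℚ) ≡⟨ cong (e * e *_) (trans (Π-cong point) (Π-* (λ i → w (S i) 2ℚ) (λ i → w (S i) 2ℚ))) ⟩
          e * e * (X * X) ≡⟨ l e X ⟩
          e * X * (e * X) ≤⟨ *-monoˡ (e * X) (*-nn 0≤e (pr-nn S (λ _ → 0≤2))) p ⟩
          e * X * 1ℚ ≡⟨ ℚ.*-identityʳ _ ⟩
          e * X ∎
          where
          open ℚ.≤-Reasoning
          X : ℚ
          X = pr S (λ _ → 2ℚ)
          l : ∀ e X → e * e * (X * X) ≡ e * X * (e * X)
          l = solve-∀ ring
          point : ∀ i → w (S i) 4ℚ ≡ w (S i) 2ℚ * w (S i) 2ℚ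
          point i with S i
          ... | true = refl
          ... | false = refl

  ι2≡ : ι 2 ≡ 2ℚ
  ι2≡ = trans (ι-suc 1) (cong (1ℚ +_) ι-one)

  ι4≡ : ι 4 ≡ 4ℚ
  ι4≡ = trans (ι-* 2 2) (cong₂ _*_ ι2≡ ι2≡)

  ι32≡ : ι 32 ≡ 2ℚ * (4ℚ * 4ℚ)
  ι32≡ = trans (ι-* 2 16) (cong₂ _*_ ι2≡ (trans (ι-* 4 4) (cong₂ _*_ ι4≡ ι4≡)))

  ι64≡ : ι 64 ≡ 64ℚ
  ι64≡ = trans (ι-* 4 16) (cong₂ _*_ ι4≡ (trans (ι-* 4 4) (cong₂ _*_ ι4≡ ι4≡)))

  ι9≡ : ι 9 ≡ (1ℚ + 1ℚ + 1ℚ) * (1ℚ + 1ℚ + 1ℚ)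
  ι9≡ = trans (ι-* 3 3) (cong₂ _*_ ι3 ι3)
    where
    ι3 : ι 3 ≡ 1ℚ + 1ℚ + 1ℚ
    ι3 = trans (ι-+ 2 1) (cong₂ _+_ ι2≡ ι-one)

  -- The ideal packing has `length H` / `D` triples; a proportion (1 - `ρ`)² of it is reached.
  -- Linearity of the hypergraph enters only through the quadratic bound on `later`.
  Packs : ℕ → ℕ → Set
  Packs m′ D₀ = ∀ {M} (H : List (Triple {M})) (D ρ : ℚ) → ρ * ι (suc m′) ≡ 1ℚ → ι D₀ ≤ D →
    (∀ e → deg H e ≤ D) → (∀ S → later H S ≤ (1ℚ + 1ℚ + 1ℚ) * (size S * size S)) →
    Σ[ s ∈ State H ] (1ℚ - ρ) * (1ℚ - ρ) * ι (length H) ≤ ι (State.count s) * D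

  -- With r = 1/`ρ`, the choice `y` = 1/(32 r³ `D`) gives `h` `D` = 2, so that error weights grow
  -- from 2 to at most 4 in one pass. After `K` = 32 r² (r - 1) passes an edge of degree `D` has
  -- predicted survival probability `ρ`. With `n₀` = 64 r⁴ the loss per pick, `tol 0 * h`, is `ρ`
  -- `y`.
  module Core (m′ K n₀ : ℕ) (1≤n₀ : 1 ℕ.≤ n₀)
    (K≡ : ι K ≡ 2ℚ * (4ℚ * 4ℚ) * (ι (suc m′) * ι (suc m′)) * ι m′)
    (n₀≡ : ι n₀ ≡ 64ℚ * (ι (suc m′) * (ι (suc m′) * (ι (suc m′) * ι (suc m′)))))
    (tol : ℕ → ℚ) (0≤tol : ∀ j → 0ℚ ≤ tol j) (n*tol : ∀ j → ι (n-tol n₀ j) * tol j ≡ 1ℚ)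
    {M : ℕ} (H : List (Triple {M})) (D ρ : ℚ) (ρr : ρ * ι (suc m′) ≡ 1ℚ) (1≤D : 1ℚ ≤ D) (D₀≤D : ι (9 ℕ.* n-tol n₀ K) ≤ D)
    (deg≤D : ∀ e → deg H e ≤ D) (lin : ∀ S → later H S ≤ (1ℚ + 1ℚ + 1ℚ) * (size S * size S))
    (y : ℚ) (0<y : 0ℚ < y) (yZ : 2ℚ * (4ℚ * 4ℚ) * (y * (ι (suc m′) * (ι (suc m′) * ι (suc m′))) * D) ≡ 1ℚ) where

    private
      m : ℕ
      m = suc m′
    r : ℚ
    r = ι m
    1≤r : 1ℚ ≤ r
    1≤r = 1≤ι m′
    0≤r : 0ℚ ≤ r
    0≤r = ι-nn m
    r³ : ℚ
    r³ = r * (r * r)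
    0≤r³ : 0ℚ ≤ r³
    0≤r³ = *-nn 0≤r (*-nn 0≤r 0≤r)
    0<ρ : 0ℚ < ρ
    0<ρ with ℚ.<-cmp 0ℚ ρ
    ... | tri< p _ _ = p
    ... | tri≈ _ p _ = ⊥-elim (contra (trans (sym ρr) (trans (cong (_* r) (sym p)) (ℚ.*-zeroˡ r))))
      where
      contra : 1ℚ ≢ 0ℚ
      contra ()
    ... | tri> _ _ p = ⊥-elim (ℚ.<-irrefl refl (ℚ.<-≤-trans (ℚ.positive⁻¹ 1ℚ) (ℚ.≤-trans (ℚ.≤-reflexive (sym ρr)) (ℚ.≤-trans (*-monoʳ r 0≤r (ℚ.<⇒≤ p)) (ℚ.≤-reflexive (ℚ.*-zeroˡ r))))))
    0≤D : 0ℚ ≤ D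
    0≤D = ℚ.≤-trans 0≤1 1≤D
    c₃₂ : ℚ
    c₃₂ = 2ℚ * (4ℚ * 4ℚ)
    0≤y : 0ℚ ≤ y
    0≤y = ℚ.<⇒≤ 0<y
    1≤32 : 1ℚ ≤ c₃₂
    1≤32 = subst (1ℚ ≤_) ι32≡ (1≤ι 31)
    yr³D≤1 : y * r³ * D ≤ 1ℚ
    yr³D≤1 = ℚ.≤-trans (ℚ.≤-trans (ℚ.≤-reflexive (sym (ℚ.*-identityˡ _))) (*-monoʳ (y * r³ * D) (*-nn (*-nn 0≤y 0≤r³) 0≤D) 1≤32)) (ℚ.≤-reflexive yZ)
    x≤1 : y * r³ ≤ 1ℚ
    x≤1 = ℚ.≤-trans (ℚ.≤-trans (ℚ.≤-reflexive (sym (ℚ.*-identityʳ _))) (*-monoˡ (y * r³) (*-nn 0≤y 0≤r³) 1≤D)) yr³D≤1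
    r≤r³ : r ≤ r³
    r≤r³ = ℚ.≤-trans (ℚ.≤-reflexive (sym (ℚ.*-identityʳ r))) (*-monoˡ r 0≤r (ℚ.≤-trans (ℚ.≤-reflexive (sym (ℚ.*-identityˡ 1ℚ))) (*-mono 0≤1 0≤r 1≤r 1≤r)))
    y≤ρ : y ≤ ρ
    y≤ρ = begin
      y ≡⟨ sym (trans (cong (y *_) (trans (ℚ.*-comm r ρ) ρr)) (ℚ.*-identityʳ y)) ⟩
      y * (r * ρ) ≡⟨ sym (ℚ.*-assoc y r ρ) ⟩
      y * r * ρ ≤⟨ *-monoʳ ρ (ℚ.<⇒≤ 0<ρ) (ℚ.≤-trans (*-monoˡ y 0≤y r≤r³) x≤1) ⟩
      1ℚ * ρ ≡⟨ ℚ.*-identityˡ ρ ⟩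
      ρ ∎
      where open ℚ.≤-Reasoning
    h : ℚ
    h = 64ℚ * (y * r³)
    0≤h : 0ℚ ≤ h
    0≤h = *-nn 0≤64 (*-nn 0≤y 0≤r³)
    hD : h * D ≡ 2ℚ
    hD = trans (l (y * r³) D) (cong (2ℚ *_) yZ)
      where
      l : ∀ u D → 64ℚ * u * D ≡ 2ℚ * (2ℚ * (4ℚ * 4ℚ) * (u * D))
      l = solve-∀ ring
    KyD : ι K * (y * D) ≡ 1ℚ - ρ
    KyD = begin
      ι K * (y * D) ≡⟨ cong (_* (y * D)) K≡ ⟩
      c₃₂ * (r * r) * ι m′ * (y * D) ≡⟨ cong (λ z → c₃₂ * (r * r) * z * (y * D)) m′≡ ⟩
      c₃₂ * (r * r) * (r - 1ℚ) * (y * D) ≡⟨ cong (λ z → c₃₂ * (r * r) * (r - z) * (y * D)) (sym ρr) ⟩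
      c₃₂ * (r * r) * (r - ρ * r) * (y * D) ≡⟨ l c₃₂ r ρ y D ⟩
      c₃₂ * (y * r³ * D) * (1ℚ - ρ) ≡⟨ cong (_* (1ℚ - ρ)) yZ ⟩
      1ℚ * (1ℚ - ρ) ≡⟨ ℚ.*-identityˡ _ ⟩
      1ℚ - ρ ∎
      where
      open ≡-Reasoning
      l : ∀ c r ρ y D → c * (r * r) * (r - ρ * r) * (y * D) ≡ c * (y * (r * (r * r)) * D) * (1ℚ - ρ)
      l = solve-∀ ring
      l₂ : ∀ x → x ≡ 1ℚ + x - 1ℚ
      l₂ = solve-∀ ring
      m′≡ : ι m′ ≡ r - 1ℚ
      m′≡ = trans (l₂ (ι m′)) (cong (_- 1ℚ) (sym (ι-suc m′)))
    -- The room for one pass is shared equally: one half is the error inherited from earlier passes,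
    -- the other pays for the pairs in `later`.
    tol-sq : ∀ j → tol j * tol j ≡ 2ℚ * tol (suc j)
    tol-sq j = begin
      u * u ≡⟨ sym (ℚ.*-identityʳ _) ⟩
      u * u * 1ℚ ≡⟨ cong (u * u *_) (sym (n*tol (suc j))) ⟩
      u * u * (ι (n-tol n₀ (suc j)) * v) ≡⟨ cong (λ z → u * u * (z * v)) (trans (ι-* 2 _) (cong₂ _*_ (trans (ι-suc 1) (cong (1ℚ +_) ι-one)) (ι-* (n-tol n₀ j) _))) ⟩
      u * u * (2ℚ * (z * z) * v) ≡⟨ l u z v ⟩
      2ℚ * ((z * u) * (z * u) * v) ≡⟨ cong (λ q → 2ℚ * (q * q * v)) (n*tol j) ⟩
      2ℚ * (1ℚ * 1ℚ * v) ≡⟨ l₂ v ⟩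
      2ℚ * v ∎
      where
      open ≡-Reasoning
      u v z : ℚ
      u = tol j
      v = tol (suc j)
      z = ι (n-tol n₀ j)
      l : ∀ u z v → u * u * ((1ℚ + 1ℚ) * (z * z) * v) ≡ (1ℚ + 1ℚ) * ((z * u) * (z * u) * v)
      l = solve-∀ ring
      l₂ : ∀ v → (1ℚ + 1ℚ) * (1ℚ * 1ℚ * v) ≡ (1ℚ + 1ℚ) * v
      l₂ = solve-∀ ring
    c₉ : ℚ
    c₉ = (1ℚ + 1ℚ + 1ℚ) * (1ℚ + 1ℚ + 1ℚ)
    1≤r³ : 1ℚ ≤ r³
    1≤r³ = ℚ.≤-trans 1≤r r≤r³
    -- The place where the degree has to be large: `y` is at most 1/`D`.
    small : ∀ j → j ℕ.≤ K → y * c₉ ≤ tol j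
    small j j≤K = begin
      y * c₉ ≡⟨ sym (trans (cong (y * c₉ *_) (n*tol j)) (ℚ.*-identityʳ _)) ⟩
      y * c₉ * (ι (n-tol n₀ j) * tol j) ≡⟨ l y c₉ (ι (n-tol n₀ j)) (tol j) ⟩
      y * (c₉ * ι (n-tol n₀ j)) * tol j ≤⟨ *-monoʳ (tol j) (0≤tol j) (*-monoˡ y 0≤y big) ⟩
      y * D * tol j ≤⟨ *-monoʳ (tol j) (0≤tol j) yD≤1 ⟩
      1ℚ * tol j ≡⟨ ℚ.*-identityˡ _ ⟩
      tol j ∎
      where
      open ℚ.≤-Reasoning
      l : ∀ y c n t → y * c * (n * t) ≡ y * (c * n) * t
      l = solve-∀ ring
      big : c₉ * ι (n-tol n₀ j) ≤ D
      big = ℚ.≤-trans (ℚ.≤-reflexive (trans (cong (_* ι (n-tol n₀ j)) (sym ι9≡)) (sym (ι-* 9 _)))) (ℚ.≤-trans (ι-mono (ℕP.*-monoʳ-≤ 9 (n-tol-mono n₀ 1≤n₀ (ℕP.≤⇒≤′ j≤K)))) D₀≤D)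
      yD≤1 : y * D ≤ 1ℚ
      yD≤1 = ℚ.≤-trans (*-monoʳ D 0≤D (ℚ.≤-trans (ℚ.≤-reflexive (sym (ℚ.*-identityʳ y))) (*-monoˡ y 0≤y 1≤r³))) yr³D≤1
    tol₀ : ∀ j → tol j * tol j ≤ tol 0
    tol₀ j = begin
      tol j * tol j ≤⟨ *-monoˡ (tol j) (0≤tol j) (tol≤1 j) ⟩
      tol j * 1ℚ ≡⟨ ℚ.*-identityʳ _ ⟩
      tol j ≡⟨ sym (trans (cong (_* tol j) (n*tol 0)) (ℚ.*-identityˡ _)) ⟩
      ι (n-tol n₀ 0) * tol 0 * tol j ≤⟨ *-monoʳ (tol j) (0≤tol j) (*-monoʳ (tol 0) (0≤tol 0) (ι-mono (n-tol-mono n₀ 1≤n₀ (ℕP.≤⇒≤′ (ℕ.z≤n {j}))))) ⟩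
      ι (n-tol n₀ j) * tol 0 * tol j ≡⟨ l (ι (n-tol n₀ j)) (tol 0) (tol j) ⟩
      ι (n-tol n₀ j) * tol j * tol 0 ≡⟨ trans (cong (_* tol 0) (n*tol j)) (ℚ.*-identityˡ _) ⟩
      tol 0 ∎
      where
      open ℚ.≤-Reasoning
      l : ∀ a b c → a * b * c ≡ a * c * b
      l = solve-∀ ring
      tol≤1 : ∀ j → tol j ≤ 1ℚ
      tol≤1 j = ℚ.≤-trans (ℚ.≤-trans (ℚ.≤-reflexive (sym (ℚ.*-identityˡ _))) (*-monoʳ (tol j) (0≤tol j) (subst (_≤ ι (n-tol n₀ j)) ι-one (ι-mono (n-tol-pos n₀ j 1≤n₀))))) (ℚ.≤-reflexive (n*tol j))
    tol₀h : tol 0 * h ≡ ρ * y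
    tol₀h = begin
      tol 0 * h ≡⟨ sym (trans (cong (_* (tol 0 * h)) ρr) (ℚ.*-identityˡ _)) ⟩
      ρ * r * (tol 0 * (64ℚ * (y * r³))) ≡⟨ l ρ r (tol 0) y 64ℚ ⟩
      (64ℚ * (r * (r * (r * r))) * tol 0) * (ρ * y) ≡⟨ cong (λ z → z * tol 0 * (ρ * y)) (sym n₀≡) ⟩
      ι n₀ * tol 0 * (ρ * y) ≡⟨ trans (cong (_* (ρ * y)) (n*tol 0)) (ℚ.*-identityˡ _) ⟩
      ρ * y ∎
      where
      open ≡-Reasoning
      l : ∀ ρ r t y k → ρ * r * (t * (k * (y * (r * (r * r))))) ≡ (k * (r * (r * (r * r))) * t) * (ρ * y)
      l = solve-∀ ring

    survival : ℕ → Edge {M} → ℚ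
    survival i e = 1ℚ - ι i * (y * deg H e)
    0≤deg : ∀ e → 0ℚ ≤ y * deg H e
    0≤deg e = *-nn 0≤y (deg-nn H e)
    L : ℚ
    L = ι (length H)

    -- `i` passes are done and `j` remain. A pass ends with an error of the form `tol j`² · 4^|S|,
    -- which `rebase` turns into `tol j` · 2^|S|, the form that the next pass starts from.
    run : ∀ j i → j ℕ.+ i ≡ K → (d : Dist H) → NonNeg d → mass d ≡ 1ℚ → (∀ S → ∣ P d S - pr S (survival i) ∣ ≤ tol j * pr S (λ _ → 2ℚ)) →
      Σ[ d′ ∈ Dist H ] (NonNeg d′ × mass d′ ≡ 1ℚ × N d + ι j * (L * (y - tol 0 * h)) ≤ N d′)
    run zero i _ d nn m=1 err = d , nn , m=1 , ℚ.≤-reflexive (trans (cong (λ z → N d + z * (L * (y - tol 0 * h))) ι-zero) (l (N d) (L * (y - tol 0 * h))))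
      where
      l : ∀ a b → a + 0ℚ * b ≡ a
      l = solve-∀ ring
    run (suc j) i ji d nn m=1 err = next (run j (suc i) (trans (ℕP.+-suc j i) ji) d₁ nn₁ m₁ err₂)
      where
      open Pass {H = H} {y} {tol j * tol j} {h} {ρ} {r} 0<y (*-nn (0≤tol j) (0≤tol j)) 0<ρ y≤ρ ρr 1≤r refl x≤1 hiding (0≤y; 0≤r; r³; 0≤r³; 0≤h)
      j<K : suc j ℕ.≤ K
      j<K = subst (suc j ℕ.≤_) ji (ℕP.m≤m+n (suc j) i)
      i<K : suc i ℕ.≤ K
      i<K = subst (suc i ℕ.≤_) (trans (ℕP.+-suc j i) ji) (ℕP.m≤n+m (suc i) j)
      low : ∀ e → ρ + y * deg H e ≤ survival i e
      low e = ≤-by ((1ℚ - ρ) - ι (suc i) * (y * deg H e)) (diff≥0 bound) (trans (l ρ (y * deg H e) (ι i)) (cong (λ z → ρ + y * deg H e + ((1ℚ - ρ) - z * (y * deg H e))) (sym (ι-suc i))))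
        where
        l : ∀ ρ u n → 1ℚ - n * u ≡ ρ + u + ((1ℚ - ρ) - (1ℚ + n) * u)
        l = solve-∀ ring
        bound : ι (suc i) * (y * deg H e) ≤ 1ℚ - ρ
        bound = ℚ.≤-trans (*-mono (ι-nn (suc i)) (*-nn 0≤y 0≤D) (ι-mono i<K) (*-monoˡ y 0≤y (deg≤D e))) (ℚ.≤-reflexive KyD)
      surv≤1 : ∀ i e → survival i e ≤ 1ℚ
      surv≤1 i e = ≤-by (ι i * (y * deg H e)) (*-nn (ι-nn i) (0≤deg e)) (l (ι i * (y * deg H e)))
        where
        l : ∀ u → 1ℚ ≡ 1ℚ - u + u
        l = solve-∀ ring
      g≤4 : ∀ e → 2ℚ + h * deg H e ≤ 4ℚ
      g≤4 e = ℚ.+-monoʳ-≤ 2ℚ (ℚ.≤-trans (*-monoˡ h 0≤h (deg≤D e)) (ℚ.≤-reflexive hD))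
      err₁ : ∀ S → ∣ P d S - pr S (survival i) ∣ + y * later H S ≤ tol j * tol j * pr S (λ _ → 2ℚ)
      err₁ S = begin
        ∣ P d S - pr S (survival i) ∣ + y * later H S ≤⟨ ℚ.+-mono-≤ (err S) (*-monoˡ y 0≤y (ℚ.≤-trans (lin S) (*-monoˡ (1ℚ + 1ℚ + 1ℚ) (+-nn 0≤2 0≤1) (size²≤ S)))) ⟩
        tol (suc j) * X + y * ((1ℚ + 1ℚ + 1ℚ) * ((1ℚ + 1ℚ + 1ℚ) * X)) ≡⟨ l₁ (tol (suc j)) X y ⟩
        (tol (suc j) + y * ((1ℚ + 1ℚ + 1ℚ) * (1ℚ + 1ℚ + 1ℚ))) * X ≤⟨ *-monoʳ X (pr-nn S (λ _ → 0≤2)) (ℚ.+-monoʳ-≤ (tol (suc j)) (small (suc j) j<K)) ⟩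
        (tol (suc j) + tol (suc j)) * X ≡⟨ cong (_* X) (trans (l₂ (tol (suc j))) (sym (tol-sq j))) ⟩
        tol j * tol j * X ∎
        where
        open ℚ.≤-Reasoning
        X : ℚ
        X = pr S (λ _ → 2ℚ)
        l₁ : ∀ t X y → t * X + y * ((1ℚ + 1ℚ + 1ℚ) * ((1ℚ + 1ℚ + 1ℚ) * X)) ≡ (t + y * ((1ℚ + 1ℚ + 1ℚ) * (1ℚ + 1ℚ + 1ℚ))) * X
        l₁ = solve-∀ ring
        l₂ : ∀ t → t + t ≡ (1ℚ + 1ℚ) * t
        l₂ = solve-∀ ring
      res = pass H id d (survival i) (λ _ → 2ℚ) nn m=1 low (surv≤1 i) (λ _ → ≤-by 1ℚ 0≤1 refl) g≤4 err₁
      d₁ : Dist H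
      d₁ = proj₁ res
      nn₁ : NonNeg d₁
      nn₁ = proj₁ (proj₂ res)
      m₁ : mass d₁ ≡ 1ℚ
      m₁ = proj₁ (proj₂ (proj₂ res))
      err₂ : ∀ S → ∣ P d₁ S - pr S (survival (suc i)) ∣ ≤ tol j * pr S (λ _ → 2ℚ)
      err₂ S = rebase {H = H} S (0≤tol j) (∣∣-bounds lo hi) (subst (λ z → ∣ P d₁ S - z ∣ ≤ tol j * tol j * pr S (λ _ → 4ℚ)) same (proj₁ (proj₂ (proj₂ (proj₂ res))) S))
        where
        l : ∀ n u → 1ℚ - n * u - u ≡ 1ℚ - (1ℚ + n) * u
        l = solve-∀ ring
        same : pr S (λ e → survival i e - y * deg H e) ≡ pr S (survival (suc i))
        same = Π-cong (λ e → cong (w (S e)) (trans (l (ι i) (y * deg H e)) (cong (λ z → 1ℚ - z * (y * deg H e)) (sym (ι-suc i)))))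
        surv-nn : ∀ e → 0ℚ ≤ survival (suc i) e
        surv-nn e = ℚ.≤-trans (ℚ.<⇒≤ 0<ρ) (≤-by (survival i e - (ρ + y * deg H e)) (diff≥0 (low e)) (trans (cong (λ z → 1ℚ - z * (y * deg H e)) (ι-suc i)) (l₂ (ι i) (y * deg H e) ρ)))
          where
          l₂ : ∀ n u ρ → 1ℚ - (1ℚ + n) * u ≡ ρ + (1ℚ - n * u - (ρ + u))
          l₂ = solve-∀ ring
        F : ℚ
        F = pr S (survival (suc i))
        PB = P-bounds nn₁ m₁ S
        0≤F : 0ℚ ≤ F
        0≤F = pr-nn S surv-nn
        F≤1 : F ≤ 1ℚ
        F≤1 = pr≤1 S surv-nn (surv≤1 (suc i))
        l₃ : ∀ p f → p - f ≡ - 1ℚ + (p + (1ℚ - f))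
        l₃ = solve-∀ ring
        l₄ : ∀ p f → 1ℚ ≡ p - f + ((1ℚ - p) + f)
        l₄ = solve-∀ ring
        lo : - 1ℚ ≤ P d₁ S - F
        lo = ≤-by (P d₁ S + (1ℚ - F)) (+-nn (proj₁ PB) (diff≥0 F≤1)) (l₃ (P d₁ S) F)
        hi : P d₁ S - F ≤ 1ℚ
        hi = ≤-by ((1ℚ - P d₁ S) + F) (+-nn (diff≥0 (proj₂ PB)) 0≤F) (l₄ (P d₁ S) F)
      next : Σ[ d′ ∈ Dist H ] (NonNeg d′ × mass d′ ≡ 1ℚ × N d₁ + ι j * (L * (y - tol 0 * h)) ≤ N d′) →
        Σ[ d′ ∈ Dist H ] (NonNeg d′ × mass d′ ≡ 1ℚ × N d + ι (suc j) * (L * (y - tol 0 * h)) ≤ N d′)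
      next (d′ , nn′ , m′ , gain) = d′ , nn′ , m′ , (begin
        N d + ι (suc j) * (L * (y - tol 0 * h)) ≡⟨ trans (cong (λ z → N d + z * (L * (y - tol 0 * h))) (ι-suc j)) (l (N d) (ι j) (L * (y - tol 0 * h))) ⟩
        N d + L * (y - tol 0 * h) + ι j * (L * (y - tol 0 * h)) ≤⟨ ℚ.+-monoˡ-≤ (ι j * (L * (y - tol 0 * h))) (ℚ.≤-trans (ℚ.+-monoʳ-≤ (N d) (*-monoˡ L (ι-nn (length H)) (ℚ.+-monoʳ-≤ y (ℚ.neg-antimono-≤ (*-monoʳ h 0≤h (tol₀ j)))))) (proj₂ (proj₂ (proj₂ (proj₂ res))))) ⟩
        N d₁ + ι j * (L * (y - tol 0 * h)) ≤⟨ gain ⟩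
        N d′ ∎)
        where
        open ℚ.≤-Reasoning
        l : ∀ n k u → n + (1ℚ + k) * u ≡ n + u + k * u
        l = solve-∀ ring

    d₀ : Dist H
    d₀ = (1ℚ , state (λ _ → true) 0 start) ∷ []
    err₀ : ∀ S → ∣ P d₀ S - pr S (survival 0) ∣ ≤ tol K * pr S (λ _ → 2ℚ)
    err₀ S = ℚ.≤-trans (ℚ.≤-reflexive (cong ∣_∣ zero-diff)) (*-nn (0≤tol K) (pr-nn S (λ _ → 0≤2)))
      where
      l : ∀ u → 1ℚ - 0ℚ * u ≡ 1ℚ
      l = solve-∀ ring
      F≡1 : pr S (survival 0) ≡ 1ℚ
      F≡1 = trans (Π-cong (λ e → cong (w (S e)) (trans (cong (λ z → 1ℚ - z * (y * deg H e)) ι-zero) (l (y * deg H e))))) (pr-one S)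
      zero-diff : P d₀ S - pr S (survival 0) ≡ 0ℚ
      zero-diff = cong₂ (λ u v → 1ℚ * u + 0ℚ - v) (pr-one S) F≡1
    fin : Σ[ s ∈ State H ] (ι K * (L * (y - tol 0 * h))) ≤ ι (State.count s)
    fin with run K 0 (ℕP.+-identityʳ K) d₀ (0≤1 ∷ []) refl err₀
    ... | d′ , nn , m=1 , gain = exists nn m=1 (ℚ.≤-trans (ℚ.≤-reflexive (sym (trans (cong (λ z → 1ℚ * z + 0ℚ + ι K * (L * (y - tol 0 * h))) ι-zero) (ℚ.+-identityˡ _)))) gain)
    -- One factor 1 - `ρ` is `K` `y` `D`, the proportion of each edge of full degree that gets used;
    -- the other is the loss `ρ` `y` per pick.
    total : (1ℚ - ρ) * (1ℚ - ρ) * L ≡ D * (ι K * (L * (y - tol 0 * h)))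
    total = begin
      (1ℚ - ρ) * (1ℚ - ρ) * L ≡⟨ cong (λ z → z * (1ℚ - ρ) * L) (sym KyD) ⟩
      ι K * (y * D) * (1ℚ - ρ) * L ≡⟨ l (ι K) y D ρ L ⟩
      D * (ι K * (L * (y - ρ * y))) ≡⟨ cong (λ z → D * (ι K * (L * (y - z)))) (sym tol₀h) ⟩
      D * (ι K * (L * (y - tol 0 * h))) ∎
      where
      open ≡-Reasoning
      l : ∀ k y D ρ L → k * (y * D) * (1ℚ - ρ) * L ≡ D * (k * (L * (y - ρ * y)))
      l = solve-∀ ring

    conclusion : Σ[ s ∈ State H ] (1ℚ - ρ) * (1ℚ - ρ) * ι (length H) ≤ ι (State.count s) * D
    conclusion = proj₁ fin , subst₂ _≤_ (sym total) (ℚ.*-comm D _) (*-monoˡ D 0≤D (proj₂ fin))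

  packing : ∀ m′ → ∃[ D₀ ] Packs m′ D₀
  packing m′ = 9 ℕ.* n-tol n₀ K ℕ.+ 1 , λ H D ρ ρr D₀≤D deg≤D lin →
      let 1≤D = ℚ.≤-trans (subst (_≤ ι (9 ℕ.* n-tol n₀ K ℕ.+ 1)) ι-one (ι-mono (ℕP.m≤n+m 1 (9 ℕ.* n-tol n₀ K)))) D₀≤D
          scale = inv (ι n₃₂ * D) (0<Z D 1≤D)
      in Core.conclusion m′ K n₀ 1≤n₀
        (trans (ι-* (32 ℕ.* (m ℕ.* m)) m′) (cong (_* ι m′) (trans (ι-* 32 (m ℕ.* m)) (cong₂ _*_ ι32≡ (ι-* m m)))))
        (trans (ι-* 64 (m ℕ.* (m ℕ.* (m ℕ.* m)))) (cong₂ _*_ ι64≡ (trans (ι-* m (m ℕ.* (m ℕ.* m))) (cong (ι m *_) m³))))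
        (λ j → proj₁ (tols j)) (λ j → ℚ.<⇒≤ (proj₁ (proj₂ (tols j)))) (λ j → proj₂ (proj₂ (tols j)))
        H D ρ ρr 1≤D (ℚ.≤-trans (ι-mono (ℕP.m≤m+n (9 ℕ.* n-tol n₀ K) 1)) D₀≤D) deg≤D lin
        (proj₁ scale) (proj₁ (proj₂ scale)) (yZ D (proj₁ scale) (proj₂ (proj₂ scale)))
    where
    m n₃₂ K n₀ : ℕ
    m = suc m′
    n₃₂ = 32 ℕ.* (m ℕ.* (m ℕ.* m))
    K = 32 ℕ.* (m ℕ.* m) ℕ.* m′
    n₀ = 64 ℕ.* (m ℕ.* (m ℕ.* (m ℕ.* m)))
    prod : ∀ a {b} → 1 ℕ.≤ a → 1 ℕ.≤ b → 1 ℕ.≤ a ℕ.* b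
    prod a p q = ℕP.*-mono-≤ p q
    1≤m³ : 1 ℕ.≤ m ℕ.* (m ℕ.* m)
    1≤m³ = prod m (ℕ.s≤s ℕ.z≤n) (prod m (ℕ.s≤s ℕ.z≤n) (ℕ.s≤s ℕ.z≤n))
    1≤n₀ : 1 ℕ.≤ n₀
    1≤n₀ = prod 64 (ℕ.s≤s ℕ.z≤n) (prod m (ℕ.s≤s ℕ.z≤n) 1≤m³)
    m³ : ι (m ℕ.* (m ℕ.* m)) ≡ ι m * (ι m * ι m)
    m³ = trans (ι-* m (m ℕ.* m)) (cong (ι m *_) (ι-* m m))
    1≤ι⁺ : ∀ {n} → 1 ℕ.≤ n → 1ℚ ≤ ι n
    1≤ι⁺ {n} p = subst (_≤ ι n) ι-one (ι-mono p)
    tols : ∀ j → ∃[ d ] (0ℚ < d × ι (n-tol n₀ j) * d ≡ 1ℚ)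
    tols j = inv (ι (n-tol n₀ j)) (ℚ.<-≤-trans (ℚ.positive⁻¹ 1ℚ) (1≤ι⁺ (n-tol-pos n₀ j 1≤n₀)))
    0<Z : ∀ D → 1ℚ ≤ D → 0ℚ < ι n₃₂ * D
    0<Z D 1≤D = ℚ.<-≤-trans (ℚ.positive⁻¹ 1ℚ) (ℚ.≤-trans (ℚ.≤-reflexive (sym (ℚ.*-identityˡ 1ℚ)))
      (*-mono 0≤1 (ℚ.≤-trans 0≤1 1≤D) (1≤ι⁺ (prod 32 (ℕ.s≤s ℕ.z≤n) 1≤m³)) 1≤D))
    yZ : ∀ D y → ι n₃₂ * D * y ≡ 1ℚ → 2ℚ * (4ℚ * 4ℚ) * (y * (ι m * (ι m * ι m)) * D) ≡ 1ℚ
    yZ D y p = trans (l (2ℚ * (4ℚ * 4ℚ)) y (ι m * (ι m * ι m)) D)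
      (trans (cong (λ z → z * D * y) (sym (trans (ι-* 32 (m ℕ.* (m ℕ.* m))) (cong₂ _*_ ι32≡ m³)))) p)
      where
      l : ∀ c y r D → c * (y * r * D) ≡ c * r * D * y
      l = solve-∀ ring

-- Inversions as sums of cliques modulo 2.

module Inversions where
  open Subset using (Subset; ∣_∣; ⁅_⁆; outside)
  open import Data.Rational.Base using (ℚ; 0ℚ; 1ℚ; _+_; _*_; _-_; -_; _≤_; _<_)
  open FiniteSums

  true≢false : ∀ {b} → b ≡ true → b ≡ false → ∀ {A : Set} → A
  true≢false refl ()

  -- A pair is reversed by each set that contains both ends, so only the number of such sets modulo
  -- 2 matters and inversions commute.
  parity : ∀ {n} → List (Subset n) → Fin n → Fin n → Bool
  parity [] i j = false
  parity (X ∷ Xs) i j = (lookup X i ∧ lookup X j) xor parity Xs i j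

  parity-sym : ∀ {n} (Xs : List (Subset n)) i j → parity Xs i j ≡ parity Xs j i
  parity-sym [] i j = refl
  parity-sym (X ∷ Xs) i j = cong₂ _xor_ (𝔹.∧-comm (lookup X i) (lookup X j)) (parity-sym Xs i j)

  invertAll-parity : ∀ {n} (Xs : List (Subset n)) A i j → invertAll Xs A i j ≡ (if parity Xs i j then A j i else A i j)
  invertAll-parity [] A i j = refl
  invertAll-parity (X ∷ Xs) A i j with lookup X i ∧ lookup X j
  ... | false = invertAll-parity Xs A i j
  ... | true = trans (invertAll-parity Xs A j i) (trans (cong (λ b → if b then A i j else A j i) (parity-sym Xs j i)) (flip (parity Xs i j)))
    where
    flip : ∀ b → (if b then A i j else A j i) ≡ (if not b then A j i else A i j)
    flip true = refl
    flip false = refl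

  acyclic : ∀ {n} (B : Digraph n) (pos : Fin n → ℕ) → (∀ i j → B i j ≡ true → pos i ℕ.< pos j) → Acyclic B
  acyclic B rank mono i cycle = ℕP.<-irrefl refl (go cycle)
    where
    go : ∀ {i j} → TransClosure (λ i j → B i j ≡ true) i j → rank i ℕ.< rank j
    go Closure.[ p ] = mono _ _ p
    go (p Closure.∷ q) = ℕP.<-trans (mono _ _ p) (go q)

  record Graph (n : ℕ) : Set where
    constructor graph
    field
      adj : Fin n → Fin n → Bool
      symm : ∀ i j → adj i j ≡ adj j i
      irr : ∀ i → adj i i ≡ false
  open Graph public

  -- A graph has cost at most k if it is, off the diagonal, the mod 2 sum of the cliques on k sets of size at most 3.
  Cost : ∀ {n} → (Fin n → Fin n → Bool) → ℕ → Set
  Cost {n} g k = Σ[ Xs ∈ List (Subset n) ] (length Xs ≡ k × All (λ X → ∣ X ∣ ℕ.≤ 3) Xs × (∀ i j → (i == j) ≡ false → parity Xs i j ≡ g i j))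

  module _ {n : ℕ} where

    cost-cong : ∀ {g h : Fin n → Fin n → Bool} {k} → (∀ i j → (i == j) ≡ false → g i j ≡ h i j) → Cost g k → Cost h k
    cost-cong p (Xs , l , s , e) = Xs , l , s , λ i j ij → trans (e i j ij) (p i j ij)

    cost-add : ∀ {g : Fin n → Fin n → Bool} {k} (X : Subset n) → ∣ X ∣ ℕ.≤ 3 → Cost (λ i j → (lookup X i ∧ lookup X j) xor g i j) k → Cost g (suc k)
    cost-add {g} X X≤3 (Xs , l , s , e) = X ∷ Xs , cong suc l , X≤3 ∷ s , λ i j ij → trans (cong ((lookup X i ∧ lookup X j) xor_) (e i j ij)) (cancel (lookup X i ∧ lookup X j) (g i j))
      where
      cancel : ∀ u v → u xor (u xor v) ≡ v
      cancel true true = refl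
      cancel true false = refl
      cancel false v = refl

    set₃ : Fin n → Fin n → Fin n → Subset n
    set₃ a b c = ⁅ a ⁆ Subset.∪ (⁅ b ⁆ Subset.∪ ⁅ c ⁆)

    mem₃ : Fin n → Fin n → Fin n → Fin n → Bool
    mem₃ a b c i = (i == a) ∨ ((i == b) ∨ (i == c))

    lookup-single : ∀ {m} (a i : Fin m) → lookup ⁅ a ⁆ i ≡ (i == a)
    lookup-single zero zero = refl
    lookup-single zero (suc i) = lookup-replicate i outside
    lookup-single (suc a) zero = refl
    lookup-single (suc a) (suc i) = lookup-single a i

    lookup-set₃ : ∀ a b c i → lookup (set₃ a b c) i ≡ mem₃ a b c i
    lookup-set₃ a b c i = trans (lookup-zipWith _∨_ i ⁅ a ⁆ _) (cong₂ _∨_ (lookup-single a i) (trans (lookup-zipWith _∨_ i ⁅ b ⁆ ⁅ c ⁆) (cong₂ _∨_ (lookup-single b i) (lookup-single c i))))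

    ∪-size : ∀ {m} (p q : Subset m) → ∣ p Subset.∪ q ∣ ℕ.≤ ∣ p ∣ ℕ.+ ∣ q ∣
    ∪-size [] [] = ℕ.z≤n
    ∪-size (true ∷ p) (true ∷ q) = ℕ.s≤s (ℕP.≤-trans (∪-size p q) (ℕP.+-monoʳ-≤ ∣ p ∣ (ℕP.n≤1+n _)))
    ∪-size (true ∷ p) (false ∷ q) = ℕ.s≤s (∪-size p q)
    ∪-size (false ∷ p) (true ∷ q) = ℕP.≤-trans (ℕ.s≤s (∪-size p q)) (ℕP.≤-reflexive (sym (ℕP.+-suc ∣ p ∣ ∣ q ∣)))
    ∪-size (false ∷ p) (false ∷ q) = ∪-size p q

    set₃-size : ∀ a b c → ∣ set₃ a b c ∣ ℕ.≤ 3
    set₃-size a b c = ℕP.≤-trans (∪-size ⁅ a ⁆ _) (ℕP.+-mono-≤ (ℕP.≤-reflexive (SP.∣⁅x⁆∣≡1 a))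
      (ℕP.≤-trans (∪-size ⁅ b ⁆ ⁅ c ⁆) (ℕP.+-mono-≤ (ℕP.≤-reflexive (SP.∣⁅x⁆∣≡1 b)) (ℕP.≤-reflexive (SP.∣⁅x⁆∣≡1 c)))))

    ed : Fin n → Fin n → Fin n → Fin n → Bool
    ed a b i j = ((i == a) ∧ (j == b)) ∨ ((i == b) ∧ (j == a))

    tog : Fin n → Fin n → (Fin n → Fin n → Bool) → Fin n → Fin n → Bool
    tog a b g i j = ed a b i j xor g i j

    ≡true⇒ : ∀ (i j a : Fin n) → (i == a) ≡ true → (j == a) ≡ true → (i == j) ≡ true
    ≡true⇒ i j a p q rewrite ==⇒≡ i a p | ==⇒≡ j a q = ==-refl a

    join : ∀ (i a b : Fin n) → (i == a) ≡ true → (i == b) ≡ true → (a == b) ≡ true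
    join i a b p q = trans (cong (_== b) (sym (==⇒≡ i a p))) q

    clique-edges : ∀ a b c → (a == b) ≡ false → (a == c) ≡ false → (b == c) ≡ false → ∀ i j → (i == j) ≡ false →
      mem₃ a b c i ∧ mem₃ a b c j ≡ ed a b i j xor (ed a c i j xor ed b c i j)
    clique-edges a b c ab ac bc i j ij
      with i == a in ia | i == b in ib | i == c in ic | j == a in ja | j == b in jb | j == c in jc
    ... | true | true | _ | _ | _ | _ = true≢false (join i a b ia ib) ab
    ... | true | false | true | _ | _ | _ = true≢false (join i a c ia ic) ac
    ... | false | true | true | _ | _ | _ = true≢false (join i b c ib ic) bc
    ... | _ | _ | _ | true | true | _ = true≢false (join j a b ja jb) ab
    ... | _ | _ | _ | true | false | true = true≢false (join j a c ja jc) ac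
    ... | _ | _ | _ | false | true | true = true≢false (join j b c jb jc) bc
    ... | true | false | false | true | false | false = true≢false (≡true⇒ i j a ia ja) ij
    ... | false | true | false | false | true | false = true≢false (≡true⇒ i j b ib jb) ij
    ... | false | false | true | false | false | true = true≢false (≡true⇒ i j c ic jc) ij
    ... | true | false | false | false | true | false = refl
    ... | true | false | false | false | false | true = refl
    ... | true | false | false | false | false | false = refl
    ... | false | true | false | true | false | false = refl
    ... | false | true | false | false | false | true = refl
    ... | false | true | false | false | false | false = refl
    ... | false | false | true | true | false | false = refl
    ... | false | false | true | false | true | false = refl
    ... | false | false | true | false | false | false = refl
    ... | false | false | false | true | false | false = refl
    ... | false | false | false | false | true | false = refl
    ... | false | false | false | false | false | true = refl
    ... | false | false | false | false | false | false = refl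

    cost-triangle : ∀ {g : Fin n → Fin n → Bool} {k} a b c → (a == b) ≡ false → (a == c) ≡ false → (b == c) ≡ false →
      Cost (tog a b (tog a c (tog b c g))) k → Cost g (suc k)
    cost-triangle {g} a b c ab ac bc C = cost-add (set₃ a b c) (set₃-size a b c) (cost-cong same C)
      where
      assoc : ∀ u v s t → u xor (v xor (s xor t)) ≡ (u xor (v xor s)) xor t
      assoc u v s t = trans (cong (u xor_) (sym (𝔹.xor-assoc v s t))) (sym (𝔹.xor-assoc u (v xor s) t))
      same : ∀ i j → (i == j) ≡ false → tog a b (tog a c (tog b c g)) i j ≡ (lookup (set₃ a b c) i ∧ lookup (set₃ a b c) j) xor g i j
      same i j ij = trans (assoc (ed a b i j) (ed a c i j) (ed b c i j) (g i j)) (cong (_xor g i j)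
        (sym (trans (cong₂ _∧_ (lookup-set₃ a b c i) (lookup-set₃ a b c j)) (clique-edges a b c ab ac bc i j ij))))

    -- Off the diagonal, the clique on the two-element set `set₃ a b b` is a single edge.
    cost-edge : ∀ {g : Fin n → Fin n → Bool} {k} a b → (a == b) ≡ false → Cost (tog a b g) k → Cost g (suc k)
    cost-edge {g} a b ab C = cost-add (set₃ a b b) (set₃-size a b b) (cost-cong same C)
      where
      clique : ∀ i j → (i == j) ≡ false → mem₃ a b b i ∧ mem₃ a b b j ≡ ed a b i j
      clique i j ij with i == a in ia | i == b in ib | j == a in ja | j == b in jb
      ... | true | _ | true | _ = true≢false (≡true⇒ i j a ia ja) ij
      ... | _ | true | _ | true = true≢false (≡true⇒ i j b ib jb) ij
      ... | true | true | false | false = refl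
      ... | true | false | false | true = refl
      ... | true | false | false | false = refl
      ... | false | true | true | false = refl
      ... | false | true | false | false = refl
      ... | false | false | true | true = refl
      ... | false | false | true | false = refl
      ... | false | false | false | true = refl
      ... | false | false | false | false = refl
      same : ∀ i j → (i == j) ≡ false → tog a b g i j ≡ (lookup (set₃ a b b) i ∧ lookup (set₃ a b b) j) xor g i j
      same i j ij = cong (_xor g i j) (sym (trans (cong₂ _∧_ (lookup-set₃ a b b i) (lookup-set₃ a b b j)) (clique i j ij)))

    ed-sym : ∀ a b i j → ed a b i j ≡ ed a b j i
    ed-sym a b i j = trans (𝔹.∨-comm ((i == a) ∧ (j == b)) ((i == b) ∧ (j == a))) (cong₂ _∨_ (𝔹.∧-comm (i == b) (j == a)) (𝔹.∧-comm (i == a) (j == b)))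

    ed-irr : ∀ a b i → (a == b) ≡ false → ed a b i i ≡ false
    ed-irr a b i ab with i == a in ia | i == b in ib
    ... | true | true = true≢false (trans (cong (_== b) (sym (==⇒≡ i a ia))) ib) ab
    ... | true | false = refl
    ... | false | true = refl
    ... | false | false = refl

    toggle : ∀ a b → (a == b) ≡ false → Graph n → Graph n
    toggle a b ab G = graph (tog a b (adj G)) (λ i j → cong₂ _xor_ (ed-sym a b i j) (symm G i j)) (λ i → cong₂ _xor_ (ed-irr a b i ab) (irr G i))

    -- Every edge is counted twice, which accounts for the factors 2 and 4 in the cost bounds.
    e₂ : Graph n → ℚ
    e₂ G = Σ (λ i → Σ (λ j → [ adj G i j ]))

    Σ-δδ : ∀ (a b : Fin n) → Σ (λ i → Σ (λ j → [ i == a ] * [ j == b ])) ≡ 1ℚ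
    Σ-δδ a b = trans (Σ-cong (λ i → trans (Σ-*ˡ [ i == a ] (λ j → [ j == b ])) (cong ([ i == a ] *_) (one b)))) (trans (Σ-cong (λ i → ℚ.*-identityʳ [ i == a ])) (one a))
      where
      one : ∀ (b : Fin n) → Σ (λ j → [ j == b ]) ≡ 1ℚ
      one b = trans (Σ-cong (λ j → sym (ℚ.*-identityʳ [ j == b ]))) (Σ-δ b (λ _ → 1ℚ))

    toggle-e₂ : ∀ a b ab G → adj G a b ≡ true → e₂ G ≡ e₂ (toggle a b ab G) + (1ℚ + 1ℚ)
    toggle-e₂ a b ab G gab = begin
      Σ (λ i → Σ (λ j → [ adj G i j ])) ≡⟨ Σ-cong (λ i → trans (Σ-cong (point i)) (trans (Σ-+ _ (λ j → δ i j + δ′ i j)) (cong (Σ (λ j → [ tog a b (adj G) i j ]) +_) (Σ-+ (δ i) (δ′ i))))) ⟩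
      Σ (λ i → Σ (λ j → [ tog a b (adj G) i j ]) + (Σ (δ i) + Σ (δ′ i))) ≡⟨ trans (Σ-+ _ (λ i → Σ (δ i) + Σ (δ′ i))) (cong (e₂ (toggle a b ab G) +_) (Σ-+ (λ i → Σ (δ i)) (λ i → Σ (δ′ i)))) ⟩
      e₂ (toggle a b ab G) + (Σ (λ i → Σ (δ i)) + Σ (λ i → Σ (δ′ i))) ≡⟨ cong (e₂ (toggle a b ab G) +_) (cong₂ _+_ (Σ-δδ a b) (Σ-δδ b a)) ⟩
      e₂ (toggle a b ab G) + (1ℚ + 1ℚ) ∎
      where
      open ≡-Reasoning
      δ δ′ : Fin n → Fin n → ℚ
      δ i j = [ i == a ] * [ j == b ]
      δ′ i j = [ i == b ] * [ j == a ]
      l₀ : ∀ x u → x ≡ x + (0ℚ * u + 0ℚ * u)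
      l₀ = solve-∀ ring
      l₁ : ∀ x → x ≡ x + (1ℚ * 0ℚ + 0ℚ * 0ℚ)
      l₁ = solve-∀ ring
      l₂ : ∀ x → x ≡ x + (0ℚ * 0ℚ + 1ℚ * 0ℚ)
      l₂ = solve-∀ ring
      l₃ : ∀ x → x ≡ x + (0ℚ * 1ℚ + 0ℚ * 0ℚ)
      l₃ = solve-∀ ring
      l₄ : ∀ x → x ≡ x + (0ℚ * 0ℚ + 0ℚ * 1ℚ)
      l₄ = solve-∀ ring
      here-ab : ∀ i j → (i == a) ≡ true → (j == b) ≡ true → adj G i j ≡ true
      here-ab i j p q rewrite ==⇒≡ i a p | ==⇒≡ j b q = gab
      here-ba : ∀ i j → (i == b) ≡ true → (j == a) ≡ true → adj G i j ≡ true
      here-ba i j p q rewrite ==⇒≡ i b p | ==⇒≡ j a q = trans (symm G b a) gab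
      point : ∀ i j → [ adj G i j ] ≡ [ tog a b (adj G) i j ] + (δ i j + δ′ i j)
      point i j with i == a in ia | i == b in ib | j == a in ja | j == b in jb
      ... | true | true | _ | _ = true≢false (trans (cong (_== b) (sym (==⇒≡ i a ia))) ib) ab
      ... | _ | _ | true | true = true≢false (trans (cong (_== b) (sym (==⇒≡ j a ja))) jb) ab
      ... | true | false | false | true rewrite here-ab i j ia jb = refl
      ... | false | true | true | false rewrite here-ba i j ib ja = refl
      ... | true | false | true | false = l₁ [ adj G i j ]
      ... | true | false | false | false = l₁ [ adj G i j ]
      ... | false | true | false | true = l₂ [ adj G i j ]
      ... | false | true | false | false = l₂ [ adj G i j ]
      ... | false | false | true | false = l₄ [ adj G i j ]
      ... | false | false | false | true = l₃ [ adj G i j ]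
      ... | false | false | false | false = l₀ [ adj G i j ] 0ℚ

    other-edge : ∀ a b g i j → ed a b i j ≡ false → tog a b g i j ≡ g i j
    other-edge a b g i j p rewrite p = refl

    ed-false₁ : ∀ a b i j → (i == a) ≡ false → (i == b) ≡ false → ed a b i j ≡ false
    ed-false₁ a b i j p q rewrite p | q = refl

    ed-false₂ : ∀ a b i j → (j == a) ≡ false → (j == b) ≡ false → ed a b i j ≡ false
    ed-false₂ a b i j p q rewrite p | q with i == a | i == b
    ... | true | true = refl
    ... | true | false = refl
    ... | false | true = refl
    ... | false | false = refl

    find : (P : Fin n → Bool) → (∃[ i ] P i ≡ true) ⊎ (∀ i → P i ≡ false)
    find P with FP.any? (λ i → P i 𝔹.≟ true)
    ... | yes p = inj₁ p
    ... | no ¬p = inj₂ (λ i → 𝔹.¬-not (λ e → ¬p (i , e)))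

    -- One pair is inverted per edge. Each such inversion lowers `e₂` by 2, so any bound on `e₂`
    -- serves as fuel.
    cost-edges : ∀ fuel (G : Graph n) → e₂ G ≤ ι fuel → ∃[ k ] (Cost (adj G) k × (1ℚ + 1ℚ) * ι k ≤ e₂ G)
    cost-edges fuel G bound with find (λ i → does-exist i)
      where
      does-exist : Fin n → Bool
      does-exist i with find (adj G i)
      ... | inj₁ _ = true
      ... | inj₂ _ = false
    cost-edges fuel G bound | inj₂ none = 0 , ([] , refl , [] , λ i j _ → sym (empty i j)) , ℚ.≤-trans (ℚ.≤-reflexive (trans (cong ((1ℚ + 1ℚ) *_) ι-zero) refl)) (Σ-nn (λ i → Σ-nn (λ j → []-nn (adj G i j))))
      where
      empty : ∀ i j → adj G i j ≡ false
      empty i j with find (adj G i) | none i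
      ... | inj₂ p | _ = p j
    cost-edges fuel G bound | inj₁ (i , ei) with find (adj G i)
    cost-edges zero G bound | inj₁ (i , ei) | inj₁ (j , gij) = ⊥-elim (ℚ.<-irrefl refl (ℚ.<-≤-trans (ℚ.positive⁻¹ 1ℚ) (ℚ.≤-trans (ℚ.≤-trans (ℚ.≤-reflexive (cong [_] (sym gij)))
        (ℚ.≤-trans (Σ-term (λ j → []-nn (adj G i j)) j) (Σ-term (λ i → Σ-nn (λ j → []-nn (adj G i j))) i))) (ℚ.≤-trans bound (ℚ.≤-reflexive ι-zero)))))
    cost-edges (suc fuel) G bound | inj₁ (i , ei) | inj₁ (j , gij) = continue (cost-edges fuel (toggle i j ij G) smaller)
      where
      ij : (i == j) ≡ false
      ij with i == j in eq
      ... | false = refl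
      ... | true = true≢false gij (trans (cong (adj G i) (sym (==⇒≡ i j eq))) (irr G i))
      dec : e₂ G ≡ e₂ (toggle i j ij G) + (1ℚ + 1ℚ)
      dec = toggle-e₂ i j ij G gij
      smaller : e₂ (toggle i j ij G) ≤ ι fuel
      smaller = ≤-by (1ℚ + (ι (suc fuel) - e₂ G)) (+-nn 0≤1 (diff≥0 bound)) (trans (l (ι fuel) (e₂ (toggle i j ij G))) (cong₂ (λ u v → e₂ (toggle i j ij G) + (1ℚ + (u - v))) (sym (ι-suc fuel)) (sym dec)))
        where
        l : ∀ f e → f ≡ e + (1ℚ + (1ℚ + f - (e + (1ℚ + 1ℚ))))
        l = solve-∀ ring
      continue : ∃[ k ] (Cost (tog i j (adj G)) k × (1ℚ + 1ℚ) * ι k ≤ e₂ (toggle i j ij G)) → ∃[ k ] (Cost (adj G) k × (1ℚ + 1ℚ) * ι k ≤ e₂ G)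
      continue (k , C , b) = suc k , cost-edge i j ij C , ℚ.≤-trans (ℚ.≤-reflexive (trans (cong ((1ℚ + 1ℚ) *_) (ι-suc k)) (l (ι k)))) (ℚ.≤-trans (ℚ.+-monoˡ-≤ (1ℚ + 1ℚ) b) (ℚ.≤-reflexive (sym dec)))
        where
        l : ∀ k → (1ℚ + 1ℚ) * (1ℚ + k) ≡ (1ℚ + 1ℚ) * k + (1ℚ + 1ℚ)
        l = solve-∀ ring

-- Two edges per inversion as long as there are 4-cycles.

module FourCycles where
  open import Data.Rational.Base using (ℚ; 0ℚ; 1ℚ; _+_; _*_; _-_; -_; _≤_; _<_)
  open FiniteSums
  open Inversions

  -- The difference of the two sides is half the sum of all squares (f i - f j)².
  cauchy : ∀ {n} (f : Fin n → ℚ) → Σ f * Σ f ≤ ι n * Σ (λ i → f i * f i)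
  cauchy {n} f = begin
    Σ f * Σ f ≤⟨ ≤-by (Σ (λ i → Σ (λ j → half (f i - f j)))) (Σ-nn (λ i → Σ-nn (λ j → *-nn 0≤½ (sq-nn (f i - f j))))) expand ⟩
    ι n * Σ (λ i → f i * f i) ∎
    where
    open ℚ.≤-Reasoning
    open import Data.Rational.Base using (½)
    0≤½ : 0ℚ ≤ ½
    0≤½ = ℚ.nonNegative⁻¹ ½
    half : ℚ → ℚ
    half x = ½ * (x * x)
    q : ℚ
    q = Σ (λ i → f i * f i)
    l : ∀ h a b → h * ((a - b) * (a - b)) ≡ h * (a * a) + (h * (b * b) - (h + h) * a * b)
    l = solve-∀ ring
    l₂ : ∀ h n q s → (h + h) * (s * s) + (n * (h * q) + (n * (h * q) - (h + h) * s * s)) ≡ (h + h) * (n * q)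
    l₂ = solve-∀ ring
    inner : ∀ i → Σ (λ j → half (f i - f j)) ≡ ι n * (½ * (f i * f i)) + (½ * q - (½ + ½) * f i * Σ f)
    inner i = trans (Σ-cong (λ j → l ½ (f i) (f j))) (trans (Σ-+ (λ j → ½ * (f i * f i)) (λ j → ½ * (f j * f j) - (½ + ½) * f i * f j))
      (cong₂ _+_ (Σ-const n (½ * (f i * f i))) (trans (Σ-- (λ j → ½ * (f j * f j)) (λ j → (½ + ½) * f i * f j)) (cong₂ _-_ (Σ-*ˡ ½ (λ j → f j * f j)) (Σ-*ˡ ((½ + ½) * f i) f)))))
    expand : ι n * q ≡ Σ f * Σ f + Σ (λ i → Σ (λ j → half (f i - f j)))
    expand = sym (begin-equality
      Σ f * Σ f + Σ (λ i → Σ (λ j → half (f i - f j))) ≡⟨ cong₂ _+_ (sym (ℚ.*-identityˡ (Σ f * Σ f))) (Σ-cong inner) ⟩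
      (½ + ½) * (Σ f * Σ f) + Σ (λ i → ι n * (½ * (f i * f i)) + (½ * q - (½ + ½) * f i * Σ f)) ≡⟨ cong ((½ + ½) * (Σ f * Σ f) +_) (trans (Σ-+ (λ i → ι n * (½ * (f i * f i))) (λ i → ½ * q - (½ + ½) * f i * Σ f))
          (cong₂ _+_ (trans (Σ-*ˡ (ι n) (λ i → ½ * (f i * f i))) (cong (ι n *_) (Σ-*ˡ ½ (λ i → f i * f i))))
            (trans (Σ-- (λ i → ½ * q) (λ i → (½ + ½) * f i * Σ f)) (cong₂ _-_ (Σ-const n (½ * q)) (trans (Σ-*ʳ (Σ f) (λ i → (½ + ½) * f i)) (cong (_* Σ f) (Σ-*ˡ (½ + ½) f))))))) ⟩
      (½ + ½) * (Σ f * Σ f) + (ι n * (½ * q) + (ι n * (½ * q) - (½ + ½) * Σ f * Σ f)) ≡⟨ l₂ ½ (ι n) q (Σ f) ⟩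
      (½ + ½) * (ι n * q) ≡⟨ ℚ.*-identityˡ _ ⟩
      ι n * q ∎)

  0≤7 : 0ℚ ≤ 1ℚ + (1ℚ + 1ℚ) + ((1ℚ + 1ℚ) + (1ℚ + 1ℚ))
  0≤7 = +-nn (+-nn 0≤1 (+-nn 0≤1 0≤1)) (+-nn (+-nn 0≤1 0≤1) (+-nn 0≤1 0≤1))

  module _ {n : ℕ} where

    -- `ab` and `cd` only say that opposite vertices are distinct; the diagonals may or may not be
    -- edges.
    record FourCycle (G : Graph n) : Set where
      field
        a b c d : Fin n
        ab : (a == b) ≡ false
        cd : (c == d) ≡ false
        ac : adj G a c ≡ true
        bc : adj G b c ≡ true
        ad : adj G a d ≡ true
        bd : adj G b d ≡ true

    adj⇒≢ : ∀ (G : Graph n) i j → adj G i j ≡ true → (i == j) ≡ false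
    adj⇒≢ G i j p with i == j in eq
    ... | false = refl
    ... | true = true≢false p (trans (cong (adj G i) (sym (==⇒≡ i j eq))) (irr G i))

    -- The triangles abc and abd share the pair ab, which cancels modulo 2 whether or not it is an
    -- edge of `G`; what is left is the 4-cycle.
    remove-four : (G : Graph n) → FourCycle G → ∃[ G′ ] ((∀ {k} → Cost (adj G′) k → Cost (adj G) (2 ℕ.+ k)) × e₂ G ≡ e₂ G′ + ((1ℚ + 1ℚ) + (1ℚ + 1ℚ) + ((1ℚ + 1ℚ) + (1ℚ + 1ℚ))))
    remove-four G C = G₄ , (λ Q → cost-triangle a b c ab a≢c b≢c (cost-triangle a b d ab a≢d b≢d (cost-cong (λ i j _ → same (ed a b i j) (ed a c i j) (ed b c i j) (ed a d i j) (ed b d i j) (adj G i j)) Q))) ,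
        trans d₁ (trans (cong (_+ (1ℚ + 1ℚ)) (trans d₂ (cong (_+ (1ℚ + 1ℚ)) (trans d₃ (cong (_+ (1ℚ + 1ℚ)) d₄))))) (l (e₂ G₄) (1ℚ + 1ℚ)))
      where
      open FourCycle C renaming (ac to gac; bc to gbc; ad to gad; bd to gbd)
      a≢c : (a == c) ≡ false
      a≢c = adj⇒≢ G a c gac
      b≢c : (b == c) ≡ false
      b≢c = adj⇒≢ G b c gbc
      a≢d : (a == d) ≡ false
      a≢d = adj⇒≢ G a d gad
      b≢d : (b == d) ≡ false
      b≢d = adj⇒≢ G b d gbd
      flip : ∀ (i j : Fin n) → (i == j) ≡ false → (j == i) ≡ false
      flip i j p = trans (==-sym j i) p
      G₁ G₂ G₃ G₄ : Graph n
      G₁ = toggle a c a≢c G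
      G₂ = toggle b c b≢c G₁
      G₃ = toggle a d a≢d G₂
      G₄ = toggle b d b≢d G₃
      d₁ : e₂ G ≡ e₂ G₁ + (1ℚ + 1ℚ)
      d₁ = toggle-e₂ a c a≢c G gac
      d₂ : e₂ G₁ ≡ e₂ G₂ + (1ℚ + 1ℚ)
      d₂ = toggle-e₂ b c b≢c G₁ (trans (other-edge a c (adj G) b c (ed-false₁ a c b c (flip a b ab) b≢c)) gbc)
      d₃ : e₂ G₂ ≡ e₂ G₃ + (1ℚ + 1ℚ)
      d₃ = toggle-e₂ a d a≢d G₂ (trans (other-edge b c (adj G₁) a d (ed-false₁ b c a d ab a≢c)) (trans (other-edge a c (adj G) a d (ed-false₂ a c a d (flip a d a≢d) (flip c d cd))) gad))
      d₄ : e₂ G₃ ≡ e₂ G₄ + (1ℚ + 1ℚ)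
      d₄ = toggle-e₂ b d b≢d G₃ (trans (other-edge a d (adj G₂) b d (ed-false₁ a d b d (flip a b ab) b≢d)) (trans (other-edge b c (adj G₁) b d (ed-false₂ b c b d (flip b d b≢d) (flip c d cd)))
             (trans (other-edge a c (adj G) b d (ed-false₁ a c b d (flip a b ab) b≢c)) gbd)))
      l : ∀ e t → e + t + t + t + t ≡ e + (t + t + (t + t))
      l = solve-∀ ring
      same : ∀ p q r s t g → t xor (s xor (r xor (q xor g))) ≡ p xor (s xor (t xor (p xor (q xor (r xor g)))))
      same p q r s t g = trans (main q r s t g) (cancel p (s xor (t xor (q xor (r xor g)))) p-out)
        where
        open xor-∧-Solver using (solve; _:+_; _:=_)
        main : ∀ q r s t g → t xor (s xor (r xor (q xor g))) ≡ s xor (t xor (q xor (r xor g)))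
        main = solve 5 (λ q r s t g → t :+ (s :+ (r :+ (q :+ g))) := s :+ (t :+ (q :+ (r :+ g)))) refl
        p-out : p xor (s xor (t xor (p xor (q xor (r xor g))))) ≡ p xor (p xor (s xor (t xor (q xor (r xor g)))))
        p-out = cong (p xor_) (solve 4 (λ p s t u → s :+ (t :+ (p :+ u)) := p :+ (s :+ (t :+ u))) refl p s t (q xor (r xor g)))
        cancel : ∀ p u {v} → v ≡ p xor (p xor u) → u ≡ v
        cancel true true refl = refl
        cancel true false refl = refl
        cancel false u refl = refl

    four-cycle? : (G : Graph n) → FourCycle G ⊎ ¬ FourCycle G
    four-cycle? G with FP.any? (λ a → FP.any? (λ b → FP.any? (λ c → FP.any? (λ d →
        ((a == b) 𝔹.≟ false) ×-dec (((c == d) 𝔹.≟ false) ×-dec ((adj G a c 𝔹.≟ true) ×-dec ((adj G b c 𝔹.≟ true) ×-dec ((adj G a d 𝔹.≟ true) ×-dec (adj G b d 𝔹.≟ true)))))))))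
    ... | yes (a , b , c , d , ab , cd , ac , bc , ad , bd) = inj₁ (record { a = a ; b = b ; c = c ; d = d ; ab = ab ; cd = cd ; ac = ac ; bc = bc ; ad = ad ; bd = bd })
    ... | no ¬p = inj₂ (λ C → let open FourCycle C in ¬p (a , b , c , d , ab , cd , ac , bc , ad , bd))

    at-most-one : ∀ (f : Fin n → Bool) → (∀ c d → f c ≡ true → f d ≡ true → (c == d) ≡ true) → Σ (λ c → [ f c ]) ≤ 1ℚ
    at-most-one f uniq with find f
    ... | inj₂ none = ℚ.≤-trans (ℚ.≤-reflexive (trans (Σ-cong (λ c → cong [_] (none c))) (Σ-zero n))) 0≤1
    ... | inj₁ (a , fa) = ℚ.≤-trans (Σ-mono below) (ℚ.≤-reflexive (Σ-δ a (λ _ → 1ℚ)))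
      where
      below : ∀ c → [ f c ] ≤ [ c == a ] * 1ℚ
      below c with f c in fc
      ... | true rewrite uniq c a fc fa = ℚ.≤-refl
      ... | false = *-nn ([]-nn (c == a)) 0≤1

    -- Kővári–Sós–Turán for 4-cycles.
    few-edges : (G : Graph n) → ¬ FourCycle G → e₂ G * e₂ G ≤ ι n * (ι n * ι n + ι n * ι n)
    few-edges G ¬C = ℚ.≤-trans (cauchy deg) (*-monoˡ (ι n) (ι-nn n) (begin
      Σ (λ c → deg c * deg c) ≡⟨ Σ-cong (λ c → trans (sym (Σ-*ʳ (deg c) (λ a → [ adj G c a ]))) (Σ-cong (λ a → sym (Σ-*ˡ [ adj G c a ] (λ b → [ adj G c b ]))))) ⟩
      Σ (λ c → Σ (λ a → Σ (λ b → [ adj G c a ] * [ adj G c b ]))) ≡⟨ Σ-swap (λ c a → Σ (λ b → [ adj G c a ] * [ adj G c b ])) ⟩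
      Σ (λ a → Σ (λ c → Σ (λ b → [ adj G c a ] * [ adj G c b ]))) ≡⟨ Σ-cong (λ a → Σ-swap (λ c b → [ adj G c a ] * [ adj G c b ])) ⟩
      Σ (λ a → Σ (λ b → Σ (λ c → [ adj G c a ] * [ adj G c b ]))) ≤⟨ Σ-mono (λ a → Σ-mono (codegree a)) ⟩
      Σ {n} (λ a → Σ {n} (λ b → 1ℚ + [ b == a ] * ι n)) ≡⟨ Σ-cong {n} (λ a → trans (Σ-+ {n} (λ _ → 1ℚ) (λ b → [ b == a ] * ι n)) (cong₂ _+_ (trans (Σ-const n 1ℚ) (ℚ.*-identityʳ (ι n))) (Σ-δ a (λ _ → ι n)))) ⟩
      Σ {n} (λ a → ι n + ι n) ≡⟨ trans (Σ-const n (ι n + ι n)) (ℚ.*-distribˡ-+ (ι n) (ι n) (ι n)) ⟩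
      ι n * ι n + ι n * ι n ∎))
      where
      open ℚ.≤-Reasoning
      deg : Fin n → ℚ
      deg c = Σ (λ a → [ adj G c a ])
      -- Without 4-cycles, distinct vertices have at most one common neighbour; for equal ones the
      -- trivial bound n suffices, since there are only n such pairs.
      codegree : ∀ a b → Σ (λ c → [ adj G c a ] * [ adj G c b ]) ≤ 1ℚ + [ b == a ] * ι n
      codegree a b with b == a in ba
      ... | true = ℚ.≤-trans (Σ-upper 1ℚ (λ c → ℚ.≤-trans (*-mono ([]-nn (adj G c a)) 0≤1 ([]≤1 (adj G c a)) ([]≤1 (adj G c b))) (ℚ.≤-reflexive (ℚ.*-identityˡ 1ℚ))))
          (≤-by 1ℚ 0≤1 (l (ι n)))
        where
        l : ∀ n → 1ℚ + 1ℚ * n ≡ n * 1ℚ + 1ℚ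
        l = solve-∀ ring
      ... | false = ℚ.≤-trans (ℚ.≤-reflexive (Σ-cong (λ c → sym ([∧] (adj G c a) (adj G c b))))) (ℚ.≤-trans (at-most-one (λ c → adj G c a ∧ adj G c b) uniq) (≤-by (0ℚ * ι n) (ℚ.≤-reflexive (sym (ℚ.*-zeroˡ (ι n)))) refl))
        where
        ∧-l : ∀ x y → x ∧ y ≡ true → x ≡ true
        ∧-l true y p = refl
        ∧-r : ∀ x y → x ∧ y ≡ true → y ≡ true
        ∧-r true y p = p
        uniq : ∀ c d → adj G c a ∧ adj G c b ≡ true → adj G d a ∧ adj G d b ≡ true → (c == d) ≡ true
        uniq c d p q with c == d in cd
        ... | true = refl
        ... | false = ⊥-elim (¬C (record { a = a ; b = b ; c = c ; d = d ; ab = trans (==-sym a b) ba ; cd = cd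
               ; ac = trans (symm G a c) (∧-l _ _ p) ; bc = trans (symm G b c) (∧-r (adj G c a) _ p)
               ; ad = trans (symm G a d) (∧-l _ _ q) ; bd = trans (symm G b d) (∧-r (adj G d a) _ q) }))

    -- Half an inversion per edge, up to `s`/4.
    Halved : ℚ → Graph n → Set
    Halved s G = ∃[ k ] (Cost (adj G) k × (1ℚ + 1ℚ + (1ℚ + 1ℚ)) * ι k ≤ e₂ G + s)

    sparse-halved : ∀ s fuel (G : Graph n) → e₂ G ≤ ι fuel → e₂ G ≤ s → Halved s G
    sparse-halved s fuel G bound e≤s = double (cost-edges fuel G bound)
      where
      l : ∀ k → (1ℚ + 1ℚ + (1ℚ + 1ℚ)) * k ≡ (1ℚ + 1ℚ) * k + (1ℚ + 1ℚ) * k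
      l = solve-∀ ring
      double : ∃[ k ] (Cost (adj G) k × (1ℚ + 1ℚ) * ι k ≤ e₂ G) → Halved s G
      double (k , C , kb) = k , C , ℚ.≤-trans (ℚ.≤-reflexive (l (ι k))) (ℚ.+-mono-≤ kb (ℚ.≤-trans kb e≤s))

    -- Every 4-cycle is the sum of two triangles, so each inversion pays for two edges as long as 4-cycles last.
    cost-half : ∀ s → 0ℚ ≤ s → ι n * (ι n * ι n + ι n * ι n) < s * s → ∀ fuel (G : Graph n) → e₂ G ≤ ι fuel → Halved s G
    cost-half s 0≤s large zero G bound = sparse-halved s zero G bound (ℚ.≤-trans bound (ℚ.≤-trans (ℚ.≤-reflexive ι-zero) 0≤s))
    cost-half s 0≤s large (suc fuel) G bound = choose (ℚ.≤-total (e₂ G) s)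
      where
      continue : ∀ (G′ : Graph n) → (∀ {k} → Cost (adj G′) k → Cost (adj G) (2 ℕ.+ k)) →
        e₂ G ≡ e₂ G′ + ((1ℚ + 1ℚ) + (1ℚ + 1ℚ) + ((1ℚ + 1ℚ) + (1ℚ + 1ℚ))) → Halved s G′ → Halved s G
      continue G′ lift dec (k , Q , kb) = suc (suc k) , lift Q , ℚ.≤-trans (ℚ.≤-reflexive (trans (cong ((1ℚ + 1ℚ + (1ℚ + 1ℚ)) *_) (trans (ι-suc (suc k)) (cong (1ℚ +_) (ι-suc k)))) (l (ι k))))
         (ℚ.≤-trans (ℚ.+-monoˡ-≤ ((1ℚ + 1ℚ) + (1ℚ + 1ℚ) + ((1ℚ + 1ℚ) + (1ℚ + 1ℚ))) kb) (ℚ.≤-reflexive (trans (l₂ (e₂ G′) s) (cong (_+ s) (sym dec)))))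
        where
        l : ∀ k → (1ℚ + 1ℚ + (1ℚ + 1ℚ)) * (1ℚ + (1ℚ + k)) ≡ (1ℚ + 1ℚ + (1ℚ + 1ℚ)) * k + ((1ℚ + 1ℚ) + (1ℚ + 1ℚ) + ((1ℚ + 1ℚ) + (1ℚ + 1ℚ)))
        l = solve-∀ ring
        l₂ : ∀ e s → e + s + ((1ℚ + 1ℚ) + (1ℚ + 1ℚ) + ((1ℚ + 1ℚ) + (1ℚ + 1ℚ))) ≡ e + ((1ℚ + 1ℚ) + (1ℚ + 1ℚ) + ((1ℚ + 1ℚ) + (1ℚ + 1ℚ))) + s
        l₂ = solve-∀ ring
      smaller : ∀ (G′ : Graph n) → e₂ G ≡ e₂ G′ + ((1ℚ + 1ℚ) + (1ℚ + 1ℚ) + ((1ℚ + 1ℚ) + (1ℚ + 1ℚ))) → e₂ G′ ≤ ι fuel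
      smaller G′ dec = ≤-by ((1ℚ + (1ℚ + 1ℚ) + ((1ℚ + 1ℚ) + (1ℚ + 1ℚ))) + (ι (suc fuel) - e₂ G)) (+-nn 0≤7 (diff≥0 bound)) (trans (l (ι fuel) (e₂ G′)) (cong₂ (λ u v → e₂ G′ + ((1ℚ + (1ℚ + 1ℚ) + ((1ℚ + 1ℚ) + (1ℚ + 1ℚ))) + (u - v))) (sym (ι-suc fuel)) (sym dec)))
        where
        l : ∀ f e → f ≡ e + ((1ℚ + (1ℚ + 1ℚ) + ((1ℚ + 1ℚ) + (1ℚ + 1ℚ))) + (1ℚ + f - (e + ((1ℚ + 1ℚ) + (1ℚ + 1ℚ) + ((1ℚ + 1ℚ) + (1ℚ + 1ℚ))))))
        l = solve-∀ ring
      removed : ∃[ G′ ] ((∀ {k} → Cost (adj G′) k → Cost (adj G) (2 ℕ.+ k)) × e₂ G ≡ e₂ G′ + ((1ℚ + 1ℚ) + (1ℚ + 1ℚ) + ((1ℚ + 1ℚ) + (1ℚ + 1ℚ)))) → Halved s G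
      removed (G′ , lift , dec) = continue G′ lift dec (cost-half s 0≤s large fuel G′ (smaller G′ dec))
      dense : s ≤ e₂ G → FourCycle G ⊎ ¬ FourCycle G → Halved s G
      dense s≤e (inj₁ C) = removed (remove-four G C)
      dense s≤e (inj₂ ¬C) = ⊥-elim (ℚ.<-irrefl refl (ℚ.<-≤-trans large (ℚ.≤-trans (*-mono 0≤s (ℚ.≤-trans 0≤s s≤e) s≤e s≤e) (few-edges G ¬C))))
      choose : e₂ G ≤ s ⊎ s ≤ e₂ G → Halved s G
      choose (inj₁ e≤s) = sparse-halved s (suc fuel) G bound e≤s
      choose (inj₂ s≤e) = dense s≤e (four-cycle? G)

-- Truncating the degrees of a hypergraph.

module Truncation where
  open import Data.Rational.Base using (ℚ; 0ℚ; 1ℚ; _+_; _*_; _-_; -_; _≤_)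
  open FiniteSums
  open Inversions
  open FourCycles
  open RandomStates
  open NibbleStep
  open Packing

  record Tournament (n : ℕ) : Set where
    field
      arc : Fin n → Fin n → Bool
      arc-irr : ∀ i → arc i i ≡ false
      arc-flip : ∀ i j → (i == j) ≡ false → arc j i ≡ not (arc i j)
  open Tournament public

  abstract
    pos⁺ : ℚ → ℚ
    pos⁺ x with ℚ.≤-total 0ℚ x
    ... | inj₁ _ = x
    ... | inj₂ _ = 0ℚ

    pos⁺-nn : ∀ x → 0ℚ ≤ pos⁺ x
    pos⁺-nn x with ℚ.≤-total 0ℚ x
    ... | inj₁ p = p
    ... | inj₂ _ = ℚ.≤-refl

    ≤pos⁺ : ∀ x → x ≤ pos⁺ x
    ≤pos⁺ x with ℚ.≤-total 0ℚ x
    ... | inj₁ p = ℚ.≤-refl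
    ... | inj₂ p = p

    pos⁺-least : ∀ {x v} → x ≤ v → 0ℚ ≤ v → pos⁺ x ≤ v
    pos⁺-least {x} p q with ℚ.≤-total 0ℚ x
    ... | inj₁ _ = p
    ... | inj₂ _ = q

    pos⁺-scale : ∀ c {x v} → 0ℚ ≤ c → c * x ≤ v → 0ℚ ≤ v → c * pos⁺ x ≤ v
    pos⁺-scale c {x} 0≤c p q with ℚ.≤-total 0ℚ x
    ... | inj₁ _ = p
    ... | inj₂ _ = ℚ.≤-trans (ℚ.≤-reflexive (ℚ.*-zeroʳ c)) q

  pos⁺-mono : ∀ {x y} → x ≤ y → pos⁺ x ≤ pos⁺ y
  pos⁺-mono {x} {y} p = pos⁺-least (ℚ.≤-trans p (≤pos⁺ y)) (pos⁺-nn y)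

  module _ {A : Set} where

    sumL : (A → ℚ) → List A → ℚ
    sumL f [] = 0ℚ
    sumL f (x ∷ xs) = f x + sumL f xs

    sumL-++ : ∀ f xs ys → sumL f (xs ++ ys) ≡ sumL f xs + sumL f ys
    sumL-++ f [] ys = sym (ℚ.+-identityˡ (sumL f ys))
    sumL-++ f (x ∷ xs) ys = trans (cong (f x +_) (sumL-++ f xs ys)) (sym (ℚ.+-assoc (f x) (sumL f xs) (sumL f ys)))

    gather : ∀ {n} → (Fin n → List A) → List A
    gather {zero} f = []
    gather {suc n} f = f zero ++ gather (f ∘ suc)

    sumL-gather : ∀ {n} f (xs : Fin n → List A) → sumL f (gather xs) ≡ Σ (λ i → sumL f (xs i))
    sumL-gather {zero} f xs = refl
    sumL-gather {suc n} f xs = trans (sumL-++ f (xs zero) _) (cong (sumL f (xs zero) +_) (sumL-gather f (xs ∘ suc)))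

    gather-All : ∀ {n} {P : A → Set} (xs : Fin n → List A) → (∀ i → All P (xs i)) → All P (gather xs)
    gather-All {zero} xs p = []
    gather-All {suc n} xs p = ++⁺ (p zero) (gather-All (xs ∘ suc) (p ∘ suc))

  Σ-split : ∀ m {k} (f : Fin (m ℕ.+ k) → ℚ) → Σ f ≡ Σ (λ i → f (i ↑ˡ k)) + Σ (λ j → f (m ↑ʳ j))
  Σ-split zero f = sym (ℚ.+-identityˡ (Σ f))
  Σ-split (suc m) {k} f = trans (cong (f zero +_) (Σ-split m (f ∘ suc))) (sym (ℚ.+-assoc (f zero) (Σ (λ i → f (suc i ↑ˡ k))) (Σ (λ j → f (suc (m ↑ʳ j))))))

  Σ-combine : ∀ m {k} (f : Fin (m ℕ.* k) → ℚ) → Σ f ≡ Σ (λ i → Σ (λ j → f (combine {m} {k} i j)))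
  Σ-combine zero f = refl
  Σ-combine (suc m) {k} f = trans (Σ-split k {m ℕ.* k} f) (cong (Σ {k} (λ j → f (j ↑ˡ (m ℕ.* k))) +_) (Σ-combine m {k} (λ e → f (k ↑ʳ e))))

  module _ {M : ℕ} where
    private
      Tr : Set
      Tr = Triple {M}

    deg-sumL : ∀ (H : List Tr) e → deg H e ≡ sumL (λ t → [ t ∋ e ]) H
    deg-sumL [] e = refl
    deg-sumL (t ∷ H) e = cong ([ t ∋ e ] +_) (deg-sumL H e)

    later-sumL : ∀ (H : List Tr) S → later H S ≡ sumL (λ t → pairs t S) H
    later-sumL [] S = refl
    later-sumL (t ∷ H) S = cong (pairs t S +_) (later-sumL H S)

    length-sumL : ∀ (H : List Tr) → ι (length H) ≡ sumL (λ _ → 1ℚ) H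
    length-sumL [] = ι-zero
    length-sumL (t ∷ H) = trans (ι-suc (length H)) (cong (1ℚ +_) (length-sumL H))

    record Truncated (H : List Tr) (D : ℚ) (P : Tr → Set) : Set where
      field
        kept : List Tr
        kept-P : All P kept
        kept-deg : ∀ e → deg kept e ≤ D + 1ℚ
        kept-later : ∀ S → later kept S ≤ later H S
        kept-sub : ∀ e → deg kept e ≤ deg H e
        kept-size : ι (length H) ≤ ι (length kept) + Σ (λ e → pos⁺ (deg H e - D))

    -- A triple is dropped if one of its edges already has kept degree at least `D`. The drop is
    -- charged to that edge: its full degree is at least `D` as well, so the new triple raises its
    -- excess by one.
    truncate-degrees : ∀ D {P : Tr → Set} → 0ℚ ≤ D → (H : List Tr) → All P H → Truncated H D P
    truncate-degrees D 0≤D [] [] = record { kept = [] ; kept-P = [] ; kept-deg = λ e → +-nn 0≤D 0≤1 ; kept-later = λ S → ℚ.≤-refl ; kept-sub = λ e → ℚ.≤-refl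
      ; kept-size = ≤-by (Σ {M} (λ e → pos⁺ (0ℚ - D))) (Σ-nn {M} (λ e → pos⁺-nn (0ℚ - D))) refl }
    truncate-degrees D {P} 0≤D (t ∷ H) (p ∷ ps) = choose (FP.any? (λ e → over? e))
      where
      rec : Truncated H D P
      rec = truncate-degrees D 0≤D H ps
      open Truncated rec
      Over : Fin M → Set
      Over e = (t ∋ e ≡ true) × D ≤ deg kept e
      open import Relation.Nullary.Decidable using (_×-dec_)
      over? : ∀ e → Dec (Over e)
      over? e = (t ∋ e 𝔹.≟ true) ×-dec (D ℚ.≤? deg kept e)
      excess-mono : ∀ e → pos⁺ (deg H e - D) ≤ pos⁺ (deg (t ∷ H) e - D)
      excess-mono e = pos⁺-mono {deg H e - D} {deg (t ∷ H) e - D} (ℚ.+-monoˡ-≤ (- D) (≤-by {deg H e} {deg (t ∷ H) e} [ t ∋ e ] ([]-nn (t ∋ e)) (ℚ.+-comm [ t ∋ e ] (deg H e))))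
      choose : Dec (∃[ e ] Over e) → Truncated (t ∷ H) D P
      choose (yes (e , te , D≤)) = record { kept = kept ; kept-P = kept-P ; kept-deg = kept-deg
        ; kept-later = λ S → ℚ.≤-trans (kept-later S) (≤-by (pairs t S) (pairs-nn t S) (ℚ.+-comm (pairs t S) (later H S)))
        ; kept-sub = λ f → ℚ.≤-trans (kept-sub f) (≤-by [ t ∋ f ] ([]-nn (t ∋ f)) (ℚ.+-comm [ t ∋ f ] (deg H f)))
        ; kept-size = begin
            ι (suc (length H)) ≡⟨ ι-suc (length H) ⟩
            1ℚ + ι (length H) ≤⟨ ℚ.+-monoʳ-≤ 1ℚ kept-size ⟩
            1ℚ + (ι (length kept) + Σ (λ f → pos⁺ (deg H f - D))) ≡⟨ l (ι (length kept)) (Σ (λ f → pos⁺ (deg H f - D))) ⟩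
            ι (length kept) + (Σ (λ f → pos⁺ (deg H f - D)) + 1ℚ) ≤⟨ ℚ.+-monoʳ-≤ (ι (length kept)) grow ⟩
            ι (length kept) + Σ (λ f → pos⁺ (deg (t ∷ H) f - D)) ∎ }
        where
        open ℚ.≤-Reasoning
        l : ∀ a b → 1ℚ + (a + b) ≡ a + (b + 1ℚ)
        l = solve-∀ ring
        at-e : pos⁺ (deg H e - D) + 1ℚ ≤ pos⁺ (deg (t ∷ H) e - D)
        at-e = ℚ.≤-trans (ℚ.+-monoˡ-≤ 1ℚ (pos⁺-least ℚ.≤-refl (diff≥0 (ℚ.≤-trans D≤ (kept-sub e))))) (ℚ.≤-trans (ℚ.≤-reflexive (trans (l₂ (deg H e) D) (cong (λ b → [ b ] + deg H e - D) (sym te)))) (≤pos⁺ (deg (t ∷ H) e - D)))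
          where
          l₂ : ∀ d D → d - D + 1ℚ ≡ 1ℚ + d - D
          l₂ = solve-∀ ring
        pointwise : ∀ f → pos⁺ (deg H f - D) + [ f == e ] * 1ℚ ≤ pos⁺ (deg (t ∷ H) f - D)
        pointwise f with f == e in fe
        ... | true rewrite ==⇒≡ f e fe = at-e
        ... | false = ℚ.≤-trans (ℚ.≤-reflexive (ℚ.+-identityʳ (pos⁺ (deg H f - D)))) (excess-mono f)
        grow : Σ (λ f → pos⁺ (deg H f - D)) + 1ℚ ≤ Σ (λ f → pos⁺ (deg (t ∷ H) f - D))
        grow = ℚ.≤-trans (ℚ.≤-reflexive (sym (trans (Σ-+ (λ f → pos⁺ (deg H f - D)) (λ f → [ f == e ] * 1ℚ)) (cong (Σ (λ f → pos⁺ (deg H f - D)) +_) (Σ-δ e (λ _ → 1ℚ)))))) (Σ-mono pointwise)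
      choose (no ¬over) = record { kept = t ∷ kept ; kept-P = p ∷ kept-P ; kept-deg = room
        ; kept-later = λ S → ℚ.+-monoʳ-≤ (pairs t S) (kept-later S)
        ; kept-sub = λ e → ℚ.+-monoʳ-≤ [ t ∋ e ] (kept-sub e)
        ; kept-size = begin
            ι (suc (length H)) ≡⟨ ι-suc (length H) ⟩
            1ℚ + ι (length H) ≤⟨ ℚ.+-monoʳ-≤ 1ℚ (ℚ.≤-trans kept-size (ℚ.+-monoʳ-≤ (ι (length kept)) (Σ-mono excess-mono))) ⟩
            1ℚ + (ι (length kept) + Σ (λ f → pos⁺ (deg (t ∷ H) f - D))) ≡⟨ sym (ℚ.+-assoc 1ℚ (ι (length kept)) (Σ (λ f → pos⁺ (deg (t ∷ H) f - D)))) ⟩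
            1ℚ + ι (length kept) + Σ (λ f → pos⁺ (deg (t ∷ H) f - D)) ≡⟨ cong (_+ Σ (λ f → pos⁺ (deg (t ∷ H) f - D))) (sym (ι-suc (length kept))) ⟩
            ι (suc (length kept)) + Σ (λ f → pos⁺ (deg (t ∷ H) f - D)) ∎ }
        where
        open ℚ.≤-Reasoning
        room : ∀ e → [ t ∋ e ] + deg kept e ≤ D + 1ℚ
        room e with t ∋ e in te
        ... | false = ℚ.≤-trans (ℚ.≤-reflexive (ℚ.+-identityˡ (deg kept e))) (kept-deg e)
        ... | true with ℚ.≤-total D (deg kept e)
        ...   | inj₁ q = ⊥-elim (¬over (e , te , q))
        ...   | inj₂ q = ℚ.≤-trans (ℚ.≤-reflexive (ℚ.+-comm 1ℚ (deg kept e))) (ℚ.+-monoˡ-≤ 1ℚ q)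

-- The hypergraph of backward transitive triangles.

module BackwardTriangles where
  open import Data.Bool.Base using (T)
  open import Data.Rational.Base using (ℚ; 0ℚ; 1ℚ; _+_; _*_; _≤_; _<_)
  open FiniteSums
  open Inversions
  open FourCycles
  open RandomStates
  open NibbleStep
  open OnePass using (size)
  open Packing
  open Truncation

  Σ₃ : ∀ {n} → (Fin n → Fin n → Fin n → ℚ) → ℚ
  Σ₃ f = Σ (λ x → Σ (λ y → Σ (λ z → f x y z)))

  module _ {n : ℕ} where

    Σ₃-mono : ∀ {f g : Fin n → Fin n → Fin n → ℚ} → (∀ x y z → f x y z ≤ g x y z) → Σ₃ f ≤ Σ₃ g
    Σ₃-mono p = Σ-mono (λ x → Σ-mono (λ y → Σ-mono (λ z → p x y z)))

    Σ₃-cong : ∀ {f g : Fin n → Fin n → Fin n → ℚ} → (∀ x y z → f x y z ≡ g x y z) → Σ₃ f ≡ Σ₃ g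
    Σ₃-cong p = Σ-cong (λ x → Σ-cong (λ y → Σ-cong (λ z → p x y z)))

    Σ₃-+ : ∀ (f g : Fin n → Fin n → Fin n → ℚ) → Σ₃ (λ x y z → f x y z + g x y z) ≡ Σ₃ f + Σ₃ g
    Σ₃-+ f g = trans (Σ-cong (λ x → trans (Σ-cong (λ y → Σ-+ (f x y) (g x y))) (Σ-+ (λ y → Σ (f x y)) (λ y → Σ (g x y))))) (Σ-+ (λ x → Σ (λ y → Σ (f x y))) (λ x → Σ (λ y → Σ (g x y))))

    -- All ordered pairs are vertices of the hypergraph; those that are not arcs have degree zero.
    code : Fin n → Fin n → Fin (n ℕ.* n)
    code a b = combine a b

    code-== : ∀ a b x y → (code a b == code x y) ≡ (a == x) ∧ (b == y)
    code-== a b x y with a == x in ax | b == y in by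
    ... | true | true rewrite ==⇒≡ a x ax | ==⇒≡ b y by = ==-refl (code x y)
    ... | false | _ = ≢⇒== (λ e → true≢false (trans (cong (_== x) (FP.combine-injectiveˡ a b x y e)) (==-refl x)) ax)
    ... | true | false = ≢⇒== (λ e → true≢false (trans (cong (_== y) (FP.combine-injectiveʳ a b x y e)) (==-refl y)) by)

    -- `pos` is the linear order and `key` a coarsening of it with possible ties. Triangles must
    -- descend strictly in `key`, so that their number depends on the keys alone.
    module Ordered (Tn : Tournament n) (key pos : Fin n → ℕ) (pos-inj : ∀ i j → pos i ≡ pos j → i ≡ j)
      (pos-key : ∀ i j → key i ℕ.< key j → pos i ℕ.< pos j) where

      before : Fin n → Fin n → Bool
      before i j = pos i <ᵇ pos j

      back : Fin n → Fin n → Bool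
      back i j = (arc Tn i j ∧ before j i) ∨ (arc Tn j i ∧ before i j)

      B : Graph n
      B = graph back (λ i j → 𝔹.∨-comm (arc Tn i j ∧ before j i) (arc Tn j i ∧ before i j)) irreflexive
        where
        irreflexive : ∀ i → back i i ≡ false
        irreflexive i rewrite arc-irr Tn i = refl

      arc≢ : ∀ i j → arc Tn i j ≡ true → (i == j) ≡ false
      arc≢ i j p with i == j in eq
      ... | false = refl
      ... | true = true≢false p (trans (cong (arc Tn i) (sym (==⇒≡ i j eq))) (arc-irr Tn i))

      arc-asym : ∀ i j → arc Tn i j ≡ true → arc Tn j i ≡ false
      arc-asym i j p = trans (arc-flip Tn i j (arc≢ i j p)) (cong not p)

      feedback : ℚ
      feedback = Σ (λ i → Σ (λ j → [ arc Tn i j ] * [ before j i ]))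

      e₂-back : e₂ B ≡ (1ℚ + 1ℚ) * feedback
      e₂-back = begin
        Σ (λ i → Σ (λ j → [ back i j ])) ≡⟨ Σ-cong (λ i → trans (Σ-cong (λ j → point i j)) (Σ-+ (λ j → [ arc Tn i j ] * [ before j i ]) (λ j → [ arc Tn j i ] * [ before i j ]))) ⟩
        Σ (λ i → Σ (λ j → [ arc Tn i j ] * [ before j i ]) + Σ (λ j → [ arc Tn j i ] * [ before i j ])) ≡⟨ Σ-+ (λ i → Σ (λ j → [ arc Tn i j ] * [ before j i ])) (λ i → Σ (λ j → [ arc Tn j i ] * [ before i j ])) ⟩
        feedback + Σ (λ i → Σ (λ j → [ arc Tn j i ] * [ before i j ])) ≡⟨ cong (feedback +_) (Σ-swap (λ i j → [ arc Tn j i ] * [ before i j ])) ⟩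
        feedback + feedback ≡⟨ l feedback ⟩
        (1ℚ + 1ℚ) * feedback ∎
        where
        open ≡-Reasoning
        l : ∀ f → f + f ≡ (1ℚ + 1ℚ) * f
        l = solve-∀ ring
        disjoint : ∀ u v p q → (u ≡ true → v ≡ false) → [ (u ∧ p) ∨ (v ∧ q) ] ≡ [ u ] * [ p ] + [ v ] * [ q ]
        disjoint true true p q d = true≢false refl (d refl)
        disjoint true false true q d = cong (λ z → 1ℚ * 1ℚ + z) (sym (ℚ.*-zeroˡ [ q ]))
        disjoint true false false q d = cong (λ z → 1ℚ * 0ℚ + z) (sym (ℚ.*-zeroˡ [ q ]))
        disjoint false true p true d = cong (λ z → z + 1ℚ * 1ℚ) (sym (ℚ.*-zeroˡ [ p ]))
        disjoint false true p false d = cong (λ z → z + 1ℚ * 0ℚ) (sym (ℚ.*-zeroˡ [ p ]))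
        disjoint false false p q d = sym (cong₂ _+_ (ℚ.*-zeroˡ [ p ]) (ℚ.*-zeroˡ [ q ]))
        point : ∀ i j → [ back i j ] ≡ [ arc Tn i j ] * [ before j i ] + [ arc Tn j i ] * [ before i j ]
        point i j = disjoint (arc Tn i j) (arc Tn j i) (before j i) (before i j) (arc-asym i j)

      cond : Fin n → Fin n → Fin n → Bool
      cond x y z = arc Tn x y ∧ (arc Tn y z ∧ (arc Tn x z ∧ ((key z <ᵇ key y) ∧ (key y <ᵇ key x))))

      record Triangle (x y z : Fin n) : Set where
        field
          xy : arc Tn x y ≡ true
          yz : arc Tn y z ≡ true
          xz : arc Tn x z ≡ true
          zy : before z y ≡ true
          yx : before y x ≡ true
          zx : before z x ≡ true

      cond⇒ : ∀ x y z → cond x y z ≡ true → Triangle x y z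
      cond⇒ x y z p with arc Tn x y in xy | arc Tn y z in yz | arc Tn x z in xz | key z <ᵇ key y in zy | key y <ᵇ key x in yx
      ... | true | true | true | true | true = record { xy = xy ; yz = yz ; xz = xz ; zy = bf z<y ; yx = bf y<x ; zx = bf (ℕP.<-trans z<y y<x) }
        where
        z<y : key z ℕ.< key y
        z<y = ℕP.<ᵇ⇒< (key z) (key y) (subst T (sym zy) tt)
        y<x : key y ℕ.< key x
        y<x = ℕP.<ᵇ⇒< (key y) (key x) (subst T (sym yx) tt)
        bf : ∀ {i j} → key i ℕ.< key j → before i j ≡ true
        bf {i} {j} lt with pos i <ᵇ pos j in eq
        ... | true = refl
        ... | false = ⊥-elim (subst T eq (ℕP.<⇒<ᵇ (pos-key i j lt)))

      Tr : Set
      Tr = Triple {n ℕ.* n}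

      record IsTri (t : Tr) : Set where
        field
          x y z : Fin n
          tri : Triangle x y z
          a≡ : Triple.a t ≡ code x y
          b≡ : Triple.b t ≡ code y z
          c≡ : Triple.c t ≡ code x z

      module _ (x y z : Fin n) where

        tri-of : Triangle x y z → Tr
        tri-of t = triple (code x y) (code y z) (code x z)
            (trans (code-== x y y z) (cong (_∧ (y == z)) (arc≢ x y xy)))
            (trans (code-== x y x z) (trans (cong ((x == x) ∧_) (arc≢ y z yz)) (𝔹.∧-zeroʳ (x == x))))
            (trans (code-== y z x z) (cong (_∧ (z == z)) (trans (==-sym y x) (arc≢ x y xy))))
          where open Triangle t

        mk′ : (v : Bool) → cond x y z ≡ v → List Tr
        mk′ true eq = tri-of (cond⇒ x y z eq) ∷ []
        mk′ false eq = []

        mk : List Tr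
        mk = mk′ (cond x y z) refl

        sumL-mk : ∀ (f : Tr → ℚ) F → (∀ t → f (tri-of t) ≡ F) → sumL f mk ≡ [ cond x y z ] * F
        sumL-mk f F p = go (cond x y z) refl
          where
          go : ∀ v (eq : cond x y z ≡ v) → sumL f (mk′ v eq) ≡ [ v ] * F
          go true eq = trans (ℚ.+-identityʳ _) (trans (p (cond⇒ x y z eq)) (sym (ℚ.*-identityˡ F)))
          go false eq = sym (ℚ.*-zeroˡ F)

        mk-All : All IsTri mk
        mk-All = go (cond x y z) refl
          where
          go : ∀ v (eq : cond x y z ≡ v) → All IsTri (mk′ v eq)
          go true eq = record { x = x ; y = y ; z = z ; tri = cond⇒ x y z eq ; a≡ = refl ; b≡ = refl ; c≡ = refl } ∷ []
          go false eq = []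

      H : List Tr
      H = gather (λ x → gather (λ y → gather (λ z → mk x y z)))

      H-All : All IsTri H
      H-All = gather-All _ (λ x → gather-All _ (λ y → gather-All _ (λ z → mk-All x y z)))

      sumL-H : ∀ (f : Tr → ℚ) (F : Fin n → Fin n → Fin n → ℚ) → (∀ x y z t → f (tri-of x y z t) ≡ F x y z) → sumL f H ≡ Σ₃ (λ x y z → [ cond x y z ] * F x y z)
      sumL-H f F p = trans (sumL-gather f (λ x → gather (λ y → gather (λ z → mk x y z)))) (Σ-cong (λ x → trans (sumL-gather f (λ y → gather (λ z → mk x y z)))
        (Σ-cong (λ y → trans (sumL-gather f (λ z → mk x y z)) (Σ-cong (λ z → sumL-mk x y z f (F x y z) (p x y z)))))))

      H-size : ι (length H) ≡ Σ₃ (λ x y z → [ cond x y z ])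
      H-size = trans (length-sumL H) (trans (sumL-H (λ _ → 1ℚ) (λ _ _ _ → 1ℚ) (λ _ _ _ _ → refl)) (Σ₃-cong (λ x y z → ℚ.*-identityʳ [ cond x y z ])))

      -- The triangles on a → b by the role of this arc: first step, second step, or the long arc.
      codeg : Fin n → Fin n → ℚ
      codeg a b = Σ (λ w → [ cond a b w ]) + (Σ (λ w → [ cond w a b ]) + Σ (λ w → [ cond a w b ]))

      H-deg : ∀ a b → deg H (code a b) ≤ codeg a b
      H-deg a b = begin
        deg H (code a b) ≡⟨ trans (deg-sumL H (code a b)) (sumL-H _ (λ x y z → [ hit x y z ]) (λ x y z t → refl)) ⟩
        Σ₃ (λ x y z → [ cond x y z ] * [ hit x y z ]) ≤⟨ Σ₃-mono (λ x y z → ℚ.≤-trans (*-monoˡ [ cond x y z ] ([]-nn (cond x y z)) (union x y z)) (ℚ.≤-reflexive (l [ cond x y z ] [ x == a ] [ y == b ] [ y == a ] [ z == b ]))) ⟩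
        Σ₃ (λ x y z → t₁ x y z + (t₂ x y z + t₃ x y z)) ≡⟨ trans (Σ₃-+ t₁ (λ x y z → t₂ x y z + t₃ x y z)) (cong (Σ₃ t₁ +_) (Σ₃-+ t₂ t₃)) ⟩
        Σ₃ t₁ + (Σ₃ t₂ + Σ₃ t₃) ≡⟨ cong₂ _+_ s₁ (cong₂ _+_ s₂ s₃) ⟩
        codeg a b ∎
        where
        open ℚ.≤-Reasoning
        hit : Fin n → Fin n → Fin n → Bool
        hit x y z = (code a b == code x y) ∨ ((code a b == code y z) ∨ (code a b == code x z))
        t₁ t₂ t₃ : Fin n → Fin n → Fin n → ℚ
        t₁ x y z = [ x == a ] * ([ y == b ] * [ cond x y z ])
        t₂ x y z = [ y == a ] * ([ z == b ] * [ cond x y z ])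
        t₃ x y z = [ x == a ] * ([ z == b ] * [ cond x y z ])
        l : ∀ c xa yb ya zb → c * (xa * yb + (ya * zb + xa * zb)) ≡ xa * (yb * c) + (ya * (zb * c) + xa * (zb * c))
        l = solve-∀ ring
        or≤ : ∀ u v → [ u ∨ v ] ≤ [ u ] + [ v ]
        or≤ true v = ≤-by [ v ] ([]-nn v) refl
        or≤ false v = ℚ.≤-reflexive (sym (ℚ.+-identityˡ [ v ]))
        pair : ∀ x y → [ code a b == code x y ] ≡ [ x == a ] * [ y == b ]
        pair x y = trans (cong [_] (trans (code-== a b x y) (cong₂ _∧_ (==-sym a x) (==-sym b y)))) ([∧] (x == a) (y == b))
        union : ∀ x y z → [ hit x y z ] ≤ [ x == a ] * [ y == b ] + ([ y == a ] * [ z == b ] + [ x == a ] * [ z == b ])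
        union x y z = ℚ.≤-trans (or≤ (code a b == code x y) _) (ℚ.≤-trans (ℚ.+-monoʳ-≤ [ code a b == code x y ] (or≤ (code a b == code y z) (code a b == code x z)))
          (ℚ.≤-reflexive (cong₂ _+_ (pair x y) (cong₂ _+_ (pair y z) (pair x z)))))
        pull : ∀ u (f : Fin n → ℚ) → Σ (λ z → u * f z) ≡ u * Σ f
        pull = Σ-*ˡ
        s₁ : Σ₃ t₁ ≡ Σ (λ w → [ cond a b w ])
        s₁ = trans (Σ-cong (λ x → trans (Σ-cong (λ y → trans (pull [ x == a ] (λ z → [ y == b ] * [ cond x y z ])) (cong ([ x == a ] *_) (pull [ y == b ] (λ z → [ cond x y z ])))))
               (trans (pull [ x == a ] (λ y → [ y == b ] * Σ (λ z → [ cond x y z ]))) (cong ([ x == a ] *_) (Σ-δ b (λ y → Σ (λ z → [ cond x y z ]))))))) (Σ-δ a (λ x → Σ (λ z → [ cond x b z ])))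
        s₂ : Σ₃ t₂ ≡ Σ (λ w → [ cond w a b ])
        s₂ = Σ-cong (λ x → trans (Σ-cong (λ y → trans (pull [ y == a ] (λ z → [ z == b ] * [ cond x y z ])) (cong ([ y == a ] *_) (Σ-δ b (λ z → [ cond x y z ]))))) (Σ-δ a (λ y → [ cond x y b ])))
        s₃ : Σ₃ t₃ ≡ Σ (λ w → [ cond a w b ])
        s₃ = trans (Σ-cong (λ x → trans (Σ-cong (λ y → trans (pull [ x == a ] (λ z → [ z == b ] * [ cond x y z ])) (cong ([ x == a ] *_) (Σ-δ b (λ z → [ cond x y z ])))))
               (pull [ x == a ] (λ y → [ cond x y b ])))) (Σ-δ a (λ x → Σ (λ y → [ cond x y b ])))

      -- Two arcs of a triangle determine it. There are three ways to single out two of its arcs,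
      -- and for each of them at most |S|² pairs inside `S`.
      H-later : ∀ S → later H S ≤ (1ℚ + 1ℚ + 1ℚ) * (size S * size S)
      H-later S = begin
        later H S ≡⟨ trans (later-sumL H S) (sumL-H _ F (λ x y z t → refl)) ⟩
        Σ₃ (λ x y z → [ cond x y z ] * F x y z) ≤⟨ Σ₃-mono (λ x y z → ℚ.≤-trans (*-monoʳ (F x y z) (F-nn x y z) ([]≤1 (cond x y z))) (ℚ.≤-reflexive (ℚ.*-identityˡ (F x y z)))) ⟩
        Σ₃ F ≡⟨ trans (Σ₃-+ (λ x y z → s x y * s y z + s x y * s x z) (λ x y z → s y z * s x z)) (cong (_+ Σ₃ (λ x y z → s y z * s x z)) (Σ₃-+ (λ x y z → s x y * s y z) (λ x y z → s x y * s x z))) ⟩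
        Σ₃ (λ x y z → s x y * s y z) + Σ₃ (λ x y z → s x y * s x z) + Σ₃ (λ x y z → s y z * s x z) ≤⟨ ℚ.+-mono-≤ (ℚ.+-mono-≤ b₁ b₂) b₃ ⟩
        size S * size S + size S * size S + size S * size S ≡⟨ l (size S * size S) ⟩
        (1ℚ + 1ℚ + 1ℚ) * (size S * size S) ∎
        where
        open ℚ.≤-Reasoning
        l : ∀ q → q + q + q ≡ (1ℚ + 1ℚ + 1ℚ) * q
        l = solve-∀ ring
        s : Fin n → Fin n → ℚ
        s a b = [ S (code a b) ]
        s-nn : ∀ a b → 0ℚ ≤ s a b
        s-nn a b = []-nn (S (code a b))
        F : Fin n → Fin n → Fin n → ℚ
        F x y z = s x y * s y z + s x y * s x z + s y z * s x z
        F-nn : ∀ x y z → 0ℚ ≤ F x y z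
        F-nn x y z = +-nn (+-nn (*-nn (s-nn x y) (s-nn y z)) (*-nn (s-nn x y) (s-nn x z))) (*-nn (s-nn y z) (s-nn x z))
        total : size S ≡ Σ (λ a → Σ (s a))
        total = Σ-combine n (λ e → [ S e ])
        row : ∀ a → Σ (s a) ≤ size S
        row a = ℚ.≤-trans (Σ-term {f = λ a → Σ (s a)} (λ a → Σ-nn (s-nn a)) a) (ℚ.≤-reflexive (sym total))
        column : ∀ b → Σ (λ a → s a b) ≤ size S
        column b = ℚ.≤-trans (Σ-mono (λ a → Σ-term {f = s a} (s-nn a) b)) (ℚ.≤-reflexive (sym total))
        weighted : ∀ (g : Fin n → Fin n → ℚ) → (∀ x y → g x y ≤ size S) → Σ (λ x → Σ (λ y → s x y * g x y)) ≤ size S * size S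
        weighted g g≤ = ℚ.≤-trans (Σ-mono (λ x → Σ-mono (λ y → *-monoˡ (s x y) (s-nn x y) (g≤ x y))))
          (ℚ.≤-reflexive (trans (Σ-cong (λ x → Σ-*ʳ (size S) (s x))) (trans (Σ-*ʳ (size S) (λ x → Σ (s x))) (cong (_* size S) (sym total)))))
        b₁ : Σ₃ (λ x y z → s x y * s y z) ≤ size S * size S
        b₁ = ℚ.≤-trans (ℚ.≤-reflexive (Σ-cong (λ x → Σ-cong (λ y → Σ-*ˡ (s x y) (s y))))) (weighted (λ x y → Σ (s y)) (λ x y → row y))
        b₂ : Σ₃ (λ x y z → s x y * s x z) ≤ size S * size S
        b₂ = ℚ.≤-trans (ℚ.≤-reflexive (Σ-cong (λ x → Σ-cong (λ y → Σ-*ˡ (s x y) (s x))))) (weighted (λ x y → Σ (s x)) (λ x y → row x))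
        b₃ : Σ₃ (λ x y z → s y z * s x z) ≤ size S * size S
        b₃ = ℚ.≤-trans (ℚ.≤-reflexive (Σ-cong (λ x → trans (Σ-swap (λ y z → s y z * s x z)) (Σ-cong (λ z → trans (Σ-*ʳ (s x z) (λ y → s y z)) (ℚ.*-comm (Σ (λ y → s y z)) (s x z)))))))
          (weighted (λ x z → Σ (λ y → s y z)) (λ x z → column z))

-- From a packing to a decycling set.

module Extraction where
  open import Data.Bool.Base using (T)
  open import Data.Rational.Base using (ℚ; 0ℚ; 1ℚ; _+_; _*_; _-_; -_; _≤_; _<_)
  open FiniteSums
  open Inversions
  open FourCycles
  open RandomStates
  open NibbleStep
  open Packing
  open Truncation
  open BackwardTriangles
  open Subset using (Subset; ∣_∣)

  6ℚ : ℚ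
  6ℚ = (1ℚ + 1ℚ) + ((1ℚ + 1ℚ) + (1ℚ + 1ℚ))

  ∨-false : ∀ u {v} → u ∨ v ≡ false → u ≡ false × v ≡ false
  ∨-false false p = refl , p

  ∧-true : ∀ u {v} → u ∧ v ≡ true → u ≡ true × v ≡ true
  ∧-true true p = refl , p

  module Extract {n : ℕ} (Tn : Tournament n) (key pos : Fin n → ℕ) (pos-inj : ∀ i j → pos i ≡ pos j → i ≡ j)
    (pos-key : ∀ i j → key i ℕ.< key j → pos i ℕ.< pos j) where
    open Ordered Tn key pos pos-inj pos-key

    -- Toggling changes a pair in both directions. Distinct codes exclude the same direction, and
    -- the opposite one is excluded because both pairs are arcs.
    no-edge : ∀ x y a b → arc Tn x y ≡ true → arc Tn a b ≡ true → (code a b == code x y) ≡ false → ed x y a b ≡ false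
    no-edge x y a b xy ab ne with trans (sym (code-== a b x y)) ne
    ... | p rewrite p with a == y in ay | b == x in bx
    ...   | false | _ = refl
    ...   | true | false = refl
    ...   | true | true = true≢false ab (trans (cong₂ (arc Tn) (==⇒≡ a y ay) (==⇒≡ b x bx)) (arc-asym x y xy))

    Rest : (Fin (n ℕ.* n) → Bool) → ℕ → Set
    Rest s k = Σ[ G ∈ Graph n ] ((∀ {l} → Cost (adj G) l → Cost back (k ℕ.+ l)) × e₂ B ≡ e₂ G + ι k * 6ℚ
        × (∀ a b → arc Tn a b ≡ true → s (code a b) ≡ true → back a b ≡ true → adj G a b ≡ true))

    -- Replays the run in the backward graph: a pick removes a triangle and hence 6 from `e₂`, while
    -- backward arcs still alive remain edges, so that the next pick finds its triangle intact.
    rest : ∀ {K s k} → All IsTri K → Reach K s k → Rest s k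
    rest P start = B , (λ C → C) , trans (l (e₂ B)) (cong (λ z → e₂ B + z * 6ℚ) (sym ι-zero)) , λ a b _ _ p → p
      where
      l : ∀ e → e ≡ e + 0ℚ * 6ℚ
      l = solve-∀ ring
    rest {K} P (pick {s} {k} t t∈ fl reach) = continue (rest P reach) (All.lookup P t∈)
      where
      continue : Rest s k → IsTri t → Rest (kill t s) (suc k)
      continue (G , lift , dec , alive) T = G₃ , lift′ , dec′ , alive′
        where
        open IsTri T
        open Triangle tri
        x≢y : (x == y) ≡ false
        x≢y = arc≢ x y xy
        x≢z : (x == z) ≡ false
        x≢z = arc≢ x z xz
        y≢z : (y == z) ≡ false
        y≢z = arc≢ y z yz
        back-of : ∀ u v → arc Tn u v ≡ true → before v u ≡ true → back u v ≡ true
        back-of u v p q rewrite p | q = refl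
        fl₁ = ∧-true (s (Triple.a t)) fl
        fl₂ = ∧-true (s (Triple.b t)) (proj₂ fl₁)
        gxy : adj G x y ≡ true
        gxy = alive x y xy (trans (cong s (sym a≡)) (proj₁ fl₁)) (back-of x y xy yx)
        gyz : adj G y z ≡ true
        gyz = alive y z yz (trans (cong s (sym b≡)) (proj₁ fl₂)) (back-of y z yz zy)
        gxz : adj G x z ≡ true
        gxz = alive x z xz (trans (cong s (sym c≡)) (proj₂ fl₂)) (back-of x z xz zx)
        G₁ G₂ G₃ : Graph n
        G₁ = toggle y z y≢z G
        G₂ = toggle x z x≢z G₁
        G₃ = toggle x y x≢y G₂
        d₁ : e₂ G ≡ e₂ G₁ + (1ℚ + 1ℚ)
        d₁ = toggle-e₂ y z y≢z G gyz
        d₂ : e₂ G₁ ≡ e₂ G₂ + (1ℚ + 1ℚ)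
        d₂ = toggle-e₂ x z x≢z G₁ (trans (other-edge y z (adj G) x z (ed-false₁ y z x z x≢y x≢z)) gxz)
        d₃ : e₂ G₂ ≡ e₂ G₃ + (1ℚ + 1ℚ)
        d₃ = toggle-e₂ x y x≢y G₂ (trans (other-edge x z (adj G₁) x y (ed-false₂ x z x y (trans (==-sym y x) x≢y) y≢z)) (trans (other-edge y z (adj G) x y (ed-false₁ y z x y x≢y x≢z)) gxy))
        lift′ : ∀ {l} → Cost (adj G₃) l → Cost back (suc k ℕ.+ l)
        lift′ {l} C = subst (Cost back) (ℕP.+-suc k l) (lift (cost-triangle x y z x≢y x≢z y≢z C))
        dec′ : e₂ B ≡ e₂ G₃ + ι (suc k) * 6ℚ
        dec′ = trans dec (trans (cong (_+ ι k * 6ℚ) (trans d₁ (trans (cong (_+ (1ℚ + 1ℚ)) (trans d₂ (cong (_+ (1ℚ + 1ℚ)) d₃))) refl))) (trans (l (e₂ G₃) (ι k)) (cong (λ u → e₂ G₃ + u * 6ℚ) (sym (ι-suc k)))))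
          where
          l : ∀ e k → e + (1ℚ + 1ℚ) + (1ℚ + 1ℚ) + (1ℚ + 1ℚ) + k * ((1ℚ + 1ℚ) + ((1ℚ + 1ℚ) + (1ℚ + 1ℚ))) ≡ e + (1ℚ + k) * ((1ℚ + 1ℚ) + ((1ℚ + 1ℚ) + (1ℚ + 1ℚ)))
          l = solve-∀ ring
        alive′ : ∀ a b → arc Tn a b ≡ true → kill t s (code a b) ≡ true → back a b ≡ true → adj G₃ a b ≡ true
        alive′ a b ab ks bk = trans (other-edge x y (adj G₂) a b (no-edge x y a b xy ab (trans (cong (code a b ==_) (sym a≡)) (proj₁ ne₁))))
            (trans (other-edge x z (adj G₁) a b (no-edge x z a b xz ab (trans (cong (code a b ==_) (sym c≡)) (proj₂ ne₂))))
            (trans (other-edge y z (adj G) a b (no-edge y z a b yz ab (trans (cong (code a b ==_) (sym b≡)) (proj₁ ne₂))))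
            (alive a b ab (proj₁ k∧) bk)))
          where
          k∧ = ∧-true (s (code a b)) ks
          not-true : ∀ u → not u ≡ true → u ≡ false
          not-true false p = refl
          ne₁ = ∨-false (code a b == Triple.a t) (not-true (t ∋ code a b) (proj₂ k∧))
          ne₂ = ∨-false (code a b == Triple.b t) (proj₂ ne₁)

    excess : ℚ → ℚ
    excess D = Σ (λ a → Σ (λ b → pos⁺ (codeg a b - D)))

    4ℚ′ : ℚ
    4ℚ′ = 1ℚ + 1ℚ + (1ℚ + 1ℚ)

    e₂-bound : ∀ (G : Graph n) → e₂ G ≤ ι (n ℕ.* n)
    e₂-bound G = ℚ.≤-trans (Σ-upper (ι n) (λ i → ℚ.≤-trans (Σ-upper 1ℚ (λ j → []≤1 (adj G i j))) (ℚ.≤-reflexive (ℚ.*-identityʳ (ι n))))) (ℚ.≤-reflexive (sym (ι-* n n)))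

    -- If k triangles are packed and the rest costs l, then 4 l ≤ `e₂ B` - 6 k + `s`, hence 4 (k +
    -- l) ≤ `e₂ B` - 2 k + `s`. The packing bounds k (`D` + 1) below by (1 - `ρ`)² times the number
    -- of kept triangles, which is the number of all triangles minus at most `excess D`.
    packed-cost : ∀ m′ D₀ → Packs m′ D₀ → ∀ D ρ s → ρ * ι (suc m′) ≡ 1ℚ → 0ℚ ≤ D → ι D₀ ≤ D + 1ℚ → 0ℚ ≤ s → ι n * (ι n * ι n + ι n * ι n) < s * s →
      ∃[ k ] (Cost back k × 4ℚ′ * ι k * (D + 1ℚ) + (1ℚ + 1ℚ) * ((1ℚ - ρ) * (1ℚ - ρ) * Σ₃ (λ x y z → [ cond x y z ])) ≤ (e₂ B + s) * (D + 1ℚ) + (1ℚ + 1ℚ) * ((1ℚ - ρ) * (1ℚ - ρ) * excess D))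
    packed-cost m′ D₀ pk D ρ s ρr 0≤D D₀≤ 0≤s large = finish (pk kept (D + 1ℚ) ρ ρr D₀≤ kept-deg (λ S → ℚ.≤-trans (kept-later S) (H-later S)))
      where
      open Truncated (truncate-degrees D 0≤D H H-All)
      r² : ℚ
      r² = (1ℚ - ρ) * (1ℚ - ρ)
      0≤r² : 0ℚ ≤ r²
      0≤r² = sq-nn (1ℚ - ρ)
      0≤D+1 : 0ℚ ≤ D + 1ℚ
      0≤D+1 = +-nn 0≤D 0≤1
      Z : ℚ
      Z = Σ₃ (λ x y z → [ cond x y z ])
      Z≤ : Z ≤ ι (length kept) + excess D
      Z≤ = ℚ.≤-trans (ℚ.≤-reflexive (sym H-size)) (ℚ.≤-trans kept-size (ℚ.+-monoʳ-≤ (ι (length kept)) (ℚ.≤-trans (ℚ.≤-reflexive (Σ-combine n (λ e → pos⁺ (deg H e - D))))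
          (Σ-mono (λ a → Σ-mono (λ b → pos⁺-mono {deg H (code a b) - D} {codeg a b - D} (ℚ.+-monoˡ-≤ (- D) (H-deg a b))))))))
      Goal : Set
      Goal = ∃[ k ] (Cost back k × 4ℚ′ * ι k * (D + 1ℚ) + (1ℚ + 1ℚ) * (r² * Z) ≤ (e₂ B + s) * (D + 1ℚ) + (1ℚ + 1ℚ) * (r² * excess D))
      finish : Σ[ σ ∈ State kept ] r² * ι (length kept) ≤ ι (State.count σ) * (D + 1ℚ) → Goal
      finish (state al k reach , many) = go (rest kept-P reach)
        where
        go : Rest al k → Goal
        go (G , lift , dec , _) = more (cost-half s 0≤s large (n ℕ.* n) G (e₂-bound G))
          where
          more : Halved s G → Goal
          more (l , C , bound) = k ℕ.+ l , lift C , (begin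
            4ℚ′ * ι (k ℕ.+ l) * (D + 1ℚ) + (1ℚ + 1ℚ) * (r² * Z) ≤⟨ ℚ.+-monoʳ-≤ (4ℚ′ * ι (k ℕ.+ l) * (D + 1ℚ)) (*-monoˡ (1ℚ + 1ℚ) 0≤2 (*-monoˡ r² 0≤r² Z≤)) ⟩
            4ℚ′ * ι (k ℕ.+ l) * (D + 1ℚ) + (1ℚ + 1ℚ) * (r² * (ι (length kept) + excess D)) ≡⟨ cong (λ u → 4ℚ′ * u * (D + 1ℚ) + (1ℚ + 1ℚ) * (r² * (ι (length kept) + excess D))) (ι-+ k l) ⟩
            4ℚ′ * (ι k + ι l) * (D + 1ℚ) + (1ℚ + 1ℚ) * (r² * (ι (length kept) + excess D)) ≡⟨ l₁ (ι k) (ι l) (D + 1ℚ) r² (ι (length kept)) (excess D) ⟩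
            (4ℚ′ * ι k * (D + 1ℚ) + 4ℚ′ * ι l * (D + 1ℚ) + (1ℚ + 1ℚ) * (r² * ι (length kept))) + (1ℚ + 1ℚ) * (r² * excess D) ≤⟨ ℚ.+-monoˡ-≤ ((1ℚ + 1ℚ) * (r² * excess D))
                (ℚ.+-mono-≤ (ℚ.+-monoʳ-≤ (4ℚ′ * ι k * (D + 1ℚ)) (*-monoʳ (D + 1ℚ) 0≤D+1 bound)) (*-monoˡ (1ℚ + 1ℚ) 0≤2 many)) ⟩
            (4ℚ′ * ι k * (D + 1ℚ) + (e₂ G + s) * (D + 1ℚ) + (1ℚ + 1ℚ) * (ι k * (D + 1ℚ))) + (1ℚ + 1ℚ) * (r² * excess D) ≡⟨ cong (_+ (1ℚ + 1ℚ) * (r² * excess D)) (l₂ (1ℚ + 1ℚ) (ι k) (D + 1ℚ) (e₂ G) s) ⟩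
            (e₂ G + ι k * 6ℚ + s) * (D + 1ℚ) + (1ℚ + 1ℚ) * (r² * excess D) ≡⟨ cong (λ u → (u + s) * (D + 1ℚ) + (1ℚ + 1ℚ) * (r² * excess D)) (sym dec) ⟩
            (e₂ B + s) * (D + 1ℚ) + (1ℚ + 1ℚ) * (r² * excess D) ∎)
            where
            open ℚ.≤-Reasoning
            l₁ : ∀ k l d r h x → (1ℚ + 1ℚ + (1ℚ + 1ℚ)) * (k + l) * d + (1ℚ + 1ℚ) * (r * (h + x)) ≡ ((1ℚ + 1ℚ + (1ℚ + 1ℚ)) * k * d + (1ℚ + 1ℚ + (1ℚ + 1ℚ)) * l * d + (1ℚ + 1ℚ) * (r * h)) + (1ℚ + 1ℚ) * (r * x)
            l₁ = solve-∀ ring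
            l₂ : ∀ t k d e s → (t + t) * k * d + (e + s) * d + t * (k * d) ≡ (e + k * (t + (t + t)) + s) * d
            l₂ = solve-∀ ring

    plain-cost : ∀ s → 0ℚ ≤ s → ι n * (ι n * ι n + ι n * ι n) < s * s → ∃[ k ] (Cost back k × 4ℚ′ * ι k ≤ e₂ B + s)
    plain-cost s 0≤s large = cost-half s 0≤s large (n ℕ.* n) B (e₂-bound B)

    -- Between distinct vertices, the parity of the inversions is adjacency in the backward graph.
    -- So backward arcs get reversed, forward arcs stay, and every arc then increases `pos`; this
    -- passes to subgraphs of the tournament.
    decycle : ∀ (A : Digraph n) → Oriented A → (∀ i j → A i j ≡ true → arc Tn i j ≡ true) → ∀ {k} → Cost back k →
      ∃[ Xs ] (length Xs ≡ k × All (λ (X : Subset n) → ∣ X ∣ ℕ.≤ 3) Xs × Acyclic (invertAll Xs A))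
    decycle A orA sub (Xs , len , small , par) = Xs , len , small , acyclic (invertAll Xs A) pos forward
      where
      A≢ : ∀ i j → A i j ≡ true → (i == j) ≡ false
      A≢ i j p = arc≢ i j (sub i j p)
      lt : ∀ i j → before i j ≡ true → pos i ℕ.< pos j
      lt i j p = ℕP.<ᵇ⇒< (pos i) (pos j) (subst T (sym p) tt)
      total : ∀ i j → (i == j) ≡ false → before i j ≡ false → before j i ≡ true
      total i j ij p with pos j <ᵇ pos i in q
      ... | true = refl
      ... | false = true≢false (trans (cong (i ==_) (sym (pos-inj i j (ℕP.≤-antisym (ℕP.≮⇒≥ (λ l → subst T q (ℕP.<⇒<ᵇ l))) (ℕP.≮⇒≥ (λ l → subst T p (ℕP.<⇒<ᵇ l))))))) (==-refl i)) ij
      forward : ∀ i j → invertAll Xs A i j ≡ true → pos i ℕ.< pos j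
      forward i j p with trans (sym (invertAll-parity Xs A i j)) p
      ... | q with parity Xs i j in e
      ...   | false = lt i j ahead
        where
        ij = A≢ i j q
        ahead : before i j ≡ true
        ahead with pos i <ᵇ pos j in b
        ... | true = refl
        ... | false = true≢false bk (trans (sym (par i j ij)) e)
          where
          bk : back i j ≡ true
          bk rewrite sub i j q | total i j ij b = refl
      ...   | true = lt i j ahead
        where
        ji = A≢ j i q
        ij : (i == j) ≡ false
        ij = trans (==-sym i j) ji
        ahead : before i j ≡ true
        ahead with arc Tn i j in a | before i j in b | trans (sym e) (par i j ij)
        ... | true | _ | r = true≢false (sub j i q) (arc-asym i j a)
        ... | false | true | r = refl
        ... | false | false | r = true≢false (sym r) (𝔹.∧-zeroʳ (arc Tn j i))

-- Rounding to the grid with a random shift.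

module HermiteRounding where
  open import Data.Nat.Base using (_∸_; _/_)
  open import Data.Bool.Base using (T)
  open import Data.Rational.Base using (ℚ; 0ℚ; 1ℚ; ½; _+_; _*_; _-_; -_; _≤_; _<_)
  open FiniteSums
  open Truncation using (pos⁺; pos⁺-scale)
  open GridMajorant

  ι-∸ : ∀ m k → k ℕ.≤ m → ι (m ∸ k) ≡ ι m - ι k
  ι-∸ m k k≤m = trans (l (ι (m ∸ k)) (ι k)) (cong (_- ι k) (trans (sym (ι-+ (m ∸ k) k)) (cong ι (ℕP.m∸n+n≡m k≤m))))
    where
    l : ∀ a b → a ≡ a + b - b
    l = solve-∀ ring

  ¼ : ℚ
  ¼ = ½ * ½

  module Rounding (n′ : ℕ) where
    n : ℕ
    n = suc n′

    module _ (g : ℕ → ℚ) where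
      window : ℕ → ℕ → ℚ
      window k x = Σ {k} (λ φ → g (x ℕ.+ toℕ φ))

      window-suc : ∀ k x → window (suc k) x ≡ g x + window k (suc x)
      window-suc k x = cong₂ _+_ (cong g (ℕP.+-identityʳ x)) (Σ-cong {k} (λ φ → cong g (ℕP.+-suc x (toℕ φ))))

      -- Both sides are the window of length `k` + 1 at `x`.
      slide : ∀ k x → window k (suc x) + g x ≡ window k x + g (x ℕ.+ k)
      slide zero x = cong (λ z → 0ℚ + g z) (sym (ℕP.+-identityʳ x))
      slide (suc k) x = begin
        window (suc k) (suc x) + g x ≡⟨ cong (_+ g x) (window-suc k (suc x)) ⟩
        g (suc x) + window k (suc (suc x)) + g x ≡⟨ l (g (suc x)) (window k (suc (suc x))) (g x) ⟩
        g x + (window k (suc (suc x)) + g (suc x)) ≡⟨ cong (g x +_) (slide k (suc x)) ⟩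
        g x + (window k (suc x) + g (suc x ℕ.+ k)) ≡⟨ sym (ℚ.+-assoc (g x) (window k (suc x)) (g (suc x ℕ.+ k))) ⟩
        g x + window k (suc x) + g (suc x ℕ.+ k) ≡⟨ cong₂ _+_ (sym (window-suc k x)) (cong g (sym (ℕP.+-suc x k))) ⟩
        window (suc k) x + g (x ℕ.+ suc k) ∎
        where
        open ≡-Reasoning
        l : ∀ a b c → a + b + c ≡ c + (b + a)
        l = solve-∀ ring

    -- Rounds x/n down after a shift by φ/n, where φ is uniform on 0, ..., n - 1.
    fl : ℕ → ℕ → ℕ
    fl x φ = (x ℕ.+ φ) / n

    /-plus-n : ∀ x → (x ℕ.+ n) / n ≡ suc (x / n)
    /-plus-n x = trans (DM.+-distrib-/-∣ʳ x {n} (divides 1 (sym (ℕP.*-identityˡ n)))) (trans (cong (x / n ℕ.+_) (DM.n/n≡1 n)) (ℕP.+-comm (x / n) 1))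

    -- Hermite's identity: the shifted rounding is exact in the mean. When `x` grows by one, the
    -- window moves by one place, and x/n is replaced by (x + n)/n, whose floor is larger by one.
    hermite : ∀ x → Σ {n} (λ φ → ι (fl x (toℕ φ))) ≡ ι x
    hermite zero = trans (Σ-cong {n} (λ φ → trans (cong ι (DM.m<n⇒m/n≡0 (FP.toℕ<n φ))) ι-zero)) (trans (Σ-zero n) (sym ι-zero))
    hermite (suc x) = begin
      W (suc x) ≡⟨ l (W (suc x)) (g x) ⟩
      W (suc x) + g x - g x ≡⟨ cong (_- g x) (slide g n x) ⟩
      W x + g (x ℕ.+ n) - g x ≡⟨ cong₂ (λ u v → u + v - g x) (hermite x) (trans (cong ι (/-plus-n x)) (ι-suc (x / n))) ⟩
      ι x + (1ℚ + g x) - g x ≡⟨ l₂ (ι x) (g x) ⟩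
      1ℚ + ι x ≡⟨ sym (ι-suc x) ⟩
      ι (suc x) ∎
      where
      open ≡-Reasoning
      g : ℕ → ℚ
      g k = ι (k / n)
      W : ℕ → ℚ
      W = window g n
      l : ∀ a b → a ≡ a + b - b
      l = solve-∀ ring
      l₂ : ∀ a b → a + (1ℚ + b) - b ≡ 1ℚ + a
      l₂ = solve-∀ ring

    fl-mono : ∀ {x x′} φ → x ℕ.≤ x′ → fl x φ ℕ.≤ fl x′ φ
    fl-mono φ p = DM./-monoˡ-≤ n (ℕP.+-monoˡ-≤ φ p)

    floor≤ : ∀ x → n ℕ.* (x / n) ℕ.≤ x
    floor≤ x = ℕP.≤-trans (ℕP.≤-reflexive (ℕP.*-comm n (x / n))) (DM.m/n*n≤m x n)

    floor> : ∀ x → x ℕ.< n ℕ.* suc (x / n)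
    floor> x = ℕP.<-≤-trans (ℕP.≤-<-trans (ℕP.≤-reflexive (DM.m≡m%n+[m/n]*n x n)) (ℕP.+-monoˡ-< (x / n ℕ.* n) (DM.m%n<n x n)))
      (ℕP.≤-reflexive (trans (cong (n ℕ.+_) (ℕP.*-comm (x / n) n)) (sym (ℕP.*-suc n (x / n)))))

    -- The floor is superadditive with a defect of at most one.
    two-values : ∀ x u φ → let q = u / n; v = fl (x ℕ.+ u) φ ∸ fl x φ in v ≡ q ⊎ v ≡ suc q
    two-values x u φ = choose (ℕP.m≤n⇒m<n∨m≡n upper′)
      where
      q A B : ℕ
      q = u / n
      A = fl x φ
      B = fl (x ℕ.+ u) φ
      rearr : x ℕ.+ u ℕ.+ φ ≡ (x ℕ.+ φ) ℕ.+ u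
      rearr = trans (ℕP.+-assoc x u φ) (trans (cong (x ℕ.+_) (ℕP.+-comm u φ)) (sym (ℕP.+-assoc x φ u)))
      lower′ : A ℕ.+ q ℕ.≤ B
      lower′ = ℕP.≤-trans (ℕP.≤-reflexive (sym (DM.m*n/n≡m (A ℕ.+ q) n))) (DM./-monoˡ-≤ n
        (ℕP.≤-trans (ℕP.≤-reflexive (trans (ℕP.*-comm (A ℕ.+ q) n) (ℕP.*-distribˡ-+ n A q))) (ℕP.≤-trans (ℕP.+-mono-≤ (floor≤ (x ℕ.+ φ)) (floor≤ u)) (ℕP.≤-reflexive (sym rearr)))))
      upper′ : B ℕ.≤ A ℕ.+ suc q
      upper′ = ℕP.≤-pred (DM.m<n*o⇒m/o<n {x ℕ.+ u ℕ.+ φ} {suc (A ℕ.+ suc q)} {n} (ℕP.≤-<-trans (ℕP.≤-reflexive rearr)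
        (ℕP.<-≤-trans (ℕP.+-mono-< (floor> (x ℕ.+ φ)) (floor> u)) (ℕP.≤-reflexive (trans (sym (ℕP.*-distribˡ-+ n (suc A) (suc q))) (ℕP.*-comm n (suc A ℕ.+ suc q)))))))
      choose : B ℕ.< A ℕ.+ suc q ⊎ B ≡ A ℕ.+ suc q → B ∸ A ≡ q ⊎ B ∸ A ≡ suc q
      choose (inj₂ e) = inj₂ (trans (cong (_∸ A) e) (ℕP.m+n∸m≡n A (suc q)))
      choose (inj₁ l) = inj₁ (trans (cong (_∸ A) (ℕP.≤-antisym (ℕP.≤-pred (ℕP.≤-trans l (ℕP.≤-reflexive (ℕP.+-suc A q)))) lower′)) (ℕP.m+n∸m≡n A q))

    Σφ : (ℕ → ℚ) → ℚ
    Σφ f = Σ {n} (λ φ → f (toℕ φ))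

    diff-sum : ∀ x u → Σφ (λ φ → ι (fl (x ℕ.+ u) φ ∸ fl x φ)) ≡ ι u
    diff-sum x u = trans (Σ-cong {n} (λ φ → ι-∸ (fl (x ℕ.+ u) (toℕ φ)) (fl x (toℕ φ)) (fl-mono (toℕ φ) (ℕP.m≤m+n x u))))
      (trans (Σ-- {n} (λ φ → ι (fl (x ℕ.+ u) (toℕ φ))) (λ φ → ι (fl x (toℕ φ)))) (trans (cong₂ _-_ (hermite (x ℕ.+ u)) (hermite x)) (trans (cong (_- ι x) (ι-+ x u)) (l (ι x) (ι u)))))
      where
      l : ∀ a b → a + b - a ≡ b
      l = solve-∀ ring

    -- A variable v with values q and q + 1 satisfies v² = (2q + 1) v - q (q + 1), which is affine
    -- in v, and the mean of v is known exactly. The slack is the square of u - n (q + 1/2).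
    square-sum : ∀ x u → ι n * Σφ (λ φ → ι (fl (x ℕ.+ u) φ ∸ fl x φ) * ι (fl (x ℕ.+ u) φ ∸ fl x φ)) ≤ ι u * ι u + ¼ * (ι n * ι n)
    square-sum x u = begin
      ι n * Σφ (λ φ → v φ * v φ) ≡⟨ cong (ι n *_) (trans (Σ-cong {n} (λ φ → sq (toℕ φ))) (trans (Σ-- {n} (λ φ → k * v (toℕ φ)) (λ _ → q * (1ℚ + q))) (cong₂ _-_ (trans (Σ-*ˡ {n} k (λ φ → v (toℕ φ))) (cong (k *_) (diff-sum x u))) (Σ-const n (q * (1ℚ + q)))))) ⟩
      ι n * (k * ι u - ι n * (q * (1ℚ + q))) ≤⟨ ≤-by ((ι u - ι n * (q + ½)) * (ι u - ι n * (q + ½))) (sq-nn (ι u - ι n * (q + ½))) (trans (l ½ (ι u) (ι n) q) (cong (λ z → ι n * ((q + q + z) * ι u - ι n * (q * (z + q))) + (ι u - ι n * (q + ½)) * (ι u - ι n * (q + ½))) refl)) ⟩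
      ι u * ι u + ¼ * (ι n * ι n) ∎
      where
      open ℚ.≤-Reasoning
      q k : ℚ
      q = ι (u / n)
      k = q + q + 1ℚ
      v : ℕ → ℚ
      v φ = ι (fl (x ℕ.+ u) φ ∸ fl x φ)
      l : ∀ h u n q → u * u + h * h * (n * n) ≡ n * ((q + q + (h + h)) * u - n * (q * (h + h + q))) + (u - n * (q + h)) * (u - n * (q + h))
      l = solve-∀ ring
      sq₁ : ∀ q → q * q ≡ (q + q + 1ℚ) * q - q * (1ℚ + q)
      sq₁ = solve-∀ ring
      sq₂ : ∀ q → (1ℚ + q) * (1ℚ + q) ≡ (q + q + 1ℚ) * (1ℚ + q) - q * (1ℚ + q)
      sq₂ = solve-∀ ring
      sq : ∀ φ → v φ * v φ ≡ k * v φ - q * (1ℚ + q)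
      sq φ with two-values x u φ
      ... | inj₁ e rewrite e = sq₁ q
      ... | inj₂ e rewrite e | ι-suc (u / n) = sq₂ q

  ι-sumTo : ∀ M f → ι (sumTo M f) ≡ Σ {M} (λ i → ι (f (toℕ i)))
  ι-sumTo zero f = ι-zero
  ι-sumTo (suc M) f = trans (ι-+ (f 0) (sumTo M (λ i → f (suc i)))) (cong (ι (f 0) +_) (ι-sumTo M (λ i → f (suc i))))

  grid-sum : ∀ M {n} k (P : ℕ → ℕ → ℚ) (p : ℕ → ℕ → ℕ → ℕ) → (∀ i j → i ℕ.< M → j ℕ.< M → k * P i j ≤ Σ {n} (λ φ → ι (p (toℕ φ) i j))) →
    k * Σ {M} (λ i → Σ {M} (λ j → P (toℕ i) (toℕ j))) ≤ Σ {n} (λ φ → ι (sumTo M (λ i → sumTo M (λ j → p (toℕ φ) i j))))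
  grid-sum M {n} k P p bound = begin
    k * Σ {M} (λ i → Σ {M} (λ j → P (toℕ i) (toℕ j))) ≡⟨ sym (trans (Σ-cong {M} (λ i → Σ-*ˡ {M} k (λ j → P (toℕ i) (toℕ j)))) (Σ-*ˡ {M} k (λ i → Σ {M} (λ j → P (toℕ i) (toℕ j))))) ⟩
    Σ {M} (λ i → Σ {M} (λ j → k * P (toℕ i) (toℕ j))) ≤⟨ Σ-mono {M} (λ i → Σ-mono {M} (λ j → bound (toℕ i) (toℕ j) (FP.toℕ<n i) (FP.toℕ<n j))) ⟩
    Σ {M} (λ i → Σ {M} (λ j → Σ {n} (λ φ → q φ i j))) ≡⟨ trans (Σ-cong {M} (λ i → Σ-swap {M} {n} (λ j φ → q φ i j))) (Σ-swap {M} {n} (λ i φ → Σ {M} (λ j → q φ i j))) ⟩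
    Σ {n} (λ φ → Σ {M} (λ i → Σ {M} (λ j → q φ i j))) ≡⟨ Σ-cong {n} (λ φ → sym (trans (ι-sumTo M (λ i → sumTo M (λ j → p (toℕ φ) i j))) (Σ-cong {M} (λ i → ι-sumTo M (λ j → p (toℕ φ) (toℕ i) j))))) ⟩
    Σ {n} (λ φ → ι (sumTo M (λ i → sumTo M (λ j → p (toℕ φ) i j)))) ∎
    where
    open ℚ.≤-Reasoning
    q : Fin n → Fin M → Fin M → ℚ
    q φ i j = ι (p (toℕ φ) (toℕ i) (toℕ j))

  ι24 : ℚ
  ι24 = ι 24

  -- The interpolated hinge of the linear form α(j - i) + β(24 - j) + γi - 8n, cf. hinge, cell and diag.
  module Corner (α β γ n : ℚ) where
    corner : ℕ → ℕ → ℚ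
    corner i j = pos⁺ (α * (ι j - ι i) + β * (ι24 - ι j) + γ * ι i - ι 8 * n)
    cellℚ diagℚ patchℚ : ℕ → ℕ → ℚ
    cellℚ i j = ι 3 * ((corner i j + corner i (suc j)) + (corner (suc i) j + corner (suc i) (suc j)))
    diagℚ i j = ι 2 * (corner i j + (corner i (suc j) + corner (suc i) (suc j)))
    patchℚ i j = if i <ᵇ j then cellℚ i j else (if j <ᵇ i then 0ℚ else diagℚ i j)
    weightℚ : ℚ
    weightℚ = Σ {24} (λ i → Σ {24} (λ j → patchℚ (toℕ i) (toℕ j)))

  -- The parts are laid end to end in the order `β`, `α`, `γ`, and the end points are rounded with
  -- one common shift. Every sum of consecutive parts is then itself a shifted rounding.
  module Majorise (n′ α β γ : ℕ) (small : β ℕ.+ α ℕ.+ γ ℕ.≤ suc n′) where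
    open Rounding n′
    open Corner (ι α) (ι β) (ι γ) (ι n)

    s₁ s₂ s₃ : ℕ
    s₁ = 24 ℕ.* β
    s₂ = s₁ ℕ.+ 24 ℕ.* α
    s₃ = s₂ ℕ.+ 24 ℕ.* γ

    a b c : ℕ → ℕ
    b φ = fl s₁ φ ∸ fl 0 φ
    a φ = fl s₂ φ ∸ fl s₁ φ
    c φ = fl s₃ φ ∸ fl s₂ φ

    fl0 : ∀ φ → φ ℕ.< n → fl 0 φ ≡ 0
    fl0 φ φ<n = DM.m<n⇒m/n≡0 φ<n

    ba≡ : ∀ φ → φ ℕ.< n → b φ ℕ.+ a φ ≡ fl s₂ φ
    ba≡ φ φ<n = trans (cong (λ z → fl s₁ φ ∸ z ℕ.+ a φ) (fl0 φ φ<n)) (ℕP.m+[n∸m]≡n (fl-mono φ (ℕP.m≤m+n s₁ (24 ℕ.* α))))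

    abc≤24 : ∀ φ → φ ℕ.< n → b φ ℕ.+ a φ ℕ.+ c φ ℕ.≤ 24
    abc≤24 φ φ<n = ℕP.≤-trans (ℕP.≤-reflexive (trans (cong (ℕ._+ c φ) (ba≡ φ φ<n)) (ℕP.m+[n∸m]≡n (fl-mono φ (ℕP.m≤m+n s₂ (24 ℕ.* γ))))))
      -- `s₃` ≤ 24 n and φ < n, so that `s₃` + φ < 25 n and the rounded total is at most 24.
      (ℕP.≤-pred (DM.m<n*o⇒m/o<n {s₃ ℕ.+ φ} {25} {n} (ℕP.<-≤-trans (ℕP.+-mono-≤-< s₃≤ φ<n) (ℕP.≤-reflexive (ℕP.+-comm (24 ℕ.* n) n)))))
      where
      s₃≤ : s₃ ℕ.≤ 24 ℕ.* n
      s₃≤ = ℕP.≤-trans (ℕP.≤-reflexive (sym (trans (ℕP.*-distribˡ-+ 24 (β ℕ.+ α) γ) (cong (ℕ._+ 24 ℕ.* γ) (ℕP.*-distribˡ-+ 24 β α))))) (ℕP.*-monoʳ-≤ 24 small)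

    Σb : Σφ (λ φ → ι (b φ)) ≡ ι24 * ι β
    Σb = trans (diff-sum 0 s₁) (ι-* 24 β)
    Σa : Σφ (λ φ → ι (a φ)) ≡ ι24 * ι α
    Σa = trans (diff-sum s₁ (24 ℕ.* α)) (ι-* 24 α)
    Σc : Σφ (λ φ → ι (c φ)) ≡ ι24 * ι γ
    Σc = trans (diff-sum s₂ (24 ℕ.* γ)) (ι-* 24 γ)

    -- Jensen's inequality: the linear form at the true proportions is the mean over all shifts of
    -- the form at the rounded ones, and the positive part is convex.
    hinge-bound : ∀ i j → i ℕ.≤ j → j ℕ.≤ 24 → ι24 * corner i j ≤ Σφ (λ φ → ι (hinge (a φ) (b φ) (c φ) i j))
    hinge-bound i j i≤j j≤24 = pos⁺-scale ι24 (ι-nn 24) below (Σ-nn {n} (λ φ → ι-nn (hinge (a (toℕ φ)) (b (toℕ φ)) (c (toℕ φ)) i j)))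
      where
      open ℚ.≤-Reasoning
      ji cj : ℚ
      ji = ι j - ι i
      cj = ι24 - ι j
      l : ∀ k α β γ u v w t n → k * (α * u + β * v + γ * w - t * n) ≡ (k * α) * u + ((k * β) * v + (k * γ) * w) - n * (k * t)
      l = solve-∀ ring
      linear : Σφ (λ φ → ι (a φ) * ji + (ι (b φ) * cj + ι (c φ) * ι i) - ι 192) ≡ (ι24 * ι α) * ji + ((ι24 * ι β) * cj + (ι24 * ι γ) * ι i) - ι n * (ι24 * ι 8)
      linear = trans (Σ-- {n} (λ φ → ι (a (toℕ φ)) * ji + (ι (b (toℕ φ)) * cj + ι (c (toℕ φ)) * ι i)) (λ _ → ι 192)) (cong₂ _-_
        (trans (Σ-+ {n} (λ φ → ι (a (toℕ φ)) * ji) (λ φ → ι (b (toℕ φ)) * cj + ι (c (toℕ φ)) * ι i)) (cong₂ _+_ (trans (Σ-*ʳ {n} ji (λ φ → ι (a (toℕ φ)))) (cong (_* ji) Σa))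
          (trans (Σ-+ {n} (λ φ → ι (b (toℕ φ)) * cj) (λ φ → ι (c (toℕ φ)) * ι i)) (cong₂ _+_ (trans (Σ-*ʳ {n} cj (λ φ → ι (b (toℕ φ)))) (cong (_* cj) Σb)) (trans (Σ-*ʳ {n} (ι i) (λ φ → ι (c (toℕ φ)))) (cong (_* ι i) Σc))))))
        (trans (Σ-const n (ι 192)) (cong (ι n *_) (ι-* 24 8))))
      ∸-lower : ∀ x t → ι x - ι t ≤ ι (x ∸ t)
      ∸-lower x t = ℚ.≤-trans (ℚ.+-monoˡ-≤ (- ι t) (ℚ.≤-trans (ι-mono (ℕP.m≤n+m∸n x t)) (ℚ.≤-reflexive (ι-+ t (x ∸ t))))) (ℚ.≤-reflexive (l₂ (ι t) (ι (x ∸ t))))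
        where
        l₂ : ∀ a b → a + b - a ≡ b
        l₂ = solve-∀ ring
      pointwise : ∀ φ → ι (a φ) * ji + (ι (b φ) * cj + ι (c φ) * ι i) - ι 192 ≤ ι (hinge (a φ) (b φ) (c φ) i j)
      pointwise φ = ℚ.≤-trans (ℚ.≤-reflexive (cong (_- ι 192) (sym (trans (ι-+ (a φ ℕ.* (j ∸ i)) (b φ ℕ.* (24 ∸ j) ℕ.+ c φ ℕ.* i)) (cong₂ _+_ (trans (ι-* (a φ) (j ∸ i)) (cong (ι (a φ) *_) (ι-∸ j i i≤j)))
          (trans (ι-+ (b φ ℕ.* (24 ∸ j)) (c φ ℕ.* i)) (cong₂ _+_ (trans (ι-* (b φ) (24 ∸ j)) (cong (ι (b φ) *_) (ι-∸ 24 j j≤24))) (ι-* (c φ) i))))))))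
          (∸-lower (a φ ℕ.* (j ∸ i) ℕ.+ (b φ ℕ.* (24 ∸ j) ℕ.+ c φ ℕ.* i)) 192)
      below : ι24 * (ι α * ji + ι β * cj + ι γ * ι i - ι 8 * ι n) ≤ Σφ (λ φ → ι (hinge (a φ) (b φ) (c φ) i j))
      below = ℚ.≤-trans (ℚ.≤-reflexive (trans (l ι24 (ι α) (ι β) (ι γ) ji cj (ι i) (ι 8) (ι n)) (sym linear))) (Σ-mono {n} (λ φ → pointwise (toℕ φ)))

    patch-bound : ∀ i j → i ℕ.< 24 → j ℕ.< 24 → ι24 * patchℚ i j ≤ Σφ (λ φ → ι (patch (a φ) (b φ) (c φ) i j))
    patch-bound i j i<24 j<24 with i <ᵇ j in ij
    ... | true = ℚ.≤-trans (ℚ.≤-reflexive (l ι24 (ι 3) _ _ _ _)) (ℚ.≤-trans (*-monoˡ (ι 3) (ι-nn 3) (ℚ.+-mono-≤ (ℚ.+-mono-≤ (hinge-bound i j (ℕP.<⇒≤ i<j) (ℕP.<⇒≤ j<24)) (hinge-bound i (suc j) (ℕP.≤-trans (ℕP.<⇒≤ i<j) (ℕP.n≤1+n j)) j<24))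
          (ℚ.+-mono-≤ (hinge-bound (suc i) j i<j (ℕP.<⇒≤ j<24)) (hinge-bound (suc i) (suc j) (ℕ.s≤s (ℕP.<⇒≤ i<j)) j<24))))
          (ℚ.≤-reflexive (sym total)))
      where
      i<j : i ℕ.< j
      i<j = ℕP.<ᵇ⇒< i j (subst T (sym ij) tt)
      l : ∀ k t p q r s → k * (t * ((p + q) + (r + s))) ≡ t * ((k * p + k * q) + (k * r + k * s))
      l = solve-∀ ring
      h : ℕ → ℕ → ℕ → ℕ
      h i j φ = hinge (a φ) (b φ) (c φ) i j
      S : ℕ → ℕ → ℚ
      S i j = Σφ (λ φ → ι (h i j φ))
      total : Σφ (λ φ → ι (cell (a φ) (b φ) (c φ) i j)) ≡ ι 3 * ((S i j + S i (suc j)) + (S (suc i) j + S (suc i) (suc j)))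
      total = trans (Σ-cong {n} (λ φ → trans (ι-* 3 ((h i j (toℕ φ) ℕ.+ h i (suc j) (toℕ φ)) ℕ.+ (h (suc i) j (toℕ φ) ℕ.+ h (suc i) (suc j) (toℕ φ)))) (cong (ι 3 *_) (trans (ι-+ (h i j (toℕ φ) ℕ.+ h i (suc j) (toℕ φ)) (h (suc i) j (toℕ φ) ℕ.+ h (suc i) (suc j) (toℕ φ))) (cong₂ _+_ (ι-+ (h i j (toℕ φ)) (h i (suc j) (toℕ φ))) (ι-+ (h (suc i) j (toℕ φ)) (h (suc i) (suc j) (toℕ φ))))))))
        (trans (Σ-*ˡ {n} (ι 3) (λ φ → (ι (h i j (toℕ φ)) + ι (h i (suc j) (toℕ φ))) + (ι (h (suc i) j (toℕ φ)) + ι (h (suc i) (suc j) (toℕ φ))))) (cong (ι 3 *_) (trans (Σ-+ {n} (λ φ → ι (h i j (toℕ φ)) + ι (h i (suc j) (toℕ φ))) (λ φ → ι (h (suc i) j (toℕ φ)) + ι (h (suc i) (suc j) (toℕ φ))))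
          (cong₂ _+_ (Σ-+ {n} (λ φ → ι (h i j (toℕ φ))) (λ φ → ι (h i (suc j) (toℕ φ)))) (Σ-+ {n} (λ φ → ι (h (suc i) j (toℕ φ))) (λ φ → ι (h (suc i) (suc j) (toℕ φ))))))))
    ... | false with j <ᵇ i in ji
    ...   | true = ℚ.≤-trans (ℚ.≤-reflexive (ℚ.*-zeroʳ ι24)) (Σ-nn {n} (λ φ → ι-nn 0))
    ...   | false = ℚ.≤-trans (ℚ.≤-reflexive (l ι24 (ι 2) _ _ _)) (ℚ.≤-trans (*-monoˡ (ι 2) (ι-nn 2) (ℚ.+-mono-≤ (hinge-bound i j i≤j (ℕP.<⇒≤ j<24)) (ℚ.+-mono-≤ (hinge-bound i (suc j) (ℕP.≤-trans i≤j (ℕP.n≤1+n j)) j<24) (hinge-bound (suc i) (suc j) (ℕ.s≤s i≤j) j<24))))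
          (ℚ.≤-reflexive (sym total)))
      where
      i≤j : i ℕ.≤ j
      i≤j = ℕP.≮⇒≥ (λ lt → subst T ji (ℕP.<⇒<ᵇ lt))
      l : ∀ k t p q r → k * (t * (p + (q + r))) ≡ t * (k * p + (k * q + k * r))
      l = solve-∀ ring
      h : ℕ → ℕ → ℕ → ℕ
      h i j φ = hinge (a φ) (b φ) (c φ) i j
      S : ℕ → ℕ → ℚ
      S i j = Σφ (λ φ → ι (h i j φ))
      total : Σφ (λ φ → ι (diag (a φ) (b φ) (c φ) i j)) ≡ ι 2 * (S i j + (S i (suc j) + S (suc i) (suc j)))
      total = trans (Σ-cong {n} (λ φ → trans (ι-* 2 (h i j (toℕ φ) ℕ.+ (h i (suc j) (toℕ φ) ℕ.+ h (suc i) (suc j) (toℕ φ)))) (cong (ι 2 *_) (trans (ι-+ (h i j (toℕ φ)) (h i (suc j) (toℕ φ) ℕ.+ h (suc i) (suc j) (toℕ φ))) (cong (ι (h i j (toℕ φ)) +_) (ι-+ (h i (suc j) (toℕ φ)) (h (suc i) (suc j) (toℕ φ))))))))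
        (trans (Σ-*ˡ {n} (ι 2) (λ φ → ι (h i j (toℕ φ)) + (ι (h i (suc j) (toℕ φ)) + ι (h (suc i) (suc j) (toℕ φ))))) (cong (ι 2 *_) (trans (Σ-+ {n} (λ φ → ι (h i j (toℕ φ))) (λ φ → ι (h i (suc j) (toℕ φ)) + ι (h (suc i) (suc j) (toℕ φ))))
          (cong (S i j +_) (Σ-+ {n} (λ φ → ι (h i (suc j) (toℕ φ))) (λ φ → ι (h (suc i) (suc j) (toℕ φ))))))))

    weight-bound : ι24 * weightℚ ≤ Σφ (λ φ → ι (weight (a φ) (b φ) (c φ)))
    weight-bound = ℚ.≤-trans (grid-sum 24 {n} ι24 patchℚ p patch-bound) (ℚ.≤-reflexive (Σ-cong {n} {λ φ → ι (sumTo 24 (λ i → sumTo 24 (λ j → p (toℕ φ) i j)))} {λ φ → ι (weight (a (toℕ φ)) (b (toℕ φ)) (c (toℕ φ)))}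
        (λ φ → cong ι (sym (weight-eq (a (toℕ φ)) (b (toℕ φ)) (c (toℕ φ)))))))
      where
      p : ℕ → ℕ → ℕ → ℕ
      p φ i j = patch (a φ) (b φ) (c φ) i j

-- The quadratic bound on the weight for arbitrary proportions.

module WeightBound where
  open import Data.Nat.Base using (_∸_)
  open import Data.Rational.Base using (ℚ; _+_; _*_; _≤_; _<_)
  open FiniteSums
  open GridMajorant
  open HermiteRounding

  module Majorise₂ (n′ α β γ : ℕ) (small : β ℕ.+ α ℕ.+ γ ℕ.≤ suc n′) where
    open Rounding n′
    open Majorise n′ α β γ small
    open Corner (ι α) (ι β) (ι γ) (ι n)

    -- n² times the sum of the squared mean (24 s/n)² and the rounding variance 1/4.
    q : ℚ → ℚ
    q s = (ι24 * s) * (ι24 * s) + ¼ * (ι n * ι n)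

    squares : (ℕ → ℕ) → ℚ
    squares f = Σφ (λ φ → ι (f φ) * ι (f φ))

    from : ∀ (f : ℕ → ℕ) x u s → ι u ≡ ι24 * s → (∀ φ → φ ℕ.< n → f φ ≡ fl (x ℕ.+ u) φ ∸ fl x φ) → ι n * squares f ≤ q s
    from f x u s us eq = ℚ.≤-trans (ℚ.≤-reflexive (cong (ι n *_) (Σ-cong {n} (λ φ → cong (λ z → ι z * ι z) (eq (toℕ φ) (FP.toℕ<n φ))))))
      (ℚ.≤-trans (square-sum x u) (ℚ.≤-reflexive (cong (λ z → z * z + ¼ * (ι n * ι n)) us)))

    sa : ι n * squares a ≤ q (ι α)
    sa = from a s₁ (24 ℕ.* α) (ι α) (ι-* 24 α) (λ _ _ → refl)
    sb : ι n * squares b ≤ q (ι β)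
    sb = from b 0 (24 ℕ.* β) (ι β) (ι-* 24 β) (λ _ _ → refl)
    sc : ι n * squares c ≤ q (ι γ)
    sc = from c s₂ (24 ℕ.* γ) (ι γ) (ι-* 24 γ) (λ _ _ → refl)

    s₂≡ : ι s₂ ≡ ι24 * (ι β + ι α)
    s₂≡ = trans (ι-+ s₁ (24 ℕ.* α)) (trans (cong₂ _+_ (ι-* 24 β) (ι-* 24 α)) (sym (ℚ.*-distribˡ-+ ι24 (ι β) (ι α))))
    s₃≡ : ι s₃ ≡ ι24 * (ι β + ι α + ι γ)
    s₃≡ = trans (ι-+ s₂ (24 ℕ.* γ)) (trans (cong₂ _+_ s₂≡ (ι-* 24 γ)) (sym (ℚ.*-distribˡ-+ ι24 (ι β + ι α) (ι γ))))

    sba : ι n * squares (λ φ → b φ ℕ.+ a φ) ≤ q (ι β + ι α)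
    sba = from (λ φ → b φ ℕ.+ a φ) 0 s₂ (ι β + ι α) s₂≡ (λ φ φ<n → trans (ba≡ φ φ<n) (cong (fl s₂ φ ∸_) (sym (fl0 φ φ<n))))

    sac : ι n * squares (λ φ → a φ ℕ.+ c φ) ≤ q (ι α + ι γ)
    sac = from (λ φ → a φ ℕ.+ c φ) s₁ (24 ℕ.* α ℕ.+ 24 ℕ.* γ) (ι α + ι γ) (trans (ι-+ (24 ℕ.* α) (24 ℕ.* γ)) (trans (cong₂ _+_ (ι-* 24 α) (ι-* 24 γ)) (sym (ℚ.*-distribˡ-+ ι24 (ι α) (ι γ)))))
      (λ φ φ<n → trans (telescope (fl-mono φ (ℕP.m≤m+n s₁ (24 ℕ.* α))) (fl-mono φ (ℕP.m≤m+n s₂ (24 ℕ.* γ)))) (cong (λ z → fl z φ ∸ fl s₁ φ) (ℕP.+-assoc s₁ (24 ℕ.* α) (24 ℕ.* γ))))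
      where
      telescope : ∀ {x y z} → x ℕ.≤ y → y ℕ.≤ z → y ∸ x ℕ.+ (z ∸ y) ≡ z ∸ x
      telescope {x} {y} {z} x≤y y≤z = ℕP.+-cancelˡ-≡ x _ _ (trans (sym (ℕP.+-assoc x (y ∸ x) (z ∸ y))) (trans (cong (ℕ._+ (z ∸ y)) (ℕP.m+[n∸m]≡n x≤y)) (trans (ℕP.m+[n∸m]≡n y≤z) (sym (ℕP.m+[n∸m]≡n (ℕP.≤-trans x≤y y≤z))))))

    sbac : ι n * squares (λ φ → b φ ℕ.+ a φ ℕ.+ c φ) ≤ q (ι β + ι α + ι γ)
    sbac = from (λ φ → b φ ℕ.+ a φ ℕ.+ c φ) 0 s₃ (ι β + ι α + ι γ) s₃≡ (λ φ φ<n → trans (cong (ℕ._+ c φ) (ba≡ φ φ<n)) (trans (ℕP.m+[n∸m]≡n (fl-mono φ (ℕP.m≤m+n s₂ (24 ℕ.* γ)))) (cong (fl s₃ φ ∸_) (sym (fl0 φ φ<n)))))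

    k₀ k₁ k₂ k₃ k₄ k₅ k₆ : ℚ
    k₀ = ι 204940
    k₁ = ι 31915
    k₂ = ι 21349
    k₃ = ι 592
    k₄ = ι 324
    k₅ = ι 214
    k₆ = ι 436

    ι-*′ : ∀ k m → ι (m ℕ.* k) ≡ ι k * ι m
    ι-*′ k m = trans (ι-* m k) (ℚ.*-comm (ι m) (ι k))

    lower-sum : Σφ (λ φ → ι (lower (a φ) (b φ) (c φ))) ≡ Σφ (λ φ → ι (weight (a φ) (b φ) (c φ))) + (k₁ * (ι24 * ι α) + k₂ * (ι24 * ι β + ι24 * ι γ))
    lower-sum = trans (Σ-cong {n} (λ φ → trans (trans (cong ι (lower-eq (a (toℕ φ)) (b (toℕ φ)) (c (toℕ φ)))) (ι-+ (weight (a (toℕ φ)) (b (toℕ φ)) (c (toℕ φ))) (a (toℕ φ) ℕ.* 31915 ℕ.+ (b (toℕ φ) ℕ.+ c (toℕ φ)) ℕ.* 21349))) (cong (ι (weight (a (toℕ φ)) (b (toℕ φ)) (c (toℕ φ))) +_) (trans (ι-+ (a (toℕ φ) ℕ.* 31915) ((b (toℕ φ) ℕ.+ c (toℕ φ)) ℕ.* 21349))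
          (cong₂ _+_ (ι-*′ 31915 (a (toℕ φ))) (trans (ι-*′ 21349 (b (toℕ φ) ℕ.+ c (toℕ φ))) (cong (k₂ *_) (ι-+ (b (toℕ φ)) (c (toℕ φ))))))))))
      (trans (Σ-+ {n} (λ φ → ι (weight (a (toℕ φ)) (b (toℕ φ)) (c (toℕ φ)))) (λ φ → k₁ * ι (a (toℕ φ)) + k₂ * (ι (b (toℕ φ)) + ι (c (toℕ φ))))) (cong (Σφ (λ φ → ι (weight (a φ) (b φ) (c φ))) +_)
        (trans (Σ-+ {n} (λ φ → k₁ * ι (a (toℕ φ))) (λ φ → k₂ * (ι (b (toℕ φ)) + ι (c (toℕ φ))))) (cong₂ _+_ (trans (Σ-*ˡ {n} k₁ (λ φ → ι (a (toℕ φ)))) (cong (k₁ *_) Σa))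
          (trans (Σ-*ˡ {n} k₂ (λ φ → ι (b (toℕ φ)) + ι (c (toℕ φ)))) (cong (k₂ *_) (trans (Σ-+ {n} (λ φ → ι (b (toℕ φ))) (λ φ → ι (c (toℕ φ)))) (cong₂ _+_ Σb Σc))))))))

    sqι : ∀ m → ι (m ℕ.* m) ≡ ι m * ι m
    sqι m = ι-* m m

    upper-sum : Σφ (λ φ → ι (upper (a φ) (b φ) (c φ))) ≡ ι n * k₀ + (k₃ * squares a + (k₄ * (squares b + squares c) + (k₅ * (squares (λ φ → b φ ℕ.+ a φ) + squares (λ φ → a φ ℕ.+ c φ)) + k₆ * squares (λ φ → b φ ℕ.+ a φ ℕ.+ c φ))))
    upper-sum = trans (Σ-cong {n} (λ φ → point (a (toℕ φ)) (b (toℕ φ)) (c (toℕ φ)))) (trans (Σ-+ {n} (λ φ → k₀) (λ φ → k₃ * A φ + (k₄ * (B φ + C φ) + (k₅ * (X φ + Y φ) + k₆ * Z φ)))) (cong₂ _+_ (Σ-const n k₀)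
      (trans (Σ-+ {n} (λ φ → k₃ * A φ) (λ φ → k₄ * (B φ + C φ) + (k₅ * (X φ + Y φ) + k₆ * Z φ))) (cong₂ _+_ (Σ-*ˡ {n} k₃ A) (trans (Σ-+ {n} (λ φ → k₄ * (B φ + C φ)) (λ φ → k₅ * (X φ + Y φ) + k₆ * Z φ)) (cong₂ _+_ (trans (Σ-*ˡ {n} k₄ (λ φ → B φ + C φ)) (cong (k₄ *_) (Σ-+ {n} B C)))
        (trans (Σ-+ {n} (λ φ → k₅ * (X φ + Y φ)) (λ φ → k₆ * Z φ)) (cong₂ _+_ (trans (Σ-*ˡ {n} k₅ (λ φ → X φ + Y φ)) (cong (k₅ *_) (Σ-+ {n} X Y))) (Σ-*ˡ {n} k₆ Z)))))))))
      where
      A B C X Y Z : Fin n → ℚ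
      A φ = ι (a (toℕ φ)) * ι (a (toℕ φ))
      B φ = ι (b (toℕ φ)) * ι (b (toℕ φ))
      C φ = ι (c (toℕ φ)) * ι (c (toℕ φ))
      X φ = ι (b (toℕ φ) ℕ.+ a (toℕ φ)) * ι (b (toℕ φ) ℕ.+ a (toℕ φ))
      Y φ = ι (a (toℕ φ) ℕ.+ c (toℕ φ)) * ι (a (toℕ φ) ℕ.+ c (toℕ φ))
      Z φ = ι (b (toℕ φ) ℕ.+ a (toℕ φ) ℕ.+ c (toℕ φ)) * ι (b (toℕ φ) ℕ.+ a (toℕ φ) ℕ.+ c (toℕ φ))
      point : ∀ a b c → ι (upper a b c) ≡ k₀ + (k₃ * (ι a * ι a) + (k₄ * (ι b * ι b + ι c * ι c) + (k₅ * (ι (b ℕ.+ a) * ι (b ℕ.+ a) + ι (a ℕ.+ c) * ι (a ℕ.+ c)) + k₆ * (ι (b ℕ.+ a ℕ.+ c) * ι (b ℕ.+ a ℕ.+ c)))))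
      point a b c = trans (trans (cong ι (upper-eq a b c)) (trans (ι-+ e₁ 204940) (ℚ.+-comm (ι e₁) k₀))) (cong (k₀ +_) (trans (ι-+ ((a ℕ.* a) ℕ.* 592) e₂) (cong₂ _+_ (trans (ι-*′ 592 (a ℕ.* a)) (cong (k₃ *_) (sqι a)))
        (trans (ι-+ ((b ℕ.* b ℕ.+ c ℕ.* c) ℕ.* 324) e₃) (cong₂ _+_ (trans (ι-*′ 324 (b ℕ.* b ℕ.+ c ℕ.* c)) (cong (k₄ *_) (trans (ι-+ (b ℕ.* b) (c ℕ.* c)) (cong₂ _+_ (sqι b) (sqι c)))))
          (trans (ι-+ (((b ℕ.+ a) ℕ.* (b ℕ.+ a) ℕ.+ (a ℕ.+ c) ℕ.* (a ℕ.+ c)) ℕ.* 214) e₄) (cong₂ _+_ (trans (ι-*′ 214 ((b ℕ.+ a) ℕ.* (b ℕ.+ a) ℕ.+ (a ℕ.+ c) ℕ.* (a ℕ.+ c))) (cong (k₅ *_) (trans (ι-+ ((b ℕ.+ a) ℕ.* (b ℕ.+ a)) ((a ℕ.+ c) ℕ.* (a ℕ.+ c))) (cong₂ _+_ (sqι (b ℕ.+ a)) (sqι (a ℕ.+ c))))))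
            (trans (ι-*′ 436 ((b ℕ.+ a ℕ.+ c) ℕ.* (b ℕ.+ a ℕ.+ c))) (cong (k₆ *_) (sqι (b ℕ.+ a ℕ.+ c)))))))))))
        where
        e₁ e₂ e₃ e₄ : ℕ
        e₄ = ((b ℕ.+ a ℕ.+ c) ℕ.* (b ℕ.+ a ℕ.+ c)) ℕ.* 436
        e₃ = ((b ℕ.+ a) ℕ.* (b ℕ.+ a) ℕ.+ (a ℕ.+ c) ℕ.* (a ℕ.+ c)) ℕ.* 214 ℕ.+ e₄
        e₂ = (b ℕ.* b ℕ.+ c ℕ.* c) ℕ.* 324 ℕ.+ e₃
        e₁ = (a ℕ.* a) ℕ.* 592 ℕ.+ e₂

    -- The mean of `majorant` over all shifts. Its linear part is exact in the mean; each square has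
    -- a nonnegative coefficient, so its mean may be replaced by the upper bound `q`.
    weightℚ-bound : ι n * (ι24 * weightℚ) + ι n * (k₁ * (ι24 * ι α) + k₂ * (ι24 * ι β + ι24 * ι γ)) ≤
      ι n * (ι n * k₀) + (k₃ * q (ι α) + (k₄ * (q (ι β) + q (ι γ)) + (k₅ * (q (ι β + ι α) + q (ι α + ι γ)) + k₆ * q (ι β + ι α + ι γ))))
    weightℚ-bound = begin
      ι n * (ι24 * weightℚ) + ι n * L ≡⟨ sym (ℚ.*-distribˡ-+ (ι n) (ι24 * weightℚ) L) ⟩
      ι n * (ι24 * weightℚ + L) ≤⟨ *-monoˡ (ι n) (ι-nn n) (ℚ.≤-trans (ℚ.+-monoˡ-≤ L weight-bound) (ℚ.≤-trans (ℚ.≤-reflexive (sym lower-sum)) (ℚ.≤-trans (Σ-mono {n} (λ φ → ι-mono (majorant (a (toℕ φ)) (b (toℕ φ)) (c (toℕ φ)) (abc≤24 (toℕ φ) (FP.toℕ<n φ))))) (ℚ.≤-reflexive upper-sum)))) ⟩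
      ι n * (ι n * k₀ + (k₃ * A + (k₄ * (B + C) + (k₅ * (X + Y) + k₆ * Z)))) ≡⟨ l (ι n) k₀ k₃ k₄ k₅ k₆ A B C X Y Z ⟩
      ι n * (ι n * k₀) + (k₃ * (ι n * A) + (k₄ * (ι n * B + ι n * C) + (k₅ * (ι n * X + ι n * Y) + k₆ * (ι n * Z)))) ≤⟨ ℚ.+-monoʳ-≤ (ι n * (ι n * k₀)) (ℚ.+-mono-≤ (*-monoˡ k₃ (ι-nn 592) sa) (ℚ.+-mono-≤ (*-monoˡ k₄ (ι-nn 324) (ℚ.+-mono-≤ sb sc)) (ℚ.+-mono-≤ (*-monoˡ k₅ (ι-nn 214) (ℚ.+-mono-≤ sba sac)) (*-monoˡ k₆ (ι-nn 436) sbac)))) ⟩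
      _ ∎
      where
      open ℚ.≤-Reasoning
      L A B C X Y Z : ℚ
      L = k₁ * (ι24 * ι α) + k₂ * (ι24 * ι β + ι24 * ι γ)
      A = squares a
      B = squares b
      C = squares c
      X = squares (λ φ → b φ ℕ.+ a φ)
      Y = squares (λ φ → a φ ℕ.+ c φ)
      Z = squares (λ φ → b φ ℕ.+ a φ ℕ.+ c φ)
      l : ∀ n k₀ k₃ k₄ k₅ k₆ A B C X Y Z → n * (n * k₀ + (k₃ * A + (k₄ * (B + C) + (k₅ * (X + Y) + k₆ * Z)))) ≡ n * (n * k₀) + (k₃ * (n * A) + (k₄ * (n * B + n * C) + (k₅ * (n * X + n * Y) + k₆ * (n * Z))))
      l = solve-∀ ring

-- Sums over triangles of lattice points.

module TriangularSums where
  open import Data.Bool.Base using (T)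
  open import Data.Rational.Base using (ℚ; 1ℚ; ½; _+_; _*_; _-_; -_; _≤_; _<_)
  open FiniteSums

  Sum : (ℕ → ℚ) → ℕ → ℚ
  Sum f k = Σ {k} (λ t → f (toℕ t))

  Sum-snoc : ∀ f k → Sum f (suc k) ≡ Sum f k + f k
  Sum-snoc f zero = trans (ℚ.+-identityʳ (f 0)) (sym (ℚ.+-identityˡ (f 0)))
  Sum-snoc f (suc k) = trans (cong (f 0 +_) (Sum-snoc (λ i → f (suc i)) k)) (sym (ℚ.+-assoc (f 0) (Sum (λ i → f (suc i)) k) (f (suc k))))

  <ᵇ-true : ∀ {m n} → m ℕ.< n → (m <ᵇ n) ≡ true
  <ᵇ-true {m} {n} p with m <ᵇ n in eq
  ... | true = refl
  ... | false = ⊥-elim (subst T eq (ℕP.<⇒<ᵇ p))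

  <ᵇ-false : ∀ {m n} → n ℕ.≤ m → (m <ᵇ n) ≡ false
  <ᵇ-false {m} {n} p with m <ᵇ n in eq
  ... | false = refl
  ... | true = ⊥-elim (ℕP.<-irrefl refl (ℕP.<-≤-trans (ℕP.<ᵇ⇒< m n (subst T (sym eq) tt)) p))

  Sum-below : ∀ g t r → t ℕ.≤ r → Sum (λ s → [ s <ᵇ t ] * g s) r ≡ Sum g t
  Sum-below g zero zero t≤r = refl
  Sum-below g t (suc r) t≤r with ℕP.m≤n⇒m<n∨m≡n t≤r
  ... | inj₁ (ℕ.s≤s t≤r′) = trans (Sum-snoc (λ s → [ s <ᵇ t ] * g s) r) (trans (cong₂ _+_ (Sum-below g t r t≤r′) (trans (cong (λ b → [ b ] * g r) (<ᵇ-false t≤r′)) (ℚ.*-zeroˡ (g r)))) (ℚ.+-identityʳ (Sum g t)))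
  ... | inj₂ refl = Σ-cong {suc r} (λ s → trans (cong (λ b → [ b ] * g (toℕ s)) (<ᵇ-true (FP.toℕ<n s))) (ℚ.*-identityˡ (g (toℕ s))))

  2* 3* 6* : ℚ
  2* = 1ℚ + 1ℚ
  3* = 1ℚ + 2*
  6* = 3* * 2*

  Sum-one : ∀ k → Sum (λ _ → 1ℚ) k ≡ ι k
  Sum-one k = trans (Σ-const k 1ℚ) (ℚ.*-identityʳ (ι k))

  Sum-linear : ∀ k → 2* * Sum ι k ≡ ι k * ι k - ι k
  Sum-linear zero = trans (ℚ.*-zeroʳ 2*) (sym (trans (cong (λ z → z * z - z) ι-zero) refl))
  Sum-linear (suc k) = trans (cong (2* *_) (Sum-snoc ι k)) (trans (ℚ.*-distribˡ-+ 2* (Sum ι k) (ι k)) (trans (cong (_+ 2* * ι k) (Sum-linear k)) (trans (l (ι k)) (cong (λ z → z * z - z) (sym (ι-suc k))))))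
    where
    l : ∀ x → x * x - x + (1ℚ + 1ℚ) * x ≡ (1ℚ + x) * (1ℚ + x) - (1ℚ + x)
    l = solve-∀ ring

  Sum-square : ∀ k → 6* * Sum (λ t → ι t * ι t) k ≡ (ι k - 1ℚ) * ι k * (2* * ι k - 1ℚ)
  Sum-square zero = trans (ℚ.*-zeroʳ 6*) (sym (trans (cong (λ z → (z - 1ℚ) * z * (2* * z - 1ℚ)) ι-zero) refl))
  Sum-square (suc k) = trans (cong (6* *_) (Sum-snoc (λ t → ι t * ι t) k)) (trans (ℚ.*-distribˡ-+ 6* (Sum (λ t → ι t * ι t) k) (ι k * ι k)) (trans (cong (_+ 6* * (ι k * ι k)) (Sum-square k)) (trans (l (ι k)) (cong (λ z → (z - 1ℚ) * z * (2* * z - 1ℚ)) (sym (ι-suc k))))))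
    where
    l : ∀ x → (x - 1ℚ) * x * ((1ℚ + 1ℚ) * x - 1ℚ) + (1ℚ + (1ℚ + 1ℚ)) * (1ℚ + 1ℚ) * (x * x) ≡ ((1ℚ + x) - 1ℚ) * (1ℚ + x) * ((1ℚ + 1ℚ) * (1ℚ + x) - 1ℚ)
    l = solve-∀ ring

  triangle-sum : ∀ r (g : ℕ → ℕ → ℚ) → Sum (λ s → Sum (λ t → [ s <ᵇ t ] * g s t) r) r ≡ Sum (λ t → Sum (λ s → g s t) t) r
  triangle-sum r g = trans (Σ-swap {r} {r} (λ s t → [ toℕ s <ᵇ toℕ t ] * g (toℕ s) (toℕ t))) (Σ-cong {r} (λ t → Sum-below (λ s → g s (toℕ t)) (toℕ t) r (ℕP.<⇒≤ (FP.toℕ<n t))))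

  Sum-cong : ∀ {f g} k → (∀ t → f t ≡ g t) → Sum f k ≡ Sum g k
  Sum-cong k p = Σ-cong {k} (λ t → p (toℕ t))

  Sum-* : ∀ c f k → Sum (λ t → c * f t) k ≡ c * Sum f k
  Sum-* c f k = Σ-*ˡ {k} c (λ t → f (toℕ t))

  Sum-+ : ∀ f g k → Sum (λ t → f t + g t) k ≡ Sum f k + Sum g k
  Sum-+ f g k = Σ-+ {k} (λ t → f (toℕ t)) (λ t → g (toℕ t))

  Sum-- : ∀ f g k → Sum (λ t → f t - g t) k ≡ Sum f k - Sum g k
  Sum-- f g k = Σ-- {k} (λ t → f (toℕ t)) (λ t → g (toℕ t))

  Sum-const : ∀ c k → Sum (λ _ → c) k ≡ ι k * c
  Sum-const c k = Σ-const k c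

  pairs-below : ∀ r → 2* * Sum (λ s → Sum (λ t → [ s <ᵇ t ]) r) r ≡ ι r * ι r - ι r
  pairs-below r = trans (cong (2* *_) (trans (Sum-cong r (λ s → Sum-cong r (λ t → sym (ℚ.*-identityʳ [ s <ᵇ t ])))) (trans (triangle-sum r (λ _ _ → 1ℚ)) (Sum-cong r Sum-one)))) (Sum-linear r)

  -- For fixed t the inner sum is a binomial coefficient t over 2, so the total is r over 3. It also
  -- counts the decreasing triples of keys.
  sum-s : ∀ r → 6* * Sum (λ s → Sum (λ t → [ s <ᵇ t ] * ι s) r) r ≡ ι r * (ι r - 1ℚ) * (ι r - 2*)
  sum-s r = begin
    6* * Sum (λ s → Sum (λ t → [ s <ᵇ t ] * ι s) r) r ≡⟨ cong (6* *_) (triangle-sum r (λ s _ → ι s)) ⟩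
    6* * Sum (λ t → Sum ι t) r ≡⟨ trans (l₁ (Sum (λ t → Sum ι t) r)) (cong (3* *_) (trans (sym (Sum-* 2* (λ t → Sum ι t) r)) (trans (Sum-cong r Sum-linear) (Sum-- (λ t → ι t * ι t) ι r)))) ⟩
    3* * (Sum (λ t → ι t * ι t) r - Sum ι r) ≡⟨ l₂ (Sum (λ t → ι t * ι t) r) (Sum ι r) ⟩
    ½ * (6* * Sum (λ t → ι t * ι t) r) - (½ + 1ℚ) * (2* * Sum ι r) ≡⟨ cong₂ (λ u v → ½ * u - (½ + 1ℚ) * v) (Sum-square r) (Sum-linear r) ⟩
    ½ * ((ι r - 1ℚ) * ι r * (2* * ι r - 1ℚ)) - (½ + 1ℚ) * (ι r * ι r - ι r) ≡⟨ l₃ (ι r) ⟩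
    ι r * (ι r - 1ℚ) * (ι r - 2*) ∎
    where
    open ≡-Reasoning
    l₁ : ∀ x → (1ℚ + (1ℚ + 1ℚ)) * (1ℚ + 1ℚ) * x ≡ (1ℚ + (1ℚ + 1ℚ)) * ((1ℚ + 1ℚ) * x)
    l₁ = solve-∀ ring
    l₂ : ∀ x y → (1ℚ + (1ℚ + 1ℚ)) * (x - y) ≡ ½ * ((1ℚ + (1ℚ + 1ℚ)) * (1ℚ + 1ℚ) * x) - (½ + 1ℚ) * ((1ℚ + 1ℚ) * y)
    l₂ = solve-∀ ring
    l₃ : ∀ x → ½ * ((x - 1ℚ) * x * ((1ℚ + 1ℚ) * x - 1ℚ)) - (½ + 1ℚ) * (x * x - x) ≡ x * (x - 1ℚ) * (x - (1ℚ + 1ℚ))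
    l₃ = solve-∀ ring

  sum-t : ∀ r → 6* * Sum (λ s → Sum (λ t → [ s <ᵇ t ] * ι t) r) r ≡ (ι r - 1ℚ) * ι r * (2* * ι r - 1ℚ)
  sum-t r = trans (cong (6* *_) (trans (triangle-sum r (λ _ t → ι t)) (Sum-cong r (λ t → Sum-const (ι t) t)))) (Sum-square r)

-- Interpolating the excess inside the cells of the grid.

module Interpolation where
  open import Data.Bool.Base using (T)
  open import Data.Rational.Base as Rat using (ℚ; 0ℚ; 1ℚ; ½; _+_; _*_; _-_; -_; _≤_; _<_)
  open FiniteSums
  open Truncation using (pos⁺; pos⁺-nn; ≤pos⁺; pos⁺-scale; Σ-combine)
  open HermiteRounding
  open TriangularSums

  0≤2* : 0ℚ ≤ 2*
  0≤2* = +-nn 0≤1 0≤1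
  0≤3* : 0ℚ ≤ 3*
  0≤3* = +-nn 0≤1 0≤2*

  ι2≡ : ι 2 ≡ 2*
  ι2≡ = trans (ι-suc 1) (cong (1ℚ +_) ι-one)
  ι3≡ : ι 3 ≡ 3*
  ι3≡ = trans (ι-suc 2) (cong (1ℚ +_) ι2≡)

  12* : ℚ
  12* = 6* * 2*
  0≤12* : 0ℚ ≤ 12*
  0≤12* = *-nn (*-nn 0≤3* 0≤2*) 0≤2*

  Σ-product : ∀ {m k} (u : Fin m → ℚ) (v : Fin k → ℚ) → Σ (λ s → Σ (λ t → u s * v t)) ≡ Σ u * Σ v
  Σ-product u v = trans (Σ-cong (λ s → Σ-*ˡ (u s) v)) (Σ-*ʳ (Σ v) u)

  -- Keys take 24 `r` values, `r` in each cell. `f` is an expected degree minus the cap, an affine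
  -- function of the two keys of the arc; at the corners of the grid it is `νr` times `L`.
  module Fine (α β γ n ν : ℚ) (0≤ν : 0ℚ ≤ ν) (r : ℕ) (1≤R : 1ℚ ≤ ι r) where
    open Corner α β γ n

    L : ℚ → ℚ → ℚ
    L x y = α * (y - x) + β * (ι24 - y) + γ * x - ι 8 * n

    f : ℕ → ℕ → ℚ
    f y z = ν * (α * (ι z - ι y) + β * (ι24 * ι r - ι z) + γ * ι y) - ν * ι r * (ι 8 * n)

    C : ℕ → ℕ → ℚ
    C = corner

    C-nn : ∀ i j → 0ℚ ≤ C i j
    C-nn i j = pos⁺-nn (L (ι i) (ι j))

    R νr : ℚ
    R = ι r
    νr = ν * R
    0≤R : 0ℚ ≤ R
    0≤R = ι-nn r
    0≤νr : 0ℚ ≤ νr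
    0≤νr = *-nn 0≤ν 0≤R

    at : ∀ i s → ι (r ℕ.* i ℕ.+ s) ≡ R * ι i + ι s
    at i s = trans (ι-+ (r ℕ.* i) s) (cong (_+ ι s) (ι-* r i))

    f-at : ∀ i s j t → f (r ℕ.* i ℕ.+ s) (r ℕ.* j ℕ.+ t) ≡ ν * (α * ((R * ι j + ι t) - (R * ι i + ι s)) + β * (ι24 * R - (R * ι j + ι t)) + γ * (R * ι i + ι s)) - νr * (ι 8 * n)
    f-at i s j t = cong₂ (λ u v → ν * (α * (v - u) + β * (ι24 * R - v) + γ * u) - νr * (ι 8 * n)) (at i s) (at j t)

    L≤C : ∀ i j x y → ι i ≡ x → ι j ≡ y → L x y ≤ C i j
    L≤C i j x y refl refl = ≤pos⁺ (L (ι i) (ι j))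

    module _ (i j s t : ℕ) (s<r : s ℕ.< r) (t<r : t ℕ.< r) where
      private
        x y u v : ℚ
        x = ι i
        y = ι j
        u = ι s
        v = ι t
        0≤R-u : 0ℚ ≤ R - u
        0≤R-u = diff≥0 (ι-mono (ℕP.<⇒≤ s<r))
        0≤R-v : 0ℚ ≤ R - v
        0≤R-v = diff≥0 (ι-mono (ℕP.<⇒≤ t<r))

      square : ℚ
      square = (R - u) * (R - v) * C i j + (R - u) * v * C i (suc j) + (u * (R - v) * C (suc i) j + u * v * C (suc i) (suc j))

      -- An affine function equals its bilinear interpolation, here with weights of total `R`², and
      -- at each corner it is at most its positive part.
      square-bound : R * R * pos⁺ (f (r ℕ.* i ℕ.+ s) (r ℕ.* j ℕ.+ t)) ≤ νr * square
      square-bound = pos⁺-scale (R * R) (*-nn 0≤R 0≤R) (ℚ.≤-trans (ℚ.≤-reflexive (trans (cong (R * R *_) (f-at i s j t)) (l ν R α β γ n x y u v ι24 (ι 8))))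
          (*-monoˡ νr 0≤νr (ℚ.+-mono-≤ (ℚ.+-mono-≤ (*-monoˡ ((R - u) * (R - v)) (*-nn 0≤R-u 0≤R-v) (L≤C i j x y refl refl)) (*-monoˡ ((R - u) * v) (*-nn 0≤R-u (ι-nn t)) (L≤C i (suc j) x (1ℚ + y) refl (ι-suc j))))
            (ℚ.+-mono-≤ (*-monoˡ (u * (R - v)) (*-nn (ι-nn s) 0≤R-v) (L≤C (suc i) j (1ℚ + x) y (ι-suc i) refl)) (*-monoˡ (u * v) (*-nn (ι-nn s) (ι-nn t)) (L≤C (suc i) (suc j) (1ℚ + x) (1ℚ + y) (ι-suc i) (ι-suc j)))))))
        (*-nn 0≤νr (+-nn (+-nn (*-nn (*-nn 0≤R-u 0≤R-v) (C-nn i j)) (*-nn (*-nn 0≤R-u (ι-nn t)) (C-nn i (suc j)))) (+-nn (*-nn (*-nn (ι-nn s) 0≤R-v) (C-nn (suc i) j)) (*-nn (*-nn (ι-nn s) (ι-nn t)) (C-nn (suc i) (suc j))))))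
        where
        l : ∀ ν R α β γ n x y u v k e → R * R * (ν * (α * ((R * y + v) - (R * x + u)) + β * (k * R - (R * y + v)) + γ * (R * x + u)) - ν * R * (e * n)) ≡
          ν * R * ((R - u) * (R - v) * (α * (y - x) + β * (k - y) + γ * x - e * n) + (R - u) * v * (α * ((1ℚ + y) - x) + β * (k - (1ℚ + y)) + γ * x - e * n)
            + (u * (R - v) * (α * (y - (1ℚ + x)) + β * (k - y) + γ * (1ℚ + x) - e * n) + u * v * (α * ((1ℚ + y) - (1ℚ + x)) + β * (k - (1ℚ + y)) + γ * (1ℚ + x) - e * n)))
        l = solve-∀ ring

      triangle : ℚ
      triangle = (R - v) * C i i + (v - u) * C i (suc i) + u * C (suc i) (suc i)

      -- In a diagonal cell the corner (i + 1, i) lies on the wrong side of y = z. The barycentric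
      -- weights R - v, v - u, u use the other three corners only.
      triangle-bound : s ℕ.≤ t → R * pos⁺ (f (r ℕ.* i ℕ.+ s) (r ℕ.* i ℕ.+ t)) ≤ νr * triangle
      triangle-bound s≤t = pos⁺-scale R 0≤R (ℚ.≤-trans (ℚ.≤-reflexive (trans (cong (R *_) (f-at i s i t)) (l ν R α β γ n x u v ι24 (ι 8))))
          (*-monoˡ νr 0≤νr (ℚ.+-mono-≤ (ℚ.+-mono-≤ (*-monoˡ (R - v) 0≤R-v (L≤C i i x x refl refl)) (*-monoˡ (v - u) 0≤v-u (L≤C i (suc i) x (1ℚ + x) refl (ι-suc i)))) (*-monoˡ u (ι-nn s) (L≤C (suc i) (suc i) (1ℚ + x) (1ℚ + x) (ι-suc i) (ι-suc i))))))
        (*-nn 0≤νr (+-nn (+-nn (*-nn 0≤R-v (C-nn i i)) (*-nn 0≤v-u (C-nn i (suc i)))) (*-nn (ι-nn s) (C-nn (suc i) (suc i)))))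
        where
        0≤v-u : 0ℚ ≤ v - u
        0≤v-u = diff≥0 (ι-mono s≤t)
        l : ∀ ν R α β γ n x u v k e → R * (ν * (α * ((R * x + v) - (R * x + u)) + β * (k * R - (R * x + v)) + γ * (R * x + u)) - ν * R * (e * n)) ≡
          ν * R * ((R - v) * (α * (x - x) + β * (k - x) + γ * x - e * n) + (v - u) * (α * ((1ℚ + x) - x) + β * (k - (1ℚ + x)) + γ * x - e * n)
            + u * (α * ((1ℚ + x) - (1ℚ + x)) + β * (k - (1ℚ + x)) + γ * (1ℚ + x) - e * n))
        l = solve-∀ ring

    block : ℕ → ℕ → ℚ
    block i j = Sum (λ s → Sum (λ t → [ r ℕ.* i ℕ.+ s <ᵇ r ℕ.* j ℕ.+ t ] * pos⁺ (f (r ℕ.* i ℕ.+ s) (r ℕ.* j ℕ.+ t))) r) r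

    K : ℚ
    K = νr * ((1ℚ + R) * (1ℚ + R))

    0<R : 0ℚ < R
    0<R = ℚ.<-≤-trans (ℚ.positive⁻¹ 1ℚ) 1≤R
    0<RR : 0ℚ < R * R
    0<RR = subst (_< R * R) (ℚ.*-zeroʳ R) (ℚ.*-monoʳ-<-pos R {{Rat.positive 0<R}} 0<R)

    Sum-mono : ∀ {g h : ℕ → ℚ} k → (∀ t → t ℕ.< k → g t ≤ h t) → Sum g k ≤ Sum h k
    Sum-mono k p = Σ-mono {k} (λ t → p (toℕ t) (FP.toℕ<n t))

    []*-≤ : ∀ p {x} → 0ℚ ≤ x → [ p ] * x ≤ x
    []*-≤ p {x} 0≤x = ℚ.≤-trans (*-monoʳ x 0≤x ([]≤1 p)) (ℚ.≤-reflexive (ℚ.*-identityˡ x))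

    -- Over the lattice points of a cell, the weights of one corner add up to at most (R (1 +
    -- R)/2)². This replaces the integral R⁴/4 and is the source of the factor (1 + R)² in `K`.
    block-cell : ∀ i j → 12* * block i j ≤ K * cellℚ i j
    block-cell i j = *-cancelˡ (R * R) 0<RR (begin
      R * R * (12* * block i j) ≡⟨ trans (c₁ (R * R) 12* (block i j)) (cong (12* *_) (sym (trans (Sum-cong r (λ s → Sum-* (R * R) (g s) r)) (Sum-* (R * R) (λ s → Sum (g s) r) r)))) ⟩
      12* * Sum (λ s → Sum (λ t → R * R * g s t) r) r ≤⟨ *-monoˡ 12* 0≤12* (Sum-mono r (λ s s< → Sum-mono r (λ t t< → ℚ.≤-trans (*-monoˡ (R * R) (*-nn 0≤R 0≤R) ([]*-≤ (r ℕ.* i ℕ.+ s <ᵇ r ℕ.* j ℕ.+ t) (pos⁺-nn _))) (square-bound i j s t s< t<)))) ⟩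
      12* * Sum (λ s → Sum (λ t → νr * square′ s t) r) r ≡⟨ cong (12* *_) (trans (Sum-cong r (λ s → Sum-* νr (square′ s) r)) (trans (Sum-* νr (λ s → Sum (square′ s) r) r) (cong (νr *_) total))) ⟩
      12* * (νr * (P * P * c₀₀ + P * Q * c₀₁ + (Q * P * c₁₀ + Q * Q * c₁₁))) ≤⟨ *-monoˡ 12* 0≤12* (*-monoˡ νr 0≤νr (ℚ.+-mono-≤ (ℚ.+-mono-≤ (*-monoʳ c₀₀ (C-nn i j) (*-mono 0≤P 0≤U P≤U P≤U)) (*-monoʳ c₀₁ (C-nn i (suc j)) (*-mono 0≤P 0≤U P≤U Q≤U)))
          (ℚ.+-mono-≤ (*-monoʳ c₁₀ (C-nn (suc i) j) (*-mono 0≤Q 0≤U Q≤U P≤U)) (*-monoʳ c₁₁ (C-nn (suc i) (suc j)) (*-mono 0≤Q 0≤U Q≤U Q≤U))))) ⟩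
      12* * (νr * (U * U * c₀₀ + U * U * c₀₁ + (U * U * c₁₀ + U * U * c₁₁))) ≡⟨ l νr U c₀₀ c₀₁ c₁₀ c₁₁ ⟩
      νr * ((2* * U) * (2* * U) * (3* * ((c₀₀ + c₀₁) + (c₁₀ + c₁₁)))) ≡⟨ cong₂ (λ a b → νr * (a * a * (b * ((c₀₀ + c₀₁) + (c₁₀ + c₁₁))))) 2U≡ (sym ι3≡) ⟩
      νr * ((R * (1ℚ + R)) * (R * (1ℚ + R)) * cellℚ i j) ≡⟨ l₂ νr R (cellℚ i j) ⟩
      R * R * (K * cellℚ i j) ∎)
      where
      open ℚ.≤-Reasoning
      g : ℕ → ℕ → ℚ
      g s t = [ r ℕ.* i ℕ.+ s <ᵇ r ℕ.* j ℕ.+ t ] * pos⁺ (f (r ℕ.* i ℕ.+ s) (r ℕ.* j ℕ.+ t))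
      c₀₀ c₀₁ c₁₀ c₁₁ P Q U : ℚ
      c₀₀ = C i j
      c₀₁ = C i (suc j)
      c₁₀ = C (suc i) j
      c₁₁ = C (suc i) (suc j)
      P = Sum (λ s → R - ι s) r
      Q = Sum ι r
      U = ½ * (R * (1ℚ + R))
      square′ : ℕ → ℕ → ℚ
      square′ s t = (R - ι s) * (R - ι t) * c₀₀ + (R - ι s) * ι t * c₀₁ + (ι s * (R - ι t) * c₁₀ + ι s * ι t * c₁₁)
      c₁ : ∀ a b c → a * (b * c) ≡ b * (a * c)
      c₁ = solve-∀ ring
      product : ∀ (u v : ℕ → ℚ) c → Sum (λ s → Sum (λ t → u s * v t * c) r) r ≡ Sum u r * Sum v r * c
      product u v c = trans (Sum-cong r (λ s → Σ-*ʳ {r} c (λ t → u s * v (toℕ t)))) (trans (Σ-*ʳ {r} c (λ s → Sum (λ t → u (toℕ s) * v t) r)) (cong (_* c) (Σ-product {r} {r} (λ s → u (toℕ s)) (λ t → v (toℕ t)))))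
      add₂ : ∀ (u v : ℕ → ℕ → ℚ) → Sum (λ s → Sum (λ t → u s t + v s t) r) r ≡ Sum (λ s → Sum (u s) r) r + Sum (λ s → Sum (v s) r) r
      add₂ u v = trans (Sum-cong r (λ s → Sum-+ (u s) (v s) r)) (Sum-+ (λ s → Sum (u s) r) (λ s → Sum (v s) r) r)
      total : Sum (λ s → Sum (square′ s) r) r ≡ P * P * c₀₀ + P * Q * c₀₁ + (Q * P * c₁₀ + Q * Q * c₁₁)
      total = trans (add₂ (λ s t → (R - ι s) * (R - ι t) * c₀₀ + (R - ι s) * ι t * c₀₁) (λ s t → ι s * (R - ι t) * c₁₀ + ι s * ι t * c₁₁))
        (cong₂ _+_ (trans (add₂ (λ s t → (R - ι s) * (R - ι t) * c₀₀) (λ s t → (R - ι s) * ι t * c₀₁)) (cong₂ _+_ (product (λ s → R - ι s) (λ t → R - ι t) c₀₀) (product (λ s → R - ι s) ι c₀₁)))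
          (trans (add₂ (λ s t → ι s * (R - ι t) * c₁₀) (λ s t → ι s * ι t * c₁₁)) (cong₂ _+_ (product ι (λ t → R - ι t) c₁₀) (product ι ι c₁₁))))
      0≤P : 0ℚ ≤ P
      0≤P = Σ-nn {r} (λ s → diff≥0 (ι-mono (ℕP.<⇒≤ (FP.toℕ<n s))))
      0≤Q : 0ℚ ≤ Q
      0≤Q = Σ-nn {r} (λ s → ι-nn (toℕ s))
      0≤U : 0ℚ ≤ U
      0≤U = *-nn (ℚ.nonNegative⁻¹ ½) (*-nn 0≤R (+-nn 0≤1 0≤R))
      half : ∀ x → x ≡ ½ * ((1ℚ + 1ℚ) * x)
      half = solve-∀ ring
      Q≡ : Q ≡ ½ * (R * R - R)
      Q≡ = trans (half Q) (cong (½ *_) (Sum-linear r))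
      Q≤U : Q ≤ U
      Q≤U = ≤-by R 0≤R (trans (e R) (cong (_+ R) (sym Q≡)))
        where
        e : ∀ R → ½ * (R * (1ℚ + R)) ≡ ½ * (R * R - R) + R
        e = solve-∀ ring
      P≤U : P ≤ U
      P≤U = ℚ.≤-reflexive (trans (Σ-- {r} (λ _ → R) (λ s → ι (toℕ s))) (trans (cong₂ _-_ (Sum-const R r) Q≡) (e R)))
        where
        e : ∀ R → R * R - ½ * (R * R - R) ≡ ½ * (R * (1ℚ + R))
        e = solve-∀ ring
      2U≡ : 2* * U ≡ R * (1ℚ + R)
      2U≡ = half′ (R * (1ℚ + R))
        where
        half′ : ∀ x → (1ℚ + 1ℚ) * (½ * x) ≡ x
        half′ = solve-∀ ring
      l : ∀ m U p q r s → (1ℚ + (1ℚ + 1ℚ)) * (1ℚ + 1ℚ) * (1ℚ + 1ℚ) * (m * (U * U * p + U * U * q + (U * U * r + U * U * s))) ≡ m * (((1ℚ + 1ℚ) * U) * ((1ℚ + 1ℚ) * U) * ((1ℚ + (1ℚ + 1ℚ)) * ((p + q) + (r + s))))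
      l = solve-∀ ring
      l₂ : ∀ m R c → m * ((R * (1ℚ + R)) * (R * (1ℚ + R)) * c) ≡ R * R * (m * ((1ℚ + R) * (1ℚ + R)) * c)
      l₂ = solve-∀ ring

    <ᵇ-shift : ∀ m s t → (m ℕ.+ s <ᵇ m ℕ.+ t) ≡ (s <ᵇ t)
    <ᵇ-shift zero s t = refl
    <ᵇ-shift (suc m) s t = <ᵇ-shift m s t

    diag-nn : ∀ i → 0ℚ ≤ diagℚ i i
    diag-nn i = *-nn (ι-nn 2) (+-nn (C-nn i i) (+-nn (C-nn i (suc i)) (C-nn (suc i) (suc i))))

    -- For each of the three corners, six times the sum of its barycentric weights over s < t is at
    -- most R³.
    block-diag : ∀ i → 12* * block i i ≤ K * diagℚ i i
    block-diag i = *-cancelˡ R 0<R (begin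
      R * (12* * block i i) ≡⟨ trans (c₁ R 12* (block i i)) (cong (12* *_) (sym (trans (Sum-cong r (λ s → Sum-* R (g s) r)) (Sum-* R (λ s → Sum (g s) r) r)))) ⟩
      12* * Sum (λ s → Sum (λ t → R * g s t) r) r ≤⟨ *-monoˡ 12* 0≤12* (Sum-mono r (λ s s< → Sum-mono r (λ t t< → point s t s< t<))) ⟩
      12* * Sum (λ s → Sum (λ t → νr * tri s t) r) r ≡⟨ cong (12* *_) (trans (Sum-cong r (λ s → Sum-* νr (tri s) r)) (trans (Sum-* νr (λ s → Sum (tri s) r) r) (cong (νr *_) total))) ⟩
      12* * (νr * ((R * T₁ - Tt) * c₀ + ((Tt - Ts) * c₁′ + Ts * c₂))) ≡⟨ l νr (R * T₁ - Tt) (Tt - Ts) Ts c₀ c₁′ c₂ ⟩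
      νr * (2* * ((6* * (R * T₁ - Tt)) * c₀ + ((6* * (Tt - Ts)) * c₁′ + (6* * Ts) * c₂))) ≤⟨ *-monoˡ νr 0≤νr (*-monoˡ 2* 0≤2* (ℚ.+-mono-≤ (*-monoʳ c₀ (C-nn i i) w₀) (ℚ.+-mono-≤ (*-monoʳ c₁′ (C-nn i (suc i)) w₁) (*-monoʳ c₂ (C-nn (suc i) (suc i)) w₂)))) ⟩
      νr * (2* * (R * R * R * c₀ + (R * R * R * c₁′ + R * R * R * c₂))) ≡⟨ trans (l₂ νr 2* R c₀ c₁′ c₂) (cong (λ z → R * (νr * (R * R) * (z * (c₀ + (c₁′ + c₂))))) (sym ι2≡)) ⟩
      R * (νr * (R * R) * diagℚ i i) ≤⟨ *-monoˡ R 0≤R (*-monoʳ (diagℚ i i) (diag-nn i) (*-monoˡ νr 0≤νr (*-mono 0≤R (+-nn 0≤1 0≤R) R≤ R≤))) ⟩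
      R * (K * diagℚ i i) ∎)
      where
      open ℚ.≤-Reasoning
      c₁ : ∀ a b c → a * (b * c) ≡ b * (a * c)
      c₁ = solve-∀ ring
      R≤ : R ≤ 1ℚ + R
      R≤ = ≤-by 1ℚ 0≤1 (ℚ.+-comm 1ℚ R)
      c₀ c₁′ c₂ T₁ Ts Tt : ℚ
      c₀ = C i i
      c₁′ = C i (suc i)
      c₂ = C (suc i) (suc i)
      T₁ = Sum (λ s → Sum (λ t → [ s <ᵇ t ]) r) r
      Ts = Sum (λ s → Sum (λ t → [ s <ᵇ t ] * ι s) r) r
      Tt = Sum (λ s → Sum (λ t → [ s <ᵇ t ] * ι t) r) r
      g tri : ℕ → ℕ → ℚ
      g s t = [ r ℕ.* i ℕ.+ s <ᵇ r ℕ.* i ℕ.+ t ] * pos⁺ (f (r ℕ.* i ℕ.+ s) (r ℕ.* i ℕ.+ t))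
      tri s t = [ s <ᵇ t ] * ((R - ι t) * c₀ + (ι t - ι s) * c₁′ + ι s * c₂)
      point : ∀ s t → s ℕ.< r → t ℕ.< r → R * g s t ≤ νr * tri s t
      point s t s< t< = ℚ.≤-trans (ℚ.≤-reflexive (cong (λ b → R * ([ b ] * pos⁺ (f (r ℕ.* i ℕ.+ s) (r ℕ.* i ℕ.+ t)))) (<ᵇ-shift (r ℕ.* i) s t))) (go (s <ᵇ t) refl)
        where
        pf tr : ℚ
        pf = pos⁺ (f (r ℕ.* i ℕ.+ s) (r ℕ.* i ℕ.+ t))
        tr = (R - ι t) * c₀ + (ι t - ι s) * c₁′ + ι s * c₂
        z : ∀ a x → a * (0ℚ * x) ≡ 0ℚ
        z a x = trans (cong (a *_) (ℚ.*-zeroˡ x)) (ℚ.*-zeroʳ a)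
        o : ∀ a x → a * (1ℚ * x) ≡ a * x
        o a x = cong (a *_) (ℚ.*-identityˡ x)
        go : ∀ b → (s <ᵇ t) ≡ b → R * ([ b ] * pf) ≤ νr * ([ b ] * tr)
        go true e = subst₂ _≤_ (sym (o R pf)) (sym (o νr tr)) (triangle-bound i i s t s< t< (ℕP.<⇒≤ (ℕP.<ᵇ⇒< s t (subst T (sym e) tt))))
        go false e = ℚ.≤-reflexive (trans (z R pf) (sym (z νr tr)))
      lin : ∀ (u : ℕ → ℕ → ℚ) c → Sum (λ s → Sum (λ t → u s t * c) r) r ≡ Sum (λ s → Sum (u s) r) r * c
      lin u c = trans (Sum-cong r (λ s → Σ-*ʳ {r} c (λ t → u s (toℕ t)))) (Σ-*ʳ {r} c (λ s → Sum (u (toℕ s)) r))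
      add₂ : ∀ (u v : ℕ → ℕ → ℚ) → Sum (λ s → Sum (λ t → u s t + v s t) r) r ≡ Sum (λ s → Sum (u s) r) r + Sum (λ s → Sum (v s) r) r
      add₂ u v = trans (Sum-cong r (λ s → Sum-+ (u s) (v s) r)) (Sum-+ (λ s → Sum (u s) r) (λ s → Sum (v s) r) r)
      total : Sum (λ s → Sum (tri s) r) r ≡ (R * T₁ - Tt) * c₀ + ((Tt - Ts) * c₁′ + Ts * c₂)
      total = trans (Sum-cong r (λ s → Sum-cong r (λ t → p [ s <ᵇ t ] (ι s) (ι t) R c₀ c₁′ c₂)))
        (trans (add₂ (λ s t → [ s <ᵇ t ] * (R * c₀)) (λ s t → [ s <ᵇ t ] * ι t * (c₁′ - c₀) + [ s <ᵇ t ] * ι s * (c₂ - c₁′)))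
        (trans (cong₂ _+_ (lin (λ s t → [ s <ᵇ t ]) (R * c₀)) (trans (add₂ (λ s t → [ s <ᵇ t ] * ι t * (c₁′ - c₀)) (λ s t → [ s <ᵇ t ] * ι s * (c₂ - c₁′))) (cong₂ _+_ (lin (λ s t → [ s <ᵇ t ] * ι t) (c₁′ - c₀)) (lin (λ s t → [ s <ᵇ t ] * ι s) (c₂ - c₁′)))))
          (q T₁ Ts Tt R c₀ c₁′ c₂)))
        where
        p : ∀ b s t R c₀ c₁ c₂ → b * ((R - t) * c₀ + (t - s) * c₁ + s * c₂) ≡ b * (R * c₀) + (b * t * (c₁ - c₀) + b * s * (c₂ - c₁))
        p = solve-∀ ring
        q : ∀ T₁ Ts Tt R c₀ c₁ c₂ → T₁ * (R * c₀) + (Tt * (c₁ - c₀) + Ts * (c₂ - c₁)) ≡ (R * T₁ - Tt) * c₀ + ((Tt - Ts) * c₁ + Ts * c₂)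
        q = solve-∀ ring
      w₀ : 6* * (R * T₁ - Tt) ≤ R * R * R
      w₀ = ≤-by R 0≤R (trans (e R) (cong (_+ R) (sym (trans (d R T₁ Tt) (cong₂ (λ a b → 3* * R * a - b) (pairs-below r) (sum-t r))))))
        where
        d : ∀ R T₁ Tt → (1ℚ + (1ℚ + 1ℚ)) * (1ℚ + 1ℚ) * (R * T₁ - Tt) ≡ (1ℚ + (1ℚ + 1ℚ)) * R * ((1ℚ + 1ℚ) * T₁) - (1ℚ + (1ℚ + 1ℚ)) * (1ℚ + 1ℚ) * Tt
        d = solve-∀ ring
        e : ∀ R → R * R * R ≡ (1ℚ + (1ℚ + 1ℚ)) * R * (R * R - R) - (R - 1ℚ) * R * ((1ℚ + 1ℚ) * R - 1ℚ) + R
        e = solve-∀ ring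
      w₁ : 6* * (Tt - Ts) ≤ R * R * R
      w₁ = ≤-by R 0≤R (trans (e R) (cong (_+ R) (sym (trans (d Tt Ts) (cong₂ _-_ (sum-t r) (sum-s r))))))
        where
        d : ∀ a b → (1ℚ + (1ℚ + 1ℚ)) * (1ℚ + 1ℚ) * (a - b) ≡ (1ℚ + (1ℚ + 1ℚ)) * (1ℚ + 1ℚ) * a - (1ℚ + (1ℚ + 1ℚ)) * (1ℚ + 1ℚ) * b
        d = solve-∀ ring
        e : ∀ R → R * R * R ≡ (R - 1ℚ) * R * ((1ℚ + 1ℚ) * R - 1ℚ) - R * (R - 1ℚ) * (R - (1ℚ + 1ℚ)) + R
        e = solve-∀ ring
      w₂ : 6* * Ts ≤ R * R * R
      w₂ = ≤-by (R * (R + 2* * (R - 1ℚ))) (*-nn 0≤R (+-nn 0≤R (*-nn 0≤2* (diff≥0 1≤R)))) (trans (e R) (cong (_+ R * (R + 2* * (R - 1ℚ))) (sym (sum-s r))))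
        where
        e : ∀ R → R * R * R ≡ R * (R - 1ℚ) * (R - (1ℚ + 1ℚ)) + R * (R + (1ℚ + 1ℚ) * (R - 1ℚ))
        e = solve-∀ ring
      l : ∀ m x y z a b c → (1ℚ + (1ℚ + 1ℚ)) * (1ℚ + 1ℚ) * (1ℚ + 1ℚ) * (m * (x * a + (y * b + z * c))) ≡ m * ((1ℚ + 1ℚ) * (((1ℚ + (1ℚ + 1ℚ)) * (1ℚ + 1ℚ) * x) * a + (((1ℚ + (1ℚ + 1ℚ)) * (1ℚ + 1ℚ) * y) * b + ((1ℚ + (1ℚ + 1ℚ)) * (1ℚ + 1ℚ) * z) * c)))
      l = solve-∀ ring
      l₂ : ∀ m t R a b c → m * (t * (R * R * R * a + (R * R * R * b + R * R * R * c))) ≡ R * (m * (R * R) * (t * (a + (b + c))))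
      l₂ = solve-∀ ring

    block-below : ∀ i j → j ℕ.< i → 12* * block i j ≡ 0ℚ
    block-below i j j<i = trans (cong (12* *_) (trans (Σ-cong {r} (λ s → trans (Σ-cong {r} (λ t → trans (cong (λ b → [ b ] * pos⁺ (f (r ℕ.* i ℕ.+ toℕ s) (r ℕ.* j ℕ.+ toℕ t))) (<ᵇ-false (lt (toℕ s) (toℕ t) (FP.toℕ<n t)))) (ℚ.*-zeroˡ (pos⁺ (f (r ℕ.* i ℕ.+ toℕ s) (r ℕ.* j ℕ.+ toℕ t)))))) (Σ-zero r))) (Σ-zero r))) (ℚ.*-zeroʳ 12*)
      where
      lt : ∀ s t → t ℕ.< r → r ℕ.* j ℕ.+ t ℕ.≤ r ℕ.* i ℕ.+ s
      lt s t t<r = ℕP.≤-trans (ℕP.+-monoʳ-≤ (r ℕ.* j) (ℕP.<⇒≤ t<r)) (ℕP.≤-trans (ℕP.≤-reflexive (trans (ℕP.+-comm (r ℕ.* j) r) (sym (ℕP.*-suc r j)))) (ℕP.≤-trans (ℕP.*-monoʳ-≤ r j<i) (ℕP.m≤m+n (r ℕ.* i) s)))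

    block-patch : ∀ i j → 12* * block i j ≤ K * patchℚ i j
    block-patch i j with i <ᵇ j in ij
    ... | true = block-cell i j
    ... | false with j <ᵇ i in ji
    ...   | true = ℚ.≤-reflexive (trans (block-below i j (ℕP.<ᵇ⇒< j i (subst T (sym ji) tt))) (sym (ℚ.*-zeroʳ K)))
    ...   | false = subst (λ j → 12* * block i j ≤ K * diagℚ i j) (ℕP.≤-antisym (ℕP.≮⇒≥ (λ lt → subst T ji (ℕP.<⇒<ᵇ lt))) (ℕP.≮⇒≥ (λ lt → subst T ij (ℕP.<⇒<ᵇ lt)))) (block-diag i)

    -- Cells below the diagonal contain no pair y < z, diagonal cells are handled by the triangle,
    -- and all others by the square.
    fine-bound : 12* * Σ {24 ℕ.* r} (λ y → Σ {24 ℕ.* r} (λ z → [ toℕ y <ᵇ toℕ z ] * pos⁺ (f (toℕ y) (toℕ z)))) ≤ K * weightℚ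
    fine-bound = begin
      12* * Σ {24 ℕ.* r} (λ y → Σ {24 ℕ.* r} (λ z → G (toℕ y) (toℕ z))) ≡⟨ cong (12* *_) expand ⟩
      12* * Σ {24} (λ i → Σ {24} (λ j → block (toℕ i) (toℕ j))) ≡⟨ sym (trans (Σ-cong {24} (λ i → Σ-*ˡ {24} 12* (λ j → block (toℕ i) (toℕ j)))) (Σ-*ˡ {24} 12* (λ i → Σ {24} (λ j → block (toℕ i) (toℕ j))))) ⟩
      Σ {24} (λ i → Σ {24} (λ j → 12* * block (toℕ i) (toℕ j))) ≤⟨ Σ-mono {24} (λ i → Σ-mono {24} (λ j → block-patch (toℕ i) (toℕ j))) ⟩
      Σ {24} (λ i → Σ {24} (λ j → K * patchℚ (toℕ i) (toℕ j))) ≡⟨ trans (Σ-cong {24} (λ i → Σ-*ˡ {24} K (λ j → patchℚ (toℕ i) (toℕ j)))) (Σ-*ˡ {24} K (λ i → Σ {24} (λ j → patchℚ (toℕ i) (toℕ j)))) ⟩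
      K * weightℚ ∎
      where
      open ℚ.≤-Reasoning
      G : ℕ → ℕ → ℚ
      G y z = [ y <ᵇ z ] * pos⁺ (f y z)
      expand : Σ {24 ℕ.* r} (λ y → Σ {24 ℕ.* r} (λ z → G (toℕ y) (toℕ z))) ≡ Σ {24} (λ i → Σ {24} (λ j → block (toℕ i) (toℕ j)))
      expand = trans (Σ-combine 24 {r} (λ y → Σ {24 ℕ.* r} (λ z → G (toℕ y) (toℕ z)))) (Σ-cong {24} (λ i → trans (Σ-cong {r} (λ s →
          trans (Σ-combine 24 {r} (λ z → G (toℕ (combine i s)) (toℕ z))) (Σ-cong {24} (λ j → Σ-cong {r} (λ t → cong₂ G (FP.toℕ-combine i s) (FP.toℕ-combine j t))))))
        (Σ-swap {r} {24} (λ s j → Σ {r} (λ t → G (r ℕ.* toℕ i ℕ.+ toℕ s) (r ℕ.* toℕ j ℕ.+ toℕ t))))))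

-- Means over independent uniform keys.

module IndependentKeys where
  open import Data.Rational.Base using (ℚ; 0ℚ; 1ℚ; _+_; _*_; _-_; -_; _≤_)
  open FiniteSums
  open Truncation using (pos⁺; pos⁺-nn; ≤pos⁺; pos⁺-least)

  least : ∀ k → k ≢ 0 → (f : Fin k → ℚ) → ∃[ i ] (∀ j → f i ≤ f j)
  least zero k≢0 f = ⊥-elim (k≢0 refl)
  least (suc zero) k≢0 f = zero , λ { zero → ℚ.≤-refl }
  least (suc (suc k)) k≢0 f = go (least (suc k) (λ ()) (f ∘ suc))
    where
    go : (∃[ i ] (∀ j → f (suc i) ≤ f (suc j))) → ∃[ i ] (∀ j → f i ≤ f j)
    go (i , p) with ℚ.≤-total (f zero) (f (suc i))
    ... | inj₁ q = zero , λ { zero → ℚ.≤-refl ; (suc j) → ℚ.≤-trans q (p j) }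
    ... | inj₂ q = suc i , λ { zero → q ; (suc j) → p j }

  module Average (N : ℕ) (ν : ℚ) (νN : ν * ι N ≡ 1ℚ) (0≤ν : 0ℚ ≤ ν) where

    mean : (Fin N → ℚ) → ℚ
    mean f = ν * Σ f

    mean-const : ∀ c → mean (λ _ → c) ≡ c
    mean-const c = trans (cong (ν *_) (Σ-const N c)) (trans (sym (ℚ.*-assoc ν (ι N) c)) (trans (cong (_* c) νN) (ℚ.*-identityˡ c)))

    mean-mono : ∀ {f g : Fin N → ℚ} → (∀ x → f x ≤ g x) → mean f ≤ mean g
    mean-mono p = *-monoˡ ν 0≤ν (Σ-mono p)

    mean-cong : ∀ {f g : Fin N → ℚ} → (∀ x → f x ≡ g x) → mean f ≡ mean g
    mean-cong p = cong (ν *_) (Σ-cong p)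

    mean-+ : ∀ (f g : Fin N → ℚ) → mean (λ x → f x + g x) ≡ mean f + mean g
    mean-+ f g = trans (cong (ν *_) (Σ-+ f g)) (ℚ.*-distribˡ-+ ν (Σ f) (Σ g))

    mean-* : ∀ c (f : Fin N → ℚ) → mean (λ x → c * f x) ≡ c * mean f
    mean-* c f = trans (cong (ν *_) (Σ-*ˡ c f)) (l ν c (Σ f))
      where
      l : ∀ a b x → a * (b * x) ≡ b * (a * x)
      l = solve-∀ ring

    mean-swap : ∀ (f : Fin N → Fin N → ℚ) → mean (λ x → mean (f x)) ≡ mean (λ y → mean (λ x → f x y))
    mean-swap f = cong (ν *_) (trans (Σ-*ˡ ν (λ x → Σ (f x))) (trans (cong (ν *_) (Σ-swap f)) (sym (Σ-*ˡ ν (λ y → Σ (λ x → f x y))))))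

    mean-Σ : ∀ {m} (f : Fin m → Fin N → ℚ) → mean (λ x → Σ (λ i → f i x)) ≡ Σ (λ i → mean (f i))
    mean-Σ f = trans (cong (ν *_) (Σ-swap (λ x i → f i x))) (sym (Σ-*ˡ ν (λ i → Σ (f i))))

    E : ∀ {n} → (Vec (Fin N) n → ℚ) → ℚ
    E {zero} F = F []
    E {suc n} F = mean (λ x → E (λ κ → F (x ∷ κ)))

    E-const : ∀ n c → E {n} (λ _ → c) ≡ c
    E-const zero c = refl
    E-const (suc n) c = trans (mean-cong (λ x → E-const n c)) (mean-const c)

    E-mono : ∀ {n} {F G : Vec (Fin N) n → ℚ} → (∀ κ → F κ ≤ G κ) → E F ≤ E G
    E-mono {zero} p = p []
    E-mono {suc n} p = mean-mono (λ x → E-mono (λ κ → p (x ∷ κ)))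

    E-cong : ∀ {n} {F G : Vec (Fin N) n → ℚ} → (∀ κ → F κ ≡ G κ) → E F ≡ E G
    E-cong {zero} p = p []
    E-cong {suc n} p = mean-cong (λ x → E-cong (λ κ → p (x ∷ κ)))

    E-+ : ∀ {n} (F G : Vec (Fin N) n → ℚ) → E (λ κ → F κ + G κ) ≡ E F + E G
    E-+ {zero} F G = refl
    E-+ {suc n} F G = trans (mean-cong (λ x → E-+ (λ κ → F (x ∷ κ)) (λ κ → G (x ∷ κ)))) (mean-+ (λ x → E (λ κ → F (x ∷ κ))) (λ x → E (λ κ → G (x ∷ κ))))

    E-* : ∀ {n} c (F : Vec (Fin N) n → ℚ) → E (λ κ → c * F κ) ≡ c * E F
    E-* {zero} c F = refl
    E-* {suc n} c F = trans (mean-cong (λ x → E-* c (λ κ → F (x ∷ κ)))) (mean-* c (λ x → E (λ κ → F (x ∷ κ))))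

    E-Σ : ∀ {m n} (F : Fin m → Vec (Fin N) n → ℚ) → E (λ κ → Σ (λ i → F i κ)) ≡ Σ (λ i → E (F i))
    E-Σ {n = zero} F = refl
    E-Σ {n = suc n} F = trans (mean-cong (λ x → E-Σ (λ i κ → F i (x ∷ κ)))) (mean-Σ (λ i x → E (λ κ → F i (x ∷ κ))))

    -- Redrawing one coordinate does not change the distribution. Repeated use brings the keys of
    -- chosen vertices in front of the expectation.
    resample : ∀ {n} (i : Fin n) (F : Vec (Fin N) n → ℚ) → E F ≡ mean (λ x → E (λ κ → F (κ [ i ]≔ x)))
    resample {suc n} zero F = sym (mean-cong (λ x → mean-const (E (λ κ → F (x ∷ κ)))))
    resample {suc n} (suc i) F = trans (mean-cong (λ y → resample i (λ κ → F (y ∷ κ)))) (mean-swap (λ y x → E (λ κ → F (y ∷ (κ [ i ]≔ x)))))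

    -- Conditional expectations: the coordinates are fixed one by one, each at a value for which the
    -- remaining mean is least.
    attained : ∀ {n} (F : Vec (Fin N) n → ℚ) → ∃[ κ ] F κ ≤ E F
    attained {zero} F = [] , ℚ.≤-refl
    attained {suc n} F = go (least N N≢0 (λ x → E (λ κ → F (x ∷ κ))))
      where
      N≢0 : N ≢ 0
      N≢0 e = ℚ.<-irrefl (trans (sym (trans (cong (λ z → ν * ι z) e) (trans (cong (ν *_) ι-zero) (ℚ.*-zeroʳ ν)))) νN) (ℚ.positive⁻¹ 1ℚ)
      go : (∃[ x ] (∀ y → E (λ κ → F (x ∷ κ)) ≤ E (λ κ → F (y ∷ κ)))) → ∃[ κ ] F κ ≤ E F
      go (x , minimal) = let κ , p = attained (λ κ → F (x ∷ κ)) in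
        x ∷ κ , ℚ.≤-trans p (ℚ.≤-trans (ℚ.≤-reflexive (sym (mean-const (E (λ κ → F (x ∷ κ)))))) (mean-mono minimal))

    -- Variances of independent centred variables add up. The constant `c` collects the coordinates
    -- that the induction has already fixed.
    square-mean : ∀ {n} (Z : Fin n → Fin N → ℚ) v → (∀ w → mean (Z w) ≡ 0ℚ) → (∀ w k → Z w k * Z w k ≤ v) → ∀ c →
      E (λ κ → (c + Σ (λ w → Z w (lookup κ w))) * (c + Σ (λ w → Z w (lookup κ w)))) ≤ c * c + ι n * v
    square-mean {zero} Z v centred bounded c = ℚ.≤-reflexive (trans (l c v) (cong (λ z → c * c + z * v) (sym ι-zero)))
      where
      l : ∀ c v → (c + 0ℚ) * (c + 0ℚ) ≡ c * c + 0ℚ * v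
      l = solve-∀ ring
    square-mean {suc n} Z v centred bounded c = begin
      mean (λ x → E (λ κ → (c + (Z zero x + S κ)) * (c + (Z zero x + S κ)))) ≤⟨ mean-mono (λ x → ℚ.≤-trans (ℚ.≤-reflexive (E-cong (λ κ → cong (λ z → z * z) (sym (ℚ.+-assoc c (Z zero x) (S κ)))))) (square-mean (Z ∘ suc) v (centred ∘ suc) (bounded ∘ suc) (c + Z zero x))) ⟩
      mean (λ x → (c + Z zero x) * (c + Z zero x) + ι n * v) ≤⟨ mean-mono (λ x → ℚ.≤-trans (ℚ.≤-reflexive (l₁ c (Z zero x) (ι n) v)) (ℚ.+-monoʳ-≤ ((c + c) * Z zero x) (ℚ.+-monoʳ-≤ (c * c + ι n * v) (bounded zero x)))) ⟩
      mean (λ x → (c + c) * Z zero x + (c * c + ι n * v + v)) ≡⟨ trans (mean-+ (λ x → (c + c) * Z zero x) (λ _ → c * c + ι n * v + v)) (cong₂ _+_ (trans (mean-* (c + c) (Z zero)) (cong ((c + c) *_) (centred zero))) (mean-const (c * c + ι n * v + v))) ⟩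
      (c + c) * 0ℚ + (c * c + ι n * v + v) ≡⟨ trans (l₂ c (ι n) v) (cong (λ z → c * c + z * v) (sym (ι-suc n))) ⟩
      c * c + ι (suc n) * v ∎
      where
      open ℚ.≤-Reasoning
      S : Vec (Fin N) n → ℚ
      S κ = Σ (λ w → Z (suc w) (lookup κ w))
      l₁ : ∀ c z n v → (c + z) * (c + z) + n * v ≡ (c + c) * z + (c * c + n * v + z * z)
      l₁ = solve-∀ ring
      l₂ : ∀ c n v → (c + c) * 0ℚ + (c * c + n * v + v) ≡ c * c + (1ℚ + n) * v
      l₂ = solve-∀ ring

    -- |d| ≤ η + θ d² for 4ηθ = 1 turns the variance bound into a bound on the mean deviation.
    hinge-mean : ∀ {n} (X : Fin n → Fin N → ℚ) u D η θ → (∀ w k → 0ℚ ≤ X w k) → (∀ w k → X w k ≤ u) → 0ℚ ≤ u → 0ℚ ≤ η → 0ℚ ≤ θ → (1ℚ + 1ℚ + (1ℚ + 1ℚ)) * (η * θ) ≡ 1ℚ →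
      E (λ κ → pos⁺ (Σ (λ w → X w (lookup κ w)) - D)) ≤ pos⁺ (Σ (λ w → mean (X w)) - D) + (η + θ * (ι n * (u * u)))
    hinge-mean {n} X u D η θ 0≤X X≤u 0≤u 0≤η 0≤θ ηθ = begin
      E (λ κ → pos⁺ (c κ - D)) ≤⟨ E-mono (λ κ → ℚ.≤-trans (pos⁺-least (point κ) (+-nn (pos⁺-nn (c̄ - D)) (+-nn 0≤η (*-nn 0≤θ (sq-nn (dev κ)))))) (ℚ.≤-reflexive (sym (ℚ.+-assoc (pos⁺ (c̄ - D)) η (θ * (dev κ * dev κ)))))) ⟩
      E (λ κ → pos⁺ (c̄ - D) + η + θ * (dev κ * dev κ)) ≡⟨ trans (E-+ (λ _ → pos⁺ (c̄ - D) + η) (λ κ → θ * (dev κ * dev κ))) (cong₂ _+_ (E-const n (pos⁺ (c̄ - D) + η)) (E-* θ (λ κ → dev κ * dev κ))) ⟩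
      pos⁺ (c̄ - D) + η + θ * E (λ κ → dev κ * dev κ) ≤⟨ ℚ.+-monoʳ-≤ (pos⁺ (c̄ - D) + η) (*-monoˡ θ 0≤θ (ℚ.≤-trans (square-mean Z (u * u) centred bounded 0ℚ) (ℚ.≤-reflexive (ℚ.+-identityˡ (ι n * (u * u)))))) ⟩
      pos⁺ (c̄ - D) + η + θ * (ι n * (u * u)) ≡⟨ ℚ.+-assoc (pos⁺ (c̄ - D)) η (θ * (ι n * (u * u))) ⟩
      pos⁺ (c̄ - D) + (η + θ * (ι n * (u * u))) ∎
      where
      open ℚ.≤-Reasoning
      m : Fin n → ℚ
      m w = mean (X w)
      c̄ : ℚ
      c̄ = Σ m
      c : Vec (Fin N) n → ℚ
      c κ = Σ (λ w → X w (lookup κ w))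
      Z : Fin n → Fin N → ℚ
      Z w k = X w k - m w
      dev : Vec (Fin N) n → ℚ
      dev κ = 0ℚ + Σ (λ w → Z w (lookup κ w))
      centred : ∀ w → mean (Z w) ≡ 0ℚ
      centred w = trans (mean-+ (X w) (λ _ → - m w)) (trans (cong (m w +_) (mean-const (- m w))) (ℚ.+-inverseʳ (m w)))
      0≤m : ∀ w → 0ℚ ≤ m w
      0≤m w = *-nn 0≤ν (Σ-nn (0≤X w))
      m≤u : ∀ w → m w ≤ u
      m≤u w = ℚ.≤-trans (mean-mono (X≤u w)) (ℚ.≤-reflexive (mean-const u))
      bounded : ∀ w k → Z w k * Z w k ≤ u * u
      bounded w k = ≤-by ((u - (X w k - m w)) * (u + (X w k - m w))) (*-nn (subst (0ℚ ≤_) (l₁ u (X w k) (m w)) (+-nn (diff≥0 (X≤u w k)) (0≤m w))) (subst (0ℚ ≤_) (l₂ u (X w k) (m w)) (+-nn (diff≥0 (m≤u w)) (0≤X w k)))) (l₃ u (X w k - m w))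
        where
        l₁ : ∀ u x m → (u - x) + m ≡ u - (x - m)
        l₁ = solve-∀ ring
        l₂ : ∀ u x m → (u - m) + x ≡ u + (x - m)
        l₂ = solve-∀ ring
        l₃ : ∀ u z → u * u ≡ z * z + (u - z) * (u + z)
        l₃ = solve-∀ ring
      c≡ : ∀ κ → c κ - D ≡ (c̄ - D) + dev κ
      c≡ κ = trans (l (c κ) c̄ D) (cong (λ z → (c̄ - D) + (0ℚ + z)) (sym (Σ-- (λ w → X w (lookup κ w)) m)))
        where
        l : ∀ c d D → c - D ≡ (d - D) + (0ℚ + (c - d))
        l = solve-∀ ring
      2η : ℚ
      2η = η + η
      linear : ∀ d → d ≤ η + θ * (d * d)
      linear d = ≤-by (θ * ((d - 2η) * (d - 2η))) (*-nn 0≤θ (sq-nn (d - 2η))) (trans (l₁ d η θ) (trans (cong (λ z → z * d + θ * ((d - 2η) * (d - 2η)) + (η - z * η)) ηθ) (l₂ d η (θ * ((d - 2η) * (d - 2η))))))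
        where
        l₁ : ∀ d η θ → η + θ * (d * d) ≡ (1ℚ + 1ℚ + (1ℚ + 1ℚ)) * (η * θ) * d + θ * ((d - (η + η)) * (d - (η + η))) + (η - (1ℚ + 1ℚ + (1ℚ + 1ℚ)) * (η * θ) * η)
        l₁ = solve-∀ ring
        l₂ : ∀ d η t → 1ℚ * d + t + (η - 1ℚ * η) ≡ d + t
        l₂ = solve-∀ ring
      point : ∀ κ → c κ - D ≤ pos⁺ (c̄ - D) + (η + θ * (dev κ * dev κ))
      point κ = ℚ.≤-trans (ℚ.≤-reflexive (c≡ κ)) (ℚ.+-mono-≤ (≤pos⁺ (c̄ - D)) (linear (dev κ)))

    pair-mean : ∀ {n} {i j : Fin n} → i ≢ j → (g : Fin N → Fin N → ℚ) → E (λ κ → g (lookup κ i) (lookup κ j)) ≡ mean (λ x → mean (λ y → g x y))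
    pair-mean {n} {i} {j} i≢j g = trans (resample i _) (mean-cong (λ x → trans (resample j _) (mean-cong (λ y → trans (E-cong (λ κ →
        cong₂ g (at-i κ x y) (at-j κ x y))) (E-const n (g x y))))))
      where
      at-i : ∀ κ x y → lookup ((κ [ j ]≔ y) [ i ]≔ x) i ≡ x
      at-i κ x y = lookup∘update i (κ [ j ]≔ y) x
      at-j : ∀ κ x y → lookup ((κ [ j ]≔ y) [ i ]≔ x) j ≡ y
      at-j κ x y = trans (lookup∘update′ (λ e → i≢j (sym e)) (κ [ j ]≔ y) x) (lookup∘update j κ y)

    triple-mean : ∀ {n} {i j k : Fin n} → i ≢ j → i ≢ k → j ≢ k → (g : Fin N → Fin N → Fin N → ℚ) →
      E (λ κ → g (lookup κ i) (lookup κ j) (lookup κ k)) ≡ mean (λ x → mean (λ y → mean (λ z → g x y z)))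
    triple-mean {n} {i} {j} {k} i≢j i≢k j≢k g = trans (resample i _) (mean-cong (λ x → trans (E-cong (λ κ → at-i κ x)) (pair-mean j≢k (g x))))
      where
      at-i : ∀ κ x → g (lookup (κ [ i ]≔ x) i) (lookup (κ [ i ]≔ x) j) (lookup (κ [ i ]≔ x) k) ≡ g x (lookup κ j) (lookup κ k)
      at-i κ x rewrite lookup∘update i κ x | lookup∘update′ (λ e → i≢j (sym e)) κ x | lookup∘update′ (λ e → i≢k (sym e)) κ x = refl

-- Backward arcs and triangles under random keys.

module KeyedOrder where
  open import Data.Bool.Base using (T)
  open import Data.Rational.Base using (ℚ; 0ℚ; 1ℚ; _+_; _*_; _-_; -_; _≤_; _<_)
  open FiniteSums
  open Inversions using (true≢false)
  open Truncation
  open BackwardTriangles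
  open TriangularSums
  open IndependentKeys

  []-disjoint : ∀ p q → (p ≡ true → q ≡ false) → [ p ] + [ q ] ≤ 1ℚ
  []-disjoint true q h rewrite h refl = ℚ.≤-reflexive (ℚ.+-identityʳ 1ℚ)
  []-disjoint false q h = ℚ.≤-trans (ℚ.≤-reflexive (ℚ.+-identityˡ [ q ])) ([]≤1 q)

  <ᵇ⇒< : ∀ {m n} → (m <ᵇ n) ≡ true → m ℕ.< n
  <ᵇ⇒< {m} {n} p = ℕP.<ᵇ⇒< m n (subst T (sym p) tt)

  <ᵇ⇒≥ : ∀ {m n} → (m <ᵇ n) ≡ false → n ℕ.≤ m
  <ᵇ⇒≥ p = ℕP.≮⇒≥ (λ lt → subst T p (ℕP.<⇒<ᵇ lt))

  module Counts {n : ℕ} (Tn : Tournament n) where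
    -- The positions of a third vertex `w` relative to an arc a → b: between its ends, beaten by
    -- both, or beating both. In the remaining case b → w → a the triangle is cyclic.
    middle below above : Fin n → Fin n → Fin n → Bool
    middle a b w = arc Tn a w ∧ arc Tn w b
    above a b w = arc Tn w a ∧ arc Tn w b
    below a b w = arc Tn b w ∧ arc Tn a w

    mid dom com : Fin n → Fin n → ℚ
    mid a b = Σ (λ w → [ middle a b w ])
    dom a b = Σ (λ w → [ above a b w ])
    com a b = Σ (λ w → [ below a b w ])

  module RandomKeys (N : ℕ) (ν : ℚ) (νN : ν * ι N ≡ 1ℚ) (0≤ν : 0ℚ ≤ ν) {n : ℕ} (Tn : Tournament n) where
    open Average N ν νN 0≤ν
    open Counts Tn

    key : Vec (Fin N) n → Fin n → ℕ
    key κ i = toℕ (lookup κ i)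

    -- The key is the leading digit, so ties are broken by the index.
    pos : Vec (Fin N) n → Fin n → ℕ
    pos κ i = toℕ (combine (lookup κ i) i)

    pos-inj : ∀ κ i j → pos κ i ≡ pos κ j → i ≡ j
    pos-inj κ i j e = FP.combine-injectiveʳ (lookup κ i) i (lookup κ j) j (FP.toℕ-injective e)

    pos-key : ∀ κ i j → key κ i ℕ.< key κ j → pos κ i ℕ.< pos κ j
    pos-key κ i j lt = FP.combine-monoˡ-< i j lt

    module At (κ : Vec (Fin N) n) = Ordered Tn (key κ) (pos κ) (pos-inj κ) (pos-key κ)

    ≢-arc : ∀ {i j} → arc Tn i j ≡ true → i ≢ j
    ≢-arc {i} p refl = true≢false p (arc-irr Tn i)

    arcs : ℚ
    arcs = Σ (λ i → Σ (λ j → [ arc Tn i j ]))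

    lessᵏ : Fin N → Fin N → ℚ
    lessᵏ x y = [ toℕ x <ᵇ toℕ y ]

    less-mean : 2* * mean (λ x → mean (λ y → lessᵏ x y)) ≡ 1ℚ - ν
    less-mean = begin
      2* * (ν * Σ (λ x → ν * Σ (lessᵏ x))) ≡⟨ cong (λ z → 2* * (ν * z)) (Σ-*ˡ {N} ν (λ x → Σ (lessᵏ x))) ⟩
      2* * (ν * (ν * Σ (λ x → Σ (lessᵏ x)))) ≡⟨ trans (l₁ ν (Σ (λ x → Σ (lessᵏ x)))) (cong (λ z → ν * (ν * z)) (pairs-below N)) ⟩
      ν * (ν * (ι N * ι N - ι N)) ≡⟨ trans (l₂ ν (ι N)) (cong (λ z → z * z - ν * z) νN) ⟩
      1ℚ * 1ℚ - ν * 1ℚ ≡⟨ cong (λ z → 1ℚ - z) (ℚ.*-identityʳ ν) ⟩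
      1ℚ - ν ∎
      where
      open ≡-Reasoning
      l₁ : ∀ ν s → (1ℚ + 1ℚ) * (ν * (ν * s)) ≡ ν * (ν * ((1ℚ + 1ℚ) * s))
      l₁ = solve-∀ ring
      l₂ : ∀ ν N → ν * (ν * (N * N - N)) ≡ (ν * N) * (ν * N) - ν * (ν * N)
      l₂ = solve-∀ ring

    -- Ties are all counted as backward, which accounts for `ν`.
    feedback-mean : 2* * E (λ κ → At.feedback κ) ≤ (1ℚ + ν) * arcs
    feedback-mean = begin
      2* * E (λ κ → At.feedback κ) ≡⟨ cong (2* *_) (trans (E-Σ (λ i κ → Σ (λ j → [ arc Tn i j ] * [ At.before κ j i ]))) (Σ-cong (λ i → trans (E-Σ (λ j κ → [ arc Tn i j ] * [ At.before κ j i ])) (Σ-cong (λ j → E-* [ arc Tn i j ] (λ κ → [ At.before κ j i ])))))) ⟩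
      2* * Σ (λ i → Σ (λ j → [ arc Tn i j ] * E (λ κ → [ At.before κ j i ]))) ≡⟨ sym (trans (Σ-cong (λ i → Σ-*ˡ 2* (λ j → [ arc Tn i j ] * E (λ κ → [ At.before κ j i ])))) (Σ-*ˡ 2* (λ i → Σ (λ j → [ arc Tn i j ] * E (λ κ → [ At.before κ j i ]))))) ⟩
      Σ (λ i → Σ (λ j → 2* * ([ arc Tn i j ] * E (λ κ → [ At.before κ j i ])))) ≤⟨ Σ-mono (λ i → Σ-mono (λ j → point i j (arc Tn i j) refl)) ⟩
      Σ (λ i → Σ (λ j → (1ℚ + ν) * [ arc Tn i j ])) ≡⟨ trans (Σ-cong (λ i → Σ-*ˡ (1ℚ + ν) (λ j → [ arc Tn i j ]))) (Σ-*ˡ (1ℚ + ν) (λ i → Σ (λ j → [ arc Tn i j ]))) ⟩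
      (1ℚ + ν) * arcs ∎
      where
      open ℚ.≤-Reasoning
      point : ∀ i j b → arc Tn i j ≡ b → 2* * ([ b ] * E (λ κ → [ At.before κ j i ])) ≤ (1ℚ + ν) * [ b ]
      point i j false p = ℚ.≤-reflexive (trans (cong (2* *_) (ℚ.*-zeroˡ (E (λ κ → [ At.before κ j i ])))) (trans (ℚ.*-zeroʳ 2*) (sym (ℚ.*-zeroʳ (1ℚ + ν)))))
      point i j true p = begin
        2* * (1ℚ * E (λ κ → [ At.before κ j i ])) ≡⟨ cong (2* *_) (ℚ.*-identityˡ (E (λ κ → [ At.before κ j i ]))) ⟩
        2* * E (λ κ → [ At.before κ j i ]) ≤⟨ *-monoˡ 2* (+-nn 0≤1 0≤1) (E-mono (λ κ → late κ)) ⟩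
        2* * E (λ κ → 1ℚ + (- 1ℚ) * lessᵏ (lookup κ i) (lookup κ j)) ≡⟨ cong (2* *_) (trans (E-+ (λ _ → 1ℚ) (λ κ → (- 1ℚ) * lessᵏ (lookup κ i) (lookup κ j))) (cong₂ _+_ (E-const n 1ℚ) (trans (E-* (- 1ℚ) (λ κ → lessᵏ (lookup κ i) (lookup κ j))) (cong (- 1ℚ *_) (pair-mean (≢-arc p) lessᵏ))))) ⟩
        2* * (1ℚ + (- 1ℚ) * M) ≡⟨ trans (l₁ M) (trans (cong (λ m → 1ℚ + 1ℚ - m) less-mean) (l₂ ν)) ⟩
        (1ℚ + ν) * 1ℚ ∎
        where
        M : ℚ
        M = mean (λ x → mean (λ y → lessᵏ x y))
        l₁ : ∀ m → (1ℚ + 1ℚ) * (1ℚ + (- 1ℚ) * m) ≡ 1ℚ + 1ℚ - (1ℚ + 1ℚ) * m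
        l₁ = solve-∀ ring
        l₂ : ∀ v → 1ℚ + 1ℚ - (1ℚ - v) ≡ (1ℚ + v) * 1ℚ
        l₂ = solve-∀ ring
        late : ∀ κ → [ At.before κ j i ] ≤ 1ℚ + (- 1ℚ) * lessᵏ (lookup κ i) (lookup κ j)
        late κ = ≤-by (1ℚ - ([ q ] + [ At.before κ j i ])) (diff≥0 ([]-disjoint q (At.before κ j i) (λ e → <ᵇ-false (ℕP.<⇒≤ (pos-key κ i j (<ᵇ⇒< e)))))) (l [ q ] [ At.before κ j i ])
          where
          q : Bool
          q = key κ i <ᵇ key κ j
          l : ∀ q b → 1ℚ + (- 1ℚ) * q ≡ b + (1ℚ - (q + b))
          l = solve-∀ ring

    transitive : ℚ
    transitive = Σ₃ (λ x y z → [ arc Tn x y ] * ([ arc Tn y z ] * [ arc Tn x z ]))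

    chain : Fin N → Fin N → Fin N → ℚ
    chain x y z = lessᵏ z y * lessᵏ y x

    -- Of the N³ triples of keys, N over 3 are decreasing.
    chain-mean : 6* * mean (λ x → mean (λ y → mean (λ z → chain x y z))) ≡ (1ℚ - ν) * (1ℚ - (ν + ν))
    chain-mean = begin
      6* * (ν * Σ (λ x → ν * Σ (λ y → ν * Σ (λ z → chain x y z)))) ≡⟨ cong (6* *_) (cong (ν *_) (trans (Σ-cong (λ x → cong (ν *_) (trans (Σ-cong (λ y → cong (ν *_) (inner x y))) (Σ-*ˡ ν (λ y → lessᵏ y x * ι (toℕ y)))))) (trans (Σ-*ˡ ν (λ x → ν * Σ (λ y → lessᵏ y x * ι (toℕ y)))) (cong (ν *_) (Σ-*ˡ ν (λ x → Σ (λ y → lessᵏ y x * ι (toℕ y)))))))) ⟩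
      6* * (ν * (ν * (ν * Σ (λ x → Σ (λ y → lessᵏ y x * ι (toℕ y)))))) ≡⟨ trans (l₁ ν (Σ (λ x → Σ (λ y → lessᵏ y x * ι (toℕ y))))) (cong (λ z → ν * (ν * (ν * z))) (trans (cong (6* *_) (Σ-swap {N} {N} (λ x y → lessᵏ y x * ι (toℕ y)))) (sum-s N))) ⟩
      ν * (ν * (ν * (ι N * (ι N - 1ℚ) * (ι N - 2*)))) ≡⟨ trans (l₂ ν (ι N)) (cong (λ z → z * (z - ν) * (z - (ν + ν))) νN) ⟩
      1ℚ * (1ℚ - ν) * (1ℚ - (ν + ν)) ≡⟨ cong (_* (1ℚ - (ν + ν))) (ℚ.*-identityˡ (1ℚ - ν)) ⟩
      (1ℚ - ν) * (1ℚ - (ν + ν)) ∎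
      where
      open ≡-Reasoning
      inner : ∀ x y → Σ (λ z → chain x y z) ≡ lessᵏ y x * ι (toℕ y)
      inner x y = trans (Σ-*ʳ (lessᵏ y x) (λ z → lessᵏ z y)) (trans (ℚ.*-comm (Σ (λ z → lessᵏ z y)) (lessᵏ y x)) (cong (lessᵏ y x *_)
        (trans (Σ-cong (λ z → sym (ℚ.*-identityʳ (lessᵏ z y)))) (trans (Sum-below (λ _ → 1ℚ) (toℕ y) N (ℕP.<⇒≤ (FP.toℕ<n y))) (Sum-one (toℕ y))))))
      l₁ : ∀ ν s → (1ℚ + (1ℚ + 1ℚ)) * (1ℚ + 1ℚ) * (ν * (ν * (ν * s))) ≡ ν * (ν * (ν * ((1ℚ + (1ℚ + 1ℚ)) * (1ℚ + 1ℚ) * s)))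
      l₁ = solve-∀ ring
      l₂ : ∀ ν N → ν * (ν * (ν * (N * (N - 1ℚ) * (N - (1ℚ + 1ℚ))))) ≡ (ν * N) * (ν * N - ν) * (ν * N - (ν + ν))
      l₂ = solve-∀ ring

    triangles-mean : 6* * E (λ κ → Σ₃ (λ x y z → [ At.cond κ x y z ])) ≡ (1ℚ - ν) * (1ℚ - (ν + ν)) * transitive
    triangles-mean = begin
      6* * E (λ κ → Σ₃ (λ x y z → [ At.cond κ x y z ])) ≡⟨ cong (6* *_) (trans (E-Σ (λ x κ → Σ (λ y → Σ (λ z → [ At.cond κ x y z ])))) (Σ-cong (λ x → trans (E-Σ (λ y κ → Σ (λ z → [ At.cond κ x y z ]))) (Σ-cong (λ y → E-Σ (λ z κ → [ At.cond κ x y z ])))))) ⟩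
      6* * Σ₃ (λ x y z → E (λ κ → [ At.cond κ x y z ])) ≡⟨ cong (6* *_) (Σ₃-cong (λ x y z → point x y z (arc Tn x y) (arc Tn y z) (arc Tn x z) refl refl refl)) ⟩
      6* * Σ₃ (λ x y z → t x y z * M) ≡⟨ trans (cong (6* *_) (trans (Σ-cong (λ x → trans (Σ-cong (λ y → Σ-*ʳ M (t x y))) (Σ-*ʳ M (λ y → Σ (t x y))))) (Σ-*ʳ M (λ x → Σ (λ y → Σ (t x y)))))) (l transitive M) ⟩
      (6* * M) * transitive ≡⟨ cong (_* transitive) chain-mean ⟩
      (1ℚ - ν) * (1ℚ - (ν + ν)) * transitive ∎
      where
      open ≡-Reasoning
      t : Fin n → Fin n → Fin n → ℚ
      t x y z = [ arc Tn x y ] * ([ arc Tn y z ] * [ arc Tn x z ])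
      M : ℚ
      M = mean (λ x → mean (λ y → mean (λ z → chain x y z)))
      l : ∀ a m → (1ℚ + (1ℚ + 1ℚ)) * (1ℚ + 1ℚ) * (a * m) ≡ (1ℚ + (1ℚ + 1ℚ)) * (1ℚ + 1ℚ) * m * a
      l = solve-∀ ring
      point : ∀ x y z p q r → arc Tn x y ≡ p → arc Tn y z ≡ q → arc Tn x z ≡ r →
        E (λ κ → [ p ∧ (q ∧ (r ∧ ((key κ z <ᵇ key κ y) ∧ (key κ y <ᵇ key κ x)))) ]) ≡ [ p ] * ([ q ] * [ r ]) * M
      point x y z false q r _ _ _ = trans (E-const n 0ℚ) (sym (trans (cong (_* M) (ℚ.*-zeroˡ ([ q ] * [ r ]))) (ℚ.*-zeroˡ M)))
      point x y z true false r _ _ _ = trans (E-const n 0ℚ) (sym (trans (cong (λ z → 1ℚ * z * M) (ℚ.*-zeroˡ [ r ])) (ℚ.*-zeroˡ M)))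
      point x y z true true false _ _ _ = trans (E-const n 0ℚ) (sym (ℚ.*-zeroˡ M))
      point x y z true true true p q r = trans (E-cong (λ κ → [∧] (key κ z <ᵇ key κ y) (key κ y <ᵇ key κ x))) (trans (triple-mean (≢-arc p) (≢-arc r) (≢-arc q) chain) (sym (ℚ.*-identityˡ M)))

    slope : ℚ → ℚ → ℚ → ℕ → ℕ → ℚ
    slope α β γ y z = ν * (α * (ι z - ι y) + β * (ι N - ι z) + γ * ι y)

    -- With the keys y of the head `b` and z of the tail `a` fixed, the degree of the arc is a sum
    -- of independent contributions `X` of the vertices: a common out-neighbour counts below y, a
    -- common in-neighbour above z, and a middle vertex between them.
    module Excess (a b : Fin n) (ab : arc Tn a b ≡ true) (D η θ : ℚ) (0≤D : 0ℚ ≤ D) (0≤η : 0ℚ ≤ η) (0≤θ : 0ℚ ≤ θ) (ηθ : (1ℚ + 1ℚ + (1ℚ + 1ℚ)) * (η * θ) ≡ 1ℚ) where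

      err : ℚ
      err = η + θ * (ι n * (3* * 3*))

      0≤3 : 0ℚ ≤ 3*
      0≤3 = +-nn 0≤1 (+-nn 0≤1 0≤1)

      0≤err : 0ℚ ≤ err
      0≤err = +-nn 0≤η (*-nn 0≤θ (*-nn (ι-nn n) (*-nn 0≤3 0≤3)))

      X : ℕ → ℕ → Fin n → ℕ → ℚ
      X y z w k = [ below a b w ] * [ k <ᵇ y ] + ([ above a b w ] * [ z <ᵇ k ] + [ middle a b w ] * ([ y <ᵇ k ] * [ k <ᵇ z ]))

      ∧false : ∀ p → p ∧ false ≡ false
      ∧false = 𝔹.∧-zeroʳ

      X-at : ∀ y z w k → below a b w ≡ false → above a b w ≡ false → middle a b w ≡ false → X y z w k ≡ 0ℚ
      X-at y z w k p q r rewrite p | q | r = l [ k <ᵇ y ] [ z <ᵇ k ] ([ y <ᵇ k ] * [ k <ᵇ z ])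
        where
        l : ∀ u v w → 0ℚ * u + (0ℚ * v + 0ℚ * w) ≡ 0ℚ
        l = solve-∀ ring

      X-a : ∀ y z k → X y z a k ≡ 0ℚ
      X-a y z k = X-at y z a k (trans (cong (arc Tn b a ∧_) (arc-irr Tn a)) (∧false (arc Tn b a))) (cong (_∧ arc Tn a b) (arc-irr Tn a)) (cong (_∧ arc Tn a b) (arc-irr Tn a))

      X-b : ∀ y z k → X y z b k ≡ 0ℚ
      X-b y z k = X-at y z b k (cong (_∧ arc Tn a b) (arc-irr Tn b)) (trans (cong (arc Tn b a ∧_) (arc-irr Tn b)) (∧false (arc Tn b a))) (trans (cong (arc Tn a b ∧_) (arc-irr Tn b)) (∧false (arc Tn a b)))

      bit-nn : ∀ p q → 0ℚ ≤ [ p ] * [ q ]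
      bit-nn p q = *-nn ([]-nn p) ([]-nn q)
      bit≤1 : ∀ p x → 0ℚ ≤ x → x ≤ 1ℚ → [ p ] * x ≤ 1ℚ
      bit≤1 p x u v = ℚ.≤-trans (*-mono ([]-nn p) 0≤1 ([]≤1 p) v) (ℚ.≤-reflexive (ℚ.*-identityˡ 1ℚ))

      X-nn : ∀ y z w k → 0ℚ ≤ X y z w k
      X-nn y z w k = +-nn (bit-nn (below a b w) (k <ᵇ y)) (+-nn (bit-nn (above a b w) (z <ᵇ k)) (*-nn ([]-nn (middle a b w)) (bit-nn (y <ᵇ k) (k <ᵇ z))))

      X≤3 : ∀ y z w k → X y z w k ≤ 3*
      X≤3 y z w k = ℚ.+-mono-≤ (bit≤1 (below a b w) [ k <ᵇ y ] ([]-nn (k <ᵇ y)) ([]≤1 (k <ᵇ y))) (ℚ.+-mono-≤ (bit≤1 (above a b w) [ z <ᵇ k ] ([]-nn (z <ᵇ k)) ([]≤1 (z <ᵇ k)))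
        (bit≤1 (middle a b w) ([ y <ᵇ k ] * [ k <ᵇ z ]) (bit-nn (y <ᵇ k) (k <ᵇ z)) (bit≤1 (y <ᵇ k) [ k <ᵇ z ] ([]-nn (k <ᵇ z)) ([]≤1 (k <ᵇ z)))))

      codeg-of : (key : Fin n → ℕ) → ℚ
      codeg-of key = Σ (λ w → [ c key a b w ]) + (Σ (λ w → [ c key w a b ]) + Σ (λ w → [ c key a w b ]))
        where
        c : (Fin n → ℕ) → Fin n → Fin n → Fin n → Bool
        c key x y z = arc Tn x y ∧ (arc Tn y z ∧ (arc Tn x z ∧ ((key z <ᵇ key y) ∧ (key y <ᵇ key x))))

      codeg≡ : ∀ key y z → key b ≡ y → key a ≡ z → codeg-of key ≡ [ y <ᵇ z ] * Σ (λ w → X y z w (key w))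
      codeg≡ key y z refl refl rewrite ab = trans (cong (Σ u +_) (sym (Σ-+ v x))) (trans (sym (Σ-+ u (λ w → v w + x w))) (trans (Σ-cong (λ w →
          trans (cong₂ _+_ (first (arc Tn b w) (arc Tn a w) (key b <ᵇ key a) (key w <ᵇ key b)) (cong₂ _+_ (second (arc Tn w a) (arc Tn w b) (key b <ᵇ key a) (key a <ᵇ key w))
          (third (arc Tn a w) (arc Tn w b) (key b <ᵇ key a) (key b <ᵇ key w) (key w <ᵇ key a) (λ p q → <ᵇ-true (ℕP.<-trans (<ᵇ⇒< {key b} {key w} p) (<ᵇ⇒< {key w} {key a} q))))))
          (l [ key b <ᵇ key a ] ([ below a b w ] * [ key w <ᵇ key b ]) ([ above a b w ] * [ key a <ᵇ key w ]) ([ middle a b w ] * ([ key b <ᵇ key w ] * [ key w <ᵇ key a ])))))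
          (Σ-*ˡ [ key b <ᵇ key a ] (λ w → X (key b) (key a) w (key w)))))
        where
        u v x : Fin n → ℚ
        u w = [ arc Tn b w ∧ (arc Tn a w ∧ ((key w <ᵇ key b) ∧ (key b <ᵇ key a))) ]
        v w = [ arc Tn w a ∧ (arc Tn w b ∧ ((key b <ᵇ key a) ∧ (key a <ᵇ key w))) ]
        x w = [ arc Tn a w ∧ (arc Tn w b ∧ ((key b <ᵇ key w) ∧ (key w <ᵇ key a))) ]
        l : ∀ k p q r → k * p + (k * q + k * r) ≡ k * (p + (q + r))
        l = solve-∀ ring
        first : ∀ bw aw yz ky → [ bw ∧ (aw ∧ (ky ∧ yz)) ] ≡ [ yz ] * ([ bw ∧ aw ] * [ ky ])
        first false aw yz ky = trans (sym (ℚ.*-zeroʳ [ yz ])) (cong ([ yz ] *_) (sym (ℚ.*-zeroˡ [ ky ])))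
        first true false yz ky = trans (sym (ℚ.*-zeroʳ [ yz ])) (cong ([ yz ] *_) (sym (ℚ.*-zeroˡ [ ky ])))
        first true true yz ky = trans ([∧] ky yz) (trans (ℚ.*-comm [ ky ] [ yz ]) (cong ([ yz ] *_) (sym (ℚ.*-identityˡ [ ky ]))))
        second : ∀ wa wb yz zk → [ wa ∧ (wb ∧ (yz ∧ zk)) ] ≡ [ yz ] * ([ wa ∧ wb ] * [ zk ])
        second wa wb yz zk = trans (cong (λ t → [ wa ∧ (wb ∧ t) ]) (𝔹.∧-comm yz zk)) (first wa wb yz zk)
        third : ∀ aw wb yz yk kz → (yk ≡ true → kz ≡ true → yz ≡ true) → [ aw ∧ (wb ∧ (yk ∧ kz)) ] ≡ [ yz ] * ([ aw ∧ wb ] * ([ yk ] * [ kz ]))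
        third aw wb yz yk kz h = trans (cong (λ t → [ aw ∧ (wb ∧ t) ]) (between yk kz yz h)) (trans (first aw wb yz (yk ∧ kz)) (cong (λ t → [ yz ] * ([ aw ∧ wb ] * t)) ([∧] yk kz)))
          where
          between : ∀ p q r → (p ≡ true → q ≡ true → r ≡ true) → p ∧ q ≡ (p ∧ q) ∧ r
          between true true r h = sym (h refl refl)
          between true false r h = refl
          between false q r h = refl

      moved : Vec (Fin N) n → Fin N → Fin N → Vec (Fin N) n
      moved κ y z = (κ [ b ]≔ y) [ a ]≔ z

      -- The ends of the arc contribute nothing themselves (`X-a`, `X-b`), so fixing their keys does
      -- not disturb the sum.
      X-moved : ∀ κ y z w → X (toℕ y) (toℕ z) w (key (moved κ y z) w) ≡ X (toℕ y) (toℕ z) w (key κ w)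
      X-moved κ y z w with FP._≟_ w a | FP._≟_ w b
      ... | yes refl | _ = trans (X-a (toℕ y) (toℕ z) (key (moved κ y z) w)) (sym (X-a (toℕ y) (toℕ z) (key κ w)))
      ... | no _ | yes refl = trans (X-b (toℕ y) (toℕ z) (key (moved κ y z) w)) (sym (X-b (toℕ y) (toℕ z) (key κ w)))
      ... | no p | no q = cong (λ v → X (toℕ y) (toℕ z) w (toℕ v)) (trans (lookup∘update′ p (κ [ b ]≔ y) z) (lookup∘update′ q κ y))

      codeg-moved : ∀ κ y z → At.codeg (moved κ y z) a b ≡ lessᵏ y z * Σ (λ w → X (toℕ y) (toℕ z) w (key κ w))
      codeg-moved κ y z = trans (codeg≡ (key (moved κ y z)) (toℕ y) (toℕ z) (cong toℕ (trans (lookup∘update′ (λ e → ≢-arc ab (sym e)) (κ [ b ]≔ y) z) (lookup∘update b κ y))) (cong toℕ (lookup∘update a (κ [ b ]≔ y) z)))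
        (cong (lessᵏ y z *_) (Σ-cong (λ w → X-moved κ y z w)))

      slope-ab : ℕ → ℕ → ℚ
      slope-ab = slope (mid a b) (dom a b) (com a b)

      count-below : ∀ t → t ℕ.≤ N → Σ {N} (λ k → [ toℕ k <ᵇ t ]) ≡ ι t
      count-below t t≤N = trans (Σ-cong {N} (λ k → sym (ℚ.*-identityʳ [ toℕ k <ᵇ t ]))) (trans (Sum-below (λ _ → 1ℚ) t N t≤N) (Sum-one t))

      count-above : ∀ z → z ℕ.≤ N → Σ {N} (λ k → [ z <ᵇ toℕ k ]) ≤ ι N - ι z
      count-above z z≤N = ℚ.≤-trans (Σ-mono {N} (λ k → ≤-by (1ℚ - ([ z <ᵇ toℕ k ] + [ toℕ k <ᵇ z ])) (diff≥0 ([]-disjoint (z <ᵇ toℕ k) (toℕ k <ᵇ z) (λ e → <ᵇ-false (ℕP.<⇒≤ (<ᵇ⇒< {z} {toℕ k} e))))) (l [ z <ᵇ toℕ k ] [ toℕ k <ᵇ z ])))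
        (ℚ.≤-reflexive (trans (Σ-- {N} (λ _ → 1ℚ) (λ k → [ toℕ k <ᵇ z ])) (cong₂ _-_ (trans (Σ-const N 1ℚ) (ℚ.*-identityʳ (ι N))) (count-below z z≤N))))
        where
        l : ∀ p q → 1ℚ - q ≡ p + (1ℚ - (p + q))
        l = solve-∀ ring

      count-between : ∀ y z → y ℕ.< z → z ℕ.≤ N → Σ {N} (λ k → [ y <ᵇ toℕ k ] * [ toℕ k <ᵇ z ]) ≤ ι z - ι y
      count-between y z y<z z≤N = ℚ.≤-trans (Σ-mono {N} (λ k → point (toℕ k))) (ℚ.≤-reflexive (trans (Σ-- {N} (λ k → [ toℕ k <ᵇ z ]) (λ k → [ toℕ k <ᵇ y ])) (cong₂ _-_ (count-below z z≤N) (count-below y (ℕP.≤-trans (ℕP.<⇒≤ y<z) z≤N)))))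
        where
        cases : ∀ yk kz ky → (ky ≡ true → kz ≡ true) → (ky ≡ true → yk ≡ false) → [ yk ] * [ kz ] ≤ [ kz ] - [ ky ]
        cases yk kz true h g rewrite h refl | g refl = ℚ.≤-refl
        cases yk kz false h g = ℚ.≤-trans (*-monoʳ [ kz ] ([]-nn kz) ([]≤1 yk)) (ℚ.≤-reflexive (l [ kz ]))
          where
          l : ∀ x → 1ℚ * x ≡ x - 0ℚ
          l = solve-∀ ring
        point : ∀ k → [ y <ᵇ k ] * [ k <ᵇ z ] ≤ [ k <ᵇ z ] - [ k <ᵇ y ]
        point k = cases (y <ᵇ k) (k <ᵇ z) (k <ᵇ y) (λ e → <ᵇ-true (ℕP.<-trans (<ᵇ⇒< {k} {y} e) y<z)) (λ e → <ᵇ-false (ℕP.<⇒≤ (<ᵇ⇒< {k} {y} e)))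

      X-mean : ∀ y z → y ℕ.< z → z ℕ.≤ N → Σ (λ w → mean (λ k → X y z w (toℕ k))) ≤ slope-ab y z
      X-mean y z y<z z≤N = begin
        Σ {n} (λ w → ν * Σ {N} (λ k → X y z w (toℕ k))) ≤⟨ Σ-mono (λ w → *-monoˡ ν 0≤ν (ℚ.≤-trans (ℚ.≤-reflexive (split w)) (ℚ.+-mono-≤ (*-monoˡ [ below a b w ] ([]-nn (below a b w)) (ℚ.≤-reflexive (count-below y (ℕP.≤-trans (ℕP.<⇒≤ y<z) z≤N))))
            (ℚ.+-mono-≤ (*-monoˡ [ above a b w ] ([]-nn (above a b w)) (count-above z z≤N)) (*-monoˡ [ middle a b w ] ([]-nn (middle a b w)) (count-between y z y<z z≤N)))))) ⟩
        Σ (λ w → ν * (p w * ι y + (q w * (ι N - ι z) + s w * (ι z - ι y)))) ≡⟨ trans (Σ-*ˡ ν (λ w → p w * ι y + (q w * (ι N - ι z) + s w * (ι z - ι y)))) (cong (ν *_) (trans (Σ-+ (λ w → p w * ι y) (λ w → q w * (ι N - ι z) + s w * (ι z - ι y))) (cong₂ _+_ (Σ-*ʳ (ι y) p) (trans (Σ-+ (λ w → q w * (ι N - ι z)) (λ w → s w * (ι z - ι y))) (cong₂ _+_ (Σ-*ʳ (ι N - ι z) q) (Σ-*ʳ (ι z - ι y) s)))))) ⟩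
        ν * (com a b * ι y + (dom a b * (ι N - ι z) + mid a b * (ι z - ι y))) ≡⟨ cong (ν *_) (l (com a b * ι y) (dom a b * (ι N - ι z)) (mid a b * (ι z - ι y))) ⟩
        slope-ab y z ∎
        where
        open ℚ.≤-Reasoning
        p q s : Fin n → ℚ
        p w = [ below a b w ]
        q w = [ above a b w ]
        s w = [ middle a b w ]
        l : ∀ a b c → a + (b + c) ≡ c + b + a
        l = solve-∀ ring
        split : ∀ w → Σ {N} (λ k → X y z w (toℕ k)) ≡ p w * Σ {N} (λ k → [ toℕ k <ᵇ y ]) + (q w * Σ {N} (λ k → [ z <ᵇ toℕ k ]) + s w * Σ {N} (λ k → [ y <ᵇ toℕ k ] * [ toℕ k <ᵇ z ]))
        split w = trans (Σ-+ {N} (λ k → p w * [ toℕ k <ᵇ y ]) (λ k → q w * [ z <ᵇ toℕ k ] + s w * ([ y <ᵇ toℕ k ] * [ toℕ k <ᵇ z ]))) (cong₂ _+_ (Σ-*ˡ {N} (p w) (λ k → [ toℕ k <ᵇ y ]))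
          (trans (Σ-+ {N} (λ k → q w * [ z <ᵇ toℕ k ]) (λ k → s w * ([ y <ᵇ toℕ k ] * [ toℕ k <ᵇ z ]))) (cong₂ _+_ (Σ-*ˡ {N} (q w) (λ k → [ z <ᵇ toℕ k ])) (Σ-*ˡ {N} (s w) (λ k → [ y <ᵇ toℕ k ] * [ toℕ k <ᵇ z ])))))

      -- Conditions on the two keys of the arc. If the arc is not strictly backward in the keys, its
      -- degree 0 does not exceed `D`; otherwise `hinge-mean` replaces the degree by its mean at the
      -- price of `err`.
      excess-mean : E (λ κ → pos⁺ (At.codeg κ a b - D)) ≤ mean (λ z → mean (λ y → lessᵏ y z * pos⁺ (slope-ab (toℕ y) (toℕ z) - D))) + err
      excess-mean = begin
        E F ≡⟨ trans (resample a F) (mean-cong (λ z → resample b (λ κ → F (κ [ a ]≔ z)))) ⟩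
        mean (λ z → mean (λ y → E (λ κ → F (moved κ y z)))) ≤⟨ mean-mono (λ z → mean-mono (λ y → ℚ.≤-trans (ℚ.≤-reflexive (E-cong (λ κ → cong (λ c → pos⁺ (c - D)) (codeg-moved κ y z)))) (point y z (toℕ y <ᵇ toℕ z) refl))) ⟩
        mean (λ z → mean (λ y → lessᵏ y z * pos⁺ (slope-ab (toℕ y) (toℕ z) - D) + err)) ≡⟨ trans (mean-cong (λ z → trans (mean-+ (λ y → lessᵏ y z * pos⁺ (slope-ab (toℕ y) (toℕ z) - D)) (λ _ → err)) (cong (mean (λ y → lessᵏ y z * pos⁺ (slope-ab (toℕ y) (toℕ z) - D)) +_) (mean-const err)))) (trans (mean-+ (λ z → mean (λ y → lessᵏ y z * pos⁺ (slope-ab (toℕ y) (toℕ z) - D))) (λ _ → err)) (cong (mean (λ z → mean (λ y → lessᵏ y z * pos⁺ (slope-ab (toℕ y) (toℕ z) - D))) +_) (mean-const err))) ⟩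
        mean (λ z → mean (λ y → lessᵏ y z * pos⁺ (slope-ab (toℕ y) (toℕ z) - D))) + err ∎
        where
        open ℚ.≤-Reasoning
        F : Vec (Fin N) n → ℚ
        F κ = pos⁺ (At.codeg κ a b - D)
        S : Fin N → Fin N → Vec (Fin N) n → ℚ
        S y z κ = Σ (λ w → X (toℕ y) (toℕ z) w (key κ w))
        point : ∀ y z v → (toℕ y <ᵇ toℕ z) ≡ v → E (λ κ → pos⁺ ([ v ] * S y z κ - D)) ≤ [ v ] * pos⁺ (slope-ab (toℕ y) (toℕ z) - D) + err
        point y z false e = ℚ.≤-trans (E-mono (λ κ → pos⁺-least {0ℚ * S y z κ - D} {0ℚ} (≤-by D 0≤D (l (S y z κ) D)) ℚ.≤-refl)) (ℚ.≤-trans (ℚ.≤-reflexive (E-const n 0ℚ)) (+-nn (*-nn (ℚ.≤-refl {0ℚ}) (pos⁺-nn (slope-ab (toℕ y) (toℕ z) - D))) 0≤err))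
          where
          l : ∀ s D → 0ℚ ≡ 0ℚ * s - D + D
          l = solve-∀ ring
        point y z true e = begin
          E (λ κ → pos⁺ (1ℚ * S y z κ - D)) ≡⟨ E-cong (λ κ → cong (λ c → pos⁺ (c - D)) (ℚ.*-identityˡ (S y z κ))) ⟩
          E (λ κ → pos⁺ (S y z κ - D)) ≤⟨ hinge-mean (λ w k → X (toℕ y) (toℕ z) w (toℕ k)) 3* D η θ (λ w k → X-nn (toℕ y) (toℕ z) w (toℕ k)) (λ w k → X≤3 (toℕ y) (toℕ z) w (toℕ k)) 0≤3 0≤η 0≤θ ηθ ⟩
          pos⁺ (m - D) + err ≤⟨ ℚ.+-monoˡ-≤ err (pos⁺-mono (ℚ.+-monoˡ-≤ (- D) (X-mean (toℕ y) (toℕ z) (<ᵇ⇒< e) (ℕP.<⇒≤ (FP.toℕ<n z))))) ⟩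
          pos⁺ (slope-ab (toℕ y) (toℕ z) - D) + err ≡⟨ cong (_+ err) (sym (ℚ.*-identityˡ (pos⁺ (slope-ab (toℕ y) (toℕ z) - D)))) ⟩
          1ℚ * pos⁺ (slope-ab (toℕ y) (toℕ z) - D) + err ∎
          where
          m : ℚ
          m = Σ (λ w → mean (λ k → X (toℕ y) (toℕ z) w (toℕ k)))

-- Local weights on four vertices.

module FourVertices where
  open import Data.Nat.Base using (_≤ᵇ_)
  open import Data.Bool.Base using (T)
  open import Data.Rational.Base using (_+_; _*_; _≤_)
  open FiniteSums
  open Truncation using (Tournament; arc; arc-flip)

  bit : Bool → ℕ
  bit true = 1
  bit false = 0

  ι-bit : ∀ b → ι (bit b) ≡ [ b ]
  ι-bit true = ι-one
  ι-bit false = ι-zero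

  -- The rank of v in the order with roots x and y, from x → y, v → x and v → y.
  rank : Bool → Bool → Bool → Fin 4
  rank true true true = suc zero
  rank true true false = zero
  rank true false true = suc (suc zero)
  rank true false false = suc (suc (suc zero))
  rank false true true = zero
  rank false true false = suc zero
  rank false false true = suc (suc (suc zero))
  rank false false false = suc (suc zero)

  -- Twice the probability that an arc whose ends have ranks p and q points backward when ties are broken at random.
  back₂ : Fin 4 → Fin 4 → ℕ
  back₂ p q = if toℕ q <ᵇ toℕ p then 2 else (if toℕ p <ᵇ toℕ q then 0 else 1)

  -- The quadratic form of `upper`, polarised: indicators at two vertices enter bilinearly, so the
  -- sum over both vertices is the form at the counts. The coefficients are those of `upper` times
  -- 24².
  quadratic : ℕ → ℕ → ℕ → ℕ → ℕ → ℕ → ℕ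
  quadratic m d c m′ d′ c′ = (m ℕ.* m′) ℕ.* 340992 ℕ.+ ((d ℕ.* d′ ℕ.+ c ℕ.* c′) ℕ.* 186624
    ℕ.+ (((d ℕ.+ m) ℕ.* (d′ ℕ.+ m′) ℕ.+ (m ℕ.+ c) ℕ.* (m′ ℕ.+ c′)) ℕ.* 123264 ℕ.+ ((d ℕ.+ m ℕ.+ c) ℕ.* (d′ ℕ.+ m′ ℕ.+ c′)) ℕ.* 251136))

  -- Raised by 24 (31915 + 2 · 21349) = 1790712, cf. lower, so that no subtraction occurs.
  linear : ℕ → ℕ → ℕ → ℕ
  -- 1429512 = 2 · 24⁴ + 24 · 31915, where 2 · 24⁴ accounts for the transitive triangles on the arc;
  -- 512376 = 24 · 21349; 205466 = 204940 + 2104/4 contains the rounding variances, 2104 being the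
  -- sum of the coefficients of the squares.
  linear m̄ d̄ c̄ = m̄ ℕ.* 1429512 ℕ.+ ((d̄ ℕ.+ c̄) ℕ.* 512376 ℕ.+ 205466)

  abstract
    -- For an arc a → b, the vertices w and x are the two arguments of the polarised form in
    -- `random` and the two roots in `rooted`.
    random rooted : Bool → Bool → Bool → Bool → Bool → Bool → Bool → Bool → Bool → Bool → ℕ
    random ab aw wa wb bw ax xa xb bx wx = bit ab ℕ.* (linear (bit (not (aw ∧ wb))) (bit (not (wa ∧ wb))) (bit (not (bw ∧ aw)))
      ℕ.+ quadratic (bit (aw ∧ wb)) (bit (wa ∧ wb)) (bit (bw ∧ aw)) (bit (ax ∧ xb)) (bit (xa ∧ xb)) (bit (bx ∧ ax)))
    rooted ab aw wa wb bw ax xa xb bx wx = bit ab ℕ.* back₂ (rank wx aw ax) (rank wx bw bx)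

    random-eq : ∀ ab aw wa wb bw ax xa xb bx wx → random ab aw wa wb bw ax xa xb bx wx ≡ bit ab ℕ.* (linear (bit (not (aw ∧ wb))) (bit (not (wa ∧ wb))) (bit (not (bw ∧ aw)))
      ℕ.+ quadratic (bit (aw ∧ wb)) (bit (wa ∧ wb)) (bit (bw ∧ aw)) (bit (ax ∧ xb)) (bit (xa ∧ xb)) (bit (bx ∧ ax)))
    random-eq ab aw wa wb bw ax xa xb bx wx = refl

    rooted-eq : ∀ ab aw wa wb bw ax xa xb bx wx → rooted ab aw wa wb bw ax xa xb bx wx ≡ bit ab ℕ.* back₂ (rank wx aw ax) (rank wx bw bx)
    rooted-eq ab aw wa wb bw ax xa xb bx wx = refl

    -- The weights 114 : 11 of the two orders, over the common denominator 663552 = 2 · 24⁴ of random.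
    body : Bool → Bool → Bool → Bool → Bool → Bool → Bool → Bool → Bool → Bool → ℕ
    body ab aw wa wb bw ax xa xb bx wx = random ab aw wa wb bw ax xa xb bx wx ℕ.* 114 ℕ.+ rooted ab aw wa wb bw ax xa xb bx wx ℕ.* 7299072

    body-eq : ∀ ab aw wa wb bw ax xa xb bx wx → body ab aw wa wb bw ax xa xb bx wx ≡ random ab aw wa wb bw ax xa xb bx wx ℕ.* 114 ℕ.+ rooted ab aw wa wb bw ax xa xb bx wx ℕ.* 7299072
    body-eq ab aw wa wb bw ax xa xb bx wx = refl

  Predicate : ℕ → Set
  Predicate zero = Bool
  Predicate (suc k) = Bool → Predicate k

  Valid : ∀ k → Predicate k → Set
  Valid zero p = p ≡ true
  Valid (suc k) p = ∀ b → Valid k (p b)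

  valid? : ∀ k → Predicate k → Bool
  valid? zero p = p
  valid? (suc k) p = valid? k (p true) ∧ valid? k (p false)

  valid-sound : ∀ k p → valid? k p ≡ true → Valid k p
  valid-sound zero p e = e
  valid-sound (suc k) p e b with valid? k (p true) in t | valid? k (p false) in u
  valid-sound (suc k) p e true | true | true = valid-sound k (p true) t
  valid-sound (suc k) p e false | true | true = valid-sound k (p false) u

  module _ {A : Set} where
    -- Sums over the orderings of the first two, the first three and all four arguments, with 2, 6
    -- and 24 terms.
    pairs₂ triples₃ quads₄ : (A → A → A → A → ℕ) → A → A → A → A → ℕ
    pairs₂ f x y z w = f x y z w ℕ.+ f y x z w
    triples₃ f x y z w = pairs₂ f x y z w ℕ.+ (pairs₂ f x z y w ℕ.+ pairs₂ f y z x w)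
    quads₄ f x y z w = triples₃ f x y z w ℕ.+ (triples₃ f x y w z ℕ.+ (triples₃ f x z w y ℕ.+ triples₃ f y z w x))

    local : (A → A → Bool) → A → A → A → A → ℕ
    local e a b w x = body (e a b) (e a w) (e w a) (e w b) (e b w) (e a x) (e x a) (e x b) (e b x) (e w x)

  abstract
    -- The constant 257/2592 allows 3239198016 in place of `bound₄`; the difference 813552 pays for
    -- the errors. The crude `cap` serves for quadruples with repeated vertices.
    bound₄ cap : ℕ
    bound₄ = 3238384464
    cap = 500000000

    bound₄-eq : bound₄ ≡ 3238384464
    bound₄-eq = refl

    cap-eq : cap ≡ 500000000
    cap-eq = refl

  -- A tournament given by twelve Booleans, on which the sum over all orderings evaluates;
  -- `value-at` identifies it by computation with the sum at four arbitrary vertices.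
  module Table (ab ba ac ca ad da bc cb bd db cd dc : Bool) where
    table : Fin 4 → Fin 4 → Bool
    table zero (suc zero) = ab
    table (suc zero) zero = ba
    table zero (suc (suc zero)) = ac
    table (suc (suc zero)) zero = ca
    table zero (suc (suc (suc zero))) = ad
    table (suc (suc (suc zero))) zero = da
    table (suc zero) (suc (suc zero)) = bc
    table (suc (suc zero)) (suc zero) = cb
    table (suc zero) (suc (suc (suc zero))) = bd
    table (suc (suc (suc zero))) (suc zero) = db
    table (suc (suc zero)) (suc (suc (suc zero))) = cd
    table (suc (suc (suc zero))) (suc (suc zero)) = dc
    table _ _ = false

    value : ℕ
    value = quads₄ (local table) zero (suc zero) (suc (suc zero)) (suc (suc (suc zero)))

  ≤ᵇ⇒≤ : ∀ m n → (m ≤ᵇ n) ≡ true → m ℕ.≤ n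
  ≤ᵇ⇒≤ m n p = ℕP.≤ᵇ⇒≤ m n (subst T (sym p) tt)

  abstract
    check₄ : ∀ ab ac ad bc bd cd → (Table.value ab (not ab) ac (not ac) ad (not ad) bc (not bc) bd (not bd) cd (not cd) ≤ᵇ bound₄) ≡ true
    check₄ = valid-sound 6 (λ ab ac ad bc bd cd → Table.value ab (not ab) ac (not ac) ad (not ad) bc (not bc) bd (not bd) cd (not cd) ≤ᵇ bound₄) refl

    check-body : ∀ ab aw wa wb bw ax xa xb bx wx → (body ab aw wa wb bw ax xa xb bx wx ≤ᵇ cap) ≡ true
    check-body = valid-sound 10 (λ ab aw wa wb bw ax xa xb bx wx → body ab aw wa wb bw ax xa xb bx wx ≤ᵇ cap) refl

  module _ {n : ℕ} (Tn : Tournament n) where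
    private
      t : Fin n → Fin n → Bool
      t = arc Tn

    value-at : ∀ a b c d → quads₄ (local t) a b c d ≡ Table.value (t a b) (t b a) (t a c) (t c a) (t a d) (t d a) (t b c) (t c b) (t b d) (t d b) (t c d) (t d c)
    value-at a b c d = refl

    quads-distinct : ∀ a b c d → (a == b) ≡ false → (a == c) ≡ false → (a == d) ≡ false → (b == c) ≡ false → (b == d) ≡ false → (c == d) ≡ false →
      quads₄ (local t) a b c d ℕ.≤ bound₄
    quads-distinct a b c d ab ac ad bc bd cd = ℕP.≤-trans (ℕP.≤-reflexive (trans (value-at a b c d) flipped)) (≤ᵇ⇒≤ _ _ (check₄ (t a b) (t a c) (t a d) (t b c) (t b d) (t c d)))
      where
      flipped : Table.value (t a b) (t b a) (t a c) (t c a) (t a d) (t d a) (t b c) (t c b) (t b d) (t d b) (t c d) (t d c)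
        ≡ Table.value (t a b) (not (t a b)) (t a c) (not (t a c)) (t a d) (not (t a d)) (t b c) (not (t b c)) (t b d) (not (t b d)) (t c d) (not (t c d))
      flipped rewrite arc-flip Tn a b ab | arc-flip Tn a c ac | arc-flip Tn a d ad | arc-flip Tn b c bc | arc-flip Tn b d bd | arc-flip Tn c d cd = refl

    local-small : ∀ a b c d → local t a b c d ℕ.≤ cap
    local-small a b c d = ≤ᵇ⇒≤ _ _ (check-body (t a b) (t a c) (t c a) (t c b) (t b c) (t a d) (t d a) (t d b) (t b d) (t c d))

-- Sums over quadruples of vertices.

module Quadruples where
  open import Data.Rational.Base using (ℚ; 0ℚ; 1ℚ; _+_; _*_; _≤_)
  open FiniteSums
  open Truncation using (Tournament; arc)
  open FourVertices

  cap₂ cap₃ cap₄ : ℕ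
  cap₂ = cap ℕ.+ cap
  cap₃ = cap₂ ℕ.+ (cap₂ ℕ.+ cap₂)
  cap₄ = cap₃ ℕ.+ (cap₃ ℕ.+ (cap₃ ℕ.+ cap₃))

  module _ {n : ℕ} where
    Σ₄ : (Fin n → Fin n → Fin n → Fin n → ℚ) → ℚ
    Σ₄ f = Σ (λ a → Σ (λ b → Σ (λ c → Σ (λ d → f a b c d))))

    Σ₄-cong : ∀ {f g : Fin n → Fin n → Fin n → Fin n → ℚ} → (∀ a b c d → f a b c d ≡ g a b c d) → Σ₄ f ≡ Σ₄ g
    Σ₄-cong p = Σ-cong (λ a → Σ-cong (λ b → Σ-cong (λ c → Σ-cong (λ d → p a b c d))))

    Σ₄-mono : ∀ {f g : Fin n → Fin n → Fin n → Fin n → ℚ} → (∀ a b c d → f a b c d ≤ g a b c d) → Σ₄ f ≤ Σ₄ g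
    Σ₄-mono p = Σ-mono (λ a → Σ-mono (λ b → Σ-mono (λ c → Σ-mono (λ d → p a b c d))))

    Σ₄-+ : ∀ (f g : Fin n → Fin n → Fin n → Fin n → ℚ) → Σ₄ (λ a b c d → f a b c d + g a b c d) ≡ Σ₄ f + Σ₄ g
    Σ₄-+ f g = trans (Σ-cong (λ a → trans (Σ-cong (λ b → trans (Σ-cong (λ c → Σ-+ (f a b c) (g a b c))) (Σ-+ (λ c → Σ (f a b c)) (λ c → Σ (g a b c))))) (Σ-+ (λ b → Σ (λ c → Σ (f a b c))) (λ b → Σ (λ c → Σ (g a b c))))))
      (Σ-+ (λ a → Σ (λ b → Σ (λ c → Σ (f a b c)))) (λ a → Σ (λ b → Σ (λ c → Σ (g a b c)))))

    Σ₄-* : ∀ k (f : Fin n → Fin n → Fin n → Fin n → ℚ) → Σ₄ (λ a b c d → k * f a b c d) ≡ k * Σ₄ f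
    Σ₄-* k f = trans (Σ-cong (λ a → trans (Σ-cong (λ b → trans (Σ-cong (λ c → Σ-*ˡ k (f a b c))) (Σ-*ˡ k (λ c → Σ (f a b c))))) (Σ-*ˡ k (λ b → Σ (λ c → Σ (f a b c)))))) (Σ-*ˡ k (λ a → Σ (λ b → Σ (λ c → Σ (f a b c)))))

    Σ₄-swap₁ : ∀ (f : Fin n → Fin n → Fin n → Fin n → ℚ) → Σ₄ (λ a b c d → f b a c d) ≡ Σ₄ f
    Σ₄-swap₁ f = Σ-swap (λ a b → Σ (λ c → Σ (f b a c)))

    Σ₄-swap₂ : ∀ (f : Fin n → Fin n → Fin n → Fin n → ℚ) → Σ₄ (λ a b c d → f a c b d) ≡ Σ₄ f
    Σ₄-swap₂ f = Σ-cong (λ a → Σ-swap (λ b c → Σ (f a c b)))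

    Σ₄-swap₃ : ∀ (f : Fin n → Fin n → Fin n → Fin n → ℚ) → Σ₄ (λ a b c d → f a b d c) ≡ Σ₄ f
    Σ₄-swap₃ f = Σ-cong (λ a → Σ-cong (λ b → Σ-swap (λ c d → f a b d c)))

    Σ₄-const : ∀ k → Σ₄ (λ _ _ _ _ → k) ≡ ι n * (ι n * (ι n * (ι n * k)))
    Σ₄-const k = trans (Σ-cong {n} (λ _ → trans (Σ-cong {n} (λ _ → trans (Σ-cong {n} (λ _ → Σ-const n k)) (Σ-const n (ι n * k)))) (Σ-const n (ι n * (ι n * k))))) (Σ-const n (ι n * (ι n * (ι n * k))))

    diagonal : Σ₄ (λ a b c d → [ a == b ]) ≡ ι n * (ι n * ι n)
    diagonal = trans (Σ-swap {n} {n} (λ a b → Σ {n} (λ c → Σ {n} (λ d → [ a == b ])))) (trans (Σ-cong {n} (λ b → trans (Σ-cong {n} (λ a → trans (Σ-cong {n} (λ c → Σ-const n [ a == b ])) (trans (Σ-const n (ι n * [ a == b ])) (l (ι n) [ a == b ])))) (Σ-δ b (λ _ → ι n * ι n)))) (Σ-const n (ι n * ι n)))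
      where
      l : ∀ x e → x * (x * e) ≡ e * (x * x)
      l = solve-∀ ring

    -- At least 1 on every quadruple with a repeated vertex, while its total is only of order n³.
    coincidences : Fin n → Fin n → Fin n → Fin n → ℚ
    coincidences a b c d = [ a == b ] + ([ a == c ] + ([ a == d ] + ([ b == c ] + ([ b == d ] + [ c == d ]))))

    6ⁿ : ℚ → ℚ
    6ⁿ x = x + (x + (x + (x + (x + x))))

    coincidences-sum : Σ₄ coincidences ≡ 6ⁿ (ι n * (ι n * ι n))
    coincidences-sum = trans (Σ₄-+ ab _) (cong₂ _+_ diagonal (trans (Σ₄-+ ac _) (cong₂ _+_ ac≡ (trans (Σ₄-+ ad _) (cong₂ _+_ ad≡ (trans (Σ₄-+ bc _) (cong₂ _+_ bc≡ (trans (Σ₄-+ bd cd) (cong₂ _+_ bd≡ cd≡)))))))))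
      where
      ab ac ad bc bd cd : Fin n → Fin n → Fin n → Fin n → ℚ
      ab a b c d = [ a == b ]
      ac a b c d = [ a == c ]
      ad a b c d = [ a == d ]
      bc a b c d = [ b == c ]
      bd a b c d = [ b == d ]
      cd a b c d = [ c == d ]
      ac≡ : Σ₄ ac ≡ ι n * (ι n * ι n)
      ac≡ = trans (Σ₄-swap₂ ab) diagonal
      ad≡ : Σ₄ ad ≡ ι n * (ι n * ι n)
      ad≡ = trans (Σ₄-swap₃ ac) ac≡
      bc≡ : Σ₄ bc ≡ ι n * (ι n * ι n)
      bc≡ = trans (Σ₄-swap₁ ac) ac≡
      bd≡ : Σ₄ bd ≡ ι n * (ι n * ι n)
      bd≡ = trans (Σ₄-swap₁ ad) ad≡
      cd≡ : Σ₄ cd ≡ ι n * (ι n * ι n)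
      cd≡ = trans (Σ₄-swap₂ bd) bd≡

    total : (Fin n → Fin n → Fin n → Fin n → ℕ) → ℚ
    total f = Σ₄ (λ a b c d → ι (f a b c d))

    total-+ : ∀ f g → total (λ a b c d → f a b c d ℕ.+ g a b c d) ≡ total f + total g
    total-+ f g = trans (Σ₄-cong (λ a b c d → ι-+ (f a b c d) (g a b c d))) (Σ₄-+ (λ a b c d → ι (f a b c d)) (λ a b c d → ι (g a b c d)))

    total-pairs : ∀ f → total (pairs₂ f) ≡ total f + total f
    total-pairs f = trans (total-+ f (λ a b c d → f b a c d)) (cong (total f +_) (Σ₄-swap₁ (λ a b c d → ι (f a b c d))))

    total-triples : ∀ f → total (triples₃ f) ≡ total (pairs₂ f) + (total (pairs₂ f) + total (pairs₂ f))
    total-triples f = trans (total-+ p (λ a b c d → p a c b d ℕ.+ p b c a d)) (cong (total p +_) (trans (total-+ (λ a b c d → p a c b d) (λ a b c d → p b c a d)) (cong₂ _+_ (Σ₄-swap₂ P) (trans (Σ₄-swap₁ (λ a b c d → P a c b d)) (Σ₄-swap₂ P)))))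
      where
      p = pairs₂ f
      P : Fin n → Fin n → Fin n → Fin n → ℚ
      P a b c d = ι (p a b c d)

    total-quads : ∀ f → total (quads₄ f) ≡ total (triples₃ f) + (total (triples₃ f) + (total (triples₃ f) + total (triples₃ f)))
    total-quads f = trans (total-+ p (λ a b c d → p a b d c ℕ.+ (p a c d b ℕ.+ p b c d a))) (cong (total p +_) (trans (total-+ (λ a b c d → p a b d c) (λ a b c d → p a c d b ℕ.+ p b c d a)) (cong₂ _+_ (Σ₄-swap₃ P)
        (trans (total-+ (λ a b c d → p a c d b) (λ a b c d → p b c d a)) (cong₂ _+_ q (trans (Σ₄-swap₁ (λ a b c d → P a c d b)) q))))))
      where
      p = triples₃ f
      P : Fin n → Fin n → Fin n → Fin n → ℚ
      P a b c d = ι (p a b c d)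
      q : Σ₄ (λ a b c d → P a c d b) ≡ Σ₄ P
      q = trans (Σ₄-swap₂ (λ a b c d → P a b d c)) (Σ₄-swap₃ P)

    24ⁿ : ℚ → ℚ
    24ⁿ x = let y = (x + x) + ((x + x) + (x + x)) in y + (y + (y + y))

    symmetrise : ∀ f → total (quads₄ f) ≡ 24ⁿ (total f)
    symmetrise f = trans (total-quads f) (cong (λ t → t + (t + (t + t))) (trans (total-triples f) (cong (λ t → t + (t + t)) (total-pairs f))))

    module _ (Tn : Tournament n) where
      private
        h : Fin n → Fin n → Fin n → Fin n → ℕ
        h = local (arc Tn)

      quads-crude : ∀ a b c d → quads₄ h a b c d ℕ.≤ cap₄
      quads-crude a b c d = ℕP.+-mono-≤ (t a b c d) (ℕP.+-mono-≤ (t a b d c) (ℕP.+-mono-≤ (t a c d b) (t b c d a)))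
        where
        p : ∀ a b c d → pairs₂ h a b c d ℕ.≤ cap₂
        p a b c d = ℕP.+-mono-≤ (local-small Tn a b c d) (local-small Tn b a c d)
        t : ∀ a b c d → triples₃ h a b c d ℕ.≤ cap₃
        t a b c d = ℕP.+-mono-≤ (p a b c d) (ℕP.+-mono-≤ (p a c b d) (p b c a d))

      module _ (C K : ℚ) (C≡ : ι bound₄ ≡ C) (K≡ : ι cap₄ ≡ K) where

        0≤C : 0ℚ ≤ C
        0≤C = subst (0ℚ ≤_) C≡ (ι-nn bound₄)
        0≤K : 0ℚ ≤ K
        0≤K = subst (0ℚ ≤_) K≡ (ι-nn cap₄)

        -- Distinct vertices are covered by `C`; otherwise the first coincident pair brings in `K`,
        -- which bounds the sum in any case.
        pointwise : ∀ a b c d → ι (quads₄ h a b c d) ≤ C + K * coincidences a b c d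
        pointwise a b c d = go (a == b) (a == c) (a == d) (b == c) (b == d) (c == d) refl refl refl refl refl refl
          where
          Q : ℚ
          Q = ι (quads₄ h a b c d)
          hit : ∀ s → 1ℚ ≤ s → Q ≤ C + K * s
          hit s 1≤s = ℚ.≤-trans (subst (Q ≤_) K≡ (ι-mono (quads-crude a b c d))) (ℚ.≤-trans (subst (_≤ K * s) (ℚ.*-identityʳ K) (*-monoˡ K 0≤K 1≤s)) (≤-by C 0≤C (ℚ.+-comm C (K * s))))
          head : ∀ {x} → 0ℚ ≤ x → 1ℚ ≤ 1ℚ + x
          head {x} p = ≤-by x p refl
          tail : ∀ {x} b → 1ℚ ≤ x → 1ℚ ≤ [ b ] + x
          tail {x} b p = ℚ.≤-trans p (≤-by [ b ] ([]-nn b) (ℚ.+-comm [ b ] x))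
          n₁ : ∀ f → 0ℚ ≤ [ f ]
          n₁ = []-nn
          n₂ : ∀ e f → 0ℚ ≤ [ e ] + [ f ]
          n₂ e f = +-nn (n₁ e) (n₁ f)
          n₃ : ∀ d e f → 0ℚ ≤ [ d ] + ([ e ] + [ f ])
          n₃ d e f = +-nn (n₁ d) (n₂ e f)
          n₄ : ∀ c d e f → 0ℚ ≤ [ c ] + ([ d ] + ([ e ] + [ f ]))
          n₄ c d e f = +-nn (n₁ c) (n₃ d e f)
          n₅ : ∀ b c d e f → 0ℚ ≤ [ b ] + ([ c ] + ([ d ] + ([ e ] + [ f ])))
          n₅ b c d e f = +-nn (n₁ b) (n₄ c d e f)
          go : ∀ p q r s t u → (a == b) ≡ p → (a == c) ≡ q → (a == d) ≡ r → (b == c) ≡ s → (b == d) ≡ t → (c == d) ≡ u →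
            Q ≤ C + K * ([ p ] + ([ q ] + ([ r ] + ([ s ] + ([ t ] + [ u ])))))
          go true q r s t u _ _ _ _ _ _ = hit _ (head (n₅ q r s t u))
          go false true r s t u _ _ _ _ _ _ = hit _ (tail false (head (n₄ r s t u)))
          go false false true s t u _ _ _ _ _ _ = hit _ (tail false (tail false (head (n₃ s t u))))
          go false false false true t u _ _ _ _ _ _ = hit _ (tail false (tail false (tail false (head (n₂ t u)))))
          go false false false false true u _ _ _ _ _ _ = hit _ (tail false (tail false (tail false (tail false (head (n₁ u))))))
          go false false false false false true _ _ _ _ _ _ = hit _ (tail false (tail false (tail false (tail false (tail false ℚ.≤-refl)))))
          go false false false false false false ab ac ad bc bd cd = ℚ.≤-trans (subst (Q ≤_) C≡ (ι-mono (quads-distinct Tn a b c d ab ac ad bc bd cd))) (≤-by (K * z) (*-nn 0≤K (n₅ false false false false false)) refl)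
            where
            z : ℚ
            z = [ false ] + ([ false ] + ([ false ] + ([ false ] + ([ false ] + [ false ]))))

        local-total : 24ⁿ (total h) ≤ ι n * (ι n * (ι n * (ι n * C))) + K * 6ⁿ (ι n * (ι n * ι n))
        local-total = begin
          24ⁿ (total h) ≡⟨ sym (symmetrise h) ⟩
          total (quads₄ h) ≤⟨ Σ₄-mono pointwise ⟩
          Σ₄ (λ a b c d → C + K * coincidences a b c d) ≡⟨ trans (Σ₄-+ (λ _ _ _ _ → C) (λ a b c d → K * coincidences a b c d)) (cong₂ _+_ (Σ₄-const C) (trans (Σ₄-* K coincidences) (cong (K *_) coincidences-sum))) ⟩
          ι n * (ι n * (ι n * (ι n * C))) + K * 6ⁿ (ι n * (ι n * ι n)) ∎
          where open ℚ.≤-Reasoning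

-- Orders determined by two roots.

module TwoRoots where
  open Subset using (Subset; ∣_∣)
  open import Data.Rational.Base using (ℚ; 0ℚ; 1ℚ; _+_; _*_; _≤_; _<_)
  open FiniteSums
  open Truncation
  open BackwardTriangles
  open Extraction
  open TriangularSums
  open IndependentKeys using (least)
  open KeyedOrder using ([]-disjoint; <ᵇ⇒<; <ᵇ⇒≥)
  open FourVertices
  open Quadruples

  Decycled : ∀ {n} → Digraph n → ℕ → Set
  Decycled {n} A k = ∃[ Xs ] (length Xs ≡ k × All (λ (X : Subset n) → ∣ X ∣ ℕ.≤ 3) Xs × Acyclic (invertAll Xs A))

  4* : ℚ
  4* = 1ℚ + 1ℚ + (1ℚ + 1ℚ)

  opposite-< : ∀ {n} {i j : Fin n} → toℕ i ℕ.< toℕ j → toℕ (opposite j) ℕ.< toℕ (opposite i)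
  opposite-< {n} {i} {j} p = subst₂ ℕ._<_ (sym (FP.opposite-prop j)) (sym (FP.opposite-prop i)) (ℕP.∸-monoʳ-< {n} {suc (toℕ j)} {suc (toℕ i)} (ℕ.s≤s p) (FP.toℕ<n j))

  opposite-injective : ∀ {n} {i j : Fin n} → opposite i ≡ opposite j → i ≡ j
  opposite-injective {i = i} {j} e = trans (sym (FP.opposite-involutive i)) (trans (cong opposite e) (FP.opposite-involutive j))

  -- Ties in rank are broken by the index in one order and by the opposite index in the other.
  -- Averaging these two orders counts an arc inside a tie as half backward, which replaces random
  -- tie breaking.
  module Rooted {n : ℕ} (Tn : Tournament n) (x y : Fin n) where

    rk : Fin n → Fin 4
    rk v = rank (arc Tn x y) (arc Tn v x) (arc Tn v y)

    key pos₁ pos₂ : Fin n → ℕ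
    key v = toℕ (rk v)
    pos₁ v = toℕ (combine (rk v) v)
    pos₂ v = toℕ (combine (rk v) (opposite v))

    pos₁-inj : ∀ i j → pos₁ i ≡ pos₁ j → i ≡ j
    pos₁-inj i j e = FP.combine-injectiveʳ (rk i) i (rk j) j (FP.toℕ-injective e)

    pos₂-inj : ∀ i j → pos₂ i ≡ pos₂ j → i ≡ j
    pos₂-inj i j e = opposite-injective (FP.combine-injectiveʳ (rk i) (opposite i) (rk j) (opposite j) (FP.toℕ-injective e))

    pos₁-key : ∀ i j → key i ℕ.< key j → pos₁ i ℕ.< pos₁ j
    pos₁-key i j lt = FP.combine-monoˡ-< i j lt

    pos₂-key : ∀ i j → key i ℕ.< key j → pos₂ i ℕ.< pos₂ j
    pos₂-key i j lt = FP.combine-monoˡ-< (opposite i) (opposite j) lt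

    module O₁ = Ordered Tn key pos₁ pos₁-inj pos₁-key
    module O₂ = Ordered Tn key pos₂ pos₂-inj pos₂-key
    module X₁ = Extract Tn key pos₁ pos₁-inj pos₁-key
    module X₂ = Extract Tn key pos₂ pos₂-inj pos₂-key

    pos₁-tie : ∀ i j → key i ≡ key j → pos₁ i ℕ.< pos₁ j → toℕ i ℕ.< toℕ j
    pos₁-tie i j e p = ℕP.+-cancelˡ-< (n ℕ.* key i) (toℕ i) (toℕ j) (subst₂ ℕ._<_ (FP.toℕ-combine (rk i) i) (trans (FP.toℕ-combine (rk j) j) (cong (λ k → n ℕ.* k ℕ.+ toℕ j) (sym e))) p)

    pos₂-tie : ∀ i j → key i ≡ key j → toℕ (opposite i) ℕ.< toℕ (opposite j) → pos₂ i ℕ.< pos₂ j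
    pos₂-tie i j e p = subst₂ ℕ._<_ (sym (FP.toℕ-combine (rk i) (opposite i))) (sym (trans (FP.toℕ-combine (rk j) (opposite j)) (cong (λ k → n ℕ.* k ℕ.+ toℕ (opposite j)) (sym e)))) (ℕP.+-monoʳ-< (n ℕ.* key i) p)

    backward : Fin n → Fin n → ℚ
    backward a b = [ arc Tn a b ] * ι (back₂ (rk a) (rk b))

    -- Inside a tie the two orders disagree, so the arc is backward in at most one of them.
    late : ∀ a b → [ O₁.before b a ] + [ O₂.before b a ] ≤ ι (back₂ (rk a) (rk b))
    late a b = go (key b <ᵇ key a) (key a <ᵇ key b) refl refl
      where
      go : ∀ p q → (key b <ᵇ key a) ≡ p → (key a <ᵇ key b) ≡ q → [ O₁.before b a ] + [ O₂.before b a ] ≤ ι (back₂ (rk a) (rk b))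
      go true q e f rewrite e = ℚ.≤-trans (ℚ.+-mono-≤ ([]≤1 (O₁.before b a)) ([]≤1 (O₂.before b a))) (ℚ.≤-reflexive (sym (trans (ι-suc 1) (cong (1ℚ +_) ι-one))))
      go false true e f rewrite e | f = ℚ.≤-reflexive (trans (cong₂ (λ u v → [ u ] + [ v ]) (<ᵇ-false (ℕP.<⇒≤ (pos₁-key a b (<ᵇ⇒< f)))) (<ᵇ-false (ℕP.<⇒≤ (pos₂-key a b (<ᵇ⇒< f))))) (sym ι-zero))
      go false false e f rewrite e | f = ℚ.≤-trans ([]-disjoint (O₁.before b a) (O₂.before b a) (λ p → <ᵇ-false (ℕP.<⇒≤ (pos₂-tie a b (sym tie) (opposite-< (pos₁-tie b a tie (<ᵇ⇒< p))))))) (ℚ.≤-reflexive (sym ι-one))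
        where
        tie : key b ≡ key a
        tie = ℕP.≤-antisym (<ᵇ⇒≥ f) (<ᵇ⇒≥ e)

    total-backward : ℚ
    total-backward = Σ (λ a → Σ (λ b → backward a b))

    feedback-sum : O₁.feedback + O₂.feedback ≤ total-backward
    feedback-sum = ℚ.≤-trans (ℚ.≤-reflexive (trans (sym (Σ-+ (λ a → Σ (λ b → [ arc Tn a b ] * [ O₁.before b a ])) (λ a → Σ (λ b → [ arc Tn a b ] * [ O₂.before b a ])))) (Σ-cong (λ a → trans (sym (Σ-+ (λ b → [ arc Tn a b ] * [ O₁.before b a ]) (λ b → [ arc Tn a b ] * [ O₂.before b a ]))) (Σ-cong (λ b → sym (ℚ.*-distribˡ-+ [ arc Tn a b ] [ O₁.before b a ] [ O₂.before b a ])))))))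
      (Σ-mono (λ a → Σ-mono (λ b → *-monoˡ [ arc Tn a b ] ([]-nn (arc Tn a b)) (late a b))))

    -- `e₂` is twice the number of backward arcs, and for the better of the two orders this is at
    -- most the sum over both.
    rooted-cost : ∀ A → Oriented A → (∀ i j → A i j ≡ true → arc Tn i j ≡ true) → ∀ s → 0ℚ ≤ s → ι n * (ι n * ι n + ι n * ι n) < s * s →
      ∃[ k ] (Decycled A k × 4* * ι k ≤ total-backward + s)
    rooted-cost A orA sub s 0≤s large with ℚ.≤-total O₁.feedback O₂.feedback
    ... | inj₁ p = let k , C , bound = X₁.plain-cost s 0≤s large in k , X₁.decycle A orA sub C ,
          ℚ.≤-trans bound (ℚ.+-monoˡ-≤ s (ℚ.≤-trans (ℚ.≤-reflexive (trans O₁.e₂-back (l O₁.feedback))) (ℚ.≤-trans (ℚ.+-monoʳ-≤ O₁.feedback p) feedback-sum)))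
      where
      l : ∀ f → (1ℚ + 1ℚ) * f ≡ f + f
      l = solve-∀ ring
    ... | inj₂ p = let k , C , bound = X₂.plain-cost s 0≤s large in k , X₂.decycle A orA sub C ,
          ℚ.≤-trans bound (ℚ.+-monoˡ-≤ s (ℚ.≤-trans (ℚ.≤-reflexive (trans O₂.e₂-back (l O₂.feedback))) (ℚ.≤-trans (ℚ.+-monoˡ-≤ O₂.feedback p) feedback-sum)))
      where
      l : ∀ f → (1ℚ + 1ℚ) * f ≡ f + f
      l = solve-∀ ring

  module _ {n : ℕ} (Tn : Tournament n) where

    rooted-local : Fin n → Fin n → Fin n → Fin n → ℕ
    rooted-local a b w x = rooted (arc Tn a b) (arc Tn a w) (arc Tn w a) (arc Tn w b) (arc Tn b w) (arc Tn a x) (arc Tn x a) (arc Tn x b) (arc Tn b x) (arc Tn w x)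

    backward-total : Σ (λ w → Σ (λ x → Rooted.total-backward Tn w x)) ≡ total rooted-local
    backward-total = begin
      Σ₄ (λ w x a b → Rooted.backward Tn w x a b) ≡⟨ Σ₄-cong (λ w x a b → sym (trans (cong ι (rooted-eq (arc Tn a b) (arc Tn a w) (arc Tn w a) (arc Tn w b) (arc Tn b w) (arc Tn a x) (arc Tn x a) (arc Tn x b) (arc Tn b x) (arc Tn w x))) (trans (ι-* (bit (arc Tn a b)) (back₂ (Rooted.rk Tn w x a) (Rooted.rk Tn w x b))) (cong (_* ι (back₂ (Rooted.rk Tn w x a) (Rooted.rk Tn w x b))) (ι-bit (arc Tn a b)))))) ⟩
      Σ₄ (λ w x a b → G a b w x) ≡⟨ sym (Σ₄-swap₂ (λ w x a b → G a b w x)) ⟩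
      Σ₄ (λ w x a b → G x b w a) ≡⟨ sym (Σ₄-swap₁ (λ w x a b → G x b w a)) ⟩
      Σ₄ (λ w x a b → G w b x a) ≡⟨ Σ₄-swap₃ (λ w x b a → G w b x a) ⟩
      Σ₄ (λ w x b a → G w b x a) ≡⟨ Σ₄-swap₂ G ⟩
      Σ₄ G ∎
      where
      open ≡-Reasoning
      G : Fin n → Fin n → Fin n → Fin n → ℚ
      G a b w x = ι (rooted-local a b w x)

    -- Some pair of roots does at least as well as the mean over all n² pairs, equal roots included.
    rooted-average : n ≢ 0 → ∀ A → Oriented A → (∀ i j → A i j ≡ true → arc Tn i j ≡ true) → ∀ s → 0ℚ ≤ s → ι n * (ι n * ι n + ι n * ι n) < s * s →
      ∃[ k ] (Decycled A k × ι n * (ι n * (4* * ι k)) ≤ total rooted-local + ι n * (ι n * s))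
    rooted-average n≢0 A orA sub s 0≤s large = go (least n n≢0 (λ w → Σ (λ x → F w x)))
      where
      F : Fin n → Fin n → ℚ
      F w x = Rooted.total-backward Tn w x
      go : (∃[ w ] (∀ v → Σ (F w) ≤ Σ (F v))) → ∃[ k ] (Decycled A k × ι n * (ι n * (4* * ι k)) ≤ total rooted-local + ι n * (ι n * s))
      go (w , min) = go₂ (least n n≢0 (F w))
        where
        go₂ : (∃[ x ] (∀ v → F w x ≤ F w v)) → ∃[ k ] (Decycled A k × ι n * (ι n * (4* * ι k)) ≤ total rooted-local + ι n * (ι n * s))
        go₂ (x , min′) = let k , dec , bound = Rooted.rooted-cost Tn w x A orA sub s 0≤s large in k , dec , (begin
          ι n * (ι n * (4* * ι k)) ≤⟨ *-monoˡ (ι n) (ι-nn n) (*-monoˡ (ι n) (ι-nn n) bound) ⟩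
          ι n * (ι n * (F w x + s)) ≡⟨ l (ι n) (F w x) s ⟩
          ι n * (ι n * F w x) + ι n * (ι n * s) ≤⟨ ℚ.+-monoˡ-≤ (ι n * (ι n * s)) (*-monoˡ (ι n) (ι-nn n) (subst (_≤ Σ (F w)) (Σ-const n (F w x)) (Σ-mono min′))) ⟩
          ι n * Σ (F w) + ι n * (ι n * s) ≤⟨ ℚ.+-monoˡ-≤ (ι n * (ι n * s)) (subst (_≤ Σ (λ w → Σ (F w))) (Σ-const n (Σ (F w))) (Σ-mono min)) ⟩
          Σ (λ w → Σ (F w)) + ι n * (ι n * s) ≡⟨ cong (_+ ι n * (ι n * s)) backward-total ⟩
          total rooted-local + ι n * (ι n * s) ∎)
          where
          open ℚ.≤-Reasoning
          l : ∀ n f s → n * (n * (f + s)) ≡ n * (n * f) + n * (n * s)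
          l = solve-∀ ring

-- The weight bound as a sum over pairs of vertices.

module LocalForm where
  open import Data.Rational.Base using (ℚ; 0ℚ; 1ℚ; ½; _+_; _*_; _-_; -_; _≤_)
  open FiniteSums
  open Inversions using (true≢false)
  open Truncation
  open BackwardTriangles
  open TriangularSums
  open HermiteRounding
  open WeightBound
  open Interpolation
  open IndependentKeys
  open KeyedOrder
  open FourVertices
  open Quadruples

  -- Counts as natural numbers, because the rounding to the grid needs integers.
  count : ∀ {n} → (Fin n → Bool) → ℕ
  count {zero} p = 0
  count {suc n} p = bit (p zero) ℕ.+ count (p ∘ suc)

  ι-count : ∀ {n} (p : Fin n → Bool) → ι (count p) ≡ Σ (λ i → [ p i ])
  ι-count {zero} p = ι-zero
  ι-count {suc n} p = trans (ι-+ (bit (p zero)) (count (p ∘ suc))) (cong₂ _+_ (ι-bit (p zero)) (ι-count (p ∘ suc)))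

  module Quadratic (n : ℚ) where
    k₀ k₁ k₂ k₃ k₄ k₅ k₆ : ℚ
    k₀ = ι 204940
    k₁ = ι 31915
    k₂ = ι 21349
    k₃ = ι 592
    k₄ = ι 324
    k₅ = ι 214
    k₆ = ι 436

    q : ℚ → ℚ
    q s = (ι24 * s) * (ι24 * s) + ¼ * (n * n)

    -- `weightℚ-bound` rearranged: `V` is a bound for 24 n times the weight.
    upperℚ lowerℚ V : ℚ → ℚ → ℚ → ℚ
    upperℚ α β γ = n * (n * k₀) + (k₃ * q α + (k₄ * (q β + q γ) + (k₅ * (q (β + α) + q (α + γ)) + k₆ * q (β + α + γ))))
    lowerℚ α β γ = n * (k₁ * (ι24 * α) + k₂ * (ι24 * β + ι24 * γ))
    V α β γ = upperℚ α β γ - lowerℚ α β γ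

  weight≤V : ∀ n′ α β γ → β ℕ.+ α ℕ.+ γ ℕ.≤ suc n′ → ι (suc n′) * (ι24 * Corner.weightℚ (ι α) (ι β) (ι γ) (ι (suc n′))) ≤ Quadratic.V (ι (suc n′)) (ι α) (ι β) (ι γ)
  weight≤V n′ α β γ small = move (Majorise₂.weightℚ-bound n′ α β γ small)
    where
    move : ∀ {x y z} → x + y ≤ z → x ≤ z - y
    move {x} {y} {z} p = ≤-by (z - (x + y)) (diff≥0 p) (l x y z)
      where
      l : ∀ x y z → z - y ≡ x + (z - (x + y))
      l = solve-∀ ring

  module Bounds (n′ : ℕ) (Tn : Tournament (suc n′)) where
    n : ℕ
    n = suc n′

    private
      t : Fin n → Fin n → Bool
      t = arc Tn

    open Counts Tn public

    opposed : ∀ i j → t i j ≡ true → t j i ≡ false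
    opposed i j p = trans (arc-flip Tn i j distinct) (cong not p)
      where
      distinct : (i == j) ≡ false
      distinct with i == j in eq
      ... | false = refl
      ... | true = true≢false p (trans (cong (t i) (sym (==⇒≡ i j eq))) (arc-irr Tn i))

    partition : ∀ a b w → [ above a b w ] + [ middle a b w ] + [ below a b w ] ≤ 1ℚ
    partition a b w = go (t w a) (t a w) (t w b) (t b w) (opposed w a) (opposed w b)
      where
      go : ∀ wa aw wb bw → (wa ≡ true → aw ≡ false) → (wb ≡ true → bw ≡ false) → [ wa ∧ wb ] + [ aw ∧ wb ] + [ bw ∧ aw ] ≤ 1ℚ
      go true aw true bw h g rewrite h refl | g refl = ℚ.≤-refl
      go true aw false bw h g rewrite h refl | 𝔹.∧-zeroʳ bw = 0≤1
      go false aw true bw h g rewrite g refl | 𝔹.∧-identityʳ aw = ℚ.≤-trans (ℚ.≤-reflexive (l [ aw ])) ([]≤1 aw)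
        where
        l : ∀ x → 0ℚ + x + 0ℚ ≡ x
        l = solve-∀ ring
      go false aw false bw h g rewrite 𝔹.∧-zeroʳ aw = ℚ.≤-trans (ℚ.≤-reflexive (l [ bw ∧ aw ])) ([]≤1 (bw ∧ aw))
        where
        l : ∀ x → 0ℚ + 0ℚ + x ≡ x
        l = solve-∀ ring

    counts≤ : ∀ a b → dom a b + mid a b + com a b ≤ ι n
    counts≤ a b = ℚ.≤-trans (ℚ.≤-reflexive (sym (trans (Σ-+ (λ w → [ above a b w ] + [ middle a b w ]) (λ w → [ below a b w ])) (cong (_+ com a b) (Σ-+ (λ w → [ above a b w ]) (λ w → [ middle a b w ]))))))
      (ℚ.≤-trans (Σ-upper 1ℚ (partition a b)) (ℚ.≤-reflexive (ℚ.*-identityʳ (ι n))))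

    0≤mid : ∀ a b → 0ℚ ≤ mid a b
    0≤mid a b = Σ-nn (λ w → []-nn (middle a b w))
    0≤dom : ∀ a b → 0ℚ ≤ dom a b
    0≤dom a b = Σ-nn (λ w → []-nn (above a b w))
    0≤com : ∀ a b → 0ℚ ≤ com a b
    0≤com a b = Σ-nn (λ w → []-nn (below a b w))

    open Quadratic (ι n)

    W Vₐ : Fin n → Fin n → ℚ
    W a b = Corner.weightℚ (mid a b) (dom a b) (com a b) (ι n)
    Vₐ a b = V (mid a b) (dom a b) (com a b)

    W≤V : ∀ a b → ι n * (ι24 * W a b) ≤ Vₐ a b
    W≤V a b = transport (ι-count (middle a b)) (ι-count (above a b)) (ι-count (below a b)) (weight≤V n′ (count (middle a b)) (count (above a b)) (count (below a b))
        (ι-cancel-≤ (subst (_≤ ι n) (sym (trans (ι-+ (count (above a b) ℕ.+ count (middle a b)) (count (below a b))) (cong₂ _+_ (trans (ι-+ (count (above a b)) (count (middle a b))) (cong₂ _+_ (ι-count (above a b)) (ι-count (middle a b)))) (ι-count (below a b))))) (counts≤ a b))))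
      where
      transport : ∀ {α α′ β β′ γ γ′} → α ≡ α′ → β ≡ β′ → γ ≡ γ′ → ι n * (ι24 * Corner.weightℚ α β γ (ι n)) ≤ V α β γ → ι n * (ι24 * Corner.weightℚ α′ β′ γ′ (ι n)) ≤ V α′ β′ γ′
      transport refl refl refl p = p

    -- Σ k q(s) ≤ 576 (592 + 2·324 + 2·214 + 436) n² + ¼ 2104 n² because every argument of q is at most n.
    V≤ : ∀ a b → Vₐ a b ≤ ι 1417370 * (ι n * ι n)
    V≤ a b = begin
      upperℚ α β γ - lowerℚ α β γ ≤⟨ ≤-by (lowerℚ α β γ) (*-nn (ι-nn n) (+-nn (*-nn (ι-nn 31915) (*-nn (ι-nn 24) 0≤α)) (*-nn (ι-nn 21349) (+-nn (*-nn (ι-nn 24) 0≤β) (*-nn (ι-nn 24) 0≤γ))))) (l (upperℚ α β γ) (lowerℚ α β γ)) ⟩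
      upperℚ α β γ ≤⟨ ℚ.+-monoʳ-≤ (ι n * (ι n * k₀)) (ℚ.+-mono-≤ (*-monoˡ k₃ (ι-nn 592) (q≤ 0≤α α≤n)) (ℚ.+-mono-≤ (*-monoˡ k₄ (ι-nn 324) (ℚ.+-mono-≤ (q≤ 0≤β β≤n) (q≤ 0≤γ γ≤n))) (ℚ.+-mono-≤ (*-monoˡ k₅ (ι-nn 214) (ℚ.+-mono-≤ (q≤ (+-nn 0≤β 0≤α) βα≤n) (q≤ (+-nn 0≤α 0≤γ) αγ≤n))) (*-monoˡ k₆ (ι-nn 436) (q≤ (+-nn (+-nn 0≤β 0≤α) 0≤γ) (counts≤ a b)))))) ⟩
      ι n * (ι n * k₀) + (k₃ * q (ι n) + (k₄ * (q (ι n) + q (ι n)) + (k₅ * (q (ι n) + q (ι n)) + k₆ * q (ι n)))) ≡⟨ l₂ (ι n) k₀ k₃ k₄ k₅ k₆ ι24 ¼ ⟩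
      (k₀ + (ι24 * ι24 + ¼) * (k₃ + (k₄ + k₄ + (k₅ + k₅ + k₆)))) * (ι n * ι n) ≡⟨ cong (_* (ι n * ι n)) (trans (cong (λ z → k₀ + (ι24 * ι24 + ¼) * z) sum≡) (trans (cong (k₀ +_) (trans (ℚ.*-distribʳ-+ (ι 2104) (ι24 * ι24) ¼) (cong₂ _+_ (sym big) small))) (sym (trans (ι-+ 204940 1212430) (cong (k₀ +_) (ι-+ 1211904 526)))))) ⟩
      ι 1417370 * (ι n * ι n) ∎
      where
      open ℚ.≤-Reasoning
      α β γ : ℚ
      α = mid a b
      β = dom a b
      γ = com a b
      0≤α = 0≤mid a b
      0≤β = 0≤dom a b
      0≤γ = 0≤com a b
      l : ∀ u v → u ≡ u - v + v
      l = solve-∀ ring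
      l₂ : ∀ n k₀ k₃ k₄ k₅ k₆ t h → let q = (t * n) * (t * n) + h * (n * n) in n * (n * k₀) + (k₃ * q + (k₄ * (q + q) + (k₅ * (q + q) + k₆ * q))) ≡ (k₀ + (t * t + h) * (k₃ + (k₄ + k₄ + (k₅ + k₅ + k₆)))) * (n * n)
      l₂ = solve-∀ ring
      sum≡ : k₃ + (k₄ + k₄ + (k₅ + k₅ + k₆)) ≡ ι 2104
      sum≡ = sym (trans (ι-+ 592 1512) (cong (k₃ +_) (trans (ι-+ 648 864) (cong₂ _+_ (ι-+ 324 324) (trans (ι-+ 428 436) (cong (_+ k₆) (ι-+ 214 214)))))))
      big : ι 1211904 ≡ ι24 * ι24 * ι 2104
      big = trans (ι-* 576 2104) (cong (_* ι 2104) (ι-* 24 24))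
      small : ¼ * ι 2104 ≡ ι 526
      small = trans (cong (¼ *_) (trans (ι-+ 1052 1052) (cong₂ _+_ (ι-+ 526 526) (ι-+ 526 526)))) (l₃ (ι 526))
        where
        l₃ : ∀ x → ½ * ½ * ((x + x) + (x + x)) ≡ x
        l₃ = solve-∀ ring
      βα≤n : β + α ≤ ι n
      βα≤n = ℚ.≤-trans (≤-by γ 0≤γ refl) (counts≤ a b)
      αγ≤n : α + γ ≤ ι n
      αγ≤n = ℚ.≤-trans (≤-by β 0≤β (e β α γ)) (counts≤ a b)
        where
        e : ∀ b a c → b + a + c ≡ a + c + b
        e = solve-∀ ring
      α≤n : α ≤ ι n
      α≤n = ℚ.≤-trans (≤-by β 0≤β (ℚ.+-comm β α)) βα≤n
      β≤n : β ≤ ι n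
      β≤n = ℚ.≤-trans (≤-by α 0≤α refl) βα≤n
      γ≤n : γ ≤ ι n
      γ≤n = ℚ.≤-trans (≤-by α 0≤α (ℚ.+-comm α γ)) αγ≤n
      q≤ : ∀ {s} → 0ℚ ≤ s → s ≤ ι n → q s ≤ q (ι n)
      q≤ {s} 0≤s s≤n = ℚ.+-monoˡ-≤ (¼ * (ι n * ι n)) (*-mono (*-nn (ι-nn 24) 0≤s) (*-nn (ι-nn 24) (ι-nn n)) (*-monoˡ ι24 (ι-nn 24) s≤n) (*-monoˡ ι24 (ι-nn 24) s≤n))

    random-local : Fin n → Fin n → Fin n → Fin n → ℕ
    random-local a b w x = random (t a b) (t a w) (t w a) (t w b) (t b w) (t a x) (t x a) (t x b) (t b x) (t w x)

    private
      c₁ c₂ c₃ d₁ d₂ d₃ d₄ : ℚ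
      c₁ = ι 1429512
      c₂ = ι 512376
      c₃ = ι 205466
      d₁ = ι 340992
      d₂ = ι 186624
      d₃ = ι 123264
      d₄ = ι 251136

    -- Summing the polarised form over w and x gives the form at the counts of the arc, and
    -- complemented indicators sum to n minus a count. Besides `Vₐ` there remain the arcs minus the
    -- triangles, with weight 663552, and the raise 1790712 that made the local weight free of
    -- subtraction.
    random-pair : ∀ a b → Σ (λ w → Σ (λ x → ι (random-local a b w x))) ≡ [ t a b ] * (Vₐ a b + (ι 663552 * (ι n * (ι n - mid a b)) + ι 1790712 * (ι n * ι n)))
    random-pair a b = begin
      Σ (λ w → Σ (λ x → ι (random-local a b w x))) ≡⟨ Σ-cong (λ w → Σ-cong (λ x → point w x)) ⟩
      Σ (λ w → Σ (λ x → e * (lin w + quad w x))) ≡⟨ trans (Σ-cong (λ w → trans (Σ-*ˡ e (λ x → lin w + quad w x)) (cong (e *_) (trans (Σ-+ (λ x → lin w) (quad w)) (cong₂ _+_ (Σ-const n (lin w)) (quad-row w)))))) (trans (Σ-*ˡ e (λ w → ι n * lin w + quadᵣ w)) (cong (e *_) (trans (Σ-+ (λ w → ι n * lin w) quadᵣ) (cong₂ _+_ (trans (Σ-*ˡ (ι n) lin) (cong (ι n *_) lin-sum)) quad-sum)))) ⟩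
      e * (ι n * (c₁ * (ι n - M) + (c₂ * ((ι n - D) + (ι n - C)) + ι n * c₃)) + quadₛ) ≡⟨ cong (e *_) numbers ⟩
      e * (Vₐ a b + (ι 663552 * (ι n * (ι n - M)) + ι 1790712 * (ι n * ι n))) ∎
      where
      open ≡-Reasoning
      e M D C : ℚ
      e = [ t a b ]
      M = mid a b
      D = dom a b
      C = com a b
      m d c : Fin n → ℚ
      m w = [ middle a b w ]
      d w = [ above a b w ]
      c w = [ below a b w ]
      lin : Fin n → ℚ
      lin w = c₁ * (1ℚ - m w) + (c₂ * ((1ℚ - d w) + (1ℚ - c w)) + c₃)
      form : ℚ → ℚ → ℚ → ℚ → ℚ → ℚ → ℚ
      form m d c m′ d′ c′ = d₁ * (m * m′) + (d₂ * (d * d′ + c * c′) + (d₃ * ((d + m) * (d′ + m′) + (m + c) * (m′ + c′)) + d₄ * ((d + m + c) * (d′ + m′ + c′))))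
      quad : Fin n → Fin n → ℚ
      quad w x = form (m w) (d w) (c w) (m x) (d x) (c x)
      quadᵣ : Fin n → ℚ
      quadᵣ w = form (m w) (d w) (c w) M D C
      quadₛ : ℚ
      quadₛ = form M D C M D C
      ι-*′ : ∀ k m → ι (m ℕ.* k) ≡ ι k * ι m
      ι-*′ k m = trans (ι-* m k) (ℚ.*-comm (ι m) (ι k))
      ι-not : ∀ b → ι (bit (not b)) ≡ 1ℚ - [ b ]
      ι-not b = trans (ι-bit (not b)) ([not] b)
      ι-form : ∀ m d c m′ d′ c′ → ι (quadratic m d c m′ d′ c′) ≡ form (ι m) (ι d) (ι c) (ι m′) (ι d′) (ι c′)
      ι-form m d c m′ d′ c′ = trans (ι-+ (q₁ ℕ.* 340992) r₁) (cong₂ _+_ (trans (ι-*′ 340992 q₁) (cong (d₁ *_) (ι-* m m′)))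
        (trans (ι-+ (q₂ ℕ.* 186624) r₂) (cong₂ _+_ (trans (ι-*′ 186624 q₂) (cong (d₂ *_) (trans (ι-+ (d ℕ.* d′) (c ℕ.* c′)) (cong₂ _+_ (ι-* d d′) (ι-* c c′)))))
        (trans (ι-+ (q₃ ℕ.* 123264) (q₄ ℕ.* 251136)) (cong₂ _+_ (trans (ι-*′ 123264 q₃) (cong (d₃ *_) (trans (ι-+ ((d ℕ.+ m) ℕ.* (d′ ℕ.+ m′)) ((m ℕ.+ c) ℕ.* (m′ ℕ.+ c′))) (cong₂ _+_ (trans (ι-* (d ℕ.+ m) (d′ ℕ.+ m′)) (cong₂ _*_ (ι-+ d m) (ι-+ d′ m′))) (trans (ι-* (m ℕ.+ c) (m′ ℕ.+ c′)) (cong₂ _*_ (ι-+ m c) (ι-+ m′ c′)))))))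
          (trans (ι-*′ 251136 q₄) (cong (d₄ *_) (trans (ι-* (d ℕ.+ m ℕ.+ c) (d′ ℕ.+ m′ ℕ.+ c′)) (cong₂ _*_ (trans (ι-+ (d ℕ.+ m) c) (cong (_+ ι c) (ι-+ d m))) (trans (ι-+ (d′ ℕ.+ m′) c′) (cong (_+ ι c′) (ι-+ d′ m′))))))))))))
        where
        q₁ q₂ q₃ q₄ r₁ r₂ : ℕ
        q₁ = m ℕ.* m′
        q₂ = d ℕ.* d′ ℕ.+ c ℕ.* c′
        q₃ = (d ℕ.+ m) ℕ.* (d′ ℕ.+ m′) ℕ.+ (m ℕ.+ c) ℕ.* (m′ ℕ.+ c′)
        q₄ = (d ℕ.+ m ℕ.+ c) ℕ.* (d′ ℕ.+ m′ ℕ.+ c′)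
        r₂ = q₃ ℕ.* 123264 ℕ.+ q₄ ℕ.* 251136
        r₁ = q₂ ℕ.* 186624 ℕ.+ r₂
      ι-lin : ∀ m̄ d̄ c̄ → ι (linear m̄ d̄ c̄) ≡ c₁ * ι m̄ + (c₂ * (ι d̄ + ι c̄) + c₃)
      ι-lin m̄ d̄ c̄ = trans (ι-+ (m̄ ℕ.* 1429512) ((d̄ ℕ.+ c̄) ℕ.* 512376 ℕ.+ 205466)) (cong₂ _+_ (ι-*′ 1429512 m̄) (trans (ι-+ ((d̄ ℕ.+ c̄) ℕ.* 512376) 205466) (cong (_+ c₃) (trans (ι-*′ 512376 (d̄ ℕ.+ c̄)) (cong (c₂ *_) (ι-+ d̄ c̄))))))
      point : ∀ w x → ι (random-local a b w x) ≡ e * (lin w + quad w x)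
      point w x = trans (cong ι (random-eq (t a b) (t a w) (t w a) (t w b) (t b w) (t a x) (t x a) (t x b) (t b x) (t w x)))
        (trans (ι-* (bit (t a b)) (linear m̄ d̄ c̄ ℕ.+ quadratic m₁ u₁ v₁ m₂ u₂ v₂)) (cong₂ _*_ (ι-bit (t a b)) (trans (ι-+ (linear m̄ d̄ c̄) (quadratic m₁ u₁ v₁ m₂ u₂ v₂))
          (cong₂ _+_ (trans (ι-lin m̄ d̄ c̄) (cong₂ (λ p q → c₁ * p + (c₂ * q + c₃)) (ι-not (middle a b w)) (cong₂ _+_ (ι-not (above a b w)) (ι-not (below a b w)))))
            (trans (ι-form m₁ u₁ v₁ m₂ u₂ v₂) (six (ι-bit (middle a b w)) (ι-bit (above a b w)) (ι-bit (below a b w)) (ι-bit (middle a b x)) (ι-bit (above a b x)) (ι-bit (below a b x))))))))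
        where
        m̄ d̄ c̄ m₁ u₁ v₁ m₂ u₂ v₂ : ℕ
        m̄ = bit (not (middle a b w))
        d̄ = bit (not (above a b w))
        c̄ = bit (not (below a b w))
        m₁ = bit (middle a b w)
        u₁ = bit (above a b w)
        v₁ = bit (below a b w)
        m₂ = bit (middle a b x)
        u₂ = bit (above a b x)
        v₂ = bit (below a b x)
        six : ∀ {p p′ q q′ r r′ s s′ u u′ v v′} → p ≡ p′ → q ≡ q′ → r ≡ r′ → s ≡ s′ → u ≡ u′ → v ≡ v′ → form p q r s u v ≡ form p′ q′ r′ s′ u′ v′
        six refl refl refl refl refl refl = refl
      lin-sum : Σ lin ≡ c₁ * (ι n - M) + (c₂ * ((ι n - D) + (ι n - C)) + ι n * c₃)
      lin-sum = trans (Σ-+ (λ w → c₁ * (1ℚ - m w)) (λ w → c₂ * ((1ℚ - d w) + (1ℚ - c w)) + c₃)) (cong₂ _+_ (trans (Σ-*ˡ c₁ (λ w → 1ℚ - m w)) (cong (c₁ *_) (co m)))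
        (trans (Σ-+ (λ w → c₂ * ((1ℚ - d w) + (1ℚ - c w))) (λ _ → c₃)) (cong₂ _+_ (trans (Σ-*ˡ c₂ (λ w → (1ℚ - d w) + (1ℚ - c w))) (cong (c₂ *_) (trans (Σ-+ (λ w → 1ℚ - d w) (λ w → 1ℚ - c w)) (cong₂ _+_ (co d) (co c))))) (Σ-const n c₃))))
        where
        co : ∀ (f : Fin n → ℚ) → Σ (λ w → 1ℚ - f w) ≡ ι n - Σ f
        co f = trans (Σ-- (λ _ → 1ℚ) f) (cong (_- Σ f) (trans (Σ-const n 1ℚ) (ℚ.*-identityʳ (ι n))))
      gather₃ : ∀ p q r → Σ (λ x → form p q r (m x) (d x) (c x)) ≡ form p q r M D C
      gather₃ p q r = trans (Σ-cong (λ x → regroup d₁ d₂ d₃ d₄ p q r (m x) (d x) (c x))) (trans (trans (Σ-+ (λ x → P * m x) (λ x → Q * d x + R * c x)) (cong₂ _+_ (Σ-*ˡ P m) (trans (Σ-+ (λ x → Q * d x) (λ x → R * c x)) (cong₂ _+_ (Σ-*ˡ Q d) (Σ-*ˡ R c))))) (sym (regroup d₁ d₂ d₃ d₄ p q r M D C)))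
        where
        P Q R : ℚ
        P = d₁ * p + d₃ * ((q + p) + (p + r)) + d₄ * (q + p + r)
        Q = d₂ * q + d₃ * (q + p) + d₄ * (q + p + r)
        R = d₂ * r + d₃ * (p + r) + d₄ * (q + p + r)
        regroup : ∀ d₁ d₂ d₃ d₄ p q r m d c → d₁ * (p * m) + (d₂ * (q * d + r * c) + (d₃ * ((q + p) * (d + m) + (p + r) * (m + c)) + d₄ * ((q + p + r) * (d + m + c))))
          ≡ (d₁ * p + d₃ * ((q + p) + (p + r)) + d₄ * (q + p + r)) * m + ((d₂ * q + d₃ * (q + p) + d₄ * (q + p + r)) * d + (d₂ * r + d₃ * (p + r) + d₄ * (q + p + r)) * c)
        regroup = solve-∀ ring
      quad-row : ∀ w → Σ (quad w) ≡ quadᵣ w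
      quad-row w = gather₃ (m w) (d w) (c w)
      form-sym : ∀ d₁ d₂ d₃ d₄ p q r m d c → d₁ * (p * m) + (d₂ * (q * d + r * c) + (d₃ * ((q + p) * (d + m) + (p + r) * (m + c)) + d₄ * ((q + p + r) * (d + m + c))))
        ≡ d₁ * (m * p) + (d₂ * (d * q + c * r) + (d₃ * ((d + m) * (q + p) + (m + c) * (p + r)) + d₄ * ((d + m + c) * (q + p + r))))
      form-sym = solve-∀ ring
      quad-sum : Σ quadᵣ ≡ quadₛ
      quad-sum = trans (Σ-cong (λ w → form-sym d₁ d₂ d₃ d₄ (m w) (d w) (c w) M D C)) (gather₃ M D C)
      numbers : ι n * (c₁ * (ι n - M) + (c₂ * ((ι n - D) + (ι n - C)) + ι n * c₃)) + quadₛ ≡ Vₐ a b + (ι 663552 * (ι n * (ι n - M)) + ι 1790712 * (ι n * ι n))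
      numbers = trans (subst-all c₁≡ c₂≡ c₃≡ d₁≡ d₂≡ d₃≡ d₄≡) (trans (l (ι n) M D C (ι 663552) k₀ k₁ k₂ k₃ k₄ k₅ k₆ ι24 ¼) (cong (λ z → Vₐ a b + (ι 663552 * (ι n * (ι n - M)) + z * (ι n * ι n))) (sym o≡)))
        where
        T : ℚ → ℚ → ℚ → ℚ → ℚ → ℚ → ℚ → ℚ
        T c₁ c₂ c₃ d₁ d₂ d₃ d₄ = ι n * (c₁ * (ι n - M) + (c₂ * ((ι n - D) + (ι n - C)) + ι n * c₃)) + (d₁ * (M * M) + (d₂ * (D * D + C * C) + (d₃ * ((D + M) * (D + M) + (M + C) * (M + C)) + d₄ * ((D + M + C) * (D + M + C)))))
        subst-all : ∀ {c₁ c₁′ c₂ c₂′ c₃ c₃′ d₁ d₁′ d₂ d₂′ d₃ d₃′ d₄ d₄′} → c₁ ≡ c₁′ → c₂ ≡ c₂′ → c₃ ≡ c₃′ → d₁ ≡ d₁′ → d₂ ≡ d₂′ → d₃ ≡ d₃′ → d₄ ≡ d₄′ → T c₁ c₂ c₃ d₁ d₂ d₃ d₄ ≡ T c₁′ c₂′ c₃′ d₁′ d₂′ d₃′ d₄′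
        subst-all refl refl refl refl refl refl refl = refl
        c₁≡ : c₁ ≡ ι 663552 + ι24 * k₁
        c₁≡ = trans (ι-+ 663552 765960) (cong (ι 663552 +_) (ι-* 24 31915))
        c₂≡ : c₂ ≡ ι24 * k₂
        c₂≡ = ι-* 24 21349
        c₃≡ : c₃ ≡ k₀ + ¼ * (k₃ + (k₄ + k₄ + (k₅ + k₅ + k₆)))
        c₃≡ = trans (ι-+ 204940 526) (cong (k₀ +_) (trans (sym small) (cong (¼ *_) sum≡)))
          where
          small : ¼ * ι 2104 ≡ ι 526
          small = trans (cong (¼ *_) (trans (ι-+ 1052 1052) (cong₂ _+_ (ι-+ 526 526) (ι-+ 526 526)))) (l₃ (ι 526))
            where
            l₃ : ∀ x → ½ * ½ * ((x + x) + (x + x)) ≡ x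
            l₃ = solve-∀ ring
          sum≡ : ι 2104 ≡ k₃ + (k₄ + k₄ + (k₅ + k₅ + k₆))
          sum≡ = trans (ι-+ 592 1512) (cong (k₃ +_) (trans (ι-+ 648 864) (cong₂ _+_ (ι-+ 324 324) (trans (ι-+ 428 436) (cong (_+ k₆) (ι-+ 214 214))))))
        d≡ : ∀ k v → k ℕ.* 576 ≡ v → ι v ≡ ι k * (ι24 * ι24)
        d≡ k v refl = trans (ι-* k 576) (cong (ι k *_) (ι-* 24 24))
        d₁≡ : d₁ ≡ k₃ * (ι24 * ι24)
        d₁≡ = d≡ 592 340992 refl
        d₂≡ : d₂ ≡ k₄ * (ι24 * ι24)
        d₂≡ = d≡ 324 186624 refl
        d₃≡ : d₃ ≡ k₅ * (ι24 * ι24)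
        d₃≡ = d≡ 214 123264 refl
        d₄≡ : d₄ ≡ k₆ * (ι24 * ι24)
        d₄≡ = d≡ 436 251136 refl
        o≡ : ι 1790712 ≡ ι24 * k₁ + (ι24 * k₂ + ι24 * k₂)
        o≡ = trans (ι-+ 765960 1024752) (cong₂ _+_ (ι-* 24 31915) (trans (ι-+ 512376 512376) (cong₂ _+_ (ι-* 24 21349) (ι-* 24 21349))))
        l : ∀ n M D C g k₀ k₁ k₂ k₃ k₄ k₅ k₆ t h →
          n * ((g + t * k₁) * (n - M) + ((t * k₂) * ((n - D) + (n - C)) + n * (k₀ + h * (k₃ + (k₄ + k₄ + (k₅ + k₅ + k₆)))))) + (k₃ * (t * t) * (M * M) + (k₄ * (t * t) * (D * D + C * C) + (k₅ * (t * t) * ((D + M) * (D + M) + (M + C) * (M + C)) + k₆ * (t * t) * ((D + M + C) * (D + M + C)))))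
          ≡ (n * (n * k₀) + (k₃ * ((t * M) * (t * M) + h * (n * n)) + (k₄ * (((t * D) * (t * D) + h * (n * n)) + ((t * C) * (t * C) + h * (n * n))) + (k₅ * (((t * (D + M)) * (t * (D + M)) + h * (n * n)) + ((t * (M + C)) * (t * (M + C)) + h * (n * n))) + k₆ * ((t * (D + M + C)) * (t * (D + M + C)) + h * (n * n)))))
              - n * (k₁ * (t * M) + k₂ * (t * D + t * C))) + (g * (n * (n - M)) + (t * k₁ + (t * k₂ + t * k₂)) * (n * n))
        l = solve-∀ ring

-- Collecting the error terms.

module Assembling where
  open import Data.Rational.Base using (ℚ; 0ℚ; 1ℚ; _+_; _*_; _-_; -_; _≤_)
  open FiniteSums
  open TriangularSums
  open Interpolation using (12*; 0≤2*; 0≤3*)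

  8* 14* 24* : ℚ
  8* = 2* * (2* * 2*)
  14* = 8* + 6*
  24* = 12* * 2*

  0≤6* : 0ℚ ≤ 6*
  0≤6* = *-nn 0≤3* 0≤2*
  0≤8* : 0ℚ ≤ 8*
  0≤8* = *-nn 0≤2* (*-nn 0≤2* 0≤2*)
  0≤24* : 0ℚ ≤ 24*
  0≤24* = *-nn (*-nn 0≤6* 0≤2*) 0≤2*

  -- `x` stands for four times the cost, `𝒜` and `P` for the numbers of arcs and of transitive
  -- triples, `u` for 1/24. The estimate is multiplied by 24⁴ n, and every error becomes a multiple
  -- of `Q` = e n⁴.
  module Assembly (n e u ν s 𝒜 P SV SW EX F x D err c : ℚ)
    (0≤n : 0ℚ ≤ n) (1≤n : 1ℚ ≤ n) (0≤e : 0ℚ ≤ e) (small-e : 6* * e ≤ 1ℚ) (1≤en : 1ℚ ≤ e * n) (0≤u : 0ℚ ≤ u) (unit : 24* * u ≡ 1ℚ)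
    (ν≡ : ν ≡ u * e) (s≡ : s ≡ e * (n * n)) (0≤𝒜 : 0ℚ ≤ 𝒜) (𝒜≤ : 𝒜 ≤ n * n) (0≤P : 0ℚ ≤ P) (P≤ : P ≤ n * (n * n))
    (0≤x : 0ℚ ≤ x) (third : 3* * D ≡ n) (0≤err : 0ℚ ≤ err) (err≤ : err ≤ 2* * (e * n))
    (h₁ : x * (D + 1ℚ) ≤ F)
    (h₂ : 6* * F ≤ 6* * ((D + 1ℚ) * ((1ℚ + ν) * 𝒜)) + 6* * ((D + 1ℚ) * s) + EX - 2* * ((1ℚ - e) * (1ℚ - e) * ((1ℚ - ν) * (1ℚ - (ν + ν)) * P)))
    (h₃ : EX ≤ u * (u * u) * ((1ℚ + e) * (1ℚ + e)) * SW + 12* * err * 𝒜)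
    (h₄ : n * (24* * SW) ≤ SV) (SV≤ : SV ≤ c * (n * (n * (n * n)))) where

    G Q : ℚ
    G = 24* * (24* * (24* * 24*))
    Q = e * (n * (n * (n * n)))

    0≤G : 0ℚ ≤ G
    0≤G = *-nn 0≤24* (*-nn 0≤24* (*-nn 0≤24* 0≤24*))

    0≤n³ : 0ℚ ≤ n * (n * n)
    0≤n³ = *-nn 0≤n (*-nn 0≤n 0≤n)

    n³≤Q : n * (n * n) ≤ Q
    n³≤Q = ℚ.≤-trans (ℚ.≤-reflexive (sym (ℚ.*-identityˡ (n * (n * n))))) (ℚ.≤-trans (*-monoʳ (n * (n * n)) 0≤n³ 1≤en) (ℚ.≤-reflexive (ℚ.*-assoc e n (n * (n * n)))))

    u≤1 : u ≤ 1ℚ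
    u≤1 = ≤-by (23* * u) (*-nn (+-nn (*-nn 0≤2* 0≤8*) (+-nn 0≤6* 0≤1)) 0≤u) (trans (sym unit) (l u))
      where
      23* : ℚ
      23* = 2* * 8* + (6* + 1ℚ)
      l : ∀ u → (1ℚ + (1ℚ + 1ℚ)) * (1ℚ + 1ℚ) * (1ℚ + 1ℚ) * (1ℚ + 1ℚ) * u ≡ u + ((1ℚ + 1ℚ) * ((1ℚ + 1ℚ) * ((1ℚ + 1ℚ) * (1ℚ + 1ℚ))) + ((1ℚ + (1ℚ + 1ℚ)) * (1ℚ + 1ℚ) + 1ℚ)) * u
      l = solve-∀ ring

    0≤ν : 0ℚ ≤ ν
    0≤ν = subst (0ℚ ≤_) (sym ν≡) (*-nn 0≤u 0≤e)

    ν≤e : ν ≤ e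
    ν≤e = subst₂ _≤_ (sym ν≡) (ℚ.*-identityˡ e) (*-monoʳ e 0≤e u≤1)

    2n+6≤8n : 2* * n + 6* ≤ 8* * n
    2n+6≤8n = ≤-by (6* * (n - 1ℚ)) (*-nn 0≤6* (diff≥0 1≤n)) (l n)
      where
      l : ∀ n → (1ℚ + 1ℚ) * ((1ℚ + 1ℚ) * (1ℚ + 1ℚ)) * n ≡ (1ℚ + 1ℚ) * n + (1ℚ + (1ℚ + 1ℚ)) * (1ℚ + 1ℚ) + (1ℚ + (1ℚ + 1ℚ)) * (1ℚ + 1ℚ) * (n - 1ℚ)
      l = solve-∀ ring

    0≤2n+6 : 0ℚ ≤ 2* * n + 6*
    0≤2n+6 = +-nn (*-nn 0≤2* 0≤n) 0≤6*

    6D+6 : 6* * (D + 1ℚ) ≡ 2* * n + 6*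
    6D+6 = trans (l D) (cong (λ z → 2* * z + 6*) third)
      where
      l : ∀ D → (1ℚ + (1ℚ + 1ℚ)) * (1ℚ + 1ℚ) * (D + 1ℚ) ≡ (1ℚ + 1ℚ) * ((1ℚ + (1ℚ + 1ℚ)) * D) + (1ℚ + (1ℚ + 1ℚ)) * (1ℚ + 1ℚ)
      l = solve-∀ ring

    T₁ T₂ T₃ T₄ : ℚ
    T₁ = n * ((2* * n + 6*) * ((1ℚ + ν) * 𝒜))
    T₂ = n * ((2* * n + 6*) * s)
    T₃ = n * EX
    T₄ = n * (2* * ((1ℚ - e) * (1ℚ - e) * ((1ℚ - ν) * (1ℚ - (ν + ν)) * P)))

    T₁≤ : T₁ ≤ 2* * (n * n * 𝒜) + 14* * Q
    T₁≤ = begin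
      T₁ ≡⟨ l n ν 𝒜 ⟩
      2* * (n * n * 𝒜) + (6* * (n * 𝒜) + ν * ((2* * n + 6*) * (n * 𝒜))) ≤⟨ ℚ.+-monoʳ-≤ (2* * (n * n * 𝒜)) (ℚ.+-mono-≤ (*-monoˡ 6* 0≤6* (ℚ.≤-trans n𝒜≤ n³≤Q))
          (*-mono 0≤ν (*-nn (*-nn 0≤8* 0≤n) 0≤n³) ν≤e (*-mono 0≤2n+6 0≤n³ 2n+6≤8n n𝒜≤))) ⟩
      2* * (n * n * 𝒜) + (6* * Q + e * ((8* * n) * (n * (n * n)))) ≡⟨ cong (2* * (n * n * 𝒜) +_) (l₂ n e 6* 8*) ⟩
      2* * (n * n * 𝒜) + 14* * Q ∎
      where
      open ℚ.≤-Reasoning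
      n𝒜≤ : n * 𝒜 ≤ n * (n * n)
      n𝒜≤ = *-monoˡ n 0≤n 𝒜≤
      l : ∀ n ν a → n * (((1ℚ + 1ℚ) * n + (1ℚ + (1ℚ + 1ℚ)) * (1ℚ + 1ℚ)) * ((1ℚ + ν) * a)) ≡ (1ℚ + 1ℚ) * (n * n * a) + ((1ℚ + (1ℚ + 1ℚ)) * (1ℚ + 1ℚ) * (n * a) + ν * (((1ℚ + 1ℚ) * n + (1ℚ + (1ℚ + 1ℚ)) * (1ℚ + 1ℚ)) * (n * a)))
      l = solve-∀ ring
      l₂ : ∀ n e k m → k * (e * (n * (n * (n * n)))) + e * ((m * n) * (n * (n * n))) ≡ (m + k) * (e * (n * (n * (n * n))))
      l₂ = solve-∀ ring

    T₂≤ : T₂ ≤ 8* * Q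
    T₂≤ = begin
      T₂ ≡⟨ cong (λ z → n * ((2* * n + 6*) * z)) s≡ ⟩
      n * ((2* * n + 6*) * (e * (n * n))) ≤⟨ *-monoˡ n 0≤n (*-monoʳ (e * (n * n)) (*-nn 0≤e (*-nn 0≤n 0≤n)) 2n+6≤8n) ⟩
      n * ((8* * n) * (e * (n * n))) ≡⟨ l n e 8* ⟩
      8* * Q ∎
      where
      open ℚ.≤-Reasoning
      l : ∀ n e m → n * ((m * n) * (e * (n * n))) ≡ m * (e * (n * (n * (n * n))))
      l = solve-∀ ring

    e≤1 : e ≤ 1ℚ
    e≤1 = ℚ.≤-trans (≤-by ((2* + 3*) * e) (*-nn (+-nn 0≤2* 0≤3*) 0≤e) (l e)) small-e
      where
      l : ∀ e → (1ℚ + (1ℚ + 1ℚ)) * (1ℚ + 1ℚ) * e ≡ e + ((1ℚ + 1ℚ) + (1ℚ + (1ℚ + 1ℚ))) * e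
      l = solve-∀ ring

    -- The three factors `u` cancel three of the four factors 24; the fourth is the one in `h₄`. The
    -- factor (1 + e)² of the interpolation is paid with the crude bound `SV≤`.
    G*T₃≤ : 0ℚ ≤ c → G * T₃ ≤ SV + (3* * c + 24* * G) * Q
    G*T₃≤ 0≤c = begin
      G * (n * EX) ≤⟨ *-monoˡ G 0≤G (*-monoˡ n 0≤n h₃) ⟩
      G * (n * (u * (u * u) * ((1ℚ + e) * (1ℚ + e)) * SW + 12* * err * 𝒜)) ≡⟨ l n u e SW 24* 12* err 𝒜 ⟩
      (24* * u) * ((24* * u) * (24* * u)) * (n * (24* * SW)) * ((1ℚ + e) * (1ℚ + e)) + G * (n * (12* * err * 𝒜)) ≡⟨ cong (_+ G * (n * (12* * err * 𝒜))) (trans (cong (λ z → z * (z * z) * (n * (24* * SW)) * ((1ℚ + e) * (1ℚ + e))) unit) (cong (_* ((1ℚ + e) * (1ℚ + e))) (l₂ (n * (24* * SW))))) ⟩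
      n * (24* * SW) * ((1ℚ + e) * (1ℚ + e)) + G * (n * (12* * err * 𝒜)) ≤⟨ ℚ.+-mono-≤ (*-monoʳ ((1ℚ + e) * (1ℚ + e)) (sq-nn (1ℚ + e)) h₄) (*-monoˡ G 0≤G (*-monoˡ n 0≤n (*-mono (*-nn (*-nn 0≤6* 0≤2*) 0≤err) (*-nn 0≤n 0≤n) (*-monoˡ 12* (*-nn 0≤6* 0≤2*) err≤) 𝒜≤))) ⟩
      SV * ((1ℚ + e) * (1ℚ + e)) + G * (n * (12* * (2* * (e * n)) * (n * n))) ≡⟨ cong₂ _+_ (l₃ SV e) (l₄ n e G 12* 2*) ⟩
      SV + e * (2* + e) * SV + 24* * G * Q ≤⟨ ℚ.+-monoˡ-≤ (24* * G * Q) (ℚ.+-monoʳ-≤ SV (ℚ.≤-trans (*-monoˡ (e * (2* + e)) (*-nn 0≤e (+-nn 0≤2* 0≤e)) SV≤) (*-monoʳ (c * (n * (n * (n * n)))) (*-nn 0≤c (*-nn 0≤n 0≤n³)) (*-monoˡ e 0≤e 2+e≤3)))) ⟩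
      SV + e * 3* * (c * (n * (n * (n * n)))) + 24* * G * Q ≡⟨ l₅ SV e 3* c n 24* G ⟩
      SV + (3* * c + 24* * G) * Q ∎
      where
      open ℚ.≤-Reasoning
      2+e≤3 : 2* + e ≤ 3*
      2+e≤3 = ℚ.≤-trans (ℚ.+-monoʳ-≤ 2* e≤1) (ℚ.≤-reflexive (ℚ.+-comm 2* 1ℚ))
      l : ∀ n u e w t m r a → t * (t * (t * t)) * (n * (u * (u * u) * ((1ℚ + e) * (1ℚ + e)) * w + m * r * a)) ≡ (t * u) * ((t * u) * (t * u)) * (n * (t * w)) * ((1ℚ + e) * (1ℚ + e)) + t * (t * (t * t)) * (n * (m * r * a))
      l = solve-∀ ring
      l₂ : ∀ z → 1ℚ * (1ℚ * 1ℚ) * z ≡ z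
      l₂ = solve-∀ ring
      l₃ : ∀ v e → v * ((1ℚ + e) * (1ℚ + e)) ≡ v + e * ((1ℚ + 1ℚ) + e) * v
      l₃ = solve-∀ ring
      l₄ : ∀ n e g m t → g * (n * (m * (t * (e * n)) * (n * n))) ≡ m * t * g * (e * (n * (n * (n * n))))
      l₄ = solve-∀ ring
      l₅ : ∀ v e t c n m g → v + e * t * (c * (n * (n * (n * n)))) + m * g * (e * (n * (n * (n * n)))) ≡ v + (t * c + m * g) * (e * (n * (n * (n * n))))
      l₅ = solve-∀ ring

    10* : ℚ
    10* = 2* * (2* + 3*)

    -- The packing loses a factor (1 - e)² and ties between keys a factor (1 - ν)(1 - 2ν); since ν ≤
    -- e, at least 1 - 5e is left.
    T₄≥ : 2* * (n * P) - 10* * Q ≤ T₄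
    T₄≥ = begin
      2* * (n * P) - 10* * Q ≤⟨ ℚ.+-monoʳ-≤ (2* * (n * P)) (ℚ.neg-antimono-≤ (*-monoˡ 10* (*-nn 0≤2* (+-nn 0≤2* 0≤3*)) (*-monoˡ e 0≤e (*-monoˡ n 0≤n P≤)))) ⟩
      2* * (n * P) - 10* * (e * (n * P)) ≡⟨ l n P e ⟩
      n * (2* * ((1ℚ - (2* + 3*) * e) * P)) ≤⟨ *-monoˡ n 0≤n (*-monoˡ 2* 0≤2* (*-monoʳ P 0≤P μ≥)) ⟩
      n * (2* * ((1ℚ - e) * (1ℚ - e) * ((1ℚ - ν) * (1ℚ - (ν + ν))) * P)) ≡⟨ cong (λ z → n * (2* * z)) (ℚ.*-assoc ((1ℚ - e) * (1ℚ - e)) ((1ℚ - ν) * (1ℚ - (ν + ν))) P) ⟩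
      T₄ ∎
      where
      open ℚ.≤-Reasoning
      l : ∀ n P e → (1ℚ + 1ℚ) * (n * P) - (1ℚ + 1ℚ) * ((1ℚ + 1ℚ) + (1ℚ + (1ℚ + 1ℚ))) * (e * (n * P)) ≡ n * ((1ℚ + 1ℚ) * ((1ℚ - ((1ℚ + 1ℚ) + (1ℚ + (1ℚ + 1ℚ))) * e) * P))
      l = solve-∀ ring
      α≥ : 1ℚ - 2* * e ≤ (1ℚ - e) * (1ℚ - e)
      α≥ = ≤-by (e * e) (sq-nn e) (l₁ e)
        where
        l₁ : ∀ e → (1ℚ - e) * (1ℚ - e) ≡ 1ℚ - (1ℚ + 1ℚ) * e + e * e
        l₁ = solve-∀ ring
      β≥ : 1ℚ - 3* * e ≤ (1ℚ - ν) * (1ℚ - (ν + ν))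
      β≥ = ≤-by (3* * (e - ν) + 2* * (ν * ν)) (+-nn (*-nn 0≤3* (diff≥0 ν≤e)) (*-nn 0≤2* (sq-nn ν))) (l₁ e ν)
        where
        l₁ : ∀ e ν → (1ℚ - ν) * (1ℚ - (ν + ν)) ≡ 1ℚ - (1ℚ + (1ℚ + 1ℚ)) * e + ((1ℚ + (1ℚ + 1ℚ)) * (e - ν) + (1ℚ + 1ℚ) * (ν * ν))
        l₁ = solve-∀ ring
      0≤1-3e : 0ℚ ≤ 1ℚ - 3* * e
      0≤1-3e = ℚ.≤-trans (diff≥0 small-e) (≤-by (3* * e) (*-nn 0≤3* 0≤e) (l₁ e))
        where
        l₁ : ∀ e → 1ℚ - (1ℚ + (1ℚ + 1ℚ)) * e ≡ 1ℚ - (1ℚ + (1ℚ + 1ℚ)) * (1ℚ + 1ℚ) * e + (1ℚ + (1ℚ + 1ℚ)) * e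
        l₁ = solve-∀ ring
      μ≥ : 1ℚ - (2* + 3*) * e ≤ (1ℚ - e) * (1ℚ - e) * ((1ℚ - ν) * (1ℚ - (ν + ν)))
      μ≥ = ℚ.≤-trans (≤-by (6* * (e * e)) (*-nn 0≤6* (sq-nn e)) (l₁ e)) (ℚ.≤-trans (*-monoʳ (1ℚ - 3* * e) 0≤1-3e α≥) (*-monoˡ ((1ℚ - e) * (1ℚ - e)) (sq-nn (1ℚ - e)) β≥))
        where
        l₁ : ∀ e → (1ℚ - (1ℚ + 1ℚ) * e) * (1ℚ - (1ℚ + (1ℚ + 1ℚ)) * e) ≡ 1ℚ - ((1ℚ + 1ℚ) + (1ℚ + (1ℚ + 1ℚ))) * e + (1ℚ + (1ℚ + 1ℚ)) * (1ℚ + 1ℚ) * (e * e)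
        l₁ = solve-∀ ring

    56* : ℚ
    56* = 14* + (8* + (24* + 10*))

    -- 6 `D` = 2 n turns the bound on `x` (`D` + 1) into one on `x` n. The constant 56 = 14 + 8 + 24
    -- + 10 collects the errors of `T₁` to `T₄`.
    assembled : 0ℚ ≤ c → 2* * G * (x * (n * n)) ≤ 2* * G * (n * n * 𝒜 - n * P) + SV + (56* * G + 3* * c) * Q
    assembled 0≤c = begin
      2* * G * (x * (n * n)) ≡⟨ trans (cong (λ z → 2* * G * (x * (n * z))) (sym third)) (l G n x D) ⟩
      G * (n * (6* * (x * D))) ≤⟨ *-monoˡ G 0≤G (*-monoˡ n 0≤n (ℚ.≤-trans (*-monoˡ 6* 0≤6* (ℚ.≤-trans (*-monoˡ x 0≤x (≤-by 1ℚ 0≤1 refl)) h₁)) h₂)) ⟩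
      G * (n * (6* * ((D + 1ℚ) * ((1ℚ + ν) * 𝒜)) + 6* * ((D + 1ℚ) * s) + EX - Z)) ≡⟨ trans (l₁ G n (D + 1ℚ) ((1ℚ + ν) * 𝒜) s EX Z 6*) (cong (λ z → G * (n * (z * ((1ℚ + ν) * 𝒜))) + G * (n * (z * s)) + G * T₃ + G * (- T₄)) 6D+6) ⟩
      G * T₁ + G * T₂ + G * T₃ + G * (- T₄) ≤⟨ ℚ.+-mono-≤ (ℚ.+-mono-≤ (ℚ.+-mono-≤ (*-monoˡ G 0≤G T₁≤) (*-monoˡ G 0≤G T₂≤)) (G*T₃≤ 0≤c)) (*-monoˡ G 0≤G (ℚ.neg-antimono-≤ T₄≥)) ⟩
      G * (2* * (n * n * 𝒜) + 14* * Q) + G * (8* * Q) + (SV + (3* * c + 24* * G) * Q) + G * (- (2* * (n * P) - 10* * Q)) ≡⟨ l₂ G (n * n * 𝒜) (n * P) Q SV c 2* 14* 8* 3* 24* 10* ⟩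
      2* * G * (n * n * 𝒜 - n * P) + SV + (56* * G + 3* * c) * Q ∎
      where
      open ℚ.≤-Reasoning
      Z : ℚ
      Z = 2* * ((1ℚ - e) * (1ℚ - e) * ((1ℚ - ν) * (1ℚ - (ν + ν)) * P))
      l : ∀ g n x D → (1ℚ + 1ℚ) * g * (x * (n * ((1ℚ + (1ℚ + 1ℚ)) * D))) ≡ g * (n * ((1ℚ + (1ℚ + 1ℚ)) * (1ℚ + 1ℚ) * (x * D)))
      l = solve-∀ ring
      l₁ : ∀ g n d a s x z k → g * (n * (k * (d * a) + k * (d * s) + x - z)) ≡ g * (n * (k * d * a)) + g * (n * (k * d * s)) + g * (n * x) + g * (- (n * z))
      l₁ = solve-∀ ring
      l₂ : ∀ g a p q v c t₂ t₁₄ t₈ t₃ t₂₄ t₁₀ → g * (t₂ * a + t₁₄ * q) + g * (t₈ * q) + (v + (t₃ * c + t₂₄ * g) * q) + g * (- (t₂ * p - t₁₀ * q)) ≡ t₂ * g * (a - p) + v + ((t₁₄ + (t₈ + (t₂₄ + t₁₀))) * g + t₃ * c) * q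
      l₂ = solve-∀ ring

-- The cost bound from independent keys.

module KeyedBound where
  open import Data.Rational.Base using (ℚ; 0ℚ; 1ℚ; _+_; _*_; _-_; -_; _≤_; _<_)
  open FiniteSums
  open Truncation
  open BackwardTriangles
  open Extraction
  open Packing using (Packs)
  open TriangularSums
  open HermiteRounding
  open Interpolation
  open IndependentKeys
  open KeyedOrder
  open Quadruples
  open TwoRoots using (Decycled; 4*)
  open Assembling
  open LocalForm

  -- With N = 24 E keys every cell of the grid contains exactly E of them. The same accuracy e = 1/E
  -- is later used as the survival probability of the packing.
  module Random (n′ : ℕ) (Tn : Tournament (suc n′)) (E : ℕ) (e u : ℚ) (eE : e * ι E ≡ 1ℚ) (0≤e : 0ℚ ≤ e) (1≤E : 1ℚ ≤ ι E)
    (24u : ι24 * u ≡ 1ℚ) (0≤u : 0ℚ ≤ u) where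
    open Bounds n′ Tn

    N : ℕ
    N = 24 ℕ.* E
    ν : ℚ
    ν = u * e
    0≤ν : 0ℚ ≤ ν
    0≤ν = *-nn 0≤u 0≤e
    ιN : ι N ≡ ι24 * ι E
    ιN = ι-* 24 E
    νN : ν * ι N ≡ 1ℚ
    νN = trans (cong (ν *_) ιN) (trans (l u e ι24 (ι E)) (trans (cong₂ _*_ 24u eE) (ℚ.*-identityˡ 1ℚ)))
      where
      l : ∀ u e t E → u * e * (t * E) ≡ (t * u) * (e * E)
      l = solve-∀ ring

    open Average N ν νN 0≤ν hiding (E)
    open Average N ν νN 0≤ν using () renaming (E to 𝔼) public
    open RandomKeys N ν νN 0≤ν Tn

    -- This is n/3, written exactly as the cap appears in `Fine`.
    D : ℚ
    D = ν * ι E * (ι 8 * ι n)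

    0≤D : 0ℚ ≤ D
    0≤D = *-nn (*-nn 0≤ν (ι-nn E)) (*-nn (ι-nn 8) (ι-nn n))

    νE : ν * ι E ≡ u
    νE = trans (ℚ.*-assoc u e (ι E)) (trans (cong (u *_) eE) (ℚ.*-identityʳ u))

    3D : 3* * D ≡ ι n
    3D = trans (cong (λ z → 3* * (z * (ι 8 * ι n))) νE) (trans (l u (ι 8) (ι n) 3*) (trans (cong (λ z → z * u * ι n) (trans (cong (_* ι 8) (sym ι3≡)) (sym (ι-* 3 8)))) (trans (cong (_* ι n) 24u) (ℚ.*-identityˡ (ι n)))))
      where
      l : ∀ u k n t → t * (u * (k * n)) ≡ t * k * u * n
      l = solve-∀ ring

    module Averages (η θ : ℚ) (0≤η : 0ℚ ≤ η) (0≤θ : 0ℚ ≤ θ) (ηθ : (1ℚ + 1ℚ + (1ℚ + 1ℚ)) * (η * θ) ≡ 1ℚ) where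

      err : ℚ
      err = η + θ * (ι n * (3* * 3*))

      0≤err : 0ℚ ≤ err
      0≤err = +-nn 0≤η (*-nn 0≤θ (*-nn (ι-nn n) (*-nn 0≤3* 0≤3*)))

      U : ℚ
      U = u * (u * u) * ((1ℚ + e) * (1ℚ + e))

      grid-mean : ∀ a b → 12* * mean (λ z → mean (λ y → lessᵏ y z * pos⁺ (slope (mid a b) (dom a b) (com a b) (toℕ y) (toℕ z) - D))) ≤ U * W a b
      grid-mean a b = begin
        12* * mean (λ z → mean (λ y → g y z)) ≡⟨ cong (12* *_) (trans (mean-swap (λ z y → g y z)) (cong (ν *_) (Σ-*ˡ ν (λ y → Σ (g y))))) ⟩
        12* * (ν * (ν * Σ (λ y → Σ (g y)))) ≡⟨ l₁ 12* ν (Σ (λ y → Σ (g y))) ⟩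
        ν * (ν * (12* * Σ (λ y → Σ (g y)))) ≡⟨ cong (λ z → ν * (ν * (12* * z))) (Σ-cong (λ y → Σ-cong (λ z → cong (λ k → lessᵏ y z * pos⁺ (ν * (mid a b * (ι (toℕ z) - ι (toℕ y)) + dom a b * (k - ι (toℕ z)) + com a b * ι (toℕ y)) - D)) ιN))) ⟩
        ν * (ν * (12* * Σ {N} (λ y → Σ {N} (λ z → [ toℕ y <ᵇ toℕ z ] * pos⁺ (f (toℕ y) (toℕ z)))))) ≤⟨ *-monoˡ ν 0≤ν (*-monoˡ ν 0≤ν fine-bound) ⟩
        ν * (ν * (ν * ι E * ((1ℚ + ι E) * (1ℚ + ι E)) * W a b)) ≡⟨ trans (l₂ u e (ι E) (W a b)) (cong (λ z → u * (u * u) * (z * ((e + z) * (e + z))) * W a b) eE) ⟩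
        u * (u * u) * (1ℚ * ((e + 1ℚ) * (e + 1ℚ))) * W a b ≡⟨ l₃ u e (W a b) ⟩
        U * W a b ∎
        where
        open ℚ.≤-Reasoning
        open Fine (mid a b) (dom a b) (com a b) (ι n) ν 0≤ν E 1≤E using (f; fine-bound)
        g : Fin N → Fin N → ℚ
        g y z = lessᵏ y z * pos⁺ (slope (mid a b) (dom a b) (com a b) (toℕ y) (toℕ z) - D)
        l₁ : ∀ t v s → t * (v * (v * s)) ≡ v * (v * (t * s))
        l₁ = solve-∀ ring
        l₂ : ∀ u e E w → u * e * (u * e * (u * e * E * ((1ℚ + E) * (1ℚ + E)) * w)) ≡ u * (u * u) * (e * E * ((e + e * E) * (e + e * E))) * w
        l₂ = solve-∀ ring
        l₃ : ∀ u e w → u * (u * u) * (1ℚ * ((e + 1ℚ) * (e + 1ℚ))) * w ≡ u * (u * u) * ((1ℚ + e) * (1ℚ + e)) * w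
        l₃ = solve-∀ ring

      codeg-zero : ∀ κ a b → arc Tn a b ≡ false → At.codeg κ a b ≡ 0ℚ
      codeg-zero κ a b ab = trans (cong₂ _+_ (vanish (λ w → At.cond κ a b w) (λ w → first)) (cong₂ _+_ (vanish (λ w → At.cond κ w a b) (λ w → second (arc Tn w a))) (vanish (λ w → At.cond κ a w b) (λ w → third (arc Tn a w) (arc Tn w b))))) (ℚ.+-identityˡ (0ℚ + 0ℚ))
        where
        vanish : ∀ (p : Fin n → Bool) → (∀ w → p w ≡ false) → Σ (λ w → [ p w ]) ≡ 0ℚ
        vanish p h = trans (Σ-cong (λ w → cong [_] (h w))) (Σ-zero n)
        first : ∀ {r} → arc Tn a b ∧ r ≡ false
        first rewrite ab = refl
        second : ∀ p {r} → p ∧ (arc Tn a b ∧ r) ≡ false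
        second p rewrite ab = 𝔹.∧-zeroʳ p
        third : ∀ p q {r} → p ∧ (q ∧ (arc Tn a b ∧ r)) ≡ false
        third p q rewrite ab | 𝔹.∧-zeroʳ q = 𝔹.∧-zeroʳ p

      pair-excess : ∀ a b v → arc Tn a b ≡ v → 12* * 𝔼 (λ κ → pos⁺ (At.codeg κ a b - D)) ≤ [ v ] * (U * W a b + 12* * err)
      pair-excess a b false ab = begin
        12* * 𝔼 (λ κ → pos⁺ (At.codeg κ a b - D)) ≤⟨ *-monoˡ 12* 0≤12* (ℚ.≤-trans (E-mono {G = λ _ → 0ℚ} (λ κ → pos⁺-least {At.codeg κ a b - D} {0ℚ} (≤-by D 0≤D (trans (l D) (cong (λ c → c - D + D) (sym (codeg-zero κ a b ab))))) ℚ.≤-refl)) (ℚ.≤-reflexive (E-const n 0ℚ))) ⟩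
        12* * 0ℚ ≡⟨ trans (ℚ.*-zeroʳ 12*) (sym (ℚ.*-zeroˡ (U * W a b + 12* * err))) ⟩
        0ℚ * (U * W a b + 12* * err) ∎
        where
        open ℚ.≤-Reasoning
        l : ∀ D → 0ℚ ≡ 0ℚ - D + D
        l = solve-∀ ring
      pair-excess a b true ab = begin
        12* * 𝔼 (λ κ → pos⁺ (At.codeg κ a b - D)) ≤⟨ *-monoˡ 12* 0≤12* (Excess.excess-mean a b ab D η θ 0≤D 0≤η 0≤θ ηθ) ⟩
        12* * (M + err) ≡⟨ ℚ.*-distribˡ-+ 12* M err ⟩
        12* * M + 12* * err ≤⟨ ℚ.+-monoˡ-≤ (12* * err) (grid-mean a b) ⟩
        U * W a b + 12* * err ≡⟨ sym (ℚ.*-identityˡ (U * W a b + 12* * err)) ⟩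
        1ℚ * (U * W a b + 12* * err) ∎
        where
        open ℚ.≤-Reasoning
        M : ℚ
        M = mean (λ z → mean (λ y → lessᵏ y z * pos⁺ (slope (mid a b) (dom a b) (com a b) (toℕ y) (toℕ z) - D)))

      ex : Vec (Fin N) n → ℚ
      ex κ = Σ (λ a → Σ (λ b → pos⁺ (At.codeg κ a b - D)))

      SW SV : ℚ
      SW = Σ (λ a → Σ (λ b → [ arc Tn a b ] * W a b))
      SV = Σ (λ a → Σ (λ b → [ arc Tn a b ] * Vₐ a b))

      ΣΣ-* : ∀ c (f : Fin n → Fin n → ℚ) → Σ (λ a → Σ (λ b → c * f a b)) ≡ c * Σ (λ a → Σ (f a))
      ΣΣ-* c f = trans (Σ-cong (λ a → Σ-*ˡ c (f a))) (Σ-*ˡ c (λ a → Σ (f a)))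

      ΣΣ-+ : ∀ (f g : Fin n → Fin n → ℚ) → Σ (λ a → Σ (λ b → f a b + g a b)) ≡ Σ (λ a → Σ (f a)) + Σ (λ a → Σ (g a))
      ΣΣ-+ f g = trans (Σ-cong (λ a → Σ-+ (f a) (g a))) (Σ-+ (λ a → Σ (f a)) (λ a → Σ (g a)))

      excess-total : 12* * 𝔼 ex ≤ U * SW + 12* * err * arcs
      excess-total = begin
        12* * 𝔼 ex ≡⟨ cong (12* *_) (trans (E-Σ (λ a κ → Σ (λ b → pos⁺ (At.codeg κ a b - D)))) (Σ-cong (λ a → E-Σ (λ b κ → pos⁺ (At.codeg κ a b - D))))) ⟩
        12* * Σ (λ a → Σ (λ b → 𝔼 (λ κ → pos⁺ (At.codeg κ a b - D)))) ≡⟨ sym (ΣΣ-* 12* (λ a b → 𝔼 (λ κ → pos⁺ (At.codeg κ a b - D)))) ⟩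
        Σ (λ a → Σ (λ b → 12* * 𝔼 (λ κ → pos⁺ (At.codeg κ a b - D)))) ≤⟨ Σ-mono (λ a → Σ-mono (λ b → ℚ.≤-trans (pair-excess a b (arc Tn a b) refl) (ℚ.≤-reflexive (l [ arc Tn a b ] U (W a b) (12* * err))))) ⟩
        Σ (λ a → Σ (λ b → U * ([ arc Tn a b ] * W a b) + 12* * err * [ arc Tn a b ])) ≡⟨ trans (ΣΣ-+ (λ a b → U * ([ arc Tn a b ] * W a b)) (λ a b → 12* * err * [ arc Tn a b ])) (cong₂ _+_ (ΣΣ-* U (λ a b → [ arc Tn a b ] * W a b)) (ΣΣ-* (12* * err) (λ a b → [ arc Tn a b ]))) ⟩
        U * SW + 12* * err * arcs ∎
        where
        open ℚ.≤-Reasoning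
        l : ∀ p U w r → p * (U * w + r) ≡ U * (p * w) + r * p
        l = solve-∀ ring

      module Choice (s : ℚ) (0≤s : 0ℚ ≤ s) where
        r² c₁ c₂ c₃ c₀ : ℚ
        r² = (1ℚ - e) * (1ℚ - e)
        c₁ = 2* * (D + 1ℚ)
        c₂ = 2* * r²
        c₃ = - (2* * r²)
        c₀ = s * (D + 1ℚ)

        -- `F` is the right side of `packed-cost` with the triangles moved over: a linear
        -- combination of backward arcs, excess and triangles. Its mean is therefore computed term
        -- by term, and some choice of keys does not exceed it.
        Z F : Vec (Fin N) n → ℚ
        Z κ = Σ₃ (λ x y z → [ At.cond κ x y z ])
        F κ = c₁ * At.feedback κ + (c₂ * ex κ + (c₃ * Z κ + c₀))

        F-mean : 𝔼 F ≡ c₁ * 𝔼 (λ κ → At.feedback κ) + (c₂ * 𝔼 ex + (c₃ * 𝔼 Z + c₀))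
        F-mean = trans (E-+ (λ κ → c₁ * At.feedback κ) (λ κ → c₂ * ex κ + (c₃ * Z κ + c₀))) (cong₂ _+_ (E-* c₁ (λ κ → At.feedback κ)) (trans (E-+ (λ κ → c₂ * ex κ) (λ κ → c₃ * Z κ + c₀)) (cong₂ _+_ (E-* c₂ ex)
          (trans (E-+ (λ κ → c₃ * Z κ) (λ _ → c₀)) (cong₂ _+_ (E-* c₃ Z) (E-const n c₀))))))

        EX : ℚ
        EX = 12* * 𝔼 ex

        0≤ex : 0ℚ ≤ 𝔼 ex
        0≤ex = ℚ.≤-trans (ℚ.≤-reflexive (sym (E-const n 0ℚ))) (E-mono (λ κ → Σ-nn (λ a → Σ-nn (λ b → pos⁺-nn (At.codeg κ a b - D)))))

        F-bound : e ≤ 1ℚ → 6* * 𝔼 F ≤ 6* * ((D + 1ℚ) * ((1ℚ + ν) * arcs)) + 6* * ((D + 1ℚ) * s) + EX - 2* * (r² * ((1ℚ - ν) * (1ℚ - (ν + ν)) * transitive))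
        F-bound e≤1 = begin
          6* * 𝔼 F ≡⟨ cong (6* *_) F-mean ⟩
          6* * (c₁ * fb + (c₂ * 𝔼 ex + (c₃ * 𝔼 Z + c₀))) ≡⟨ l (D + 1ℚ) fb r² (𝔼 ex) (𝔼 Z) s ⟩
          6* * ((D + 1ℚ) * (2* * fb)) + 6* * ((D + 1ℚ) * s) + r² * EX - 2* * (r² * (6* * 𝔼 Z)) ≤⟨ ℚ.+-mono-≤ (ℚ.+-mono-≤ (ℚ.+-monoˡ-≤ (6* * ((D + 1ℚ) * s)) (*-monoˡ 6* 0≤6* (*-monoˡ (D + 1ℚ) (+-nn 0≤D 0≤1) feedback-mean)))
              (ℚ.≤-trans (*-monoʳ EX (*-nn 0≤12* 0≤ex) r²≤1) (ℚ.≤-reflexive (ℚ.*-identityˡ EX)))) (ℚ.≤-reflexive (cong (λ z → - (2* * (r² * z))) triangles-mean)) ⟩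
          6* * ((D + 1ℚ) * ((1ℚ + ν) * arcs)) + 6* * ((D + 1ℚ) * s) + EX - 2* * (r² * ((1ℚ - ν) * (1ℚ - (ν + ν)) * transitive)) ∎
          where
          open ℚ.≤-Reasoning
          fb : ℚ
          fb = 𝔼 (λ κ → At.feedback κ)
          r²≤1 : r² ≤ 1ℚ
          r²≤1 = ≤-by (e * (1ℚ + (1ℚ - e))) (*-nn 0≤e (+-nn 0≤1 (diff≥0 e≤1))) (l₂ e)
            where
            l₂ : ∀ e → 1ℚ ≡ (1ℚ - e) * (1ℚ - e) + e * (1ℚ + (1ℚ - e))
            l₂ = solve-∀ ring
          l : ∀ d f r x z s → (1ℚ + (1ℚ + 1ℚ)) * (1ℚ + 1ℚ) * ((1ℚ + 1ℚ) * d * f + ((1ℚ + 1ℚ) * r * x + ((- ((1ℚ + 1ℚ) * r)) * z + s * d)))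
            ≡ (1ℚ + (1ℚ + 1ℚ)) * (1ℚ + 1ℚ) * (d * ((1ℚ + 1ℚ) * f)) + (1ℚ + (1ℚ + 1ℚ)) * (1ℚ + 1ℚ) * (d * s) + r * ((1ℚ + (1ℚ + 1ℚ)) * (1ℚ + 1ℚ) * (1ℚ + 1ℚ) * x) - (1ℚ + 1ℚ) * (r * ((1ℚ + (1ℚ + 1ℚ)) * (1ℚ + 1ℚ) * z))
          l = solve-∀ ring

        chosen : ∀ A → Oriented A → (∀ i j → A i j ≡ true → arc Tn i j ≡ true) → ∀ m′ D₀ → Packs m′ D₀ → e * ι (suc m′) ≡ 1ℚ → ι D₀ ≤ D + 1ℚ →
          ι n * (ι n * ι n + ι n * ι n) < s * s → ∃[ k ] (Decycled A k × 4* * ι k * (D + 1ℚ) ≤ 𝔼 F)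
        chosen A orA sub m′ D₀ packs em D₀≤ large = go (attained F)
          where
          go : (∃[ κ ] F κ ≤ 𝔼 F) → ∃[ k ] (Decycled A k × 4* * ι k * (D + 1ℚ) ≤ 𝔼 F)
          go (κ , p) = let k , C , bound = packed-cost m′ D₀ packs D e s em 0≤D D₀≤ 0≤s large in
              k , decycle A orA sub C , ℚ.≤-trans (cancel (4* * ι k * (D + 1ℚ)) (At.feedback κ) (ex κ) (Z κ) (At.e₂-back κ) bound) p
            where
            open Extract Tn (key κ) (pos κ) (pos-inj κ) (pos-key κ) using (packed-cost; decycle)
            cancel : ∀ x f w z {e₂} → e₂ ≡ 2* * f → x + 2* * (r² * z) ≤ (e₂ + s) * (D + 1ℚ) + 2* * (r² * w) → x ≤ c₁ * f + (c₂ * w + (c₃ * z + c₀))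
            cancel x f w z refl q = ≤-by _ (diff≥0 q) (l x f w z r² s (D + 1ℚ))
              where
              l : ∀ x f w z r s d → (1ℚ + 1ℚ) * d * f + ((1ℚ + 1ℚ) * r * w + ((- ((1ℚ + 1ℚ) * r)) * z + s * d)) ≡ x + (((1ℚ + 1ℚ) * f + s) * d + (1ℚ + 1ℚ) * (r * w) - (x + (1ℚ + 1ℚ) * (r * z)))
              l = solve-∀ ring

-- Combining the two orders.

module Conclusion where
  open Subset using (Subset; ∣_∣)
  open import Data.Rational.Base using (ℚ; 0ℚ; 1ℚ; _+_; _*_; _-_; -_; _≤_; _<_)
  open FiniteSums
  open Inversions using (true≢false)
  open Truncation
  open BackwardTriangles
  open Packing using (Packs; packing)
  open TriangularSums
  open HermiteRounding
  open Interpolation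
  open KeyedOrder
  open FourVertices
  open Quadruples
  open TwoRoots
  open Assembling
  open LocalForm
  open KeyedBound

  ι6≡ : ι 6 ≡ 6*
  ι6≡ = trans (ι-* 3 2) (cong₂ _*_ ι3≡ ι2≡)
  ι8≡ : ι 8 ≡ 8*
  ι8≡ = trans (ι-* 2 4) (cong₂ _*_ ι2≡ (trans (ι-* 2 2) (cong₂ _*_ ι2≡ ι2≡)))
  ι12≡ : ι 12 ≡ 12*
  ι12≡ = trans (ι-* 6 2) (cong₂ _*_ ι6≡ ι2≡)
  ι24≡ : ι24 ≡ 24*
  ι24≡ = trans (ι-* 12 2) (cong₂ _*_ ι12≡ ι2≡)

  -- Pairs without an arc are oriented by index; sets that decycle the tournament also decycle its
  -- subgraph.
  extend : ∀ {n} (A : Digraph n) → Oriented A → Tournament n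
  extend {n} A orA = record { arc = a ; arc-irr = irr ; arc-flip = flip }
    where
    open Oriented orA
    a : Fin n → Fin n → Bool
    a i j = A i j ∨ (not (A j i) ∧ (toℕ i <ᵇ toℕ j))
    irr : ∀ i → a i i ≡ false
    irr i rewrite irrefl i = <ᵇ-false {toℕ i} {toℕ i} ℕP.≤-refl
    less-flip : ∀ i j → (i == j) ≡ false → (toℕ j <ᵇ toℕ i) ≡ not (toℕ i <ᵇ toℕ j)
    less-flip i j ij with ℕP.<-cmp (toℕ i) (toℕ j)
    ... | tri< p _ _ = trans (<ᵇ-false (ℕP.<⇒≤ p)) (cong not (sym (<ᵇ-true p)))
    ... | tri≈ _ e _ = true≢false (trans (cong (i ==_) (sym (FP.toℕ-injective e))) (==-refl i)) ij
    ... | tri> _ _ p = trans (<ᵇ-true p) (cong not (sym (<ᵇ-false (ℕP.<⇒≤ p))))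
    flip : ∀ i j → (i == j) ≡ false → a j i ≡ not (a i j)
    flip i j ij with A i j in p | A j i in q
    ... | true | true = true≢false q (antisym i j p)
    ... | true | false = refl
    ... | false | true = refl
    ... | false | false = less-flip i j ij

  extend-⊇ : ∀ {n} (A : Digraph n) (orA : Oriented A) i j → A i j ≡ true → arc (extend A orA) i j ≡ true
  extend-⊇ A orA i j p rewrite p = refl

  module Totals (n′ : ℕ) (Tn : Tournament (suc n′)) where
    open Bounds n′ Tn

    private
      t : Fin n → Fin n → Bool
      t = arc Tn

    𝒜 P SW SV : ℚ
    𝒜 = Σ (λ a → Σ (λ b → [ t a b ]))
    P = Σ₃ (λ x y z → [ t x y ] * ([ t y z ] * [ t x z ]))
    SW = Σ (λ a → Σ (λ b → [ t a b ] * W a b))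
    SV = Σ (λ a → Σ (λ b → [ t a b ] * Vₐ a b))

    -- Transitive triples are grouped by their long arc.
    P≡ : P ≡ Σ (λ a → Σ (λ b → [ t a b ] * mid a b))
    P≡ = Σ-cong (λ x → trans (Σ-swap (λ y z → [ t x y ] * ([ t y z ] * [ t x z ]))) (Σ-cong (λ z → trans (Σ-cong (λ y → trans (l [ t x y ] [ t y z ] [ t x z ]) (cong ([ t x z ] *_) (sym ([∧] (t x y) (t y z)))))) (Σ-*ˡ [ t x z ] (λ y → [ middle x z y ])))))
      where
      l : ∀ a b c → a * (b * c) ≡ c * (a * b)
      l = solve-∀ ring

    ΣΣ≤ : ∀ {f : Fin n → Fin n → ℚ} c → (∀ a b → f a b ≤ c) → Σ (λ a → Σ (f a)) ≤ ι n * (ι n * c)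
    ΣΣ≤ c p = Σ-upper (ι n * c) (λ a → Σ-upper c (p a))

    weighted≤ : ∀ b {x c} → x ≤ c → 0ℚ ≤ c → [ b ] * x ≤ c
    weighted≤ true {x} p q = ℚ.≤-trans (ℚ.≤-reflexive (ℚ.*-identityˡ x)) p
    weighted≤ false {x} p q = ℚ.≤-trans (ℚ.≤-reflexive (ℚ.*-zeroˡ x)) q

    𝒜≤ : 𝒜 ≤ ι n * ι n
    𝒜≤ = ℚ.≤-trans (ΣΣ≤ 1ℚ (λ a b → []≤1 (t a b))) (ℚ.≤-reflexive (cong (ι n *_) (ℚ.*-identityʳ (ι n))))
    0≤𝒜 : 0ℚ ≤ 𝒜
    0≤𝒜 = Σ-nn (λ a → Σ-nn (λ b → []-nn (t a b)))

    P≤ : P ≤ ι n * (ι n * ι n)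
    P≤ = ℚ.≤-trans (ℚ.≤-reflexive P≡) (ΣΣ≤ (ι n) (λ a b → weighted≤ (t a b) (ℚ.≤-trans (Σ-upper 1ℚ (λ w → []≤1 (middle a b w))) (ℚ.≤-reflexive (ℚ.*-identityʳ (ι n)))) (ι-nn n)))
    0≤P : 0ℚ ≤ P
    0≤P = subst (0ℚ ≤_) (sym P≡) (Σ-nn (λ a → Σ-nn (λ b → *-nn ([]-nn (t a b)) (0≤mid a b))))

    c : ℚ
    c = ι 1417370
    0≤c : 0ℚ ≤ c
    0≤c = ι-nn 1417370

    SV≤ : SV ≤ c * (ι n * (ι n * (ι n * ι n)))
    SV≤ = ℚ.≤-trans (ΣΣ≤ (c * (ι n * ι n)) (λ a b → weighted≤ (t a b) (V≤ a b) (*-nn 0≤c (*-nn (ι-nn n) (ι-nn n))))) (ℚ.≤-reflexive (l (ι n) c))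
      where
      l : ∀ n c → n * (n * (c * (n * n))) ≡ c * (n * (n * (n * n)))
      l = solve-∀ ring

    SW≤ : ι n * (24* * SW) ≤ SV
    SW≤ = ℚ.≤-trans (ℚ.≤-reflexive (trans (l (ι n) 24* SW) (sym (trans (Σ-cong (λ a → Σ-*ˡ (ι n * 24*) (λ b → [ t a b ] * W a b))) (Σ-*ˡ (ι n * 24*) (λ a → Σ (λ b → [ t a b ] * W a b)))))))
      (Σ-mono (λ a → Σ-mono (λ b → ℚ.≤-trans (ℚ.≤-reflexive (l₂ (ι n) 24* [ t a b ] (W a b))) (*-monoˡ [ t a b ] ([]-nn (t a b)) (subst (λ z → ι n * (z * W a b) ≤ Vₐ a b) ι24≡ (W≤V a b))))))
      where
      l : ∀ n k w → n * (k * w) ≡ n * k * w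
      l = solve-∀ ring
      l₂ : ∀ n k p w → n * k * (p * w) ≡ p * (n * (k * w))
      l₂ = solve-∀ ring

    g o : ℚ
    g = ι 663552
    o = ι 1790712

    random-total : total random-local ≡ SV + g * (ι n * ι n * 𝒜 - ι n * P) + o * (ι n * ι n * 𝒜)
    random-total = trans (Σ-cong (λ a → trans (Σ-cong (λ b → trans (random-pair a b) (l₁ [ t a b ] (Vₐ a b) g o (ι n) (mid a b)))) (split (λ b → [ t a b ] * Vₐ a b) (λ b → [ t a b ]) (λ b → [ t a b ] * mid a b))))
      (trans (split (λ a → Σ (λ b → [ t a b ] * Vₐ a b)) (λ a → Σ (λ b → [ t a b ])) (λ a → Σ (λ b → [ t a b ] * mid a b)))
        (trans (cong (λ p → SV + (x * 𝒜 + y * p)) (sym P≡)) (l₂ SV g o (ι n) 𝒜 P)))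
      where
      x y : ℚ
      x = (g + o) * (ι n * ι n)
      y = - (g * ι n)
      l₁ : ∀ p v g o n m → p * (v + (g * (n * (n - m)) + o * (n * n))) ≡ p * v + ((g + o) * (n * n) * p + (- (g * n)) * (p * m))
      l₁ = solve-∀ ring
      l₂ : ∀ v g o n a p → v + ((g + o) * (n * n) * a + (- (g * n)) * p) ≡ v + g * (n * n * a - n * p) + o * (n * n * a)
      l₂ = solve-∀ ring
      split : ∀ (f h k : Fin n → ℚ) → Σ (λ i → f i + (x * h i + y * k i)) ≡ Σ f + (x * Σ h + y * Σ k)
      split f h k = trans (Σ-+ f (λ i → x * h i + y * k i)) (cong (Σ f +_) (trans (Σ-+ (λ i → x * h i) (λ i → y * k i)) (cong₂ _+_ (Σ-*ˡ x h) (Σ-*ˡ y k))))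

    arcs-total : 2* * 𝒜 ≡ ι n * ι n - ι n
    arcs-total = begin
      2* * 𝒜 ≡⟨ l 𝒜 ⟩
      𝒜 + 𝒜 ≡⟨ cong (𝒜 +_) (Σ-swap (λ a b → [ t a b ])) ⟩
      𝒜 + Σ (λ b → Σ (λ a → [ t a b ])) ≡⟨ trans (sym (Σ-+ (λ a → Σ (λ b → [ t a b ])) (λ a → Σ (λ b → [ t b a ])))) (Σ-cong {n} (λ a → trans (sym (Σ-+ {n} (λ b → [ t a b ]) (λ b → [ t b a ]))) (Σ-cong {n} (λ b → point a b (a == b) refl)))) ⟩
      Σ {n} (λ a → Σ {n} (λ b → 1ℚ - [ b == a ] * 1ℚ)) ≡⟨ Σ-cong {n} (λ a → trans (Σ-- {n} (λ _ → 1ℚ) (λ b → [ b == a ] * 1ℚ)) (cong₂ _-_ (trans (Σ-const n 1ℚ) (ℚ.*-identityʳ (ι n))) (Σ-δ a (λ _ → 1ℚ)))) ⟩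
      Σ {n} (λ a → ι n - 1ℚ) ≡⟨ trans (Σ-const n (ι n - 1ℚ)) (l₂ (ι n)) ⟩
      ι n * ι n - ι n ∎
      where
      open ≡-Reasoning
      l : ∀ a → (1ℚ + 1ℚ) * a ≡ a + a
      l = solve-∀ ring
      l₂ : ∀ n → n * (n - 1ℚ) ≡ n * n - n
      l₂ = solve-∀ ring
      bits : ∀ b → [ b ] + [ not b ] ≡ 1ℚ
      bits true = refl
      bits false = refl
      point : ∀ a b v → (a == b) ≡ v → [ t a b ] + [ t b a ] ≡ 1ℚ - [ b == a ] * 1ℚ
      point a b true p with ==⇒≡ a b p
      ... | refl rewrite arc-irr Tn a | ==-refl a = refl
      point a b false p rewrite arc-flip Tn a b p | trans (==-sym b a) p = bits (t a b)

    local-split : total (local t) ≡ ι 114 * total random-local + ι 7299072 * total (rooted-local Tn)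
    local-split = trans (Σ₄-cong (λ a b w x → trans (cong ι (body-eq (t a b) (t a w) (t w a) (t w b) (t b w) (t a x) (t x a) (t x b) (t b x) (t w x)))
        (trans (ι-+ (random-local a b w x ℕ.* 114) (rooted-local Tn a b w x ℕ.* 7299072)) (cong₂ _+_ (flip-* (random-local a b w x) 114) (flip-* (rooted-local Tn a b w x) 7299072)))))
      (trans (Σ₄-+ (λ a b w x → ι 114 * ι (random-local a b w x)) (λ a b w x → ι 7299072 * ι (rooted-local Tn a b w x))) (cong₂ _+_ (Σ₄-* (ι 114) (λ a b w x → ι (random-local a b w x))) (Σ₄-* (ι 7299072) (λ a b w x → ι (rooted-local Tn a b w x)))))
      where
      flip-* : ∀ m k → ι (m ℕ.* k) ≡ ι k * ι m
      flip-* m k = trans (ι-* m k) (ℚ.*-comm (ι m) (ι k))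

  -- `long` says e² n ≥ 3. It makes s = e n² exceed the 4-cycle threshold, as s² ≥ 3 n³ > 2 n³, and
  -- keeps the fluctuation of the degrees below order e n.
  module Parameters (n′ : ℕ) (A : Digraph (suc n′)) (orA : Oriented A) (m′ D₀ : ℕ) (packs : Packs m′ D₀) (e u : ℚ) (0≤e : 0ℚ ≤ e) (eE : e * ι (suc m′) ≡ 1ℚ)
    (0≤u : 0ℚ ≤ u) (24u : ι24 * u ≡ 1ℚ) (6≤E : 6 ℕ.≤ suc m′) (3D₀≤n : 3 ℕ.* D₀ ℕ.≤ suc n′) (long : 3* ≤ e * (e * ι (suc n′))) where

    Tn : Tournament (suc n′)
    Tn = extend A orA
    open Bounds n′ Tn using (n; random-local)
    open Totals n′ Tn

    sub : ∀ i j → A i j ≡ true → arc Tn i j ≡ true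
    sub = extend-⊇ A orA

    small-e : 6* * e ≤ 1ℚ
    small-e = ℚ.≤-trans (*-monoʳ e 0≤e (subst (_≤ ι (suc m′)) ι6≡ (ι-mono 6≤E))) (ℚ.≤-reflexive (trans (ℚ.*-comm (ι (suc m′)) e) eE))

    e≤1 : e ≤ 1ℚ
    e≤1 = ℚ.≤-trans (≤-by ((2* + 3*) * e) (*-nn (+-nn 0≤2* 0≤3*) 0≤e) (l e)) small-e
      where
      l : ∀ e → (1ℚ + (1ℚ + 1ℚ)) * (1ℚ + 1ℚ) * e ≡ e + ((1ℚ + 1ℚ) + (1ℚ + (1ℚ + 1ℚ))) * e
      l = solve-∀ ring

    0≤n : 0ℚ ≤ ι n
    0≤n = ι-nn n
    0≤en : 0ℚ ≤ e * ι n
    0≤en = *-nn 0≤e 0≤n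

    3≤en : 3* ≤ e * ι n
    3≤en = ℚ.≤-trans long (ℚ.≤-trans (*-monoʳ (e * ι n) 0≤en e≤1) (ℚ.≤-reflexive (ℚ.*-identityˡ (e * ι n))))

    1≤3 : 1ℚ ≤ 3*
    1≤3 = ≤-by 2* 0≤2* refl

    1≤en : 1ℚ ≤ e * ι n
    1≤en = ℚ.≤-trans 1≤3 3≤en

    s Q : ℚ
    s = e * (ι n * ι n)
    Q = e * (ι n * (ι n * (ι n * ι n)))
    0≤s : 0ℚ ≤ s
    0≤s = *-nn 0≤e (*-nn 0≤n 0≤n)

    0<n³ : 0ℚ < ι n * (ι n * ι n)
    0<n³ = ℚ.<-≤-trans (ℚ.positive⁻¹ 1ℚ) (ℚ.≤-trans (1≤ι n′) (subst (_≤ ι n * (ι n * ι n)) (ℚ.*-identityʳ (ι n)) (*-monoˡ (ι n) 0≤n (ℚ.≤-trans (1≤ι n′) (subst (_≤ ι n * ι n) (ℚ.*-identityʳ (ι n)) (*-monoˡ (ι n) 0≤n (1≤ι n′)))))))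

    large : ι n * (ι n * ι n + ι n * ι n) < s * s
    large = ℚ.<-≤-trans (subst₂ _<_ (l (ι n)) (l₂ (ι n)) (ℚ.+-monoʳ-< (c₃ + c₃) 0<n³)) (ℚ.≤-trans (*-monoˡ c₃ (ℚ.<⇒≤ 0<n³) long) (ℚ.≤-reflexive (l₃ (ι n) e)))
      where
      c₃ : ℚ
      c₃ = ι n * (ι n * ι n)
      l : ∀ n → n * (n * n) + n * (n * n) + 0ℚ ≡ n * (n * n + n * n)
      l = solve-∀ ring
      l₂ : ∀ n → n * (n * n) + n * (n * n) + n * (n * n) ≡ n * (n * n) * (1ℚ + (1ℚ + 1ℚ))
      l₂ = solve-∀ ring
      l₃ : ∀ n e → n * (n * n) * (e * (e * n)) ≡ e * (n * n) * (e * (n * n))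
      l₃ = solve-∀ ring

    -- With θ = 1/(4 e n) the variance term 9 θ n is at most e n, because 4 e² n ≥ 9; both parts of
    -- `err` are then bounded by e n.
    η : ℚ
    η = e * ι n

    0<4η : 0ℚ < 4* * η
    0<4η = ℚ.<-≤-trans (ℚ.positive⁻¹ 1ℚ) (ℚ.≤-trans 1≤en (≤-by (3* * η) (*-nn 0≤3* 0≤en) (l η)))
      where
      l : ∀ h → (1ℚ + 1ℚ + (1ℚ + 1ℚ)) * h ≡ h + (1ℚ + (1ℚ + 1ℚ)) * h
      l = solve-∀ ring

    -- 22831566 = 56 · 24⁴ + 3 · 1417370 is the error constant of `assembled`. The raise `o` is
    -- added on both sides, as the local weights contain it.
    random-cost : ∃[ k ] (Decycled A k × g * (4* * ι k * (ι n * ι n)) + o * (ι n * ι n * 𝒜) ≤ total random-local + ι 22831566 * Q)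
    random-cost = go (inv (4* * η) 0<4η)
      where
      open Random n′ Tn (suc m′) e u eE 0≤e (1≤ι m′) 24u 0≤u
      go : ∃[ θ ] (0ℚ < θ × 4* * η * θ ≡ 1ℚ) → ∃[ k ] (Decycled A k × g * (4* * ι k * (ι n * ι n)) + o * (ι n * ι n * 𝒜) ≤ total random-local + ι 22831566 * Q)
      go (θ , 0<θ , 4ηθ) = finish (Choice.chosen s 0≤s A orA sub m′ D₀ packs eE D₀≤ large)
        where
        0≤θ : 0ℚ ≤ θ
        0≤θ = ℚ.<⇒≤ 0<θ
        ηθ : 4* * (η * θ) ≡ 1ℚ
        ηθ = trans (sym (ℚ.*-assoc 4* η θ)) 4ηθ
        open Averages η θ 0≤en 0≤θ ηθ hiding (SW; SV)
        D₀≤ : ι D₀ ≤ D + 1ℚ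
        D₀≤ = ℚ.≤-trans (*-cancelˡ {ι D₀} {D} 3* (ℚ.<-≤-trans (ℚ.positive⁻¹ 1ℚ) 1≤3) (subst₂ _≤_ (trans (ι-* 3 D₀) (cong (_* ι D₀) ι3≡)) (sym 3D) (ι-mono 3D₀≤n))) (≤-by {D} 1ℚ 0≤1 refl)
        err≤ : err ≤ 2* * (e * ι n)
        err≤ = ℚ.≤-trans (ℚ.+-monoʳ-≤ η (ℚ.≤-trans (ℚ.≤-reflexive (l₀ θ (ι n))) (ℚ.≤-trans (*-monoˡ (θ * ι n) (*-nn 0≤θ 0≤n) nine) (ℚ.≤-reflexive (trans (l₁ θ (ι n) e) (trans (cong (_* (e * ι n)) ηθ) (ℚ.*-identityˡ (e * ι n)))))))) (ℚ.≤-reflexive (l₂ η))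
          where
          l₀ : ∀ t n → t * (n * ((1ℚ + (1ℚ + 1ℚ)) * (1ℚ + (1ℚ + 1ℚ)))) ≡ t * n * ((1ℚ + (1ℚ + 1ℚ)) * (1ℚ + (1ℚ + 1ℚ)))
          l₀ = solve-∀ ring
          l₁ : ∀ t n e → t * n * ((1ℚ + 1ℚ + (1ℚ + 1ℚ)) * (e * (e * n))) ≡ (1ℚ + 1ℚ + (1ℚ + 1ℚ)) * (e * n * t) * (e * n)
          l₁ = solve-∀ ring
          l₂ : ∀ h → h + h ≡ (1ℚ + 1ℚ) * h
          l₂ = solve-∀ ring
          nine : 3* * 3* ≤ 4* * (e * (e * ι n))
          nine = *-mono 0≤3* (ℚ.≤-trans 0≤3* long) (≤-by 1ℚ 0≤1 refl) long
        finish : ∃[ k ] (Decycled A k × 4* * ι k * (D + 1ℚ) ≤ 𝔼 (Choice.F s 0≤s)) → ∃[ k ] (Decycled A k × g * (4* * ι k * (ι n * ι n)) + o * (ι n * ι n * 𝒜) ≤ total random-local + ι 22831566 * Q)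
        finish (k , dec , bound) = k , dec , (begin
          g * (4* * ι k * (ι n * ι n)) + o * (ι n * ι n * 𝒜) ≡⟨ cong (λ z → z * (4* * ι k * (ι n * ι n)) + o * (ι n * ι n * 𝒜)) g≡ ⟩
          2* * G * (4* * ι k * (ι n * ι n)) + o * (ι n * ι n * 𝒜) ≤⟨ ℚ.+-monoˡ-≤ (o * (ι n * ι n * 𝒜)) (assembled 0≤c) ⟩
          2* * G * (ι n * ι n * 𝒜 - ι n * P) + SV + (56* * G + 3* * c) * Q + o * (ι n * ι n * 𝒜) ≡⟨ cong₂ (λ z y → z * (ι n * ι n * 𝒜 - ι n * P) + SV + y * Q + o * (ι n * ι n * 𝒜)) (sym g≡) Kr≡ ⟩
          g * (ι n * ι n * 𝒜 - ι n * P) + SV + ι 22831566 * Q + o * (ι n * ι n * 𝒜) ≡⟨ l g (ι n * ι n * 𝒜 - ι n * P) SV (ι 22831566 * Q) (o * (ι n * ι n * 𝒜)) ⟩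
          SV + g * (ι n * ι n * 𝒜 - ι n * P) + o * (ι n * ι n * 𝒜) + ι 22831566 * Q ≡⟨ cong (_+ ι 22831566 * Q) (sym random-total) ⟩
          total random-local + ι 22831566 * Q ∎)
          where
          open ℚ.≤-Reasoning
          open Assembly (ι n) e u ν s 𝒜 P SV SW (Choice.EX s 0≤s) (𝔼 (Choice.F s 0≤s)) (4* * ι k) D err c
            0≤n (1≤ι n′) 0≤e small-e 1≤en 0≤u (trans (cong (_* u) (sym ι24≡)) 24u) refl refl 0≤𝒜 𝒜≤ 0≤P P≤
            (*-nn (+-nn 0≤2* 0≤2*) (ι-nn k)) 3D 0≤err err≤ bound (Choice.F-bound s 0≤s e≤1) excess-total SW≤ SV≤ using (G; 56*; assembled)
          l : ∀ g x v q y → g * x + v + q + y ≡ v + g * x + y + q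
          l = solve-∀ ring
          G≡ : G ≡ ι 331776
          G≡ = sym (trans (ι-* 24 13824) (cong₂ _*_ ι24≡ (trans (ι-* 24 576) (cong₂ _*_ ι24≡ (trans (ι-* 24 24) (cong₂ _*_ ι24≡ ι24≡))))))
          g≡ : g ≡ 2* * G
          g≡ = trans (ι-* 2 331776) (cong₂ _*_ ι2≡ (sym G≡))
          56≡ : 56* ≡ ι 56
          56≡ = sym (trans (ι-+ 14 42) (cong₂ _+_ (trans (ι-+ 8 6) (cong₂ _+_ ι8≡ ι6≡)) (trans (ι-+ 8 34) (cong₂ _+_ ι8≡ (trans (ι-+ 24 10) (cong₂ _+_ ι24≡ (trans (ι-* 2 5) (cong₂ _*_ ι2≡ (trans (ι-+ 2 3) (cong₂ _+_ ι2≡ ι3≡))))))))))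
          Kr≡ : 56* * G + 3* * c ≡ ι 22831566
          Kr≡ = sym (trans (ι-+ 18579456 4252110) (cong₂ _+_ (trans (ι-* 56 331776) (cong₂ _*_ (sym 56≡) (sym G≡))) (trans (ι-* 3 1417370) (cong (_* c) ι3≡))))

    rooted-cost′ : ∃[ k ] (Decycled A k × 4* * ι k * (ι n * ι n) ≤ total (rooted-local Tn) + Q)
    rooted-cost′ = let k , dec , bound = rooted-average Tn (λ ()) A orA sub s 0≤s large in
        k , dec , subst₂ _≤_ (l₁ (ι n) (4* * ι k)) (l₂ (total (rooted-local Tn)) (ι n) e) bound
      where
      l₁ : ∀ n x → n * (n * x) ≡ x * (n * n)
      l₁ = solve-∀ ring
      l₂ : ∀ t n e → t + n * (n * (e * (n * n))) ≡ t + e * (n * (n * (n * n)))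
      l₂ = solve-∀ ring

    n³ n⁴ : ℚ
    n³ = ι n * (ι n * ι n)
    n⁴ = ι n * (ι n * (ι n * ι n))

    cap₄≡ : cap₄ ≡ 12000000000
    cap₄≡ = cong (λ c → let c₂ = c ℕ.+ c; c₃ = c₂ ℕ.+ (c₂ ℕ.+ c₂) in c₃ ℕ.+ (c₃ ℕ.+ (c₃ ℕ.+ c₃))) cap-eq

    module Both (big : ι 137092036320 ≤ ι 813552 * ι (suc m′)) where

      K : ℚ
      K = ι 12000000000

      total-bound : 24* * total (local (arc Tn)) ≤ ι 3238384464 * n⁴ + ι 72000000000 * n³
      total-bound = subst₂ _≤_ (l₁ (total (local (arc Tn)))) (trans (l₂ (ι n) (ι 3238384464) K) (cong (λ z → ι 3238384464 * n⁴ + z * n³) (sym (trans (ι-* 6 12000000000) (cong (_* K) ι6≡)))))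
          (local-total Tn (ι 3238384464) K (cong ι bound₄-eq) (cong ι cap₄≡))
        where
        l₁ : ∀ x → (x + x + (x + x + (x + x))) + ((x + x + (x + x + (x + x))) + ((x + x + (x + x + (x + x))) + (x + x + (x + x + (x + x))))) ≡ (1ℚ + (1ℚ + 1ℚ)) * (1ℚ + 1ℚ) * (1ℚ + 1ℚ) * (1ℚ + 1ℚ) * x
        l₁ = solve-∀ ring
        l₂ : ∀ n b k → n * (n * (n * (n * b))) + k * (n * (n * n) + (n * (n * n) + (n * (n * n) + (n * (n * n) + (n * (n * n) + n * (n * n)))))) ≡ b * (n * (n * (n * n))) + (1ℚ + (1ℚ + 1ℚ)) * (1ℚ + 1ℚ) * k * (n * (n * n))
        l₂ = solve-∀ ring

      -- The same `x` satisfies both bounds, so they combine with weights 114 and 11 into the sum of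
      -- `body`. The raise is taken out again: it amounts to 1790712 n² `𝒜`, where 2 `𝒜` = n² - n,
      -- whence 2449694016 = 12 · 114 · 1790712.
      mixture : ∀ x → g * (x * (ι n * ι n)) + o * (ι n * ι n * 𝒜) ≤ total random-local + ι 22831566 * Q → x * (ι n * ι n) ≤ total (rooted-local Tn) + Q →
        ι 1990656000 * (x * (ι n * ι n)) ≤ ι 789504000 * n⁴
      mixture x r p = begin
        ι 1990656000 * X ≡⟨ cong (_* X) c₁≡ ⟩
        24* * ((a + b) * g) * X ≡⟨ l₁ 24* a b g X o Y ⟩
        24* * (a * (g * X + o * Y) + b * g * X) - 24* * a * o * Y ≤⟨ ℚ.+-monoˡ-≤ (- (24* * a * o * Y)) (*-monoˡ 24* 0≤24* (ℚ.+-mono-≤ (*-monoˡ a (ι-nn 114) r) (subst (λ z → z * X ≤ h * (TP + Q)) h≡ (*-monoˡ h (ι-nn 7299072) p)))) ⟩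
        24* * (a * (TR + Kr * Q) + h * (TP + Q)) - 24* * a * o * Y ≡⟨ trans (l₂ 24* a h TR TP Kr Q (24* * a * o * Y)) (cong (λ z → 24* * z + 24* * (a * Kr + h) * Q - 24* * a * o * Y) (sym local-split)) ⟩
        24* * TL + 24* * (a * Kr + h) * Q - 24* * a * o * Y ≤⟨ ℚ.+-monoˡ-≤ (- (24* * a * o * Y)) (ℚ.+-monoˡ-≤ (24* * (a * Kr + h) * Q) total-bound) ⟩
        B * n⁴ + k₆ * n³ + 24* * (a * Kr + h) * Q - 24* * a * o * Y ≡⟨ trans (l₃ (B * n⁴) (k₆ * n³) (24* * (a * Kr + h) * Q) 12* a o (ι n) 𝒜) (cong (λ z → B * n⁴ + k₆ * n³ + 24* * (a * Kr + h) * Q - 12* * a * o * (ι n * ι n * z)) arcs-total) ⟩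
        B * n⁴ + k₆ * n³ + 24* * (a * Kr + h) * Q - 12* * a * o * (ι n * ι n * (ι n * ι n - ι n)) ≡⟨ trans (l₄ (ι n) B k₆ (24* * (a * Kr + h) * Q) (12* * a * o)) (cong₂ (λ y z → B * n⁴ + (k₆ + y) * n³ + z * Q - y * n⁴) c₂≡ c₃≡) ⟩
        B * n⁴ + (k₆ + M) * n³ + R * Q - M * n⁴ ≤⟨ ℚ.+-monoˡ-≤ (- (M * n⁴)) (ℚ.+-monoˡ-≤ (R * Q) (ℚ.+-monoʳ-≤ (B * n⁴) (*-monoˡ (k₆ + M) (+-nn (ι-nn 72000000000) (ι-nn 2449694016)) n³≤Q))) ⟩
        B * n⁴ + (k₆ + M) * Q + R * Q - M * n⁴ ≡⟨ trans (l₅ B n⁴ k₆ M R Q) (cong (λ z → B * n⁴ + z * Q - M * n⁴) c₄≡) ⟩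
        B * n⁴ + ι 137092036320 * (e * n⁴) - M * n⁴ ≤⟨ ℚ.+-monoˡ-≤ (- (M * n⁴)) (ℚ.+-monoʳ-≤ (B * n⁴) error) ⟩
        B * n⁴ + ι 813552 * n⁴ - M * n⁴ ≡⟨ trans (cong (_- M * n⁴) (trans (sym (ℚ.*-distribʳ-+ n⁴ B (ι 813552))) (cong (_* n⁴) c₅≡))) (l₆ (ι 789504000) M n⁴) ⟩
        ι 789504000 * n⁴ ∎
        where
        open ℚ.≤-Reasoning
        a b h X Y TR TP TL Kr B k₆ M R : ℚ
        a = ι 114
        b = ι 11
        h = ι 7299072
        X = x * (ι n * ι n)
        Y = ι n * ι n * 𝒜
        TR = total random-local
        TP = total (rooted-local Tn)
        TL = total (local (arc Tn))
        Kr = ι 22831566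
        B = ι 3238384464
        k₆ = ι 72000000000
        M = ι 2449694016
        R = ι 62642342304
        h≡ : h ≡ b * g
        h≡ = ι-* 11 663552
        c₁≡ : ι 1990656000 ≡ 24* * ((a + b) * g)
        c₁≡ = trans (ι-* 24 82944000) (cong₂ _*_ ι24≡ (trans (ι-* 125 663552) (cong (_* g) (ι-+ 114 11))))
        c₂≡ : 12* * a * o ≡ M
        c₂≡ = sym (trans (ι-* 1368 1790712) (cong (_* o) (trans (ι-* 12 114) (cong (_* a) ι12≡))))
        c₃≡ : 24* * (a * Kr + h) ≡ R
        c₃≡ = sym (trans (ι-* 24 2610097596) (cong₂ _*_ ι24≡ (trans (ι-+ 2602798524 7299072) (cong (_+ h) (ι-* 114 22831566)))))
        c₄≡ : k₆ + M + R ≡ ι 137092036320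
        c₄≡ = sym (trans (ι-+ 74449694016 62642342304) (cong (_+ R) (ι-+ 72000000000 2449694016)))
        c₅≡ : B + ι 813552 ≡ ι 789504000 + M
        c₅≡ = trans (sym (ι-+ 3238384464 813552)) (ι-+ 789504000 2449694016)
        l₁ : ∀ t a b g x o y → t * ((a + b) * g) * x ≡ t * (a * (g * x + o * y) + b * g * x) - t * a * o * y
        l₁ = solve-∀ ring
        l₂ : ∀ t a h r p k q y → t * (a * (r + k * q) + h * (p + q)) - y ≡ t * (a * r + h * p) + t * (a * k + h) * q - y
        l₂ = solve-∀ ring
        l₃ : ∀ b k q t a o n z → b + k + q - t * (1ℚ + 1ℚ) * a * o * (n * n * z) ≡ b + k + q - t * a * o * (n * n * ((1ℚ + 1ℚ) * z))
        l₃ = solve-∀ ring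
        l₄ : ∀ n b k q m → b * (n * (n * (n * n))) + k * (n * (n * n)) + q - m * (n * n * (n * n - n)) ≡ b * (n * (n * (n * n))) + (k + m) * (n * (n * n)) + q - m * (n * (n * (n * n)))
        l₄ = solve-∀ ring
        l₅ : ∀ b n k m r q → b * n + (k + m) * q + r * q - m * n ≡ b * n + (k + m + r) * q - m * n
        l₅ = solve-∀ ring
        l₆ : ∀ t m n → (t + m) * n - m * n ≡ t * n
        l₆ = solve-∀ ring
        0≤n⁴ : 0ℚ ≤ n⁴
        0≤n⁴ = *-nn 0≤n (ℚ.<⇒≤ 0<n³)
        n³≤Q : n³ ≤ Q
        n³≤Q = ℚ.≤-trans (ℚ.≤-reflexive (sym (ℚ.*-identityˡ n³))) (ℚ.≤-trans (*-monoʳ n³ (ℚ.<⇒≤ 0<n³) 1≤en) (ℚ.≤-reflexive (ℚ.*-assoc e (ι n) n³)))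
        -- All error terms together against the slack 813552 of the four-vertex bound.
        error : ι 137092036320 * (e * n⁴) ≤ ι 813552 * n⁴
        error = ℚ.≤-trans (*-monoʳ (e * n⁴) (*-nn 0≤e 0≤n⁴) big) (ℚ.≤-reflexive (trans (l (ι 813552) (ι (suc m′)) e n⁴) (trans (cong (λ z → ι 813552 * (z * n⁴)) eE) (cong (ι 813552 *_) (ℚ.*-identityˡ n⁴)))))
          where
          l : ∀ a E e n → a * E * (e * n) ≡ a * ((e * E) * n)
          l = solve-∀ ring

      -- Cancels 3072000 n²: 789504000 = 3072000 · 257 and 4 · 1990656000 = 3072000 · 2592.
      conclude : ∀ k → ι 1990656000 * (4* * ι k * (ι n * ι n)) ≤ ι 789504000 * n⁴ → 2592 ℕ.* k ℕ.≤ 257 ℕ.* (n ℕ.* n)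
      conclude k p = ι-cancel-≤ (subst₂ _≤_ (sym (ι-* 2592 k)) (sym (trans (ι-* 257 (n ℕ.* n)) (cong (ι 257 *_) (ι-* n n)))) (*-cancelˡ (ι 3072000 * (ι n * ι n)) positive (subst₂ _≤_ left right p)))
        where
        positive : 0ℚ < ι 3072000 * (ι n * ι n)
        positive = ℚ.<-≤-trans (ℚ.positive⁻¹ 1ℚ) (*-mono 0≤1 (*-nn 0≤n 0≤n) (subst (_≤ ι 3072000) ι-one (ι-mono {1} {3072000} (ℕ.s≤s ℕ.z≤n))) (*-mono 0≤1 0≤n (1≤ι n′) (1≤ι n′)))
        left : ι 1990656000 * (4* * ι k * (ι n * ι n)) ≡ ι 3072000 * (ι n * ι n) * (ι 2592 * ι k)
        left = trans (l (ι 1990656000) 4* (ι k) (ι n * ι n)) (trans (cong (λ z → z * (ι k * (ι n * ι n))) (trans (cong (ι 1990656000 *_) (sym ι4≡)) (trans (sym (ι-* 1990656000 4)) (ι-* 3072000 2592)))) (l₂ (ι 3072000) (ι 2592) (ι k) (ι n * ι n)))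
          where
          ι4≡ : ι 4 ≡ 4*
          ι4≡ = trans (ι-+ 2 2) (cong₂ _+_ ι2≡ ι2≡)
          l : ∀ c f k m → c * (f * k * m) ≡ c * f * (k * m)
          l = solve-∀ ring
          l₂ : ∀ c f k m → c * f * (k * m) ≡ c * m * (f * k)
          l₂ = solve-∀ ring
        right : ι 789504000 * n⁴ ≡ ι 3072000 * (ι n * ι n) * (ι 257 * (ι n * ι n))
        right = trans (cong (_* n⁴) (ι-* 3072000 257)) (l (ι 3072000) (ι 257) (ι n))
          where
          l : ∀ c f n → c * f * (n * (n * (n * n))) ≡ c * (n * n) * (f * (n * n))
          l = solve-∀ ring

      -- The smaller of the two costs satisfies both estimates, so a mixture of the orders need not
      -- be sampled.
      bound : ∃[ k ] (Decycled A k × 2592 ℕ.* k ℕ.≤ 257 ℕ.* (n ℕ.* n))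
      bound = let k , dec , p = random-cost; k′ , dec′ , p′ = rooted-cost′ in choose k dec p k′ dec′ p′ (ℕP.≤-total k k′)
        where
        scaled : ∀ {k k′} → k ℕ.≤ k′ → 4* * ι k * (ι n * ι n) ≤ 4* * ι k′ * (ι n * ι n)
        scaled q = *-monoʳ (ι n * ι n) (*-nn 0≤n 0≤n) (*-monoˡ 4* (+-nn 0≤2* 0≤2*) (ι-mono q))
        choose : ∀ k → Decycled A k → g * (4* * ι k * (ι n * ι n)) + o * (ι n * ι n * 𝒜) ≤ total random-local + ι 22831566 * Q →
          ∀ k′ → Decycled A k′ → 4* * ι k′ * (ι n * ι n) ≤ total (rooted-local Tn) + Q → k ℕ.≤ k′ ⊎ k′ ℕ.≤ k → ∃[ k ] (Decycled A k × 2592 ℕ.* k ℕ.≤ 257 ℕ.* (n ℕ.* n))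
        choose k dec p k′ dec′ p′ (inj₁ q) = k , dec , conclude k (mixture (4* * ι k) p (ℚ.≤-trans (scaled q) p′))
        choose k dec p k′ dec′ p′ (inj₂ q) = k′ , dec′ , conclude k′ (mixture (4* * ι k′) (ℚ.≤-trans (ℚ.+-monoˡ-≤ (o * (ι n * ι n * 𝒜)) (*-monoˡ g (ι-nn 663552) (scaled q))) p) p′)

  abstract
    -- The accuracy 1/1000000: the quotient 137092036320 / 813552 is below 170000.
    pred-E : ℕ
    pred-E = 999999

    pred-E≡ : pred-E ≡ 999999
    pred-E≡ = refl

  -- n ≥ 3 E² gives e² n ≥ 3, and n ≥ 3 D₀ lifts the cap n/3 to the degree at which the packing
  -- works.
  threshold : ℕ → ℕ → ℕ
  threshold E D₀ = suc (3 ℕ.* (E ℕ.* E) ℕ.+ 3 ℕ.* D₀)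

  bounded : ∀ D₀ → Packs pred-E D₀ → ∀ n → threshold (suc pred-E) D₀ ℕ.≤ n → (A : Digraph n) → Oriented A → ∃[ k ] (Decycled A k × 2592 ℕ.* k ℕ.≤ 257 ℕ.* (n ℕ.* n))
  bounded D₀ packs (suc n′) (ℕ.s≤s N≤) A orA = go (inv (ι (suc pred-E)) (0<ι pred-E)) (inv ι24 (0<ι 23))
    where
    E : ℕ
    E = suc pred-E
    go : ∃[ e ] (0ℚ < e × ι E * e ≡ 1ℚ) → ∃[ u ] (0ℚ < u × ι24 * u ≡ 1ℚ) → ∃[ k ] (Decycled A k × 2592 ℕ.* k ℕ.≤ 257 ℕ.* (suc n′ ℕ.* suc n′))
    go (e , 0<e , Ee) (u , 0<u , 24u) = Parameters.Both.bound n′ A orA pred-E D₀ packs e u 0≤e eE (ℚ.<⇒≤ 0<u) 24u 6≤E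
        (ℕP.≤-trans (ℕP.m≤n+m (3 ℕ.* D₀) (3 ℕ.* (E ℕ.* E))) (ℕP.≤-trans N≤ (ℕP.n≤1+n n′))) long big
      where
      0≤e : 0ℚ ≤ e
      0≤e = ℚ.<⇒≤ 0<e
      eE : e * ι E ≡ 1ℚ
      eE = trans (ℚ.*-comm e (ι E)) Ee
      6≤E : 6 ℕ.≤ E
      6≤E = subst (λ m → 6 ℕ.≤ suc m) (sym pred-E≡) (≤ᵇ⇒≤ 6 1000000 refl)
      big : ι 137092036320 ≤ ι 813552 * ι E
      big = subst (ι 137092036320 ≤_) (trans (ι-* 813552 1000000) (cong (λ m → ι 813552 * ι (suc m)) (sym pred-E≡))) (ι-mono (≤ᵇ⇒≤ 137092036320 813552000000 refl))
      long : 3* ≤ e * (e * ι (suc n′))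
      long = ℚ.≤-trans (ℚ.≤-reflexive (sym (trans (cong (λ z → e * (e * z)) (trans (ι-* 3 (E ℕ.* E)) (cong₂ _*_ ι3≡ (ι-* E E)))) (trans (l e (ι E) 3*) (cong (λ z → 3* * (z * z)) eE)))))
        (*-monoˡ e 0≤e (*-monoˡ e 0≤e (ι-mono (ℕP.≤-trans (ℕP.m≤m+n (3 ℕ.* (E ℕ.* E)) (3 ℕ.* D₀)) (ℕP.≤-trans N≤ (ℕP.n≤1+n n′))))))
        where
        l : ∀ e E t → e * (e * (t * (E * E))) ≡ t * ((e * E) * (e * E))
        l = solve-∀ ring

open Conclusion using (threshold; pred-E; bounded)
open Packing using (Packs; packing)
open TwoRoots using (Decycled)
open import Data.Nat using (_+_; _*_; _≤_; _<_)
open Subset using (Subset; ∣_∣)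

-- The term o(1) is rendered by an arbitrary positive rational p/q, and the inequality is cleared of
-- denominators.
theorem1p3 : (p q : ℕ) → 0 < p → 0 < q →
    ∃[ N ] ((n : ℕ) → N ≤ n → (A : Digraph n) → Oriented A →
    ∃[ Xs ] (All (λ (X : Subset n) → ∣ X ∣ ≤ 3) Xs
    × Acyclic (invertAll Xs A)
    × 2592 * q * length Xs ≤ 257 * (q + p) * (n * n)))
theorem1p3 p q 0<p 0<q = go (packing pred-E)
  where
  rearrange : ∀ c q k → c ℕ.* q ℕ.* k ≡ q ℕ.* (c ℕ.* k)
  rearrange c q k = trans (cong (ℕ._* k) (ℕP.*-comm c q)) (ℕP.*-assoc q c k)
  go : ∃[ D₀ ] Packs pred-E D₀ → _
  go (D₀ , packs) = threshold (suc pred-E) D₀ , λ n N≤n A orA → finish n A (bounded D₀ packs n N≤n A orA)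
    where
    finish : ∀ n (A : Digraph n) → ∃[ k ] (Decycled A k × 2592 ℕ.* k ℕ.≤ 257 ℕ.* (n ℕ.* n)) → ∃[ Xs ] (All (λ (X : Subset n) → ∣ X ∣ ℕ.≤ 3) Xs × Acyclic (invertAll Xs A) × 2592 ℕ.* q ℕ.* length Xs ℕ.≤ 257 ℕ.* (q ℕ.+ p) ℕ.* (n ℕ.* n))
    finish n A (k , (Xs , len , small , acy) , le) = Xs , small , acy , subst (λ k → 2592 ℕ.* q ℕ.* k ℕ.≤ 257 ℕ.* (q ℕ.+ p) ℕ.* (n ℕ.* n)) (sym len)
      (ℕP.≤-trans (ℕP.≤-reflexive (rearrange 2592 q k)) (ℕP.≤-trans (ℕP.*-mono-≤ (ℕP.m≤m+n q p) le) (ℕP.≤-reflexive (sym (rearrange 257 (q ℕ.+ p) (n ℕ.* n))))))
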